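{- Let $K$ be a quadratic field with embeddings into $\mathbb{R}$ and $\mathbb{Q}_2$, and let $\alpha\in K\setminus\mathbb{Q}$ have property $I$. With $p'_n,q'_n$ as defined in the context, there exist $\gamma,C,C'\in\mathbb{R}_{>0}$ with $0<\gamma<1$ such that for all $n\in\mathbb{Z}_{>0}$, $$\left|\alpha_\infty-\frac{p'_n}{q'_n}\right|\le\frac{C}{|q'_n|^{2-2\gamma}}\quad\text{and}\quad\left|\alpha_{\langle 2\rangle}-\frac{p'_n}{q'_n}\right|_2\le\frac{C'}{|q'_n|^{2\gamma}}.$$
   Context: $K$ is a quadratic field with fixed field embeddings $\sigma_\infty:K\to\mathbb{R}$ and $\sigma_2:K\to\mathbb{Q}_2$. For $\alpha\in K$ write $\alpha_\infty=\sigma_\infty(\alpha)$, $\alpha_{\langle 2\rangle}=\sigma_2(\alpha)$. $v_2$ is the $2$-adic valuation and $|u|_2=2^{ -v_2(u)}$; $|\cdot|$ is the real absolute value. For $u=\sum_{n}c_n2^n\in\mathbb{Q}_2$ with digits $c_n\in\{0,1\}$ ($c_n=0$ for $n<v_2(u)$), put $\lfloor u\rfloor_2=\sum_{n\le 0}c_n2^n\in\mathbb{Z}[1/2]$. Property $I$: $\alpha_\infty\in(-1,1]$ and $v_2(\alpha_{\langle 2\rangle})>0$. For $\alpha\in K^\times$ let $a^{(0)}(\alpha)=2m+\lfloor(1/\alpha)_{\langle 2\rangle}\rfloor_2$, where $m$ is the smallest among the integers $i$ minimizing $|(1/\alpha)_\infty-2i-\lfloor(1/\alpha)_{\langle 2\rangle}\rfloor_2|$;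 let $a^{(1)}(\alpha)=m'+\lfloor(1/\alpha)_{\langle 2\rangle}\rfloor_2$, where $m'$ is the smallest among the integers $i$ minimizing $|(1/\alpha)_\infty-i-\lfloor(1/\alpha)_{\langle 2\rangle}\rfloor_2|$. Put $T_{2,\epsilon}(\alpha)=\frac1\alpha-a^{(\epsilon)}(\alpha)$ for $\epsilon\in\{0,1\}$. Algorithm: $\alpha_{(1)}=\alpha$; for $n\ge1$ put $\epsilon=0$ if $n$ is even, $\epsilon=1$ if $n$ is odd, $a_n(\alpha)=a^{(\epsilon)}(\alpha_{(n)})$ and $\alpha_{(n+1)}=T_{2,\epsilon}(\alpha_{(n)})$ (for $\alpha\in K\setminus\mathbb{Q}$ the algorithm never terminates). Convergents: $p_0=0$, $q_0=1$, and for $n\ge1$ $$\begin{pmatrix} p_{n-1} & p_n \\ q_{n-1} & q_n \end{pmatrix}=\begin{pmatrix} 0 & 1 \\ 1 & a_1(\alpha) \end{pmatrix}\cdots\begin{pmatrix} 0 & 1 \\ 1 & a_n(\alpha) \end{pmatrix};$$ $p_n,q_n\in\mathbb{Z}[1/2]$ and $q_n\ne0$. For $n\ge1$ put $p'_n=2^{ -\sum_{s=1}^n v_2(a_s(\alpha))}p_n$ and $q'_n=2^{ -\sum_{s=1}^n v_2(a_s(\alpha))}q_n$; these are coprime integers with $p'_n/q'_n=p_n/q_n$. -}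

module Defs where

open import Algebra.Bundles using (CommutativeRing; RawRing)
import Algebra.Definitions.RawSemiring as RawSemiringDefs
open import Algebra.Morphism.Structures using (module RingMorphisms)
open import Data.Integer.Base as ℤ using (ℤ; +_; -[1+_]; +[1+_])
import Data.Integer.Divisibility.Signed as ℤ∣
import Data.Integer.Properties as ℤₚ
open import Data.Integer.Solver using () renaming (module +-*-Solver to ℤ-Solver)
open import Data.Nat.Base as ℕ using (ℕ; zero; suc; parity)
import Data.Nat.Properties as ℕₚ
open import Data.Parity.Base using (Parity; 0ℙ; 1ℙ)
open import Data.Product.Base using (_×_; _,_; ∃; ∃₂; proj₁; proj₂)
open import Data.Rational.Base hiding (_⊔_)
import Data.Rational.Properties as ℚₚ
import Data.Rational.Unnormalised.Base as ℚᵘ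
import Data.Rational.Unnormalised.Properties as ℚᵘₚ
open import Data.Rational.Solver using () renaming (module +-*-Solver to ℚ-Solver)
open import Data.Sum.Base using (_⊎_; inj₁; inj₂)
open import Level using (Level; _⊔_) renaming (suc to lsuc; 0ℓ to ℓ₀)
open import Relation.Binary.PropositionalEquality
open import Relation.Binary.Definitions using (tri<; tri≈; tri>)
open import Relation.Nullary using (¬_; yes; no; contradiction; from-yes)

module ℚ^ = RawSemiringDefs (RawRing.rawSemiring +-*-rawRing)

module RationalLemmas where

  0<½ε : ∀ {ε} → 0ℚ < ε → 0ℚ < ½ * ε
  0<½ε {ε} 0<ε = subst (_< ½ * ε) (ℚₚ.*-zeroʳ ½) (ℚₚ.*-monoʳ-<-pos ½ 0<ε)

  ½ε+½ε≡ε : ∀ ε → ½ * ε + ½ * ε ≡ ε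
  ½ε+½ε≡ε ε = trans (sym (ℚₚ.*-distribʳ-+ ε ½ ½)) (ℚₚ.*-identityˡ ε)

  sub-self : ∀ q → q - q ≡ 0ℚ
  sub-self = ℚₚ.+-inverseʳ

  ∣a∣-∣b∣≤∣a-b∣ : ∀ a b → ∣ a ∣ - ∣ b ∣ ≤ ∣ a - b ∣
  ∣a∣-∣b∣≤∣a-b∣ a b = begin
    ∣ a ∣ - ∣ b ∣                ≡⟨ cong (λ t → ∣ t ∣ - ∣ b ∣) (split a b) ⟩
    ∣ (a - b) + b ∣ - ∣ b ∣      ≤⟨ ℚₚ.+-monoˡ-≤ (- ∣ b ∣) (ℚₚ.∣p+q∣≤∣p∣+∣q∣ (a - b) b) ⟩
    (∣ a - b ∣ + ∣ b ∣) - ∣ b ∣  ≡⟨ cancel (∣ a - b ∣) (∣ b ∣) ⟩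
    ∣ a - b ∣                    ∎
    where
    open ℚₚ.≤-Reasoning
    open ℚ-Solver
    split : ∀ a b → a ≡ (a - b) + b
    split = solve 2 (λ a b → a := (a :- b) :+ b) refl
    cancel : ∀ a b → (a + b) - b ≡ a
    cancel = solve 2 (λ a b → (a :+ b) :- b := a) refl

  ∣a-b∣≡∣b-a∣ : ∀ a b → ∣ a - b ∣ ≡ ∣ b - a ∣
  ∣a-b∣≡∣b-a∣ a b = trans (sym (ℚₚ.∣-p∣≡∣p∣ (a - b))) (cong ∣_∣ (swap a b))
    where
    open ℚ-Solver
    swap : ∀ a b → - (a - b) ≡ b - a
    swap = solve 2 (λ a b → :- (a :- b) := b :- a) refl

  ∣∣a∣-∣b∣∣≤∣a-b∣ : ∀ a b → ∣ ∣ a ∣ - ∣ b ∣ ∣ ≤ ∣ a - b ∣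
  ∣∣a∣-∣b∣∣≤∣a-b∣ a b with ℚₚ.∣p∣≡p∨∣p∣≡-p (∣ a ∣ - ∣ b ∣)
  ... | inj₁ eq = subst (_≤ ∣ a - b ∣) (sym eq) (∣a∣-∣b∣≤∣a-b∣ a b)
  ... | inj₂ eq = subst₂ _≤_ (sym (trans eq (swap (∣ a ∣) (∣ b ∣)))) (∣a-b∣≡∣b-a∣ b a)
                    (∣a∣-∣b∣≤∣a-b∣ b a)
    where
    open ℚ-Solver
    swap : ∀ a b → - (a - b) ≡ b - a
    swap = solve 2 (λ a b → :- (a :- b) := b :- a) refl

  inverse-right : ∀ {B} .{{_ : Positive B}} ε →
                  B * ((1/ B) {{ℚₚ.pos⇒nonZero B}} * (½ * ε)) ≡ ½ * ε
  inverse-right {B} ε = begin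
    B * (i * (½ * ε))  ≡⟨ sym (ℚₚ.*-assoc B i (½ * ε)) ⟩
    (B * i) * (½ * ε)  ≡⟨ cong (_* (½ * ε)) (ℚₚ.*-inverseʳ B {{ℚₚ.pos⇒nonZero B}}) ⟩
    1ℚ * (½ * ε)       ≡⟨ ℚₚ.*-identityˡ (½ * ε) ⟩
    ½ * ε              ∎
    where
    open ≡-Reasoning
    i = (1/ B) {{ℚₚ.pos⇒nonZero B}}

open RationalLemmas

-- Division with the convention x / 0 = 0.

infixl 7 _/₀_

_/₀_ : ℚ → ℚ → ℚ
p /₀ q with q ℚₚ.≟ 0ℚ
... | yes _   = 0ℚ
... | no  q≢0 = (p ÷ q) {{≢-nonZero q≢0}}

2^ : ℤ → ℚ
2^ (+ n)    = (+ 2 / 1) ℚ^.^ n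
2^ -[1+ n ] = ½ ℚ^.^ suc n

-- ℝ consists of Cauchy sequences of rationals up to _≈ℝ_.

Eventually : (ℕ → Set) → Set
Eventually P = ∃ λ N → ∀ n → N ℕ.≤ n → P n

record ℝ : Set where
  constructor mkℝ
  field
    seq    : ℕ → ℚ
    cauchy : ∀ ε → 0ℚ < ε → ∃ λ N → ∀ m n → N ℕ.≤ m → N ℕ.≤ n →
             ∣ seq m - seq n ∣ < ε

open ℝ

infix  4 _≈ℝ_ _≤ℝ_ _<ℝ_
infixl 6 _+ℝ_ _-ℝ_
infixl 7 _*ℝ_
infix  8 -ℝ_

_≈ℝ_ : ℝ → ℝ → Set
x ≈ℝ y = ∀ ε → 0ℚ < ε → Eventually λ n → ∣ seq x n - seq y n ∣ < ε

_≤ℝ_ : ℝ → ℝ → Set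
x ≤ℝ y = ∀ ε → 0ℚ < ε → Eventually λ n → seq x n < seq y n + ε

_<ℝ_ : ℝ → ℝ → Set
x <ℝ y = ∃ λ ε → 0ℚ < ε × Eventually λ n → seq x n + ε < seq y n

fromℚ : ℚ → ℝ
fromℚ q = mkℝ (λ _ → q) λ ε 0<ε →
  0 , λ _ _ _ _ → subst (λ t → ∣ t ∣ < ε) (sym (sub-self q)) 0<ε

0ℝ 1ℝ 2ℝ : ℝ
0ℝ = fromℚ 0ℚ
1ℝ = fromℚ 1ℚ
2ℝ = fromℚ (+ 2 / 1)

-ℝ_ : ℝ → ℝ
-ℝ x = mkℝ (λ n → - seq x n) λ ε 0<ε →
  let N , h = cauchy x ε 0<ε in
  N , λ m n N≤m N≤n → subst (_< ε) (eq (seq x m) (seq x n)) (h m n N≤m N≤n)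
  where
  open ℚ-Solver
  lem : ∀ a b → - (a - b) ≡ - a - - b
  lem = solve 2 (λ a b → :- (a :- b) := (:- a) :- (:- b)) refl
  eq : ∀ a b → ∣ a - b ∣ ≡ ∣ - a - - b ∣
  eq a b = trans (sym (ℚₚ.∣-p∣≡∣p∣ (a - b))) (cong ∣_∣ (lem a b))

_+ℝ_ : ℝ → ℝ → ℝ
x +ℝ y = mkℝ (λ n → seq x n + seq y n) λ ε 0<ε →
  let N₁ , h₁ = cauchy x (½ * ε) (0<½ε 0<ε)
      N₂ , h₂ = cauchy y (½ * ε) (0<½ε 0<ε)
  in N₁ ℕ.⊔ N₂ , λ m n N≤m N≤n →
       bound ε (seq x m) (seq x n) (seq y m) (seq y n)
         (h₁ m n (ℕₚ.m⊔n≤o⇒m≤o N₁ N₂ N≤m) (ℕₚ.m⊔n≤o⇒m≤o N₁ N₂ N≤n))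
         (h₂ m n (ℕₚ.m⊔n≤o⇒n≤o N₁ N₂ N≤m) (ℕₚ.m⊔n≤o⇒n≤o N₁ N₂ N≤n))
  where
  open ℚ-Solver
  regroup : ∀ a a′ b b′ → (a + b) - (a′ + b′) ≡ (a - a′) + (b - b′)
  regroup = solve 4 (λ a a′ b b′ → (a :+ b) :- (a′ :+ b′) := (a :- a′) :+ (b :- b′)) refl
  bound : ∀ ε a a′ b b′ → ∣ a - a′ ∣ < ½ * ε → ∣ b - b′ ∣ < ½ * ε →
          ∣ (a + b) - (a′ + b′) ∣ < ε
  bound ε a a′ b b′ h₁ h₂ = begin-strict
    ∣ (a + b) - (a′ + b′) ∣      ≡⟨ cong ∣_∣ (regroup a a′ b b′) ⟩
    ∣ (a - a′) + (b - b′) ∣      ≤⟨ ℚₚ.∣p+q∣≤∣p∣+∣q∣ (a - a′) (b - b′) ⟩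
    ∣ a - a′ ∣ + ∣ b - b′ ∣      <⟨ ℚₚ.+-mono-< h₁ h₂ ⟩
    ½ * ε + ½ * ε                ≡⟨ ½ε+½ε≡ε ε ⟩
    ε                            ∎
    where open ℚₚ.≤-Reasoning

_-ℝ_ : ℝ → ℝ → ℝ
x -ℝ y = x +ℝ (-ℝ y)

module BoundedLemmas where
  eventually-bounded : (x : ℝ) →
    ∃₂ λ N B → 0ℚ < B × (∀ n → N ℕ.≤ n → ∣ seq x n ∣ ≤ B)
  eventually-bounded x =
    let N , h = cauchy x 1ℚ (ℚₚ.positive⁻¹ 1ℚ) in
    N , ∣ seq x N ∣ + 1ℚ ,
    ℚₚ.<-≤-trans (ℚₚ.positive⁻¹ 1ℚ)
      (subst (_≤ ∣ seq x N ∣ + 1ℚ) (ℚₚ.+-identityˡ 1ℚ) (ℚₚ.+-monoˡ-≤ 1ℚ (ℚₚ.0≤∣p∣ (seq x N)))) ,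
    λ n N≤n → begin
      ∣ seq x n ∣                          ≡⟨ cong ∣_∣ (split (seq x n) (seq x N)) ⟩
      ∣ seq x N + (seq x n - seq x N) ∣    ≤⟨ ℚₚ.∣p+q∣≤∣p∣+∣q∣ (seq x N) (seq x n - seq x N) ⟩
      ∣ seq x N ∣ + ∣ seq x n - seq x N ∣  ≤⟨ ℚₚ.+-monoʳ-≤ (∣ seq x N ∣) (ℚₚ.<⇒≤ (h n N N≤n ℕₚ.≤-refl)) ⟩
      ∣ seq x N ∣ + 1ℚ                     ∎
    where
    open ℚₚ.≤-Reasoning
    open ℚ-Solver
    split : ∀ a b → a ≡ b + (a - b)
    split = solve 2 (λ a b → a := b :+ (a :- b)) refl

open BoundedLemmas

_*ℝ_ : ℝ → ℝ → ℝ
x *ℝ y = mkℝ (λ n → seq x n * seq y n) λ ε 0<ε →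
  let Nˣ , Bˣ , 0<Bˣ , hˣ = eventually-bounded x
      Nʸ , Bʸ , 0<Bʸ , hʸ = eventually-bounded y
      N₁ , h₁ = cauchy x (δ Bʸ 0<Bʸ ε) (0<δ Bʸ 0<Bʸ 0<ε)
      N₂ , h₂ = cauchy y (δ Bˣ 0<Bˣ ε) (0<δ Bˣ 0<Bˣ 0<ε)
  in (Nˣ ℕ.⊔ Nʸ) ℕ.⊔ (N₁ ℕ.⊔ N₂) , λ m n N≤m N≤n →
       let B≤m = ℕₚ.m⊔n≤o⇒m≤o (Nˣ ℕ.⊔ Nʸ) (N₁ ℕ.⊔ N₂) N≤m
           C≤m = ℕₚ.m⊔n≤o⇒n≤o (Nˣ ℕ.⊔ Nʸ) (N₁ ℕ.⊔ N₂) N≤m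
           B≤n = ℕₚ.m⊔n≤o⇒m≤o (Nˣ ℕ.⊔ Nʸ) (N₁ ℕ.⊔ N₂) N≤n
           C≤n = ℕₚ.m⊔n≤o⇒n≤o (Nˣ ℕ.⊔ Nʸ) (N₁ ℕ.⊔ N₂) N≤n
       in bound ε Bˣ Bʸ 0<Bˣ 0<Bʸ (seq x m) (seq x n) (seq y m) (seq y n)
            (hˣ m (ℕₚ.m⊔n≤o⇒m≤o Nˣ Nʸ B≤m)) (hʸ n (ℕₚ.m⊔n≤o⇒n≤o Nˣ Nʸ B≤n))
            (h₁ m n (ℕₚ.m⊔n≤o⇒m≤o N₁ N₂ C≤m) (ℕₚ.m⊔n≤o⇒m≤o N₁ N₂ C≤n))
            (h₂ m n (ℕₚ.m⊔n≤o⇒n≤o N₁ N₂ C≤m) (ℕₚ.m⊔n≤o⇒n≤o N₁ N₂ C≤n))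
  where
  δ : ∀ B → 0ℚ < B → ℚ → ℚ
  δ B 0<B ε = (1/ B) {{ℚₚ.pos⇒nonZero B {{positive 0<B}}}} * (½ * ε)
  0<δ : ∀ B (0<B : 0ℚ < B) {ε} → 0ℚ < ε → 0ℚ < δ B 0<B ε
  0<δ B 0<B {ε} 0<ε = subst (_< δ B 0<B ε) (ℚₚ.*-zeroʳ i)
      (ℚₚ.*-monoʳ-<-pos i {{ℚₚ.1/pos⇒pos B {{positive 0<B}}}} (0<½ε 0<ε))
    where i = (1/ B) {{ℚₚ.pos⇒nonZero B {{positive 0<B}}}}
  Bδ : ∀ B (0<B : 0ℚ < B) ε → B * δ B 0<B ε ≡ ½ * ε
  Bδ B 0<B ε = inverse-right {B} {{positive 0<B}} ε
  open ℚ-Solver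
  regroup : ∀ a a′ b b′ → a * b - a′ * b′ ≡ a * (b - b′) + b′ * (a - a′)
  regroup = solve 4 (λ a a′ b b′ →
    a :* b :- a′ :* b′ := a :* (b :- b′) :+ b′ :* (a :- a′)) refl
  step : ∀ ε B (0<B : 0ℚ < B) a d → ∣ a ∣ ≤ B → ∣ d ∣ < δ B 0<B ε → ∣ a * d ∣ < ½ * ε
  step ε B 0<B a d a≤B d<δ = begin-strict
    ∣ a * d ∣      ≡⟨ ℚₚ.∣p*q∣≡∣p∣*∣q∣ a d ⟩
    ∣ a ∣ * ∣ d ∣  ≤⟨ ℚₚ.*-monoʳ-≤-nonNeg (∣ d ∣) {{ℚₚ.∣-∣-nonNeg d}} a≤B ⟩
    B * ∣ d ∣      <⟨ ℚₚ.*-monoʳ-<-pos B {{positive 0<B}} d<δ ⟩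
    B * δ B 0<B ε  ≡⟨ Bδ B 0<B ε ⟩
    ½ * ε          ∎
    where open ℚₚ.≤-Reasoning
  bound : ∀ ε Bˣ Bʸ (0<Bˣ : 0ℚ < Bˣ) (0<Bʸ : 0ℚ < Bʸ) a a′ b b′ →
          ∣ a ∣ ≤ Bˣ → ∣ b′ ∣ ≤ Bʸ →
          ∣ a - a′ ∣ < δ Bʸ 0<Bʸ ε → ∣ b - b′ ∣ < δ Bˣ 0<Bˣ ε →
          ∣ a * b - a′ * b′ ∣ < ε
  bound ε Bˣ Bʸ 0<Bˣ 0<Bʸ a a′ b b′ ha hb h₁ h₂ = begin-strict
    ∣ a * b - a′ * b′ ∣                  ≡⟨ cong ∣_∣ (regroup a a′ b b′) ⟩
    ∣ a * (b - b′) + b′ * (a - a′) ∣     ≤⟨ ℚₚ.∣p+q∣≤∣p∣+∣q∣ (a * (b - b′)) (b′ * (a - a′)) ⟩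
    ∣ a * (b - b′) ∣ + ∣ b′ * (a - a′) ∣ <⟨ ℚₚ.+-mono-< (step ε Bˣ 0<Bˣ a (b - b′) ha h₂) (step ε Bʸ 0<Bʸ b′ (a - a′) hb h₁) ⟩
    ½ * ε + ½ * ε                        ≡⟨ ½ε+½ε≡ε ε ⟩
    ε                                    ∎
    where open ℚₚ.≤-Reasoning

∣_∣ℝ : ℝ → ℝ
∣ x ∣ℝ = mkℝ (λ n → ∣ seq x n ∣) λ ε 0<ε →
  let N , h = cauchy x ε 0<ε in
  N , λ m n N≤m N≤n → ℚₚ.≤-<-trans (∣∣a∣-∣b∣∣≤∣a-b∣ (seq x m) (seq x n)) (h m n N≤m N≤n)

ℝ-rawRing : RawRing ℓ₀ ℓ₀
ℝ-rawRing = record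
  { Carrier = ℝ ; _≈_ = _≈ℝ_ ; _+_ = _+ℝ_ ; _*_ = _*ℝ_ ; -_ = -ℝ_ ; 0# = 0ℝ ; 1# = 1ℝ }

module ℝ^ = RawSemiringDefs (RawRing.rawSemiring ℝ-rawRing)

-- ℚ₂ = ℤ₂[1/2], where ℤ₂ = lim ℤ/2ⁿ

record ℤ₂ : Set where
  constructor mkℤ₂
  field
    res      : ℕ → ℤ
    coherent : ∀ n → + (2 ℕ.^ n) ℤ∣.∣ res (suc n) ℤ.- res n

open ℤ₂

infixl 6 _+ℤ₂_
infixl 7 _*ℤ₂_

_+ℤ₂_ _*ℤ₂_ : ℤ₂ → ℤ₂ → ℤ₂
x +ℤ₂ y = mkℤ₂ (λ n → res x n ℤ.+ res y n) λ n →
  subst (_ ℤ∣.∣_) (sym (regroup (res x (suc n)) (res x n) (res y (suc n)) (res y n)))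
    (ℤ∣.∣m∣n⇒∣m+n (coherent x n) (coherent y n))
  where
  open ℤ-Solver
  regroup : ∀ a a′ b b′ → (a ℤ.+ b) ℤ.- (a′ ℤ.+ b′) ≡ (a ℤ.- a′) ℤ.+ (b ℤ.- b′)
  regroup = solve 4 (λ a a′ b b′ → (a :+ b) :- (a′ :+ b′) := (a :- a′) :+ (b :- b′)) refl
x *ℤ₂ y = mkℤ₂ (λ n → res x n ℤ.* res y n) λ n →
  subst (_ ℤ∣.∣_) (sym (regroup (res x (suc n)) (res x n) (res y (suc n)) (res y n)))
    (ℤ∣.∣m∣n⇒∣m+n (ℤ∣.∣n⇒∣m*n (res x (suc n)) (coherent y n))
                  (ℤ∣.∣n⇒∣m*n (res y n) (coherent x n)))
  where
  open ℤ-Solver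
  regroup : ∀ a a′ b b′ →
    a ℤ.* b ℤ.- a′ ℤ.* b′ ≡ a ℤ.* (b ℤ.- b′) ℤ.+ b′ ℤ.* (a ℤ.- a′)
  regroup = solve 4 (λ a a′ b b′ →
    a :* b :- a′ :* b′ := a :* (b :- b′) :+ b′ :* (a :- a′)) refl

-ℤ₂_ : ℤ₂ → ℤ₂
-ℤ₂ x = mkℤ₂ (λ n → ℤ.- res x n) λ n →
  subst (_ ℤ∣.∣_) (regroup (res x (suc n)) (res x n)) (ℤ∣.∣m⇒∣-m (coherent x n))
  where
  open ℤ-Solver
  regroup : ∀ a a′ → ℤ.- (a ℤ.- a′) ≡ (ℤ.- a) ℤ.- (ℤ.- a′)
  regroup = solve 2 (λ a a′ → :- (a :- a′) := (:- a) :- (:- a′)) refl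

fromℤ : ℤ → ℤ₂
fromℤ z = mkℤ₂ (λ _ → z) λ n → ℤ∣.divides ℤ.0ℤ (ℤₚ.+-inverseʳ z)

-- x /2^ k is the 2-adic number x / 2ᵏ.
infix 5 _/2^_

record ℚ₂ : Set where
  constructor _/2^_
  field
    num : ℤ₂
    exp : ℕ

infix  4 _≈ℚ₂_
infixl 6 _+ℚ₂_ _-ℚ₂_
infixl 7 _*ℚ₂_
infix  8 -ℚ₂_

_≈ℚ₂_ : ℚ₂ → ℚ₂ → Set
x /2^ k ≈ℚ₂ y /2^ l = ∀ n →
  + (2 ℕ.^ n) ℤ∣.∣ + (2 ℕ.^ l) ℤ.* res x n ℤ.- + (2 ℕ.^ k) ℤ.* res y n

_+ℚ₂_ _*ℚ₂_ : ℚ₂ → ℚ₂ → ℚ₂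
(x /2^ k) +ℚ₂ (y /2^ l) =
  (fromℤ (+ (2 ℕ.^ l)) *ℤ₂ x) +ℤ₂ (fromℤ (+ (2 ℕ.^ k)) *ℤ₂ y) /2^ (k ℕ.+ l)
(x /2^ k) *ℚ₂ (y /2^ l) = x *ℤ₂ y /2^ (k ℕ.+ l)

-ℚ₂_ : ℚ₂ → ℚ₂
-ℚ₂ (x /2^ k) = -ℤ₂ x /2^ k

_-ℚ₂_ : ℚ₂ → ℚ₂ → ℚ₂
u -ℚ₂ w = u +ℚ₂ (-ℚ₂ w)

ℚ₂-rawRing : RawRing ℓ₀ ℓ₀
ℚ₂-rawRing = record
  { Carrier = ℚ₂ ; _≈_ = _≈ℚ₂_ ; _+_ = _+ℚ₂_ ; _*_ = _*ℚ₂_ ; -_ = -ℚ₂_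
  ; 0# = fromℤ ℤ.0ℤ /2^ 0 ; 1# = fromℤ ℤ.1ℤ /2^ 0 }

-- v₂(x / 2ᵏ) ≥ e, for e ≥ 0.
infix 4 _≤v₂_

_≤v₂_ : ℕ → ℚ₂ → Set
e ≤v₂ (x /2^ k) = + (2 ℕ.^ (e ℕ.+ k)) ℤ∣.∣ res x (e ℕ.+ k)

-- If cⱼ is the j-th binary digit of x, then x / 2ᵏ = Σ cⱼ 2ʲ⁻ᵏ, and the
-- terms with j - k ≤ 0 are those with j < suc k.

digit : ℤ₂ → ℕ → ℕ
digit x j = ((res x (suc j) ℤ.%ℕ (2 ℕ.^ suc j)) {{ℕₚ.m^n≢0 2 (suc j)}} ℕ./ 2 ℕ.^ j)
              {{ℕₚ.m^n≢0 2 j}}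

digitSum : ℤ₂ → ℕ → ℕ
digitSum x zero    = 0
digitSum x (suc j) = digitSum x j ℕ.+ digit x j ℕ.* 2 ℕ.^ j

⌊_⌋₂ : ℚ₂ → ℚ
⌊ x /2^ k ⌋₂ = ((+ digitSum x (suc k)) / 2 ℕ.^ k) {{ℕₚ.m^n≢0 2 k}}

-- min(v₂(z), n)
v₂-upTo : ℤ → ℕ → ℕ
v₂-upTo z zero    = 0
v₂-upTo z (suc n) with + (2 ℕ.^ suc n) ℤ∣.∣? z
... | yes _ = suc n
... | no  _ = v₂-upTo z n

-- v₂ of a non-zero rational; v₂(n) ≤ n for natural n > 0.
v₂ : ℚ → ℤ
v₂ q = + v₂-upTo (↥ q) ℤ.∣ ↥ q ∣ ℤ.- + v₂-upTo (↧ q) (↧ₙ q)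

module DyadicLemmas where

  v₂-upTo-≤ : ∀ z n → v₂-upTo z n ℕ.≤ n
  v₂-upTo-≤ z zero = ℕ.z≤n
  v₂-upTo-≤ z (suc n) with + (2 ℕ.^ suc n) ℤ∣.∣? z
  ... | yes _ = ℕₚ.≤-refl
  ... | no  _ = ℕₚ.m≤n⇒m≤1+n (v₂-upTo-≤ z n)

  v₂-upTo-∣ : ∀ z n → + (2 ℕ.^ v₂-upTo z n) ℤ∣.∣ z
  v₂-upTo-∣ z zero = ℤ∣.divides z (sym (ℤₚ.*-identityʳ z))
  v₂-upTo-∣ z (suc n) with + (2 ℕ.^ suc n) ℤ∣.∣? z
  ... | yes d = d
  ... | no  _ = v₂-upTo-∣ z n

  v₂-upTo-greatest : ∀ z n j → j ℕ.≤ n → + (2 ℕ.^ j) ℤ∣.∣ z → j ℕ.≤ v₂-upTo z n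
  v₂-upTo-greatest z zero j j≤n d = j≤n
  v₂-upTo-greatest z (suc n) j j≤n d with + (2 ℕ.^ suc n) ℤ∣.∣? z
  ... | yes _ = j≤n
  ... | no ¬d with ℕₚ.m≤n⇒m<n∨m≡n j≤n
  ...   | inj₁ (ℕ.s≤s j≤n′) = v₂-upTo-greatest z n j j≤n′ d
  ...   | inj₂ refl = contradiction d ¬d

  2^-mono-∣ : ∀ {m n} → m ℕ.≤ n → + (2 ℕ.^ m) ℤ∣.∣ + (2 ℕ.^ n)
  2^-mono-∣ {m} {n} m≤n = ℤ∣.divides (+ (2 ℕ.^ (n ℕ.∸ m))) (begin
    + (2 ℕ.^ n)                              ≡⟨ cong (λ t → + (2 ℕ.^ t)) (sym (ℕₚ.m∸n+n≡m m≤n)) ⟩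
    + (2 ℕ.^ ((n ℕ.∸ m) ℕ.+ m))              ≡⟨ cong +_ (ℕₚ.^-distribˡ-+-* 2 (n ℕ.∸ m) m) ⟩
    + (2 ℕ.^ (n ℕ.∸ m) ℕ.* 2 ℕ.^ m)          ≡⟨ ℤₚ.pos-* (2 ℕ.^ (n ℕ.∸ m)) (2 ℕ.^ m) ⟩
    + (2 ℕ.^ (n ℕ.∸ m)) ℤ.* + (2 ℕ.^ m)      ∎)
    where open ≡-Reasoning

  coherent′ : ∀ x N k → + (2 ℕ.^ N) ℤ∣.∣ res x (k ℕ.+ N) ℤ.- res x N
  coherent′ x N zero = ℤ∣.divides ℤ.0ℤ (ℤₚ.+-inverseʳ (res x N))
  coherent′ x N (suc k) = subst (_ ℤ∣.∣_) (regroup (res x (suc k ℕ.+ N)) (res x (k ℕ.+ N)) (res x N))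
    (ℤ∣.∣m∣n⇒∣m+n (ℤ∣.∣-trans (2^-mono-∣ (ℕₚ.m≤n+m N k)) (coherent x (k ℕ.+ N))) (coherent′ x N k))
    where
    open ℤ-Solver
    regroup : ∀ a b c → (a ℤ.- b) ℤ.+ (b ℤ.- c) ≡ a ℤ.- c
    regroup = solve 3 (λ a b c → (a :- b) :+ (b :- c) := a :- c) refl

  coherent″ : ∀ x N m n → N ℕ.≤ m → N ℕ.≤ n → + (2 ℕ.^ N) ℤ∣.∣ res x m ℤ.- res x n
  coherent″ x N m n N≤m N≤n = subst (_ ℤ∣.∣_) (regroup (res x m) (res x n) (res x N))
    (ℤ∣.∣m∣n⇒∣m+n (to m N≤m) (ℤ∣.∣m⇒∣-m (to n N≤n)))
    where
    to : ∀ m → N ℕ.≤ m → + (2 ℕ.^ N) ℤ∣.∣ res x m ℤ.- res x N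
    to m N≤m = subst (λ t → _ ℤ∣.∣ res x t ℤ.- res x N) (ℕₚ.m∸n+n≡m N≤m) (coherent′ x N (m ℕ.∸ N))
    open ℤ-Solver
    regroup : ∀ a b c → (a ℤ.- c) ℤ.+ (ℤ.- (b ℤ.- c)) ≡ a ℤ.- b
    regroup = solve 3 (λ a b c → (a :- c) :+ (:- (b :- c)) := a :- b) refl

  transfer : ∀ {d a b} → d ℤ∣.∣ a ℤ.- b → d ℤ∣.∣ a → d ℤ∣.∣ b
  transfer {d} {a} {b} h k = subst (d ℤ∣.∣_) (regroup a b) (ℤ∣.∣m∣n⇒∣m+n k (ℤ∣.∣m⇒∣-m h))
    where
    open ℤ-Solver
    regroup : ∀ a b → a ℤ.+ (ℤ.- (a ℤ.- b)) ≡ b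
    regroup = solve 2 (λ a b → a :+ (:- (a :- b)) := b) refl

  v₂-upTo-mono : ∀ x N m n → N ℕ.≤ m → N ℕ.≤ n →
    ¬ (+ (2 ℕ.^ N) ℤ∣.∣ res x m) → v₂-upTo (res x m) m ℕ.≤ v₂-upTo (res x n) n
  v₂-upTo-mono x N m n N≤m N≤n ¬d =
    v₂-upTo-greatest (res x n) n e (ℕₚ.≤-trans (ℕₚ.<⇒≤ e<N) N≤n)
      (transfer (ℤ∣.∣-trans (2^-mono-∣ (ℕₚ.<⇒≤ e<N)) (coherent″ x N m n N≤m N≤n))
                (v₂-upTo-∣ (res x m) m))
    where
    e = v₂-upTo (res x m) m
    e<N : e ℕ.< N
    e<N = ℕₚ.≰⇒> λ N≤e → ¬d (ℤ∣.∣-trans (2^-mono-∣ N≤e) (v₂-upTo-∣ (res x m) m))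

  v₂-upTo-cauchy : ∀ x N m n → N ℕ.≤ m → N ℕ.≤ n →
    (v₂-upTo (res x m) m ≡ v₂-upTo (res x n) n) ⊎
    (N ℕ.≤ v₂-upTo (res x m) m × N ℕ.≤ v₂-upTo (res x n) n)
  v₂-upTo-cauchy x N m n N≤m N≤n with + (2 ℕ.^ N) ℤ∣.∣? res x m
  ... | yes d = inj₂ ( v₂-upTo-greatest (res x m) m N N≤m d
                     , v₂-upTo-greatest (res x n) n N N≤n (transfer (coherent″ x N m n N≤m N≤n) d))
  ... | no ¬d = inj₁ (ℕₚ.≤-antisym
      (v₂-upTo-mono x N m n N≤m N≤n ¬d)
      (v₂-upTo-mono x N n m N≤n N≤m λ d → ¬d (transfer (coherent″ x N n m N≤n N≤m) d)))

  toℚᵘ-/1 : ∀ i → toℚᵘ (i / 1) ℚᵘ.≃ ℚᵘ.mkℚᵘ i 0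
  toℚᵘ-/1 i = ℚₚ.toℚᵘ-fromℚᵘ (ℚᵘ.mkℚᵘ i 0)

  /1-+ : ∀ i j → (i ℤ.+ j) / 1 ≡ i / 1 + j / 1
  /1-+ i j = ℚₚ.toℚᵘ-injective (begin
    toℚᵘ ((i ℤ.+ j) / 1)                 ≈⟨ toℚᵘ-/1 (i ℤ.+ j) ⟩
    ℚᵘ.mkℚᵘ (i ℤ.+ j) 0                  ≈⟨ ℚᵘ.*≡* (lem i j) ⟩
    ℚᵘ.mkℚᵘ i 0 ℚᵘ.+ ℚᵘ.mkℚᵘ j 0         ≈⟨ ℚᵘₚ.+-cong (ℚᵘₚ.≃-sym (toℚᵘ-/1 i)) (ℚᵘₚ.≃-sym (toℚᵘ-/1 j)) ⟩
    toℚᵘ (i / 1) ℚᵘ.+ toℚᵘ (j / 1)       ≈⟨ ℚᵘₚ.≃-sym (ℚₚ.toℚᵘ-homo-+ (i / 1) (j / 1)) ⟩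
    toℚᵘ (i / 1 + j / 1)                 ∎)
    where
    open ℚᵘₚ.≃-Reasoning
    open ℤ-Solver
    lem : ∀ i j → (i ℤ.+ j) ℤ.* + 1 ≡ (i ℤ.* + 1 ℤ.+ j ℤ.* + 1) ℤ.* + 1
    lem = solve 2 (λ i j → (i :+ j) :* con (+ 1) :=
      (i :* con (+ 1) :+ j :* con (+ 1)) :* con (+ 1)) refl

  /1-mono-≤ : ∀ {i j} → i ℤ.≤ j → i / 1 ≤ j / 1
  /1-mono-≤ {i} {j} i≤j = ℚₚ.toℚᵘ-cancel-≤ (ℚᵘₚ.≤-respˡ-≃ (ℚᵘₚ.≃-sym (toℚᵘ-/1 i))
    (ℚᵘₚ.≤-respʳ-≃ (ℚᵘₚ.≃-sym (toℚᵘ-/1 j))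
      (ℚᵘ.*≤* (ℤₚ.*-monoʳ-≤-nonNeg (+ 1) i≤j))))

  *-denominator : ∀ q → q * (↧ q / 1) ≡ ↥ q / 1
  *-denominator q@record{} = ℚₚ.toℚᵘ-injective (begin
    toℚᵘ (q * (↧ q / 1))               ≈⟨ ℚₚ.toℚᵘ-homo-* q (↧ q / 1) ⟩
    toℚᵘ q ℚᵘ.* toℚᵘ (↧ q / 1)         ≈⟨ ℚᵘₚ.*-congˡ {toℚᵘ q} (toℚᵘ-/1 (↧ q)) ⟩
    toℚᵘ q ℚᵘ.* ℚᵘ.mkℚᵘ (↧ q) 0        ≈⟨ ℚᵘ.*≡* (lem (↥ q) (↧ q)) ⟩
    ℚᵘ.mkℚᵘ (↥ q) 0                    ≈⟨ ℚᵘₚ.≃-sym (toℚᵘ-/1 (↥ q)) ⟩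
    toℚᵘ (↥ q / 1)                     ∎)
    where
    open ℚᵘₚ.≃-Reasoning
    open ℤ-Solver
    lem : ∀ a b → (a ℤ.* b) ℤ.* + 1 ≡ a ℤ.* (b ℤ.* + 1)
    lem = solve 2 (λ a b → (a :* b) :* con (+ 1) := a :* (b :* con (+ 1))) refl

  1≤-denominator : ∀ q → 1ℚ ≤ ↧ q / 1
  1≤-denominator q = /1-mono-≤ {+ 1} {↧ q} (ℤ.+≤+ (ℕ.s≤s ℕ.z≤n))

  1≤numerator : ∀ ε → .{{Positive ε}} → 1ℚ ≤ ↥ ε / 1
  1≤numerator (mkℚ +[1+ n ] _ _) = /1-mono-≤ {+ 1} {+[1+ n ]} (ℤ.+≤+ (ℕ.s≤s ℕ.z≤n))

  0<2^ : ∀ n → 0ℚ < 2^ (+ n)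
  0<2^ zero    = ℚₚ.positive⁻¹ 1ℚ
  0<2^ (suc n) = subst (_< 2^ (+ suc n)) (ℚₚ.*-zeroʳ (+ 2 / 1)) (ℚₚ.*-monoʳ-<-pos (+ 2 / 1) (0<2^ n))

  0<½^ : ∀ n → 0ℚ < ½ ℚ^.^ n
  0<½^ zero    = ℚₚ.positive⁻¹ 1ℚ
  0<½^ (suc n) = 0<½ε (0<½^ n)

  ½^-anti : ∀ n k → ½ ℚ^.^ (k ℕ.+ n) ≤ ½ ℚ^.^ n
  ½^-anti n zero    = ℚₚ.≤-refl
  ½^-anti n (suc k) = ℚₚ.≤-trans
    (subst (½ * t ≤_) (ℚₚ.*-identityˡ t)
      (ℚₚ.*-monoʳ-≤-nonNeg t {{nonNegative (ℚₚ.<⇒≤ (0<½^ (k ℕ.+ n)))}} (ℚₚ.<⇒≤ (from-yes (½ ℚₚ.<? 1ℚ)))))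
    (½^-anti n k)
    where t = ½ ℚ^.^ (k ℕ.+ n)

  ½^-anti-≤ : ∀ {n m} → n ℕ.≤ m → ½ ℚ^.^ m ≤ ½ ℚ^.^ n
  ½^-anti-≤ {n} {m} n≤m = subst (λ t → ½ ℚ^.^ t ≤ ½ ℚ^.^ n) (ℕₚ.m∸n+n≡m n≤m) (½^-anti n (m ℕ.∸ n))

  2^*½^≡1 : ∀ n → 2^ (+ n) * ½ ℚ^.^ n ≡ 1ℚ
  2^*½^≡1 zero = ℚₚ.*-identityˡ 1ℚ
  2^*½^≡1 (suc n) = trans (lem (2^ (+ n)) (½ ℚ^.^ n)) (2^*½^≡1 n)
    where
    open ℚ-Solver
    lem : ∀ a b → ((+ 2 / 1) * a) * (½ * b) ≡ a * b
    lem = solve 2 (λ a b → (con (+ 2 / 1) :* a) :* (con ½ :* b) := a :* b) refl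

  n<2^n : ∀ n → + n / 1 < 2^ (+ n)
  n<2^n zero = ℚₚ.positive⁻¹ 1ℚ
  n<2^n (suc n) = begin-strict
    + suc n / 1                ≡⟨ /1-+ (+ 1) (+ n) ⟩
    1ℚ + + n / 1               <⟨ ℚₚ.+-mono-≤-< (1≤2^ n) (n<2^n n) ⟩
    2^ (+ n) + 2^ (+ n)        ≡⟨ lem (2^ (+ n)) ⟩
    (+ 2 / 1) * 2^ (+ n)       ∎
    where
    open ℚₚ.≤-Reasoning
    open ℚ-Solver
    lem : ∀ a → a + a ≡ (+ 2 / 1) * a
    lem = solve 1 (λ a → a :+ a := con (+ 2 / 1) :* a) refl
    1≤2^ : ∀ n → 1ℚ ≤ 2^ (+ n)
    1≤2^ zero = ℚₚ.≤-refl
    1≤2^ (suc n) = ℚₚ.≤-trans (1≤2^ n) (subst (_≤ 2^ (+ suc n)) (ℚₚ.*-identityˡ (2^ (+ n)))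
      (ℚₚ.*-monoʳ-≤-nonNeg (2^ (+ n)) {{nonNegative (ℚₚ.<⇒≤ (0<2^ n))}} (ℚₚ.<⇒≤ (from-yes (1ℚ ℚₚ.<? + 2 / 1)))))

  ½^-small : ∀ {ε} → 0ℚ < ε → ½ ℚ^.^ ↧ₙ ε < ε
  ½^-small {ε} 0<ε = ℚₚ.*-cancelˡ-<-nonNeg (2^ (+ d)) {{nonNegative (ℚₚ.<⇒≤ (0<2^ d))}} (begin-strict
    2^ (+ d) * ½ ℚ^.^ d  ≡⟨ 2^*½^≡1 d ⟩
    1ℚ                   ≤⟨ 1≤numerator ε {{positive 0<ε}} ⟩
    ↥ ε / 1              ≡⟨ sym (*-denominator ε) ⟩
    ε * (+ d / 1)        <⟨ ℚₚ.*-monoʳ-<-pos ε {{positive 0<ε}} (n<2^n d) ⟩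
    ε * 2^ (+ d)         ≡⟨ ℚₚ.*-comm ε (2^ (+ d)) ⟩
    2^ (+ d) * ε         ∎)
    where
    open ℚₚ.≤-Reasoning
    d = ↧ₙ ε

  ∣a-b∣<ε : ∀ {a b ε} → 0ℚ ≤ a → 0ℚ ≤ b → a < ε → b < ε → ∣ a - b ∣ < ε
  ∣a-b∣<ε {a} {b} {ε} 0≤a 0≤b a<ε b<ε with ℚₚ.∣p∣≡p∨∣p∣≡-p (a - b)
  ... | inj₁ eq = subst (_< ε) (sym eq) (ℚₚ.≤-<-trans (a-b≤a a b 0≤b) a<ε)
    where
    a-b≤a : ∀ a b → 0ℚ ≤ b → a - b ≤ a
    a-b≤a a b 0≤b = subst (a - b ≤_) (ℚₚ.+-identityʳ a) (ℚₚ.+-monoʳ-≤ a (ℚₚ.neg-antimono-≤ 0≤b))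
  ... | inj₂ eq = subst (_< ε) (sym (trans eq (swap a b))) (ℚₚ.≤-<-trans (a-b≤a b a 0≤a) b<ε)
    where
    a-b≤a : ∀ a b → 0ℚ ≤ b → a - b ≤ a
    a-b≤a a b 0≤b = subst (a - b ≤_) (ℚₚ.+-identityʳ a) (ℚₚ.+-monoʳ-≤ a (ℚₚ.neg-antimono-≤ 0≤b))
    open ℚ-Solver
    swap : ∀ a b → - (a - b) ≡ b - a
    swap = solve 2 (λ a b → :- (a :- b) := b :- a) refl

open DyadicLemmas

-- ∣ x / 2ᵏ ∣₂ is the limit of 2ᵏ 2^(- min(v₂(xₙ), n)).
∣_∣₂ : ℚ₂ → ℝ
∣ x /2^ k ∣₂ = mkℝ (λ n → 2^ (+ k) * ½ ℚ^.^ v₂-upTo (res x n) n) λ ε 0<ε →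
  k ℕ.+ ↧ₙ ε , λ m n N≤m N≤n →
    close ε 0<ε (v₂-upTo-cauchy x (k ℕ.+ ↧ₙ ε) m n N≤m N≤n)
  where
  small : ∀ {ε} e → 0ℚ < ε → k ℕ.+ ↧ₙ ε ℕ.≤ e → 2^ (+ k) * ½ ℚ^.^ e < ε
  small {ε} e 0<ε N≤e = begin-strict
    2^ (+ k) * ½ ℚ^.^ e                    ≤⟨ ℚₚ.*-monoˡ-≤-nonNeg (2^ (+ k)) {{nonNegative (ℚₚ.<⇒≤ (0<2^ k))}} (½^-anti-≤ N≤e) ⟩
    2^ (+ k) * ½ ℚ^.^ (k ℕ.+ ↧ₙ ε)         ≡⟨ lem k (↧ₙ ε) ⟩
    ½ ℚ^.^ ↧ₙ ε                            <⟨ ½^-small 0<ε ⟩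
    ε                                      ∎
    where
    open ℚₚ.≤-Reasoning
    lem : ∀ k n → 2^ (+ k) * ½ ℚ^.^ (k ℕ.+ n) ≡ ½ ℚ^.^ n
    lem zero n = ℚₚ.*-identityˡ _
    lem (suc k) n = trans (cancel (2^ (+ k)) (½ ℚ^.^ (k ℕ.+ n))) (lem k n)
      where
      open ℚ-Solver
      cancel : ∀ a b → ((+ 2 / 1) * a) * (½ * b) ≡ a * b
      cancel = solve 2 (λ a b → (con (+ 2 / 1) :* a) :* (con ½ :* b) := a :* b) refl
  nonneg : ∀ e → 0ℚ ≤ 2^ (+ k) * ½ ℚ^.^ e
  nonneg e = subst (_≤ 2^ (+ k) * ½ ℚ^.^ e) (ℚₚ.*-zeroʳ (2^ (+ k)))
    (ℚₚ.*-monoˡ-≤-nonNeg (2^ (+ k)) {{nonNegative (ℚₚ.<⇒≤ (0<2^ k))}} (ℚₚ.<⇒≤ (0<½^ e)))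
  close : ∀ ε → 0ℚ < ε → ∀ {e e′} → (e ≡ e′) ⊎ (k ℕ.+ ↧ₙ ε ℕ.≤ e × k ℕ.+ ↧ₙ ε ℕ.≤ e′) →
          ∣ 2^ (+ k) * ½ ℚ^.^ e - 2^ (+ k) * ½ ℚ^.^ e′ ∣ < ε
  close ε 0<ε {e} (inj₁ refl) = subst (λ t → ∣ t ∣ < ε) (sym (sub-self (2^ (+ k) * ½ ℚ^.^ e))) 0<ε
  close ε 0<ε {e} {e′} (inj₂ (h , h′)) = ∣a-b∣<ε (nonneg e) (nonneg e′) (small e 0<ε h) (small e′ 0<ε h′)

module RealLemmas where

  ev-map₂ : ∀ {P Q R : ℕ → Set} → Eventually P → Eventually Q →
            (∀ n → P n → Q n → R n) → Eventually R
  ev-map₂ (N₁ , h₁) (N₂ , h₂) f = N₁ ℕ.⊔ N₂ , λ n N≤n →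
    f n (h₁ n (ℕₚ.m⊔n≤o⇒m≤o N₁ N₂ N≤n)) (h₂ n (ℕₚ.m⊔n≤o⇒n≤o N₁ N₂ N≤n))

  ev-map : ∀ {P R : ℕ → Set} → Eventually P → (∀ n → P n → R n) → Eventually R
  ev-map (N , h) f = N , λ n N≤n → f n (h n N≤n)

  -- a < b follows from c < d when b - a = d - c

  lin : ∀ {a b c d} → b - a ≡ d - c → b ≡ d + (a - c)
  lin {a} {b} {c} {d} eq = trans (l₁ a b) (trans (cong (_+ a) eq) (l₂ a c d))
    where
    open ℚ-Solver
    l₁ : ∀ a b → b ≡ (b - a) + a
    l₁ = solve 2 (λ a b → b := (b :- a) :+ a) refl
    l₂ : ∀ a c d → (d - c) + a ≡ d + (a - c)
    l₂ = solve 3 (λ a c d → (d :- c) :+ a := d :+ (a :- c)) refl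

  split-at : ∀ a c → c + (a - c) ≡ a
  split-at = solve 2 (λ a c → c :+ (a :- c) := a) refl
    where open ℚ-Solver

  lin< : ∀ {a b c d} → b - a ≡ d - c → c < d → a < b
  lin< {a} {b} {c} {d} eq c<d =
    subst₂ _<_ (split-at a c) (sym (lin {a} {b} {c} {d} eq)) (ℚₚ.+-monoˡ-< (a - c) c<d)

  lin≤ : ∀ {a b c d} → b - a ≡ d - c → c ≤ d → a ≤ b
  lin≤ {a} {b} {c} {d} eq c≤d =
    subst₂ _≤_ (split-at a c) (sym (lin {a} {b} {c} {d} eq)) (ℚₚ.+-monoˡ-≤ (a - c) c≤d)

  p≤∣p∣ : ∀ p → p ≤ ∣ p ∣
  p≤∣p∣ p with ℚₚ.≤-total 0ℚ p
  ... | inj₁ 0≤p = ℚₚ.≤-reflexive (sym (ℚₚ.0≤p⇒∣p∣≡p 0≤p))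
  ... | inj₂ p≤0 = ℚₚ.≤-trans p≤0 (ℚₚ.0≤∣p∣ p)

  -p≤∣p∣ : ∀ p → - p ≤ ∣ p ∣
  -p≤∣p∣ p = subst (- p ≤_) (ℚₚ.∣-p∣≡∣p∣ p) (p≤∣p∣ (- p))

  ∣p∣<q : ∀ {p q} → p < q → - p < q → ∣ p ∣ < q
  ∣p∣<q {p} {q} h h′ with ℚₚ.∣p∣≡p∨∣p∣≡-p p
  ... | inj₁ eq = subst (_< q) (sym eq) h
  ... | inj₂ eq = subst (_< q) (sym eq) h′

  p+ε>p : ∀ {p ε} → 0ℚ < ε → p < p + ε
  p+ε>p {p} {ε} 0<ε = subst (_< p + ε) (ℚₚ.+-identityʳ p) (ℚₚ.+-monoʳ-< p 0<ε)

  ≈-refl : ∀ x → x ≈ℝ x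
  ≈-refl x ε 0<ε = 0 , λ n _ → subst (λ t → ∣ t ∣ < ε) (sym (sub-self (seq x n))) 0<ε

  ≈-sym : ∀ x y → x ≈ℝ y → y ≈ℝ x
  ≈-sym x y h ε 0<ε = ev-map (h ε 0<ε) λ n → subst (_< ε) (∣a-b∣≡∣b-a∣ (seq x n) (seq y n))

  triangle : ∀ a b c → ∣ a - c ∣ ≤ ∣ a - b ∣ + ∣ b - c ∣
  triangle a b c = subst (λ t → ∣ t ∣ ≤ ∣ a - b ∣ + ∣ b - c ∣) (lem a b c) (ℚₚ.∣p+q∣≤∣p∣+∣q∣ (a - b) (b - c))
    where
    open ℚ-Solver
    lem : ∀ a b c → (a - b) + (b - c) ≡ a - c
    lem = solve 3 (λ a b c → (a :- b) :+ (b :- c) := a :- c) refl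

  ≈-trans : ∀ x y z → x ≈ℝ y → y ≈ℝ z → x ≈ℝ z
  ≈-trans x y z h k ε 0<ε = ev-map₂ (h (½ * ε) (0<½ε 0<ε)) (k (½ * ε) (0<½ε 0<ε)) λ n p q →
    ℚₚ.≤-<-trans (triangle (seq x n) (seq y n) (seq z n))
      (subst (_ <_) (½ε+½ε≡ε ε) (ℚₚ.+-mono-< p q))

  +-cong : ∀ x x′ y y′ → x ≈ℝ x′ → y ≈ℝ y′ → (x +ℝ y) ≈ℝ (x′ +ℝ y′)
  +-cong x x′ y y′ h k ε 0<ε = ev-map₂ (h (½ * ε) (0<½ε 0<ε)) (k (½ * ε) (0<½ε 0<ε)) λ n p q →
    ℚₚ.≤-<-trans
      (subst (λ t → ∣ t ∣ ≤ ∣ seq x n - seq x′ n ∣ + ∣ seq y n - seq y′ n ∣)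
        (lem (seq x n) (seq x′ n) (seq y n) (seq y′ n))
        (ℚₚ.∣p+q∣≤∣p∣+∣q∣ (seq x n - seq x′ n) (seq y n - seq y′ n)))
      (subst (_ <_) (½ε+½ε≡ε ε) (ℚₚ.+-mono-< p q))
    where
    open ℚ-Solver
    lem : ∀ a a′ b b′ → (a - a′) + (b - b′) ≡ (a + b) - (a′ + b′)
    lem = solve 4 (λ a a′ b b′ → (a :- a′) :+ (b :- b′) := (a :+ b) :- (a′ :+ b′)) refl

  neg-cong : ∀ x y → x ≈ℝ y → (-ℝ x) ≈ℝ (-ℝ y)
  neg-cong x y h ε 0<ε = ev-map (h ε 0<ε) λ n →
    subst (_< ε) (trans (sym (ℚₚ.∣-p∣≡∣p∣ (seq x n - seq y n))) (cong ∣_∣ (lem (seq x n) (seq y n))))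
    where
    open ℚ-Solver
    lem : ∀ a b → - (a - b) ≡ - a - - b
    lem = solve 2 (λ a b → :- (a :- b) := (:- a) :- (:- b)) refl

  inv : ∀ B → 0ℚ < B → ℚ
  inv B 0<B = (1/ B) {{ℚₚ.pos⇒nonZero B {{positive 0<B}}}}

  0<inv : ∀ B (0<B : 0ℚ < B) → 0ℚ < inv B 0<B
  0<inv B 0<B = ℚₚ.positive⁻¹ _ {{ℚₚ.1/pos⇒pos B {{positive 0<B}}}}

  0<* : ∀ {a b} → 0ℚ < a → 0ℚ < b → 0ℚ < a * b
  0<* {a} {b} 0<a 0<b = subst (_< a * b) (ℚₚ.*-zeroʳ a) (ℚₚ.*-monoʳ-<-pos a {{positive 0<a}} 0<b)

  *-inv : ∀ B (0<B : 0ℚ < B) ε → B * (inv B 0<B * ε) ≡ ε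
  *-inv B 0<B ε = trans (sym (ℚₚ.*-assoc B (inv B 0<B) ε))
    (trans (cong (_* ε) (ℚₚ.*-inverseʳ B {{ℚₚ.pos⇒nonZero B {{positive 0<B}}}})) (ℚₚ.*-identityˡ ε))

  *-congˡ : ∀ x y y′ → y ≈ℝ y′ → (x *ℝ y) ≈ℝ (x *ℝ y′)
  *-congˡ x y y′ h ε 0<ε =
    let N , B , 0<B , b = eventually-bounded x in
    ev-map₂ (N , b) (h (inv B 0<B * ε) (0<* (0<inv B 0<B) 0<ε)) λ n p q → begin-strict
      ∣ seq x n * seq y n - seq x n * seq y′ n ∣  ≡⟨ cong ∣_∣ (lem (seq x n) (seq y n) (seq y′ n)) ⟩
      ∣ seq x n * (seq y n - seq y′ n) ∣          ≡⟨ ℚₚ.∣p*q∣≡∣p∣*∣q∣ (seq x n) (seq y n - seq y′ n) ⟩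
      ∣ seq x n ∣ * ∣ seq y n - seq y′ n ∣        ≤⟨ ℚₚ.*-monoʳ-≤-nonNeg ∣ seq y n - seq y′ n ∣ {{ℚₚ.∣-∣-nonNeg (seq y n - seq y′ n)}} p ⟩
      B * ∣ seq y n - seq y′ n ∣                  <⟨ ℚₚ.*-monoʳ-<-pos B {{positive 0<B}} q ⟩
      B * (inv B 0<B * ε)                         ≡⟨ *-inv B 0<B ε ⟩
      ε                                           ∎
    where
    open ℚₚ.≤-Reasoning
    open ℚ-Solver
    lem : ∀ a b c → a * b - a * c ≡ a * (b - c)
    lem = solve 3 (λ a b c → a :* b :- a :* c := a :* (b :- c)) refl

  *-cancelʳ : ∀ x q d → 0ℚ < d → (x *ℝ fromℚ d) ≈ℝ fromℚ (q * d) → x ≈ℝ fromℚ q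
  *-cancelʳ x q d 0<d h ε 0<ε = ev-map (h (ε * d) (0<* 0<ε 0<d)) λ n p →
    ℚₚ.*-cancelʳ-<-nonNeg d {{nonNegative (ℚₚ.<⇒≤ 0<d)}} (begin-strict
      ∣ seq x n - q ∣ * d       ≡⟨ cong (∣ seq x n - q ∣ *_) (sym (ℚₚ.0≤p⇒∣p∣≡p (ℚₚ.<⇒≤ 0<d))) ⟩
      ∣ seq x n - q ∣ * ∣ d ∣   ≡⟨ sym (ℚₚ.∣p*q∣≡∣p∣*∣q∣ (seq x n - q) d) ⟩
      ∣ (seq x n - q) * d ∣     ≡⟨ cong ∣_∣ (lem (seq x n) q d) ⟩
      ∣ seq x n * d - q * d ∣   <⟨ p ⟩
      ε * d                     ∎)
    where
    open ℚₚ.≤-Reasoning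
    open ℚ-Solver
    lem : ∀ a b c → (a - b) * c ≡ a * c - b * c
    lem = solve 3 (λ a b c → (a :- b) :* c := a :* c :- b :* c) refl

open RealLemmas

IsMinimiser : (ℤ → ℝ) → ℤ → Set
IsMinimiser f i = ∀ j → f i ≤ℝ f j

IsLeastMinimiser : (ℤ → ℝ) → ℤ → Set
IsLeastMinimiser f m = IsMinimiser f m × (∀ i → IsMinimiser f i → m ℤ.≤ i)

-- The least minimiser of ∣ y - s i - r ∣ is the i with
-- s i + r - s/2 < y ≤ s i + r + s/2.
module LeastMinimiser (y : ℝ) (s r : ℚ) (1≤s : 1ℚ ≤ s) where

  distance : ℤ → ℝ
  distance i = ∣ y -ℝ fromℚ (s * (i / 1)) -ℝ fromℚ r ∣ℝ

  t : ℤ → ℚ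
  t i = s * (i / 1) + r + ½ * s

  0≤s : 0ℚ ≤ s
  0≤s = ℚₚ.≤-trans (ℚₚ.<⇒≤ (ℚₚ.positive⁻¹ 1ℚ)) 1≤s

  0<s : 0ℚ < s
  0<s = ℚₚ.<-≤-trans (ℚₚ.positive⁻¹ 1ℚ) 1≤s

  ≤s* : ∀ n → + n / 1 ≤ s * (+ n / 1)
  ≤s* n = subst (_≤ s * (+ n / 1)) (ℚₚ.*-identityˡ (+ n / 1))
    (ℚₚ.*-monoʳ-≤-nonNeg (+ n / 1) {{nonNegative (/1-mono-≤ {+ 0} {+ n} (ℤ.+≤+ ℕ.z≤n))}} 1≤s)

  ≤ceil : ∀ q → 0ℚ ≤ q → q ≤ + ℤ.∣ ↥ q ∣ / 1
  ≤ceil q 0≤q = ℚₚ.≤-trans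
    (subst (_≤ q * (↧ q / 1)) (ℚₚ.*-identityʳ q)
      (ℚₚ.*-monoˡ-≤-nonNeg q {{nonNegative 0≤q}} (1≤-denominator q)))
    (ℚₚ.≤-trans (ℚₚ.≤-reflexive (*-denominator q)) (/1-mono-≤ (i≤∣i∣ (↥ q))))
    where
    i≤∣i∣ : ∀ i → i ℤ.≤ + ℤ.∣ i ∣
    i≤∣i∣ (+ n)    = ℤₚ.≤-refl
    i≤∣i∣ -[1+ n ] = ℤ.-≤+

  module Bounds (B : ℚ) (0≤B : 0ℚ ≤ B) (∣y∣≤B : Eventually λ n → ∣ seq y n ∣ ≤ B)
                (M : ℕ) (threshold≤M : B + ∣ r ∣ + ½ * s + (+ 2 / 1) ≤ + M / 1) where

    threshold = B + ∣ r ∣ + ½ * s + (+ 2 / 1)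

    threshold≤ : threshold ≤ s * (+ M / 1)
    threshold≤ = ℚₚ.≤-trans threshold≤M (≤s* M)

    threshold≤′ : threshold ≤ s * (+ suc M / 1)
    threshold≤′ = ℚₚ.≤-trans threshold≤M
      (ℚₚ.≤-trans (/1-mono-≤ {+ M} {+ suc M} (ℤ.+≤+ (ℕₚ.n≤1+n M))) (≤s* (suc M)))

    lower : fromℚ (t (ℤ.- + M)) <ℝ y
    lower = 1ℚ , ℚₚ.positive⁻¹ 1ℚ , ev-map ∣y∣≤B λ n h →
      lin< {t (ℤ.- + M) + 1ℚ} {seq y n}
        {((threshold + r) + - seq y n) + 0ℚ} {((s * (+ M / 1) + ∣ r ∣) + B) + 1ℚ}
        (trans (cong (λ e → seq y n - (s * e + r + ½ * s + 1ℚ)) (neg/1 M))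
          (lem s (+ M / 1) r (seq y n) B ∣ r ∣))
        (ℚₚ.+-mono-≤-< (ℚₚ.+-mono-≤ (ℚₚ.+-mono-≤ threshold≤ (p≤∣p∣ r))
          (ℚₚ.≤-trans (-p≤∣p∣ (seq y n)) h)) (ℚₚ.positive⁻¹ 1ℚ))
      where
      open ℚ-Solver
      neg/1 : ∀ n → (ℤ.- + n) / 1 ≡ - (+ n / 1)
      neg/1 zero    = refl
      neg/1 (suc n) = refl
      lem : ∀ s e r y B R → y - (s * - e + r + ½ * s + 1ℚ) ≡
        (((s * e + R) + B) + 1ℚ) - (((B + R + ½ * s + (+ 2 / 1) + r) + - y) + 0ℚ)
      lem = solve 6 (λ s e r y B R →
        y :- (s :* (:- e) :+ r :+ con ½ :* s :+ con 1ℚ) :=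
        (((s :* e :+ R) :+ B) :+ con 1ℚ) :-
        (((B :+ R :+ con ½ :* s :+ con (+ 2 / 1) :+ r) :+ (:- y)) :+ con 0ℚ)) refl

    upper : y ≤ℝ fromℚ (t (+ suc M))
    upper ε 0<ε = ev-map ∣y∣≤B λ n h →
      lin< {seq y n} {t (+ suc M) + ε}
        {(((threshold + - r) + seq y n) + 0ℚ) + (0ℚ + 0ℚ)}
        {(((s * (+ suc M / 1) + ∣ r ∣) + B) + s) + ((+ 2 / 1) + ε)}
        (lem s (+ suc M / 1) r (seq y n) B ∣ r ∣ ε)
        (ℚₚ.+-mono-≤-< (ℚₚ.+-mono-≤ (ℚₚ.+-mono-≤ (ℚₚ.+-mono-≤ threshold≤′ (-p≤∣p∣ r))
          (ℚₚ.≤-trans (p≤∣p∣ (seq y n)) h)) 0≤s)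
          (ℚₚ.+-mono-< (ℚₚ.positive⁻¹ (+ 2 / 1)) 0<ε))
      where
      open ℚ-Solver
      lem : ∀ s e r y B R ε → (s * e + r + ½ * s + ε) - y ≡
        ((((s * e + R) + B) + s) + ((+ 2 / 1) + ε)) -
        ((((B + R + ½ * s + (+ 2 / 1) + - r) + y) + 0ℚ) + (0ℚ + 0ℚ))
      lem = solve 7 (λ s e r y B R ε → (s :* e :+ r :+ con ½ :* s :+ ε) :- y :=
        ((((s :* e :+ R) :+ B) :+ s) :+ (con (+ 2 / 1) :+ ε)) :-
        ((((B :+ R :+ con ½ :* s :+ con (+ 2 / 1) :+ (:- r)) :+ y) :+ con 0ℚ) :+ (con 0ℚ :+ con 0ℚ))) refl

  bounds : ∃ λ M → (fromℚ (t (ℤ.- + M)) <ℝ y) × (y ≤ℝ fromℚ (t (+ suc M)))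
  bounds =
    let N , B , 0<B , ∣y∣≤B = eventually-bounded y
        q = B + ∣ r ∣ + ½ * s + (+ 2 / 1)
        M = ℤ.∣ ↥ q ∣
        0≤q = ℚₚ.+-mono-≤ (ℚₚ.+-mono-≤ (ℚₚ.+-mono-≤
          (ℚₚ.<⇒≤ 0<B) (ℚₚ.0≤∣p∣ r)) (ℚₚ.<⇒≤ (0<½ε 0<s))) (ℚₚ.<⇒≤ (ℚₚ.positive⁻¹ (+ 2 / 1)))
        open Bounds B (ℚₚ.<⇒≤ 0<B) (N , ∣y∣≤B) M (≤ceil q 0≤q)
    in M , lower , upper

  module _ (i₀ m : ℤ) (m≡i₀+1 : m ≡ i₀ ℤ.+ + 1)
           (t<y : fromℚ (t i₀) <ℝ y) (y≤t : y ≤ℝ fromℚ (t m)) where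

    X : ℤ → ℕ → ℚ
    X j n = seq y n - s * (j / 1) - r

    s+ : ∀ {i j} → i ℤ.< j → s * (i / 1) + s ≤ s * (j / 1)
    s+ {i} {j} i<j = subst (_≤ s * (j / 1)) (lem s (i / 1))
      (ℚₚ.*-monoˡ-≤-nonNeg s {{nonNegative 0≤s}}
        (subst (_≤ j / 1) (/1-+ (+ 1) i) (/1-mono-≤ (ℤₚ.i<j⇒suc[i]≤j i<j))))
      where
      open ℚ-Solver
      lem : ∀ s e → s * (1ℚ + e) ≡ s * e + s
      lem = solve 2 (λ s e → s :* (con 1ℚ :+ e) := s :* e :+ s) refl

    s*m : s * (m / 1) ≡ s * (i₀ / 1) + s
    s*m = trans (cong (λ j → s * (j / 1)) m≡i₀+1) (trans (cong (s *_) (/1-+ i₀ (+ 1))) (lem s (i₀ / 1)))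
      where
      open ℚ-Solver
      lem : ∀ s e → s * (e + 1ℚ) ≡ s * e + s
      lem = solve 2 (λ s e → s :* (e :+ con 1ℚ) := s :* e :+ s) refl

    above : ∀ j → m ℤ.< j → ∀ ε → 0ℚ < ε → ∀ n →
            seq y n < t m + ½ * ε → ∣ X m n ∣ < ∣ X j n ∣ + ε
    above j m<j ε 0<ε n h = ℚₚ.<-≤-trans
      (∣p∣<q
        (lin< {X m n} {(- X j n + ε)}
          {((seq y n + seq y n) + (s * (m / 1) + s))} {((t m + ½ * ε) + (t m + ½ * ε)) + s * (j / 1)}
          (lem₁ s (m / 1) (j / 1) r (seq y n) ε)
          (ℚₚ.+-mono-<-≤ (ℚₚ.+-mono-< h h) (s+ m<j)))
        (lin< {(- X m n)} {(- X j n + ε)} {(s * (m / 1) + s) + (0ℚ + 0ℚ)} {s * (j / 1) + (s + ε)}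
          (lem₂ s (m / 1) (j / 1) r (seq y n) ε)
          (ℚₚ.+-mono-≤-< (s+ m<j) (ℚₚ.+-mono-< 0<s 0<ε))))
      (ℚₚ.+-monoˡ-≤ ε (-p≤∣p∣ (X j n)))
      where
      open ℚ-Solver
      lem₁ : ∀ s e d r y ε → (- (y - s * d - r) + ε) - (y - s * e - r) ≡
        (((s * e + r + ½ * s + ½ * ε) + (s * e + r + ½ * s + ½ * ε)) + s * d) - ((y + y) + (s * e + s))
      lem₁ = solve 6 (λ s e d r y ε → ((:- (y :- s :* d :- r)) :+ ε) :- (y :- s :* e :- r) :=
        (((s :* e :+ r :+ con ½ :* s :+ con ½ :* ε) :+ (s :* e :+ r :+ con ½ :* s :+ con ½ :* ε)) :+ s :* d)
        :- ((y :+ y) :+ (s :* e :+ s))) refl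
      lem₂ : ∀ s e d r y ε → (- (y - s * d - r) + ε) - - (y - s * e - r) ≡
        (s * d + (s + ε)) - ((s * e + s) + (0ℚ + 0ℚ))
      lem₂ = solve 6 (λ s e d r y ε → ((:- (y :- s :* d :- r)) :+ ε) :- (:- (y :- s :* e :- r)) :=
        (s :* d :+ (s :+ ε)) :- ((s :* e :+ s) :+ (con 0ℚ :+ con 0ℚ))) refl

    below : ∀ j → j ℤ.< m → ∀ η ε → ε ≤ s → ε ≤ η + η → ∀ n →
            t i₀ + η < seq y n → ∣ X m n ∣ + ε ≤ ∣ X j n ∣
    below j j<m η ε ε≤s ε≤2η n h = ℚₚ.≤-trans
      (shift (∣p∣≤q
        (lin≤ {X m n} {X j n - ε} {(s * (j / 1) + s) + ε} {s * (m / 1) + s}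
          (lem₁ s (m / 1) (j / 1) r (seq y n) ε)
          (ℚₚ.+-mono-≤ (s+ j<m) ε≤s))
        (lin≤ {(- X m n)} {X j n - ε}
          {(((t i₀ + η) + (t i₀ + η)) + (s * (j / 1) + s)) + ε}
          {((seq y n + seq y n) + s * (m / 1)) + (η + η)}
          (trans (lem₂ (s * (m / 1)) (s * (j / 1)) r (seq y n) ε)
            (trans (cong (λ e → (seq y n + seq y n) - (s * (j / 1) + e) - (r + r) - ε) s*m)
              (lem₃ (s * (i₀ / 1)) (s * (j / 1)) r (seq y n) ε η s (s * (m / 1)) s*m)))
          (ℚₚ.+-mono-≤ (ℚₚ.+-mono-≤ (ℚₚ.<⇒≤ (ℚₚ.+-mono-< h h)) (s+ j<m)) ε≤2η))))
      (p≤∣p∣ (X j n))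
      where
      ∣p∣≤q : ∀ {p q} → p ≤ q → - p ≤ q → ∣ p ∣ ≤ q
      ∣p∣≤q {p} {q} h h′ with ℚₚ.∣p∣≡p∨∣p∣≡-p p
      ... | inj₁ eq = subst (_≤ q) (sym eq) h
      ... | inj₂ eq = subst (_≤ q) (sym eq) h′
      open ℚ-Solver
      shift : ∀ {a b c} → a ≤ b - c → a + c ≤ b
      shift {a} {b} {c} = lin≤ (solve 3 (λ a b c → b :- (a :+ c) := (b :- c) :- a) refl a b c)
      lem₁ : ∀ s e d r y ε → ((y - s * d - r) - ε) - (y - s * e - r) ≡
        (s * e + s) - ((s * d + s) + ε)
      lem₁ = solve 6 (λ s e d r y ε → ((y :- s :* d :- r) :- ε) :- (y :- s :* e :- r) :=
        (s :* e :+ s) :- ((s :* d :+ s) :+ ε)) refl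
      lem₂ : ∀ e d r y ε → ((y - d - r) - ε) - - (y - e - r) ≡ (y + y) - (d + e) - (r + r) - ε
      lem₂ = solve 5 (λ e d r y ε → ((y :- d :- r) :- ε) :- (:- (y :- e :- r)) :=
        (y :+ y) :- (d :+ e) :- (r :+ r) :- ε) refl
      lem₄ : ∀ i d r y ε η s → (y + y) - (d + (i + s)) - (r + r) - ε ≡
        (((y + y) + (i + s)) + (η + η)) - ((((i + r + ½ * s + η) + (i + r + ½ * s + η)) + (d + s)) + ε)
      lem₄ = solve 7 (λ i d r y ε η s → (y :+ y) :- (d :+ (i :+ s)) :- (r :+ r) :- ε :=
        (((y :+ y) :+ (i :+ s)) :+ (η :+ η)) :-
        ((((i :+ r :+ con ½ :* s :+ η) :+ (i :+ r :+ con ½ :* s :+ η)) :+ (d :+ s)) :+ ε)) refl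
      lem₃ : ∀ i d r y ε η s e → e ≡ i + s → (y + y) - (d + (i + s)) - (r + r) - ε ≡
        (((y + y) + e) + (η + η)) - ((((i + r + ½ * s + η) + (i + r + ½ * s + η)) + (d + s)) + ε)
      lem₃ i d r y ε η s e refl = lem₄ i d r y ε η s

    smaller : ∀ a b → 0ℚ < a → 0ℚ < b → ∃ λ ε → 0ℚ < ε × ε ≤ a × ε ≤ b
    smaller a b 0<a 0<b with ℚₚ.≤-total a b
    ... | inj₁ a≤b = a , 0<a , ℚₚ.≤-refl , a≤b
    ... | inj₂ b≤a = b , 0<b , b≤a , ℚₚ.≤-refl

    gap : ∀ j → j ℤ.< m → ∃ λ ε → 0ℚ < ε × Eventually λ n → ∣ X m n ∣ + ε ≤ ∣ X j n ∣
    gap j j<m =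
      let η , 0<η , ev = t<y
          ε , 0<ε , ε≤s , ε≤2η = smaller s (η + η) 0<s (ℚₚ.+-mono-< 0<η 0<η)
      in ε , 0<ε , ev-map ev (below j j<m η ε ε≤s ε≤2η)

    minimal : IsMinimiser distance m
    minimal j with ℤₚ.<-cmp m j
    ... | tri< m<j _ _ = λ ε 0<ε → ev-map (y≤t (½ * ε) (0<½ε 0<ε)) (above j m<j ε 0<ε)
    ... | tri≈ _ refl _ = λ ε 0<ε → 0 , λ _ _ → p+ε>p 0<ε
    ... | tri> _ _ j<m = λ ε 0<ε → let ζ , 0<ζ , ev = gap j j<m in
            ev-map ev λ n h → ℚₚ.<-trans (ℚₚ.<-≤-trans (p+ε>p 0<ζ) h) (p+ε>p 0<ε)

    least : ∀ i → IsMinimiser distance i → m ℤ.≤ i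
    least i i-min = ℤₚ.≮⇒≥ λ i<m →
      let ζ , 0<ζ , ev = gap i i<m
          N , absurd = ev-map₂ ev (i-min m ζ 0<ζ) λ n h k →
            ℚₚ.<-irrefl {∣ X i n ∣} refl (ℚₚ.<-≤-trans k h)
      in absurd N ℕₚ.≤-refl

  module _ (comp : ∀ q → (fromℚ q <ℝ y) ⊎ (y ≤ℝ fromℚ q)) where

    search : ∀ L k → fromℚ (t L) <ℝ y → y ≤ℝ fromℚ (t (L ℤ.+ + suc k)) →
             ∃ λ i → (fromℚ (t i) <ℝ y) × (y ≤ℝ fromℚ (t (i ℤ.+ + 1)))
    search L zero    p q = L , p , q
    search L (suc k) p q with comp (t (L ℤ.+ + suc k))
    ... | inj₁ p′ = L ℤ.+ + suc k , p′ ,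
            subst (λ j → y ≤ℝ fromℚ (t j)) (lem L (suc k)) q
      where
      lem : ∀ L k → L ℤ.+ + suc k ≡ (L ℤ.+ + k) ℤ.+ + 1
      lem L k = trans (cong (λ j → L ℤ.+ + j) (ℕₚ.+-comm 1 k))
        (trans (cong (λ j → L ℤ.+ j) (ℤₚ.pos-+ k 1)) (sym (ℤₚ.+-assoc L (+ k) (+ 1))))
    ... | inj₂ q′ = search L k p q′

    leastMinimiser : ∃ (IsLeastMinimiser distance)
    leastMinimiser =
      let M , lower , upper = bounds
          i₀ , t<y , y≤t = search (ℤ.- + M) (M ℕ.+ M) lower
            (subst (λ j → y ≤ℝ fromℚ (t j)) (sym (lem M)) upper)
      in i₀ ℤ.+ + 1 , minimal i₀ (i₀ ℤ.+ + 1) refl t<y y≤t , least i₀ (i₀ ℤ.+ + 1) refl t<y y≤t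
      where
      lem : ∀ M → ℤ.- + M ℤ.+ + suc (M ℕ.+ M) ≡ + suc M
      lem M = trans (cong (λ j → ℤ.- + M ℤ.+ + j) (sym (ℕₚ.+-suc M M)))
        (trans (cong (λ j → ℤ.- + M ℤ.+ j) (ℤₚ.pos-+ M (suc M)))
        (trans (sym (ℤₚ.+-assoc (ℤ.- + M) (+ M) (+ suc M)))
        (trans (cong (λ j → j ℤ.+ + suc M) (ℤₚ.+-inverseˡ (+ M))) (ℤₚ.+-identityˡ (+ suc M)))))

-- A field extension of ℚ with ℚ-basis 1, θ.  The value of _⁻¹ at 0 is
-- unconstrained.
record QuadraticField c ℓ : Set (lsuc (c ⊔ ℓ)) where
  field
    commutativeRing : CommutativeRing c ℓ
  open CommutativeRing commutativeRing public
    using (Carrier; rawRing)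
    renaming ( _≈_ to _≈K_; _+_ to _+K_; _*_ to _*K_; _-_ to _-K_; -_ to -K_
             ; 0# to 0K; 1# to 1K )
  infix 9 _⁻¹
  field
    _⁻¹                  : Carrier → Carrier
    *-inverse            : ∀ x → ¬ x ≈K 0K → x *K x ⁻¹ ≈K 1K
    ι                    : ℚ → Carrier
    ι-isRingHomomorphism : RingMorphisms.IsRingHomomorphism +-*-rawRing rawRing ι
    θ                    : Carrier
    spanning             : ∀ x → ∃₂ λ a b → x ≈K ι a +K ι b *K θ
    independent          : ∀ a b → ι a +K ι b *K θ ≈K 0K → a ≡ 0ℚ × b ≡ 0ℚ

-- σ₂ (ι r) is the rational r viewed in ℚ₂.
record EmbeddedQuadraticField c ℓ : Set (lsuc (c ⊔ ℓ)) where
  field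
    quadraticField : QuadraticField c ℓ
  open QuadraticField quadraticField public
  field
    σ∞           : Carrier → ℝ
    σ∞-embedding : RingMorphisms.IsRingMonomorphism rawRing ℝ-rawRing σ∞
    σ₂           : Carrier → ℚ₂
    σ₂-embedding : RingMorphisms.IsRingMonomorphism rawRing ℚ₂-rawRing σ₂

module Comparison {c ℓ} (K : EmbeddedQuadraticField c ℓ) where

  open EmbeddedQuadraticField K
  module R = CommutativeRing commutativeRing
  module ιH = RingMorphisms.IsRingHomomorphism ι-isRingHomomorphism
  module σH = RingMorphisms.IsRingMonomorphism σ∞-embedding

  f : ℚ → ℝ
  f q = σ∞ (ι q)

  f-+ : ∀ p q → f (p + q) ≈ℝ (f p +ℝ f q)
  f-+ p q = ≈-trans (f (p + q)) (σ∞ (ι p +K ι q)) (f p +ℝ f q)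
    (σH.⟦⟧-cong (ιH.+-homo p q)) (σH.+-homo (ι p) (ι q))

  f-* : ∀ p q → f (p * q) ≈ℝ (f p *ℝ f q)
  f-* p q = ≈-trans (f (p * q)) (σ∞ (ι p *K ι q)) (f p *ℝ f q)
    (σH.⟦⟧-cong (ιH.*-homo p q)) (σH.*-homo (ι p) (ι q))

  f-neg : ∀ p → f (- p) ≈ℝ (-ℝ f p)
  f-neg p = ≈-trans (f (- p)) (σ∞ (-K ι p)) (-ℝ f p)
    (σH.⟦⟧-cong (ιH.-‿homo p)) (σH.-‿homo (ι p))

  f-0 : f 0ℚ ≈ℝ 0ℝ
  f-0 = ≈-trans (f 0ℚ) (σ∞ 0K) 0ℝ (σH.⟦⟧-cong ιH.0#-homo) σH.0#-homo

  f-1 : f 1ℚ ≈ℝ 1ℝ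
  f-1 = ≈-trans (f 1ℚ) (σ∞ 1K) 1ℝ (σH.⟦⟧-cong ιH.1#-homo) σH.1#-homo

  f-ℕ : ∀ n → f (+ n / 1) ≈ℝ fromℚ (+ n / 1)
  f-ℕ zero    = f-0
  f-ℕ (suc n) = subst (λ q → f q ≈ℝ fromℚ q) (sym (/1-+ (+ 1) (+ n)))
    (≈-trans (f (1ℚ + + n / 1)) (f 1ℚ +ℝ f (+ n / 1)) (fromℚ (1ℚ + + n / 1))
      (f-+ 1ℚ (+ n / 1)) (+-cong (f 1ℚ) 1ℝ (f (+ n / 1)) (fromℚ (+ n / 1)) f-1 (f-ℕ n)))

  f-ℤ : ∀ i → f (i / 1) ≈ℝ fromℚ (i / 1)
  f-ℤ (+ n)    = f-ℕ n
  f-ℤ -[1+ n ] = ≈-trans (f (- (+ suc n / 1))) (-ℝ f (+ suc n / 1)) (fromℚ (- (+ suc n / 1)))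
    (f-neg (+ suc n / 1)) (neg-cong (f (+ suc n / 1)) (fromℚ (+ suc n / 1)) (f-ℕ (suc n)))

  f-ℚ : ∀ q → f q ≈ℝ fromℚ q
  f-ℚ q = *-cancelʳ (f q) q d (ℚₚ.<-≤-trans (ℚₚ.positive⁻¹ 1ℚ) (1≤-denominator q))
    (≈-trans (f q *ℝ fromℚ d) (f q *ℝ f d) (fromℚ (q * d))
      (*-congˡ (f q) (fromℚ d) (f d) (≈-sym (f d) (fromℚ d) (f-ℤ (↧ q))))
      (≈-trans (f q *ℝ f d) (f (q * d)) (fromℚ (q * d))
        (≈-sym (f (q * d)) (f q *ℝ f d) (f-* q d))
        (subst (λ t → f t ≈ℝ fromℚ t) (sym (*-denominator q)) (f-ℤ (↥ q)))))
    where
    d = ↧ q / 1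

  zero? : ∀ x → (x ≈K 0K) ⊎ (¬ x ≈K 0K)
  zero? x with spanning x
  ... | a , b , eq with a ℚₚ.≟ 0ℚ | b ℚₚ.≟ 0ℚ
  ... | yes refl | yes refl = inj₁ (R.trans eq (R.trans
          (R.+-cong ιH.0#-homo (R.trans (R.*-congʳ ιH.0#-homo) (R.zeroˡ θ))) (R.+-identityˡ 0K)))
  ... | no a≢0   | _        = inj₂ λ x≈0 → a≢0 (proj₁ (independent a b (R.trans (R.sym eq) x≈0)))
  ... | yes _    | no b≢0   = inj₂ λ x≈0 → b≢0 (proj₂ (independent a b (R.trans (R.sym eq) x≈0)))

  -- A non-zero element has an inverse, so its image in ℝ is apart from 0.
  sign : ∀ δ → (σ∞ δ ≈ℝ 0ℝ) ⊎ (0ℝ <ℝ σ∞ δ) ⊎ (σ∞ δ <ℝ 0ℝ)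
  sign δ with zero? δ
  ... | inj₁ δ≈0 = inj₁ (≈-trans (σ∞ δ) (σ∞ 0K) 0ℝ (σH.⟦⟧-cong δ≈0) σH.0#-homo)
  ... | inj₂ δ≉0 = inj₂ (conclude (ℚₚ.∣p∣≡p∨∣p∣≡-p (seq w N)))
    where
    w = σ∞ δ
    v = σ∞ (δ ⁻¹)
    wv≈1 : (w *ℝ v) ≈ℝ 1ℝ
    wv≈1 = ≈-trans (w *ℝ v) (σ∞ (δ *K δ ⁻¹)) 1ℝ
      (≈-sym (σ∞ (δ *K δ ⁻¹)) (w *ℝ v) (σH.*-homo δ (δ ⁻¹)))
      (≈-trans (σ∞ (δ *K δ ⁻¹)) (σ∞ 1K) 1ℝ (σH.⟦⟧-cong (*-inverse δ δ≉0)) σH.1#-homo)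
    bounded = eventually-bounded v
    B = proj₁ (proj₂ bounded)
    0<B : 0ℚ < B
    0<B = proj₁ (proj₂ (proj₂ bounded))
    0<½ : 0ℚ < ½
    0<½ = ℚₚ.positive⁻¹ ½
    c₀ = inv B 0<B * ½
    0<c : 0ℚ < c₀
    0<c = 0<* (0<inv B 0<B) 0<½
    large : Eventually λ n → c₀ < ∣ seq w n ∣
    large = ev-map₂ (proj₁ bounded , proj₂ (proj₂ (proj₂ bounded))) (wv≈1 ½ 0<½) λ n p q →
      ℚₚ.*-cancelˡ-<-nonNeg B {{nonNegative (ℚₚ.<⇒≤ 0<B)}} (begin-strict
        B * c₀                           ≡⟨ *-inv B 0<B ½ ⟩
        ½                                <⟨ half (seq w n * seq v n) q ⟩
        seq w n * seq v n                ≤⟨ p≤∣p∣ (seq w n * seq v n) ⟩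
        ∣ seq w n * seq v n ∣            ≡⟨ ℚₚ.∣p*q∣≡∣p∣*∣q∣ (seq w n) (seq v n) ⟩
        ∣ seq w n ∣ * ∣ seq v n ∣        ≤⟨ ℚₚ.*-monoˡ-≤-nonNeg ∣ seq w n ∣ {{ℚₚ.∣-∣-nonNeg (seq w n)}} p ⟩
        ∣ seq w n ∣ * B                  ≡⟨ ℚₚ.*-comm ∣ seq w n ∣ B ⟩
        B * ∣ seq w n ∣                  ∎)
      where
      open ℚₚ.≤-Reasoning
      open ℚ-Solver
      half : ∀ t → ∣ t - 1ℚ ∣ < ½ → ½ < t
      half t h = lin< {½} {t} {(- (t - 1ℚ))} {½} (lem t) (ℚₚ.≤-<-trans (-p≤∣p∣ (t - 1ℚ)) h)
        where
        lem : ∀ t → t - ½ ≡ ½ - (- (t - 1ℚ))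
        lem = solve 1 (λ t → t :- con ½ := con ½ :- (:- (t :- con 1ℚ))) refl
    tail = cauchy w (½ * c₀) (0<½ε 0<c)
    N₁ = proj₁ large
    N₂ = proj₁ tail
    N = N₁ ℕ.⊔ N₂
    w-N = λ n (N≤n : N ℕ.≤ n) →
      proj₂ tail n N (ℕₚ.m⊔n≤o⇒n≤o N₁ N₂ N≤n) (ℕₚ.m≤n⊔m N₁ N₂)
    conclude : (∣ seq w N ∣ ≡ seq w N) ⊎ (∣ seq w N ∣ ≡ - seq w N) → (0ℝ <ℝ w) ⊎ (w <ℝ 0ℝ)
    conclude (inj₁ eq) = inj₁ (½ * c₀ , 0<½ε 0<c , N , λ n N≤n →
      lin< {0ℚ + ½ * c₀} {seq w n} {c₀ + - (seq w n - seq w N)} {seq w N + ½ * c₀}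
        (lem c₀ (seq w n) (seq w N))
        (ℚₚ.+-mono-< (subst (c₀ <_) eq (proj₂ large N (ℕₚ.m≤m⊔n N₁ N₂)))
          (ℚₚ.≤-<-trans (-p≤∣p∣ (seq w n - seq w N)) (w-N n N≤n))))
      where
      open ℚ-Solver
      lem : ∀ c a b → a - (0ℚ + ½ * c) ≡ (b + ½ * c) - (c + - (a - b))
      lem = solve 3 (λ c a b → a :- (con 0ℚ :+ con ½ :* c) :=
        (b :+ con ½ :* c) :- (c :+ (:- (a :- b)))) refl
    conclude (inj₂ eq) = inj₂ (½ * c₀ , 0<½ε 0<c , N , λ n N≤n →
      lin< {seq w n + ½ * c₀} {0ℚ} {c₀ + (seq w n - seq w N)} {(- seq w N + ½ * c₀)}
        (lem c₀ (seq w n) (seq w N))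
        (ℚₚ.+-mono-< (subst (c₀ <_) eq (proj₂ large N (ℕₚ.m≤m⊔n N₁ N₂)))
          (ℚₚ.≤-<-trans (p≤∣p∣ (seq w n - seq w N)) (w-N n N≤n))))
      where
      open ℚ-Solver
      lem : ∀ c a b → 0ℚ - (a + ½ * c) ≡ (- b + ½ * c) - (c + (a - b))
      lem = solve 3 (λ c a b → con 0ℚ :- (a :+ con ½ :* c) :=
        ((:- b) :+ con ½ :* c) :- (c :+ (a :- b))) refl

  compare : ∀ γ q → (fromℚ q <ℝ σ∞ γ) ⊎ (σ∞ γ ≤ℝ fromℚ q)
  compare γ q = conclude (sign δ)
    where
    δ = γ -K ι q
    w = σ∞ δ
    y = σ∞ γ
    w≈y-q : w ≈ℝ (y -ℝ fromℚ q)
    w≈y-q = ≈-trans w (y +ℝ σ∞ (-K ι q)) (y -ℝ fromℚ q) (σH.+-homo γ (-K ι q))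
      (+-cong y y (σ∞ (-K ι q)) (-ℝ fromℚ q) (≈-refl y)
        (≈-trans (σ∞ (-K ι q)) (-ℝ f q) (-ℝ fromℚ q) (σH.-‿homo (ι q))
          (neg-cong (f q) (fromℚ q) (f-ℚ q))))
    open ℚ-Solver
    conclude : (w ≈ℝ 0ℝ) ⊎ (0ℝ <ℝ w) ⊎ (w <ℝ 0ℝ) → (fromℚ q <ℝ y) ⊎ (y ≤ℝ fromℚ q)
    conclude (inj₁ w≈0) = inj₂ λ ε 0<ε →
      ev-map (≈-trans (y -ℝ fromℚ q) w 0ℝ (≈-sym w (y -ℝ fromℚ q) w≈y-q) w≈0 ε 0<ε) λ n h →
        lin< {seq y n} {q + ε} {seq y n - q - 0ℚ} {ε} (lem (seq y n) q ε)
          (ℚₚ.≤-<-trans (p≤∣p∣ (seq y n - q - 0ℚ)) h)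
      where
      lem : ∀ y q ε → (q + ε) - y ≡ ε - (y - q - 0ℚ)
      lem = solve 3 (λ y q ε → (q :+ ε) :- y := ε :- (y :- q :- con 0ℚ)) refl
    conclude (inj₂ (inj₁ (η , 0<η , pos))) = inj₁ (½ * η , 0<½ε 0<η ,
      ev-map₂ pos (w≈y-q (½ * η) (0<½ε 0<η)) λ n h k →
        lin< {q + ½ * η} {seq y n} {(0ℚ + η) + (seq w n - (seq y n - q))} {seq w n + ½ * η}
          (lem (seq y n) q η (seq w n))
          (ℚₚ.+-mono-< h (ℚₚ.≤-<-trans (p≤∣p∣ (seq w n - (seq y n - q))) k)))
      where
      lem : ∀ y q η w → y - (q + ½ * η) ≡ (w + ½ * η) - ((0ℚ + η) + (w - (y - q)))
      lem = solve 4 (λ y q η w → y :- (q :+ con ½ :* η) :=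
        (w :+ con ½ :* η) :- ((con 0ℚ :+ η) :+ (w :- (y :- q)))) refl
    conclude (inj₂ (inj₂ (η , 0<η , neg))) = inj₂ λ ε 0<ε →
      ev-map₂ neg (w≈y-q η 0<η) λ n h k →
        ℚₚ.<-trans
          (lin< {seq y n} {q} {(seq w n + η) + - (seq w n - (seq y n - q))} {0ℚ + η}
            (lem (seq y n) q η (seq w n))
            (ℚₚ.+-mono-< h (ℚₚ.≤-<-trans (-p≤∣p∣ (seq w n - (seq y n - q))) k)))
          (p+ε>p 0<ε)
      where
      lem : ∀ y q η w → q - y ≡ (0ℚ + η) - ((w + η) + - (w - (y - q)))
      lem = solve 4 (λ y q η w → q :- y :=
        (con 0ℚ :+ η) :- ((w :+ η) :+ (:- (w :- (y :- q))))) refl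

record Mat₂ : Set where
  constructor mat
  field
    m₁₁ m₁₂ m₂₁ m₂₂ : ℚ

open Mat₂

infixl 7 _*M_

_*M_ : Mat₂ → Mat₂ → Mat₂
mat a b c d *M mat a′ b′ c′ d′ =
  mat (a * a′ + b * c′) (a * b′ + b * d′) (c * a′ + d * c′) (c * b′ + d * d′)

-- a^(ε) subtracts multiples of 2 if ε = 0, and of 1 if ε = 1.
scale : Parity → ℚ
scale 0ℙ = + 2 / 1
scale 1ℙ = 1ℚ

1≤scale : ∀ ε → 1ℚ ≤ scale ε
1≤scale 0ℙ = from-yes (1ℚ ℚₚ.≤? + 2 / 1)
1≤scale 1ℙ = ℚₚ.≤-refl

module Algorithm {c ℓ} (K : EmbeddedQuadraticField c ℓ) where

  open EmbeddedQuadraticField K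

  Irrational : Carrier → Set ℓ
  Irrational α = ∀ r → ¬ α ≈K ι r

  PropertyI : Carrier → Set
  PropertyI α = (fromℚ (- 1ℚ) <ℝ σ∞ α × σ∞ α ≤ℝ 1ℝ) × 1 ≤v₂ σ₂ α

  distance : Parity → Carrier → ℤ → ℝ
  distance ε α i =
    ∣ σ∞ (α ⁻¹) -ℝ fromℚ (scale ε * (i / 1)) -ℝ fromℚ ⌊ σ₂ (α ⁻¹) ⌋₂ ∣ℝ

  -- The minimum is found by search because K has decidable equality, so
  -- that σ∞ γ can be compared with rationals.
  abstract
    nearest : ∀ ε α → ∃ λ m → IsLeastMinimiser (distance ε α) m
    nearest ε α = LeastMinimiser.leastMinimiser (σ∞ (α ⁻¹)) (scale ε) ⌊ σ₂ (α ⁻¹) ⌋₂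
      (1≤scale ε) (Comparison.compare K (α ⁻¹))

  partialQuotient : Parity → Carrier → ℚ
  partialQuotient ε α = scale ε * (proj₁ (nearest ε α) / 1) + ⌊ σ₂ (α ⁻¹) ⌋₂

  T : Parity → Carrier → Carrier
  T ε α = α ⁻¹ -K ι (partialQuotient ε α)

  -- Indexed from 1; the entry at 0 is unused.
  orbit : Carrier → ℕ → Carrier
  orbit α 0             = α
  orbit α 1             = α
  orbit α (suc (suc n)) = T (parity (suc n)) (orbit α (suc n))

  a : Carrier → ℕ → ℚ
  a α n = partialQuotient (parity n) (orbit α n)

  -- The convergent matrix with rows (p_{n-1} p_n) and (q_{n-1} q_n).
  convergents : Carrier → ℕ → Mat₂
  convergents α zero    = mat 1ℚ 0ℚ 0ℚ 1ℚ
  convergents α (suc n) = convergents α n *M mat 0ℚ 1ℚ 1ℚ (a α (suc n))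

  p q : Carrier → ℕ → ℚ
  p α n = m₁₂ (convergents α n)
  q α n = m₂₂ (convergents α n)

  -- Σ_{s=1}^{n} v₂(a_s)
  Σv₂ : Carrier → ℕ → ℤ
  Σv₂ α zero    = ℤ.0ℤ
  Σv₂ α (suc n) = Σv₂ α n ℤ.+ v₂ (a α (suc n))

  p′ q′ : Carrier → ℕ → ℚ
  p′ α n = 2^ (ℤ.- Σv₂ α n) * p α n
  q′ α n = 2^ (ℤ.- Σv₂ α n) * q α n

-- z = bˢ for a rational base b ≥ 1: bʳ ≤ z for all rational r ≤ s and
-- z ≤ bʳ for all rational r ≥ s.  Writing r = (i - j) / k, the comparison
-- of bʳ with z is that of bⁱ with bʲ zᵏ.
record IsPower (b : ℚ) (s z : ℝ) : Set where
  field
    1≤base   : 1ℚ ≤ b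
    0<power  : 0ℝ <ℝ z
    lower    : ∀ i j k .{{_ : ℕ.NonZero k}} → fromℚ ((i ℤ.⊖ j) / k) ≤ℝ s →
               fromℚ (b ℚ^.^ i) ≤ℝ fromℚ (b ℚ^.^ j) *ℝ z ℝ^.^ k
    upper    : ∀ i j k .{{_ : ℕ.NonZero k}} → s ≤ℝ fromℚ ((i ℤ.⊖ j) / k) →
               fromℚ (b ℚ^.^ j) *ℝ z ℝ^.^ k ≤ℝ fromℚ (b ℚ^.^ i)

-- x ≤ C / bˢ
infix 4 _≤ℝ_/_^_

_≤ℝ_/_^_ : ℝ → ℝ → ℚ → ℝ → Set
x ≤ℝ C / b ^ s = ∃ λ z → IsPower b s z × x *ℝ z ≤ℝ C

-- The coefficients of the quadratic forms over ℤ[1/2] of fixed discriminant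
-- with roots α_(n) are bounded both in ℝ and in ℚ₂, so there are finitely many
-- of them and the orbit of α is eventually periodic.  Let η be the product of
-- the α_(n) over a period, up to sign, and Q = 1 / |η|₂.  Over k periods,
-- |q_n|₂ is Qᵏ, |q_n| is 1 / |η|ᵏ and |q′_n| is (Q / |η|)ᵏ, up to bounded
-- factors, while |α - p_n / q_n| and |α - p_n / q_n|₂ are O(|η|²ᵏ) and
-- O(Q⁻²ᵏ).  Hence γ is defined by (Q / |η|)^γ = Q.
module Submission where

open import Defs

-- Alternating the multiples 2 and 1 makes both places contract: one remainder may shrink at a
-- single place only, but two consecutive ones have product at most 1/2 in ℝ and of positive
-- valuation in ℚ₂. The quantity behind all bounds is w_n = q_n (q_{n-1} α - p_{n-1}), which
-- satisfies w_{n+1} = α_(n+1) α_(n+2) w_n ± 1 and so is bounded at both places. The error also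
-- needs a lower bound on w_n; it comes from norms, which are non-zero integers up to a fixed
-- denominator. Two obstacles shape the rest. Partial quotients are found by a search through
-- representing sequences, so equal remainders in K do not have equal partial quotients by
-- congruence; uniqueness of the remainder has to be proved, and irrationality rules out ties. And
-- there are no logarithms: γ is built from integer exponents, found by comparisons that are
-- decidable because they concern elements of K and rationals, and every inequality with a
-- fractional exponent is first proved for integral powers.

module SimultaneousApproximation where

  open import Algebra.Bundles using (CommutativeRing)
  open import Algebra.Morphism.Structures using (module RingMorphisms)
  import Algebra.Properties.CommutativeSemiring.Exp as Exp
  import Algebra.Solver.Ring
  open import Algebra.Solver.Ring.AlmostCommutativeRing
    using (fromCommutativeRing; _-Raw-AlmostCommutative⟶_; Induced-equivalence)
  open import Data.Fin.Base using (Fin; fromℕ<; toℕ; combine)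
  import Data.Fin.Properties as Finₚ
  open import Data.Integer.Base as ℤ using (ℤ; +_; -[1+_])
  import Data.Integer.DivMod as ℤ%
  import Data.Integer.Divisibility.Signed as ℤ∣
  import Data.Integer.Properties as ℤₚ
  open import Data.Integer.Solver using () renaming (module +-*-Solver to ℤ-Solver₀)
  open import Data.Maybe.Base using (map)
  open import Data.Nat.Base as ℕ using (ℕ; zero; suc; parity)
  import Data.Nat.DivMod as ℕ%
  import Data.Nat.Divisibility as ℕ∣
  open import Data.Nat.Induction using (<-rec)
  import Data.Nat.Properties as ℕₚ
  open import Data.Nat.Solver using () renaming (module +-*-Solver to ℕ-Solver₀)
  open import Data.Parity.Base using (Parity; 0ℙ; 1ℙ)
  open import Data.Product.Base using (_×_; _,_; ∃; ∃₂; proj₁; proj₂)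
  open import Data.Rational.Base
  import Data.Rational.Properties as ℚₚ
  open import Data.Rational.Solver using () renaming (module +-*-Solver to ℚ-Solver₀)
  import Data.Rational.Unnormalised.Base as ℚᵘ
  import Data.Rational.Unnormalised.Properties as ℚᵘₚ
  open import Data.Sum.Base using (_⊎_; inj₁; inj₂)
  import Level
  open import Relation.Binary.Definitions using (WeaklyDecidable)
  open import Relation.Binary.PropositionalEquality
  open import Relation.Nullary using (¬_; Dec; yes; no; contradiction; from-yes)
  open import Relation.Nullary.Decidable using (dec⇒maybe)

  open RationalLemmas
  open BoundedLemmas
  open ℝ
  open ℤ₂
  open DyadicLemmas
  open RealLemmas
  open ℚ^ using (_^_)

  module ℚ-Solver where
    open ℚ-Solver₀ public using (solve; con; _:+_; _:*_; _:-_; :-_; _:=_)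

  module ℚ^ₚ = Exp (CommutativeRing.commutativeSemiring ℚₚ.+-*-commutativeRing)

  module ℕ-Solver where
    open ℕ-Solver₀ public using (solve; con; _:+_; _:*_; _:=_)

  module ℤ-Solver where
    open ℤ-Solver₀ public using (solve; con; _:+_; _:*_; _:-_; :-_; _:=_)

  -- Ordered-field arithmetic in ℚ

  infix 9 ⟦_⟧

  abstract
    -- Opaque, so that conversion checking does not unfold the gcd normalisation inside `_/_`.
    ⟦_⟧ : ℕ → ℚ
    ⟦ n ⟧ = + n / 1

    ⟦_⟧≡ : ∀ n → ⟦ n ⟧ ≡ + n / 1
    ⟦ n ⟧≡ = refl

    ⟦0⟧ : ⟦ 0 ⟧ ≡ 0ℚ
    ⟦0⟧ = refl

    ⟦1⟧ : ⟦ 1 ⟧ ≡ 1ℚ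
    ⟦1⟧ = refl

  0<1 : 0ℚ < 1ℚ
  0<1 = ℚₚ.positive⁻¹ 1ℚ

  0≤1 : 0ℚ ≤ 1ℚ
  0≤1 = ℚₚ.<⇒≤ 0<1

  /1-* : ∀ i j → (i ℤ.* j) / 1 ≡ (i / 1) * (j / 1)
  /1-* i j = ℚₚ.toℚᵘ-injective (begin
    toℚᵘ ((i ℤ.* j) / 1)  ≈⟨ toℚᵘ-/1 (i ℤ.* j) ⟩
    ℚᵘ.mkℚᵘ i 0 ℚᵘ.* ℚᵘ.mkℚᵘ j 0  ≈⟨ ℚᵘₚ.*-cong (ℚᵘₚ.≃-sym (toℚᵘ-/1 i)) (ℚᵘₚ.≃-sym (toℚᵘ-/1 j)) ⟩
    toℚᵘ (i / 1) ℚᵘ.* toℚᵘ (j / 1)  ≈⟨ ℚᵘₚ.≃-sym (ℚₚ.toℚᵘ-homo-* (i / 1) (j / 1)) ⟩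
    toℚᵘ ((i / 1) * (j / 1))  ∎)
    where open ℚᵘₚ.≃-Reasoning

  /1-injective : ∀ {i j} → i / 1 ≡ j / 1 → i ≡ j
  /1-injective {i} {j} eq
    with ℚᵘ.*≡* h ← ℚᵘₚ.≃-trans (ℚᵘₚ.≃-sym (toℚᵘ-/1 i)) (ℚᵘₚ.≃-trans (ℚᵘₚ.≃-reflexive (cong toℚᵘ eq)) (toℚᵘ-/1 j))
    = trans (sym (ℤₚ.*-identityʳ i)) (trans h (ℤₚ.*-identityʳ j))

  /1-cancel-≤ : ∀ {i j} → i / 1 ≤ j / 1 → i ℤ.≤ j
  /1-cancel-≤ {i} {j} h with ℤₚ.≤-total i j
  ... | inj₁ i≤j = i≤j
  ... | inj₂ j≤i = ℤₚ.≤-reflexive (/1-injective (ℚₚ.≤-antisym h (/1-mono-≤ j≤i)))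

  abstract
    ⟦+⟧ : ∀ m n → ⟦ m ℕ.+ n ⟧ ≡ ⟦ m ⟧ + ⟦ n ⟧
    ⟦+⟧ m n = trans (cong (_/ 1) (ℤₚ.pos-+ m n)) (/1-+ (+ m) (+ n))

    ⟦*⟧ : ∀ m n → ⟦ m ℕ.* n ⟧ ≡ ⟦ m ⟧ * ⟦ n ⟧
    ⟦*⟧ m n = trans (cong (_/ 1) (ℤₚ.pos-* m n)) (/1-* (+ m) (+ n))

    ⟦⟧-mono-≤ : ∀ {m n} → m ℕ.≤ n → ⟦ m ⟧ ≤ ⟦ n ⟧
    ⟦⟧-mono-≤ m≤n = /1-mono-≤ (ℤ.+≤+ m≤n)

    ⟦⟧-cancel-≤ : ∀ {m n} → ⟦ m ⟧ ≤ ⟦ n ⟧ → m ℕ.≤ n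
    ⟦⟧-cancel-≤ h = ℤₚ.drop‿+≤+ (/1-cancel-≤ h)

  0≤⟦_⟧ : ∀ n → 0ℚ ≤ ⟦ n ⟧
  0≤⟦ n ⟧ = subst (_≤ ⟦ n ⟧) ⟦0⟧ (⟦⟧-mono-≤ ℕ.z≤n)

  0<⟦suc_⟧ : ∀ n → 0ℚ < ⟦ suc n ⟧
  0<⟦suc n ⟧ = ℚₚ.<-≤-trans 0<1 (subst (_≤ ⟦ suc n ⟧) ⟦1⟧ (⟦⟧-mono-≤ (ℕ.s≤s ℕ.z≤n)))

  -- ≤ceil does not depend on the parameters of LeastMinimiser.
  ≤⟦⟧ : ∀ q → 0ℚ ≤ q → ∃ λ n → q ≤ ⟦ n ⟧
  ≤⟦⟧ q 0≤q = ℤ.∣ ↥ q ∣ , subst (q ≤_) (sym ⟦ ℤ.∣ ↥ q ∣ ⟧≡) (LeastMinimiser.≤ceil 0ℝ 1ℚ 0ℚ ℚₚ.≤-refl q 0≤q)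

  *-monoˡ : ∀ {a b c} → 0ℚ ≤ c → a ≤ b → c * a ≤ c * b
  *-monoˡ {c = c} 0≤c = ℚₚ.*-monoˡ-≤-nonNeg c {{nonNegative 0≤c}}

  *-monoʳ : ∀ {a b c} → 0ℚ ≤ c → a ≤ b → a * c ≤ b * c
  *-monoʳ {c = c} 0≤c = ℚₚ.*-monoʳ-≤-nonNeg c {{nonNegative 0≤c}}

  *-mono : ∀ {a b c d} → 0ℚ ≤ a → a ≤ b → 0ℚ ≤ c → c ≤ d → a * c ≤ b * d
  *-mono 0≤a a≤b 0≤c c≤d = ℚₚ.≤-trans (*-monoʳ 0≤c a≤b) (*-monoˡ (ℚₚ.≤-trans 0≤a a≤b) c≤d)

  0≤* : ∀ {a b} → 0ℚ ≤ a → 0ℚ ≤ b → 0ℚ ≤ a * b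
  0≤* {a} {b} 0≤a 0≤b = subst (_≤ a * b) (ℚₚ.*-zeroʳ a) (*-monoˡ 0≤a 0≤b)

  0≤+ : ∀ {a b} → 0ℚ ≤ a → 0ℚ ≤ b → 0ℚ ≤ a + b
  0≤+ = ℚₚ.+-mono-≤

  p≤p+q : ∀ {p q} → 0ℚ ≤ q → p ≤ p + q
  p≤p+q {p} {q} 0≤q = subst (_≤ p + q) (ℚₚ.+-identityʳ p) (ℚₚ.+-monoʳ-≤ p 0≤q)

  p≤q+p : ∀ {p q} → 0ℚ ≤ q → p ≤ q + p
  p≤q+p {p} {q} 0≤q = subst (_≤ q + p) (ℚₚ.+-identityˡ p) (ℚₚ.+-monoˡ-≤ p 0≤q)

  1≤a⇒b≤a*b : ∀ {a b} → 1ℚ ≤ a → 0ℚ ≤ b → b ≤ a * b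
  1≤a⇒b≤a*b {a} {b} 1≤a 0≤b = subst (_≤ a * b) (ℚₚ.*-identityˡ b) (*-monoʳ 0≤b 1≤a)

  1≤* : ∀ {a b} → 1ℚ ≤ a → 1ℚ ≤ b → 1ℚ ≤ a * b
  1≤* 1≤a 1≤b = ℚₚ.≤-trans 1≤b (1≤a⇒b≤a*b 1≤a (ℚₚ.≤-trans 0≤1 1≤b))

  0≤^ : ∀ {x} n → 0ℚ ≤ x → 0ℚ ≤ x ^ n
  0≤^ zero    0≤x = 0≤1
  0≤^ (suc n) 0≤x = 0≤* 0≤x (0≤^ n 0≤x)

  0<^ : ∀ {x} n → 0ℚ < x → 0ℚ < x ^ n
  0<^ zero    0<x = 0<1
  0<^ (suc n) 0<x = 0<* 0<x (0<^ n 0<x)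

  1≤^ : ∀ {x} n → 1ℚ ≤ x → 1ℚ ≤ x ^ n
  1≤^ zero    1≤x = ℚₚ.≤-refl
  1≤^ (suc n) 1≤x = 1≤* 1≤x (1≤^ n 1≤x)

  ^-monoˡ : ∀ {x y} n → 0ℚ ≤ x → x ≤ y → x ^ n ≤ y ^ n
  ^-monoˡ zero    0≤x x≤y = ℚₚ.≤-refl
  ^-monoˡ (suc n) 0≤x x≤y = *-mono 0≤x x≤y (0≤^ n 0≤x) (^-monoˡ n 0≤x x≤y)

  ^≤1 : ∀ {x} n → 0ℚ ≤ x → x ≤ 1ℚ → x ^ n ≤ 1ℚ
  ^≤1 zero    0≤x x≤1 = ℚₚ.≤-refl
  ^≤1 {x} (suc n) 0≤x x≤1 = subst (x ^ suc n ≤_) (ℚₚ.*-identityˡ 1ℚ) (*-mono 0≤x x≤1 (0≤^ n 0≤x) (^≤1 n 0≤x x≤1))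

  ^-monoʳ : ∀ {x m n} → 1ℚ ≤ x → m ℕ.≤ n → x ^ m ≤ x ^ n
  ^-monoʳ {x} {n = n} 1≤x ℕ.z≤n = 1≤^ n 1≤x
  ^-monoʳ 1≤x (ℕ.s≤s m≤n) = *-monoˡ (ℚₚ.≤-trans 0≤1 1≤x) (^-monoʳ 1≤x m≤n)

  ^-mono-< : ∀ {x y} n → 0ℚ ≤ x → x < y → x ^ suc n < y ^ suc n
  ^-mono-< {x} {y} n 0≤x x<y = ℚₚ.≤-<-trans
    (*-monoˡ 0≤x (^-monoˡ n 0≤x (ℚₚ.<⇒≤ x<y)))
    (ℚₚ.*-monoˡ-<-pos (y ^ n) {{positive (0<^ n (ℚₚ.≤-<-trans 0≤x x<y))}} x<y)

  -- Stands in for taking roots: inequalities with fractional exponents are proved after raising to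
  -- a common integral power.
  ^-cancel-≤ : ∀ {x y} n → 0ℚ ≤ y → x ^ suc n ≤ y ^ suc n → x ≤ y
  ^-cancel-≤ n 0≤y h = ℚₚ.≮⇒≥ λ y<x → ℚₚ.<-irrefl refl (ℚₚ.<-≤-trans (^-mono-< n 0≤y y<x) h)

  1^n≡1 : ∀ n → 1ℚ ^ n ≡ 1ℚ
  1^n≡1 zero    = refl
  1^n≡1 (suc n) = trans (ℚₚ.*-identityˡ _) (1^n≡1 n)

  bernoulli : ∀ {x} d → 0ℚ ≤ x → 1ℚ + ⟦ d ⟧ * x ≤ (1ℚ + x) ^ d
  bernoulli {x} zero 0≤x = ℚₚ.≤-reflexive
    (trans (cong (λ t → 1ℚ + t) (trans (cong (_* x) ⟦0⟧) (ℚₚ.*-zeroˡ x))) (ℚₚ.+-identityʳ 1ℚ))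
  bernoulli {x} (suc d) 0≤x = begin
    1ℚ + ⟦ suc d ⟧ * x  ≡⟨ cong (λ t → 1ℚ + t * x) (trans (⟦+⟧ 1 d) (cong (_+ ⟦ d ⟧) ⟦1⟧)) ⟩
    1ℚ + (1ℚ + ⟦ d ⟧) * x  ≤⟨ p≤p+q (0≤* 0≤⟦ d ⟧ (0≤* 0≤x 0≤x)) ⟩
    1ℚ + (1ℚ + ⟦ d ⟧) * x + ⟦ d ⟧ * (x * x)  ≡⟨ lem x ⟦ d ⟧ ⟩
    (1ℚ + x) * (1ℚ + ⟦ d ⟧ * x)  ≤⟨ *-monoˡ (0≤+ 0≤1 0≤x) (bernoulli d 0≤x) ⟩
    (1ℚ + x) ^ suc d  ∎
    where
    open ℚₚ.≤-Reasoning
    open ℚ-Solver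
    lem : ∀ x d → 1ℚ + (1ℚ + d) * x + d * (x * x) ≡ (1ℚ + x) * (1ℚ + d * x)
    lem = solve 2 (λ x d → con 1ℚ :+ (con 1ℚ :+ d) :* x :+ d :* (x :* x) :=
      (con 1ℚ :+ x) :* (con 1ℚ :+ d :* x)) refl

  -- The constants satisfy c' = B^k + B c. One constant serves all `x` and `y` below `B`, hence
  -- every term of a sequence that defines a power.
  ^-lipschitz : ∀ B k → 0ℚ ≤ B → ∃ λ c → 0ℚ ≤ c ×
    (∀ x y → 0ℚ ≤ x → x ≤ y → y ≤ B → y ^ k ≤ x ^ k + c * (y - x))
  ^-lipschitz B zero 0≤B = 0ℚ , ℚₚ.≤-refl , λ x y _ _ _ →
    ℚₚ.≤-reflexive (sym (trans (cong (λ t → 1ℚ + t) (ℚₚ.*-zeroˡ (y - x))) (ℚₚ.+-identityʳ 1ℚ)))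
  ^-lipschitz B (suc k) 0≤B =
    let c , 0≤c , h = ^-lipschitz B k 0≤B in
    B ^ k + B * c , 0≤+ (0≤^ k 0≤B) (0≤* 0≤B 0≤c) , λ x y 0≤x x≤y y≤B →
      let 0≤y-x = lin≤ {0ℚ} {y - x} {x} {y} (lem₀ x y) x≤y in begin
      y * y ^ k  ≤⟨ *-monoˡ (ℚₚ.≤-trans 0≤x x≤y) (h x y 0≤x x≤y y≤B) ⟩
      y * (x ^ k + c * (y - x))  ≡⟨ lem₁ x y (x ^ k) c ⟩
      x * x ^ k + (x ^ k + y * c) * (y - x)  ≤⟨ ℚₚ.+-monoʳ-≤ (x * x ^ k) (*-monoʳ 0≤y-x
          (ℚₚ.+-mono-≤ (^-monoˡ k 0≤x (ℚₚ.≤-trans x≤y y≤B)) (*-monoʳ 0≤c y≤B))) ⟩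
      x * x ^ k + (B ^ k + B * c) * (y - x)  ∎
    where
    open ℚₚ.≤-Reasoning
    open ℚ-Solver
    lem₀ : ∀ x y → (y - x) - 0ℚ ≡ y - x
    lem₀ = solve 2 (λ x y → (y :- x) :- con 0ℚ := y :- x) refl
    lem₁ : ∀ x y p c → y * (p + c * (y - x)) ≡ x * p + (p + y * c) * (y - x)
    lem₁ = solve 4 (λ x y p c → y :* (p :+ c :* (y :- x)) := x :* p :+ (p :+ y :* c) :* (y :- x)) refl

  crossing : ∀ {P : ℕ → Set} → (∀ n → Dec (P n)) → P 0 → ∀ N → ¬ P N → ∃ λ n → P n × ¬ P (suc n)
  crossing P? P0 zero ¬PN = contradiction P0 ¬PN
  crossing P? P0 (suc N) ¬PN with P? N
  ... | yes PN = N , PN , ¬PN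
  ... | no ¬P  = crossing P? P0 N ¬P

  -- The reciprocals 1/(n+1) as standard error bounds

  1/⟦suc_⟧ : ℕ → ℚ
  1/⟦suc n ⟧ = inv ⟦ suc n ⟧ 0<⟦suc n ⟧

  0<1/⟦suc_⟧ : ∀ n → 0ℚ < 1/⟦suc n ⟧
  0<1/⟦suc n ⟧ = 0<inv ⟦ suc n ⟧ 0<⟦suc n ⟧

  ⟦suc⟧*1/ : ∀ n → ⟦ suc n ⟧ * 1/⟦suc n ⟧ ≡ 1ℚ
  ⟦suc⟧*1/ n = ℚₚ.*-inverseʳ ⟦ suc n ⟧ {{ℚₚ.pos⇒nonZero ⟦ suc n ⟧ {{positive 0<⟦suc n ⟧}}}}

  1/-anti : ∀ {m n} → m ℕ.≤ n → 1/⟦suc n ⟧ ≤ 1/⟦suc m ⟧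
  1/-anti {m} {n} m≤n = begin
    1/⟦suc n ⟧  ≡⟨ sym (trans (cong (_* 1/⟦suc n ⟧) (⟦suc⟧*1/ m)) (ℚₚ.*-identityˡ _)) ⟩
    ⟦ suc m ⟧ * 1/⟦suc m ⟧ * 1/⟦suc n ⟧  ≤⟨ *-monoʳ (ℚₚ.<⇒≤ 0<1/⟦suc n ⟧) (*-monoʳ (ℚₚ.<⇒≤ 0<1/⟦suc m ⟧) (⟦⟧-mono-≤ (ℕ.s≤s m≤n))) ⟩
    ⟦ suc n ⟧ * 1/⟦suc m ⟧ * 1/⟦suc n ⟧  ≡⟨ lem ⟦ suc n ⟧ 1/⟦suc m ⟧ 1/⟦suc n ⟧ ⟩
    1/⟦suc m ⟧ * (⟦ suc n ⟧ * 1/⟦suc n ⟧)  ≡⟨ trans (cong (1/⟦suc m ⟧ *_) (⟦suc⟧*1/ n)) (ℚₚ.*-identityʳ _) ⟩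
    1/⟦suc m ⟧  ∎
    where
    open ℚₚ.≤-Reasoning
    open ℚ-Solver
    lem : ∀ a b c → a * b * c ≡ b * (a * c)
    lem = solve 3 (λ a b c → a :* b :* c := b :* (a :* c)) refl

  archimedean : ∀ {a ε} → 0ℚ ≤ a → 0ℚ < ε → ∃ λ N → ∀ n → N ℕ.≤ n → a * 1/⟦suc n ⟧ ≤ ε
  archimedean {a} {ε} 0≤a 0<ε =
    let i = inv ε 0<ε
        N , h = ≤⟦⟧ (i * a) (0≤* (ℚₚ.<⇒≤ (0<inv ε 0<ε)) 0≤a)
    in N , λ n N≤n → begin
      a * 1/⟦suc n ⟧  ≡⟨ cong (_* 1/⟦suc n ⟧) (sym (*-inv ε 0<ε a)) ⟩
      ε * (i * a) * 1/⟦suc n ⟧  ≤⟨ *-monoʳ (ℚₚ.<⇒≤ 0<1/⟦suc n ⟧) (*-monoˡ (ℚₚ.<⇒≤ 0<ε)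
          (ℚₚ.≤-trans h (⟦⟧-mono-≤ (ℕₚ.≤-trans N≤n (ℕₚ.n≤1+n n))))) ⟩
      ε * ⟦ suc n ⟧ * 1/⟦suc n ⟧  ≡⟨ ℚₚ.*-assoc ε ⟦ suc n ⟧ _ ⟩
      ε * (⟦ suc n ⟧ * 1/⟦suc n ⟧)  ≡⟨ trans (cong (ε *_) (⟦suc⟧*1/ n)) (ℚₚ.*-identityʳ ε) ⟩
      ε  ∎
    where open ℚₚ.≤-Reasoning

  1/⟦suc_⟧≤1 : ∀ n → 1/⟦suc n ⟧ ≤ 1ℚ
  1/⟦suc n ⟧≤1 = ℚₚ.≤-trans (1/-anti {0} {n} ℕ.z≤n) (ℚₚ.≤-reflexive
    (trans (sym (ℚₚ.*-identityˡ _)) (trans (cong (_* 1/⟦suc 0 ⟧) (sym ⟦1⟧)) (⟦suc⟧*1/ 0))))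

  -- Roots and real powers of a rational base

  root : ∀ {x} → 1ℚ ≤ x → ∀ v n → ∃ λ z → 0ℚ ≤ z × z ^ suc v ≤ x × x < (z + 1/⟦suc n ⟧) ^ suc v
  root {x} 1≤x v n =
    let t , below , above = crossing (λ t → (⟦ t ⟧ * δ) ^ suc v ℚₚ.≤? x) P0 T ¬PT in
    ⟦ t ⟧ * δ , 0≤* 0≤⟦ t ⟧ 0≤δ , below , subst (λ y → x < y ^ suc v) (next t) (ℚₚ.≰⇒> above)
    where
    open ℚₚ.≤-Reasoning
    open ℚ-Solver
    δ = 1/⟦suc n ⟧
    0≤δ = ℚₚ.<⇒≤ 0<1/⟦suc n ⟧
    0≤x = ℚₚ.≤-trans 0≤1 1≤x
    next : ∀ t → ⟦ suc t ⟧ * δ ≡ ⟦ t ⟧ * δ + δ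
    next t = trans (cong (_* δ) (trans (⟦+⟧ 1 t) (cong (_+ ⟦ t ⟧) ⟦1⟧)))
      (solve 2 (λ t δ → (con 1ℚ :+ t) :* δ := t :* δ :+ δ) refl ⟦ t ⟧ δ)
    P0 : (⟦ 0 ⟧ * δ) ^ suc v ≤ x
    P0 = subst (_≤ x) (sym (trans (cong (λ z → z * z ^ v) (trans (cong (_* δ) ⟦0⟧) (ℚₚ.*-zeroˡ δ))) (ℚₚ.*-zeroˡ (0ℚ ^ v)))) 0≤x
    -- At T/(n+1) ≥ x + 1 ≥ 1 the power is at least x + 1, so the walk through the multiples of
    -- 1/(n+1) must cross x before T.
    bound = ≤⟦⟧ ((x + 1ℚ) * ⟦ suc n ⟧) (0≤* (0≤+ 0≤x 0≤1) 0≤⟦ suc n ⟧)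
    T = proj₁ bound
    1≤x+1 : 1ℚ ≤ x + 1ℚ
    1≤x+1 = p≤q+p 0≤x
    x+1≤Tδ : x + 1ℚ ≤ ⟦ T ⟧ * δ
    x+1≤Tδ = begin
      x + 1ℚ  ≡⟨ sym (trans (ℚₚ.*-assoc (x + 1ℚ) ⟦ suc n ⟧ δ) (trans (cong ((x + 1ℚ) *_) (⟦suc⟧*1/ n)) (ℚₚ.*-identityʳ _))) ⟩
      (x + 1ℚ) * ⟦ suc n ⟧ * δ  ≤⟨ *-monoʳ 0≤δ (proj₂ bound) ⟩
      ⟦ T ⟧ * δ  ∎
    ¬PT : ¬ (⟦ T ⟧ * δ) ^ suc v ≤ x
    ¬PT h = ℚₚ.<-irrefl refl (begin-strict
      x  <⟨ p+ε>p 0<1 ⟩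
      x + 1ℚ  ≡⟨ sym (ℚₚ.*-identityʳ _) ⟩
      (x + 1ℚ) * 1ℚ  ≤⟨ *-mono (0≤+ 0≤x 0≤1) x+1≤Tδ 0≤1 (1≤^ v (ℚₚ.≤-trans 1≤x+1 x+1≤Tδ)) ⟩
      (⟦ T ⟧ * δ) ^ suc v  ≤⟨ h ⟩
      x  ∎)

  -- With b ≤ gᵈ, so that g is at least b^(1/d), the hypotheses say that
  -- (i - j) / k ≤ u / v + 1 / d and bᵘ ≤ yᵛ.
  power-lower : ∀ {b g y} i j k u v d → 1ℚ ≤ b → 0ℚ ≤ g → 0ℚ ≤ y →
    i ℕ.* (suc v ℕ.* suc d) ℕ.≤ (j ℕ.* suc v ℕ.+ k ℕ.* u) ℕ.* suc d ℕ.+ k ℕ.* suc v →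
    b ^ u ≤ y ^ suc v → b ≤ g ^ suc d → b ^ i ≤ b ^ j * (g * y) ^ k
  power-lower {b} {g} {y} i j k u v d 1≤b 0≤g 0≤y h hy hg =
    ^-cancel-≤ (d ℕ.+ v ℕ.* suc d) (0≤* (0≤^ j 0≤b) (0≤^ k (0≤* 0≤g 0≤y))) (begin
      (b ^ i) ^ (V ℕ.* D)  ≡⟨ ℚ^ₚ.^-assocʳ b i (V ℕ.* D) ⟩
      b ^ (i ℕ.* (V ℕ.* D))  ≤⟨ ^-monoʳ 1≤b h ⟩
      b ^ ((j ℕ.* V ℕ.+ k ℕ.* u) ℕ.* D ℕ.+ k ℕ.* V)  ≡⟨ cong (b ^_) (e₁ j V k u D) ⟩
      b ^ ((j ℕ.* (V ℕ.* D) ℕ.+ u ℕ.* (k ℕ.* D)) ℕ.+ k ℕ.* V)  ≡⟨ trans (ℚ^ₚ.^-homo-* b (j ℕ.* (V ℕ.* D) ℕ.+ u ℕ.* (k ℕ.* D)) (k ℕ.* V))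
          (cong (_* b ^ (k ℕ.* V)) (ℚ^ₚ.^-homo-* b (j ℕ.* (V ℕ.* D)) (u ℕ.* (k ℕ.* D)))) ⟩
      b ^ (j ℕ.* (V ℕ.* D)) * b ^ (u ℕ.* (k ℕ.* D)) * b ^ (k ℕ.* V)  ≡⟨ cong (λ t → b ^ (j ℕ.* (V ℕ.* D)) * t * b ^ (k ℕ.* V)) (sym (ℚ^ₚ.^-assocʳ b u (k ℕ.* D))) ⟩
      b ^ (j ℕ.* (V ℕ.* D)) * (b ^ u) ^ (k ℕ.* D) * b ^ (k ℕ.* V)  ≤⟨ *-mono (0≤* 0≤bʲ (0≤^ (k ℕ.* D) (0≤^ u 0≤b))) (*-monoˡ 0≤bʲ (^-monoˡ (k ℕ.* D) (0≤^ u 0≤b) hy))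
          (0≤^ (k ℕ.* V) 0≤b) (^-monoˡ (k ℕ.* V) 0≤b hg) ⟩
      b ^ (j ℕ.* (V ℕ.* D)) * (y ^ V) ^ (k ℕ.* D) * (g ^ D) ^ (k ℕ.* V)
        ≡⟨ cong₂ (λ s t → b ^ (j ℕ.* (V ℕ.* D)) * s * t)
             (trans (ℚ^ₚ.^-assocʳ y V (k ℕ.* D)) (cong (y ^_) (e₂ V k D)))
             (trans (ℚ^ₚ.^-assocʳ g D (k ℕ.* V)) (cong (g ^_) (e₃ D k V))) ⟩
      b ^ (j ℕ.* (V ℕ.* D)) * y ^ (k ℕ.* (V ℕ.* D)) * g ^ (k ℕ.* (V ℕ.* D))
        ≡⟨ rearrange (b ^ (j ℕ.* (V ℕ.* D))) (y ^ (k ℕ.* (V ℕ.* D))) (g ^ (k ℕ.* (V ℕ.* D))) ⟩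
      b ^ (j ℕ.* (V ℕ.* D)) * (g ^ (k ℕ.* (V ℕ.* D)) * y ^ (k ℕ.* (V ℕ.* D)))
        ≡⟨ cong₂ _*_ (sym (ℚ^ₚ.^-assocʳ b j (V ℕ.* D)))
             (trans (sym (ℚ^ₚ.^-distrib-* g y (k ℕ.* (V ℕ.* D)))) (sym (ℚ^ₚ.^-assocʳ (g * y) k (V ℕ.* D)))) ⟩
      (b ^ j) ^ (V ℕ.* D) * ((g * y) ^ k) ^ (V ℕ.* D)  ≡⟨ sym (ℚ^ₚ.^-distrib-* (b ^ j) ((g * y) ^ k) (V ℕ.* D)) ⟩
      (b ^ j * (g * y) ^ k) ^ (V ℕ.* D)  ∎)
    where
    open ℚₚ.≤-Reasoning
    V = suc v
    D = suc d
    0≤b = ℚₚ.≤-trans 0≤1 1≤b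
    0≤bʲ = 0≤^ (j ℕ.* (V ℕ.* D)) 0≤b
    e₁ : ∀ j V k u D → (j ℕ.* V ℕ.+ k ℕ.* u) ℕ.* D ℕ.+ k ℕ.* V ≡ (j ℕ.* (V ℕ.* D) ℕ.+ u ℕ.* (k ℕ.* D)) ℕ.+ k ℕ.* V
    e₁ = solve 5 (λ j V k u D → (j :* V :+ k :* u) :* D :+ k :* V := (j :* (V :* D) :+ u :* (k :* D)) :+ k :* V) refl
      where open ℕ-Solver
    e₂ : ∀ V k D → V ℕ.* (k ℕ.* D) ≡ k ℕ.* (V ℕ.* D)
    e₂ = solve 3 (λ V k D → V :* (k :* D) := k :* (V :* D)) refl
      where open ℕ-Solver
    e₃ : ∀ D k V → D ℕ.* (k ℕ.* V) ≡ k ℕ.* (V ℕ.* D)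
    e₃ = solve 3 (λ D k V → D :* (k :* V) := k :* (V :* D)) refl
      where open ℕ-Solver
    rearrange : ∀ a b c → a * b * c ≡ a * (c * b)
    rearrange = solve 3 (λ a b c → a :* b :* c := a :* (c :* b)) refl
      where open ℚ-Solver

  -- The mirror image of `power-lower`: here u/(v+1) ≤ (i - j)/k + 1/(d+1), and the slack 1/(d+1)
  -- turns into the factor g^k on the right.
  power-upper : ∀ {b g z} i j k u v d → 1ℚ ≤ b → 0ℚ ≤ g → 0ℚ ≤ z →
    (j ℕ.* suc v ℕ.+ k ℕ.* u) ℕ.* suc d ℕ.≤ i ℕ.* (suc v ℕ.* suc d) ℕ.+ k ℕ.* suc v →
    z ^ suc v ≤ b ^ u → b ≤ g ^ suc d → b ^ j * z ^ k ≤ b ^ i * g ^ k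
  power-upper {b} {g} {z} i j k u v d 1≤b 0≤g 0≤z h hz hg =
    ^-cancel-≤ (d ℕ.+ v ℕ.* suc d) (0≤* (0≤^ i 0≤b) (0≤^ k 0≤g)) (begin
      (b ^ j * z ^ k) ^ (V ℕ.* D)  ≡⟨ ℚ^ₚ.^-distrib-* (b ^ j) (z ^ k) (V ℕ.* D) ⟩
      (b ^ j) ^ (V ℕ.* D) * (z ^ k) ^ (V ℕ.* D)  ≡⟨ cong₂ _*_ (ℚ^ₚ.^-assocʳ b j (V ℕ.* D))
          (trans (ℚ^ₚ.^-assocʳ z k (V ℕ.* D))
            (trans (cong (z ^_) (e₂ V k D)) (sym (ℚ^ₚ.^-assocʳ z V (k ℕ.* D))))) ⟩
      b ^ (j ℕ.* (V ℕ.* D)) * (z ^ V) ^ (k ℕ.* D)  ≤⟨ *-monoˡ (0≤^ (j ℕ.* (V ℕ.* D)) 0≤b) (^-monoˡ (k ℕ.* D) (0≤^ V 0≤z) hz) ⟩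
      b ^ (j ℕ.* (V ℕ.* D)) * (b ^ u) ^ (k ℕ.* D)  ≡⟨ cong (b ^ (j ℕ.* (V ℕ.* D)) *_) (ℚ^ₚ.^-assocʳ b u (k ℕ.* D)) ⟩
      b ^ (j ℕ.* (V ℕ.* D)) * b ^ (u ℕ.* (k ℕ.* D))  ≡⟨ sym (ℚ^ₚ.^-homo-* b (j ℕ.* (V ℕ.* D)) (u ℕ.* (k ℕ.* D))) ⟩
      b ^ (j ℕ.* (V ℕ.* D) ℕ.+ u ℕ.* (k ℕ.* D))  ≡⟨ cong (b ^_) (e₁ j V k u D) ⟩
      b ^ ((j ℕ.* V ℕ.+ k ℕ.* u) ℕ.* D)  ≤⟨ ^-monoʳ 1≤b h ⟩
      b ^ (i ℕ.* (V ℕ.* D) ℕ.+ k ℕ.* V)  ≡⟨ ℚ^ₚ.^-homo-* b (i ℕ.* (V ℕ.* D)) (k ℕ.* V) ⟩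
      b ^ (i ℕ.* (V ℕ.* D)) * b ^ (k ℕ.* V)  ≤⟨ *-monoˡ (0≤^ (i ℕ.* (V ℕ.* D)) 0≤b) (^-monoˡ (k ℕ.* V) 0≤b hg) ⟩
      b ^ (i ℕ.* (V ℕ.* D)) * (g ^ D) ^ (k ℕ.* V)  ≡⟨ cong₂ _*_ (sym (ℚ^ₚ.^-assocʳ b i (V ℕ.* D)))
          (trans (ℚ^ₚ.^-assocʳ g D (k ℕ.* V))
            (trans (cong (g ^_) (e₃ D k V)) (sym (ℚ^ₚ.^-assocʳ g k (V ℕ.* D))))) ⟩
      (b ^ i) ^ (V ℕ.* D) * (g ^ k) ^ (V ℕ.* D)  ≡⟨ sym (ℚ^ₚ.^-distrib-* (b ^ i) (g ^ k) (V ℕ.* D)) ⟩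
      (b ^ i * g ^ k) ^ (V ℕ.* D)  ∎)
    where
    open ℚₚ.≤-Reasoning
    V = suc v
    D = suc d
    0≤b = ℚₚ.≤-trans 0≤1 1≤b
    e₁ : ∀ j V k u D → j ℕ.* (V ℕ.* D) ℕ.+ u ℕ.* (k ℕ.* D) ≡ (j ℕ.* V ℕ.+ k ℕ.* u) ℕ.* D
    e₁ = solve 5 (λ j V k u D → j :* (V :* D) :+ u :* (k :* D) := (j :* V :+ k :* u) :* D) refl
      where open ℕ-Solver
    e₂ : ∀ V k D → k ℕ.* (V ℕ.* D) ≡ V ℕ.* (k ℕ.* D)
    e₂ = solve 3 (λ V k D → k :* (V :* D) := V :* (k :* D)) refl
      where open ℕ-Solver
    e₃ : ∀ D k V → D ℕ.* (k ℕ.* V) ≡ k ℕ.* (V ℕ.* D)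
    e₃ = solve 3 (λ D k V → D :* (k :* V) := k :* (V :* D)) refl
      where open ℕ-Solver

  ↥-nonNeg : ∀ q → 0ℚ ≤ q → ↥ q ≡ + ℤ.∣ ↥ q ∣
  ↥-nonNeg q@(mkℚ (+ n) _ _) 0≤q = refl
  ↥-nonNeg q@(mkℚ -[1+ n ] _ _) 0≤q = contradiction (nonNegative 0≤q) λ ()

  *↧≡↥ : ∀ q → 0ℚ ≤ q → q * ⟦ ↧ₙ q ⟧ ≡ ⟦ ℤ.∣ ↥ q ∣ ⟧
  *↧≡↥ q 0≤q = trans (cong (q *_) ⟦ ↧ₙ q ⟧≡)
    (trans (*-denominator q) (trans (cong (_/ 1) (↥-nonNeg q 0≤q)) (sym ⟦ ℤ.∣ ↥ q ∣ ⟧≡)))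

  /1-neg : ∀ j → (ℤ.- + j) / 1 ≡ - (+ j / 1)
  /1-neg zero    = refl
  /1-neg (suc j) = refl

  ∣/1∣ : ∀ k → ∣ k / 1 ∣ ≡ ⟦ ℤ.∣ k ∣ ⟧
  ∣/1∣ (+ n)    = trans (ℚₚ.0≤p⇒∣p∣≡p (subst (0ℚ ≤_) ⟦ n ⟧≡ 0≤⟦ n ⟧)) (sym ⟦ n ⟧≡)
  ∣/1∣ -[1+ n ] = trans (ℚₚ.∣-p∣≡∣p∣ (+ suc n / 1)) (∣/1∣ (+ suc n))

  /-* : ∀ i n .{{_ : ℕ.NonZero n}} → (i / n) * (+ n / 1) ≡ i / 1
  /-* i n@(suc n-1) = ℚₚ.toℚᵘ-injective (begin
    toℚᵘ ((i / n) * (+ n / 1))  ≈⟨ ℚₚ.toℚᵘ-homo-* (i / n) (+ n / 1) ⟩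
    toℚᵘ (i / n) ℚᵘ.* toℚᵘ (+ n / 1)  ≈⟨ ℚᵘₚ.*-cong (ℚₚ.toℚᵘ-fromℚᵘ (ℚᵘ.mkℚᵘ i n-1)) (toℚᵘ-/1 (+ n)) ⟩
    ℚᵘ.mkℚᵘ i n-1 ℚᵘ.* ℚᵘ.mkℚᵘ (+ n) 0  ≈⟨ ℚᵘ.*≡* (lem i (+ n)) ⟩
    ℚᵘ.mkℚᵘ i 0  ≈⟨ ℚᵘₚ.≃-sym (toℚᵘ-/1 i) ⟩
    toℚᵘ (i / 1)  ∎)
    where
    open ℚᵘₚ.≃-Reasoning
    lem : ∀ i k → (i ℤ.* k) ℤ.* + 1 ≡ i ℤ.* (k ℤ.* + 1)
    lem i k = trans (ℤₚ.*-identityʳ (i ℤ.* k)) (cong (i ℤ.*_) (sym (ℤₚ.*-identityʳ k)))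

  [i⊖j]/k*k : ∀ i j k .{{_ : ℕ.NonZero k}} → ((i ℤ.⊖ j) / k) * ⟦ k ⟧ ≡ ⟦ i ⟧ - ⟦ j ⟧
  [i⊖j]/k*k i j k = begin
    ((i ℤ.⊖ j) / k) * ⟦ k ⟧  ≡⟨ cong (((i ℤ.⊖ j) / k) *_) ⟦ k ⟧≡ ⟩
    ((i ℤ.⊖ j) / k) * (+ k / 1) ≡⟨ /-* (i ℤ.⊖ j) k ⟩
    (i ℤ.⊖ j) / 1  ≡⟨ cong (_/ 1) (sym (ℤₚ.[+m]-[+n]≡m⊖n i j)) ⟩
    (+ i ℤ.- + j) / 1  ≡⟨ /1-+ (+ i) (ℤ.- + j) ⟩
    + i / 1 + (ℤ.- + j) / 1  ≡⟨ cong₂ _+_ (sym ⟦ i ⟧≡) (trans (/1-neg j) (cong -_ (sym ⟦ j ⟧≡))) ⟩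
    ⟦ i ⟧ - ⟦ j ⟧  ∎
    where open ≡-Reasoning

  seq-^ : ∀ x k n → seq (x ℝ^.^ k) n ≡ seq x n ^ k
  seq-^ x zero    n = refl
  seq-^ x (suc k) n = cong (seq x n *_) (seq-^ x k n)

  ½ε<ε : ∀ {ε} → 0ℚ < ε → ½ * ε < ε
  ½ε<ε {ε} 0<ε = subst (½ * ε <_) (½ε+½ε≡ε ε) (p+ε>p (0<½ε 0<ε))

  -- g is 1 + b / d for a large d, so that g is at least b^(1/d) by
  -- Bernoulli's inequality.
  almost-one : ∀ {b B δ} → 0ℚ ≤ b → 0ℚ ≤ B → 0ℚ < δ → ∃ λ g → ∃ λ d → ∃ λ N →
    1ℚ ≤ g × b ≤ g ^ suc d × (∀ n → N ℕ.≤ n → ∀ z → 0ℚ ≤ z → z ≤ B → g * (z + 1/⟦suc n ⟧) ≤ z + δ)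
  almost-one {b} {B} {δ} 0≤b 0≤B 0<δ =
    -- The product (1 + β)(z + 1/(n+1)) exceeds z by 1/(n+1) and by β (z + 1/(n+1)); `N` and `d`
    -- make each of these at most δ/2.
    let d , hd = archimedean (0≤* 0≤b (0≤+ 0≤B 0≤1)) (0<½ε 0<δ)
        N , hN = archimedean 0≤1 (0<½ε 0<δ)
        β = b * 1/⟦suc d ⟧
        0≤β = 0≤* 0≤b (ℚₚ.<⇒≤ 0<1/⟦suc d ⟧)
    in 1ℚ + β , d , N , p≤p+q 0≤β , (begin
        b  ≡⟨ sym (ℚₚ.*-identityʳ b) ⟩
        b * 1ℚ  ≡⟨ cong (b *_) (sym (⟦suc⟧*1/ d)) ⟩
        b * (⟦ suc d ⟧ * 1/⟦suc d ⟧)  ≡⟨ lem₁ b ⟦ suc d ⟧ 1/⟦suc d ⟧ ⟩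
        ⟦ suc d ⟧ * β  ≤⟨ p≤q+p 0≤1 ⟩
        1ℚ + ⟦ suc d ⟧ * β  ≤⟨ bernoulli (suc d) 0≤β ⟩
        (1ℚ + β) ^ suc d  ∎) ,
      λ n N≤n z 0≤z z≤B → begin
        (1ℚ + β) * (z + 1/⟦suc n ⟧)  ≡⟨ lem₂ β z 1/⟦suc n ⟧ ⟩
        z + (1ℚ * 1/⟦suc n ⟧ + β * (z + 1/⟦suc n ⟧))  ≤⟨ ℚₚ.+-monoʳ-≤ z (ℚₚ.+-mono-≤ (hN n N≤n)
            (ℚₚ.≤-trans (*-monoˡ 0≤β (ℚₚ.+-mono-≤ z≤B 1/⟦suc n ⟧≤1))
              (ℚₚ.≤-trans (ℚₚ.≤-reflexive (lem₃ b 1/⟦suc d ⟧ (B + 1ℚ))) (hd d ℕₚ.≤-refl)))) ⟩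
        z + (½ * δ + ½ * δ)  ≡⟨ cong (λ t → z + t) (½ε+½ε≡ε δ) ⟩
        z + δ  ∎
    where
    open ℚₚ.≤-Reasoning
    open ℚ-Solver
    lem₁ : ∀ b d i → b * (d * i) ≡ d * (b * i)
    lem₁ = solve 3 (λ b d i → b :* (d :* i) := d :* (b :* i)) refl
    lem₂ : ∀ β z δ → (1ℚ + β) * (z + δ) ≡ z + (1ℚ * δ + β * (z + δ))
    lem₂ = solve 3 (λ β z δ → (con 1ℚ :+ β) :* (z :+ δ) := z :+ (con 1ℚ :* δ :+ β :* (z :+ δ))) refl
    lem₃ : ∀ b d B → b * d * B ≡ b * B * d
    lem₃ = solve 3 (λ b d B → b :* d :* B := b :* B :* d) refl

  -- The n-th term approximates b to the power `seq s n` from below, with error at most 1/(n+1),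
  -- using the reduced fraction `u n` / `V n`. The exponents in view are 2γ and 2 - 2γ, whence the
  -- cap 2; it bounds all terms by b^2.
  module Power (b : ℚ) (1≤b : 1ℚ ≤ b) (s : ℝ) (0≤s : ∀ n → 0ℚ ≤ seq s n) (s≤2 : ∀ n → seq s n ≤ ⟦ 2 ⟧) where

    open ℚₚ.≤-Reasoning

    0≤b = ℚₚ.≤-trans 0≤1 1≤b

    u v V : ℕ → ℕ
    u n = ℤ.∣ ↥ seq s n ∣
    v n = ℚ.denominator-1 (seq s n)
    V n = suc (v n)

    s*V : ∀ n → seq s n * ⟦ V n ⟧ ≡ ⟦ u n ⟧
    s*V n = *↧≡↥ (seq s n) (0≤s n)

    abstract
      approximation : ∀ n → ∃ λ z → 0ℚ ≤ z × z ^ V n ≤ b ^ u n × b ^ u n < (z + 1/⟦suc n ⟧) ^ V n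
      approximation n = root (1≤^ (u n) 1≤b) (v n) n

    z : ℕ → ℚ
    z n = proj₁ (approximation n)

    0≤z : ∀ n → 0ℚ ≤ z n
    0≤z n = proj₁ (proj₂ (approximation n))

    z^V≤b^u : ∀ n → z n ^ V n ≤ b ^ u n
    z^V≤b^u n = proj₁ (proj₂ (proj₂ (approximation n)))

    b^u≤ : ∀ n → b ^ u n ≤ (z n + 1/⟦suc n ⟧) ^ V n
    b^u≤ n = ℚₚ.<⇒≤ (proj₂ (proj₂ (proj₂ (approximation n))))

    0≤z+ : ∀ n → 0ℚ ≤ z n + 1/⟦suc n ⟧
    0≤z+ n = 0≤+ (0≤z n) (ℚₚ.<⇒≤ 0<1/⟦suc n ⟧)

    1≤z+ : ∀ n → 1ℚ ≤ z n + 1/⟦suc n ⟧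
    1≤z+ n = ^-cancel-≤ (v n) (0≤z+ n) (subst (_≤ (z n + 1/⟦suc n ⟧) ^ V n) (sym (1^n≡1 (V n)))
      (ℚₚ.≤-trans (1≤^ (u n) 1≤b) (b^u≤ n)))

    -- Valid for any fraction i / k equal to `seq s n`, reduced or not. The final estimates take k =
    -- n + 1, the denominator with which the terms of γ are built.
    z^k≤b^i : ∀ n i k .{{_ : ℕ.NonZero k}} → seq s n * ⟦ k ⟧ ≡ ⟦ i ⟧ → z n ^ k ≤ b ^ i
    z^k≤b^i n i k@(suc k-1) eq = ^-cancel-≤ (v n) (0≤^ i 0≤b) (begin
      (z n ^ k) ^ V n  ≡⟨ trans (ℚ^ₚ.^-assocʳ (z n) k (V n)) (trans (cong (z n ^_) (ℕₚ.*-comm k (V n))) (sym (ℚ^ₚ.^-assocʳ (z n) (V n) k))) ⟩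
      (z n ^ V n) ^ k  ≤⟨ ^-monoˡ k (0≤^ (V n) (0≤z n)) (z^V≤b^u n) ⟩
      (b ^ u n) ^ k  ≡⟨ ℚ^ₚ.^-assocʳ b (u n) k ⟩
      b ^ (u n ℕ.* k)  ≤⟨ ^-monoʳ 1≤b (⟦⟧-cancel-≤ (ℚₚ.≤-reflexive cross)) ⟩
      b ^ (i ℕ.* V n)  ≡⟨ sym (ℚ^ₚ.^-assocʳ b i (V n)) ⟩
      (b ^ i) ^ V n  ∎)
      where
      open ℚ-Solver
      cross : ⟦ u n ℕ.* k ⟧ ≡ ⟦ i ℕ.* V n ⟧
      cross = trans (⟦*⟧ (u n) k) (trans (cong (_* ⟦ k ⟧) (sym (s*V n)))
        (trans (solve 3 (λ s V k → s :* V :* k := s :* k :* V) refl (seq s n) ⟦ V n ⟧ ⟦ k ⟧)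
        (trans (cong (_* ⟦ V n ⟧) eq) (sym (⟦*⟧ i (V n))))))

    z≤b² : ∀ n → z n ≤ b ^ 2
    z≤b² n = ^-cancel-≤ (v n) (0≤^ 2 0≤b) (begin
      z n ^ V n  ≤⟨ z^V≤b^u n ⟩
      b ^ u n  ≤⟨ ^-monoʳ 1≤b (⟦⟧-cancel-≤ (subst₂ _≤_ (s*V n) (sym (⟦*⟧ 2 (V n))) (*-monoʳ 0≤⟦ V n ⟧ (s≤2 n)))) ⟩
      b ^ (2 ℕ.* V n)  ≡⟨ sym (ℚ^ₚ.^-assocʳ b 2 (V n)) ⟩
      (b ^ 2) ^ V n  ∎)

    cast : ∀ i j k u V D → ⟦ (j ℕ.* V ℕ.+ k ℕ.* u) ℕ.* D ⟧ ≡ (⟦ j ⟧ * ⟦ V ⟧ + ⟦ k ⟧ * ⟦ u ⟧) * ⟦ D ⟧ ×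
           ⟦ i ℕ.* (V ℕ.* D) ⟧ ≡ ⟦ i ⟧ * (⟦ V ⟧ * ⟦ D ⟧)
    cast i j k u V D =
      trans (⟦*⟧ (j ℕ.* V ℕ.+ k ℕ.* u) D) (cong (_* ⟦ D ⟧) (trans (⟦+⟧ (j ℕ.* V) (k ℕ.* u)) (cong₂ _+_ (⟦*⟧ j V) (⟦*⟧ k u)))) ,
      trans (⟦*⟧ i (V ℕ.* D)) (cong (⟦ i ⟧ *_) (⟦*⟧ V D))

    -- r = (i - j) / k
    module _ (r : ℚ) (i j k n d : ℕ) (r*k : r * ⟦ k ⟧ ≡ ⟦ i ⟧ - ⟦ j ⟧) where

      private
        D = suc d
        δ = 1/⟦suc d ⟧

      0≤kVD : 0ℚ ≤ ⟦ k ⟧ * (⟦ V n ⟧ * ⟦ D ⟧)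
      0≤kVD = 0≤* 0≤⟦ k ⟧ (0≤* 0≤⟦ V n ⟧ 0≤⟦ D ⟧)

      rkVD : r * (⟦ k ⟧ * (⟦ V n ⟧ * ⟦ D ⟧)) + ⟦ j ⟧ * (⟦ V n ⟧ * ⟦ D ⟧) ≡ ⟦ i ⟧ * (⟦ V n ⟧ * ⟦ D ⟧)
      rkVD = trans (solve 5 (λ r k V D j → r :* (k :* (V :* D)) :+ j :* (V :* D) := (r :* k :+ j) :* (V :* D)) refl r ⟦ k ⟧ ⟦ V n ⟧ ⟦ D ⟧ ⟦ j ⟧)
        (cong (_* (⟦ V n ⟧ * ⟦ D ⟧)) (trans (cong (_+ ⟦ j ⟧) r*k) (solve 2 (λ i j → (i :- j) :+ j := i) refl ⟦ i ⟧ ⟦ j ⟧)))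
        where open ℚ-Solver

      skVD : seq s n * (⟦ k ⟧ * (⟦ V n ⟧ * ⟦ D ⟧)) + ⟦ j ⟧ * (⟦ V n ⟧ * ⟦ D ⟧) ≡ (⟦ j ⟧ * ⟦ V n ⟧ + ⟦ k ⟧ * ⟦ u n ⟧) * ⟦ D ⟧
      skVD = trans (solve 5 (λ s k V D j → s :* (k :* (V :* D)) :+ j :* (V :* D) := (j :* V :+ k :* (s :* V)) :* D) refl (seq s n) ⟦ k ⟧ ⟦ V n ⟧ ⟦ D ⟧ ⟦ j ⟧)
        (cong (λ t → (⟦ j ⟧ * ⟦ V n ⟧ + ⟦ k ⟧ * t) * ⟦ D ⟧) (s*V n))
        where open ℚ-Solver

      δkVD : δ * (⟦ k ⟧ * (⟦ V n ⟧ * ⟦ D ⟧)) ≡ ⟦ k ℕ.* V n ⟧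
      δkVD = trans (solve 4 (λ δ k V D → δ :* (k :* (V :* D)) := (D :* δ) :* (k :* V)) refl δ ⟦ k ⟧ ⟦ V n ⟧ ⟦ D ⟧)
        (trans (cong (_* (⟦ k ⟧ * ⟦ V n ⟧)) (⟦suc⟧*1/ d)) (trans (ℚₚ.*-identityˡ _) (sym (⟦*⟧ k (V n)))))
        where open ℚ-Solver

      -- Clearing the denominators k, V and D turns the rational inequality into the hypothesis on
      -- exponents in `power-lower`.
      r≤s+δ : r ≤ seq s n + δ → i ℕ.* (V n ℕ.* D) ℕ.≤ (j ℕ.* V n ℕ.+ k ℕ.* u n) ℕ.* D ℕ.+ k ℕ.* V n
      r≤s+δ h = ⟦⟧-cancel-≤ (subst₂ _≤_
        (trans rkVD (sym (proj₂ (cast i j k (u n) (V n) D))))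
        (trans (solve 4 (λ s δ w x → (s :+ δ) :* w :+ x := (s :* w :+ x) :+ δ :* w) refl (seq s n) δ w x)
          (trans (cong₂ _+_ (trans skVD (sym (proj₁ (cast i j k (u n) (V n) D)))) δkVD)
            (sym (⟦+⟧ ((j ℕ.* V n ℕ.+ k ℕ.* u n) ℕ.* D) (k ℕ.* V n)))))
        (ℚₚ.+-monoˡ-≤ x (*-monoʳ 0≤kVD h)))
        where
        open ℚ-Solver
        w = ⟦ k ⟧ * (⟦ V n ⟧ * ⟦ D ⟧)
        x = ⟦ j ⟧ * (⟦ V n ⟧ * ⟦ D ⟧)

      s≤r+δ : seq s n ≤ r + δ → (j ℕ.* V n ℕ.+ k ℕ.* u n) ℕ.* D ℕ.≤ i ℕ.* (V n ℕ.* D) ℕ.+ k ℕ.* V n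
      s≤r+δ h = ⟦⟧-cancel-≤ (subst₂ _≤_
        (trans skVD (sym (proj₁ (cast i j k (u n) (V n) D))))
        (trans (solve 4 (λ s δ w x → (s :+ δ) :* w :+ x := (s :* w :+ x) :+ δ :* w) refl r δ w x)
          (trans (cong₂ _+_ (trans rkVD (sym (proj₂ (cast i j k (u n) (V n) D)))) δkVD)
            (sym (⟦+⟧ (i ℕ.* (V n ℕ.* D)) (k ℕ.* V n)))))
        (ℚₚ.+-monoˡ-≤ x (*-monoʳ 0≤kVD h)))
        where
        open ℚ-Solver
        w = ⟦ k ⟧ * (⟦ V n ⟧ * ⟦ D ⟧)
        x = ⟦ j ⟧ * (⟦ V n ⟧ * ⟦ D ⟧)

    -- If the exponents at m and n differ by less than 1/(d+1), the powers differ by at most the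
    -- factor g of `almost-one`. One side is enough, as m and n may be exchanged.
    z≤z+ : ∀ {δ} → 0ℚ < δ → ∃ λ N → ∀ m n → N ℕ.≤ m → N ℕ.≤ n → z m ≤ z n + δ
    z≤z+ {δ} 0<δ =
      let g , d , N₁ , 1≤g , b≤g^D , near = almost-one {b} {b ^ 2} 0≤b (0≤^ 2 0≤b) 0<δ
          0≤g = ℚₚ.≤-trans 0≤1 1≤g
          N₂ , close = cauchy s 1/⟦suc d ⟧ 0<1/⟦suc d ⟧
      in N₁ ℕ.⊔ N₂ , λ m n N≤m N≤n →
        let ∣s-s∣<δ = close m n (ℕₚ.m⊔n≤o⇒n≤o N₁ N₂ N≤m) (ℕₚ.m⊔n≤o⇒n≤o N₁ N₂ N≤n)
            s≤ = lin≤ {seq s m} {seq s n + 1/⟦suc d ⟧} {seq s m - seq s n} {1/⟦suc d ⟧}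
                   (lem (seq s m) (seq s n) 1/⟦suc d ⟧) (ℚₚ.≤-trans (p≤∣p∣ _) (ℚₚ.<⇒≤ ∣s-s∣<δ))
            -- `seq s m` enters as the fraction (u m - 0) / V m, that is with j = 0.
            s*V-0 = trans (s*V m) (sym (trans (cong (λ t → ⟦ u m ⟧ - t) ⟦0⟧) (ℚₚ.+-identityʳ ⟦ u m ⟧)))
        in begin
        z m  ≤⟨ ^-cancel-≤ (v m) (0≤* 0≤g (0≤z+ n)) (ℚₚ.≤-trans (z^V≤b^u m)
            (subst (b ^ u m ≤_) (ℚₚ.*-identityˡ _)
              (power-lower (u m) 0 (V m) (u n) (v n) d 1≤b 0≤g (0≤z+ n)
                (r≤s+δ (seq s m) (u m) 0 (V m) n d s*V-0 s≤) (b^u≤ n) b≤g^D))) ⟩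
        g * (z n + 1/⟦suc n ⟧)  ≤⟨ near n (ℕₚ.m⊔n≤o⇒m≤o N₁ N₂ N≤n) (z n) (0≤z n) (z≤b² n) ⟩
        z n + δ  ∎
      where
      open ℚ-Solver
      lem : ∀ a b δ → (b + δ) - a ≡ δ - (a - b)
      lem = solve 3 (λ a b δ → (b :+ δ) :- a := δ :- (a :- b)) refl

    power : ℝ
    power = mkℝ z λ ε 0<ε →
      let N , h = z≤z+ (0<½ε 0<ε) in
      N , λ m n N≤m N≤n → ∣p∣<q
        (ℚₚ.≤-<-trans (lin≤ (lem₁ (z m) (z n) (½ * ε)) (h m n N≤m N≤n)) (½ε<ε 0<ε))
        (ℚₚ.≤-<-trans (lin≤ (lem₂ (z m) (z n) (½ * ε)) (h n m N≤n N≤m)) (½ε<ε 0<ε))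
      where
      open ℚ-Solver
      lem₁ : ∀ a b ε → ε - (a - b) ≡ (b + ε) - a
      lem₁ = solve 3 (λ a b ε → ε :- (a :- b) := (b :+ ε) :- a) refl
      lem₂ : ∀ a b ε → ε - (- (a - b)) ≡ (a + ε) - b
      lem₂ = solve 3 (λ a b ε → ε :- (:- (a :- b)) := (a :+ ε) :- b) refl

    0<power : 0ℝ <ℝ power
    0<power =
      -- Once 1/(n+1) ≤ 1/4, the term is at least 3/4, which leaves room above 1/2.
      let N , h = archimedean 0≤1 (0<½ε (0<½ε 0<1)) in
      ½ , ℚₚ.positive⁻¹ ½ , N , λ n N≤n →
        lin< {0ℚ + ½} {z n} {1ℚ + 1ℚ * 1/⟦suc n ⟧ + 0ℚ} {(z n + 1/⟦suc n ⟧) + ½ * (½ * 1ℚ) + ½ * ½} (lem (z n) 1/⟦suc n ⟧)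
          (ℚₚ.+-mono-≤-< (ℚₚ.+-mono-≤ (1≤z+ n) (h n N≤n)) (0<½ε (ℚₚ.positive⁻¹ ½)))
      where
      open ℚ-Solver
      lem : ∀ z δ → z - (0ℚ + ½) ≡ ((z + δ) + ½ * (½ * 1ℚ) + ½ * ½) - (1ℚ + 1ℚ * δ + 0ℚ)
      lem = solve 2 (λ z δ → z :- (con 0ℚ :+ con ½) :=
        ((z :+ δ) :+ con ½ :* (con ½ :* con 1ℚ) :+ con ½ :* con ½) :- (con 1ℚ :+ con 1ℚ :* δ :+ con 0ℚ)) refl

    module _ (i j k : ℕ) .{{_ : ℕ.NonZero k}} where

      private
        r = (i ℤ.⊖ j) / k
        B = b ^ 2 + 1ℚ
        0≤B = 0≤+ (0≤^ 2 0≤b) 0≤1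
        c = proj₁ (^-lipschitz B k 0≤B)
        0≤c = proj₁ (proj₂ (^-lipschitz B k 0≤B))
        lipschitz = proj₂ (proj₂ (^-lipschitz B k 0≤B))

      ^-near : ∀ {e ε} m x y → 0ℚ ≤ x → x ≤ b ^ 2 → x ≤ y → y ≤ x + 1/⟦suc m ⟧ →
               0ℚ ≤ e → e * c * 1/⟦suc m ⟧ ≤ ε → e * y ^ k ≤ e * x ^ k + ε
      ^-near {e} {ε} m x y 0≤x x≤ x≤y y≤ 0≤e h = begin
        e * y ^ k  ≤⟨ *-monoˡ 0≤e (lipschitz x y 0≤x x≤y (ℚₚ.≤-trans y≤ (ℚₚ.+-mono-≤ x≤ 1/⟦suc m ⟧≤1))) ⟩
        e * (x ^ k + c * (y - x))  ≤⟨ *-monoˡ 0≤e (ℚₚ.+-monoʳ-≤ (x ^ k) (*-monoˡ 0≤c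
            (lin≤ (lem₁ x y 1/⟦suc m ⟧) y≤))) ⟩
        e * (x ^ k + c * 1/⟦suc m ⟧)  ≡⟨ lem₂ e (x ^ k) c 1/⟦suc m ⟧ ⟩
        e * x ^ k + e * c * 1/⟦suc m ⟧  ≤⟨ ℚₚ.+-monoʳ-≤ (e * x ^ k) h ⟩
        e * x ^ k + ε  ∎
        where
        open ℚ-Solver
        lem₁ : ∀ x y δ → δ - (y - x) ≡ (x + δ) - y
        lem₁ = solve 3 (λ x y δ → δ :- (y :- x) := (x :+ δ) :- y) refl
        lem₂ : ∀ e p c δ → e * (p + c * δ) ≡ e * p + e * c * δ
        lem₂ = solve 4 (λ e p c δ → e :* (p :+ c :* δ) := e :* p :+ e :* c :* δ) refl

      lower : fromℚ r ≤ℝ s → fromℚ (b ^ i) ≤ℝ fromℚ (b ^ j) *ℝ power ℝ^.^ k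
      lower r≤s ε 0<ε =
        let m , small = archimedean (0≤* (0≤^ j 0≤b) 0≤c) (0<½ε 0<ε)
            g , d , N , 1≤g , b≤g^D , near = almost-one {b} {b ^ 2} 0≤b (0≤^ 2 0≤b) 0<1/⟦suc m ⟧
            0≤g = ℚₚ.≤-trans 0≤1 1≤g
        in ev-map₂ (N , λ n N≤n → N≤n) (r≤s 1/⟦suc d ⟧ 0<1/⟦suc d ⟧) λ n N≤n r<s+δ → begin-strict
          b ^ i  ≤⟨ power-lower i j k (u n) (v n) d 1≤b 0≤g (0≤z+ n)
              (r≤s+δ r i j k n d ([i⊖j]/k*k i j k) (ℚₚ.<⇒≤ r<s+δ)) (b^u≤ n) b≤g^D ⟩
          b ^ j * (g * (z n + 1/⟦suc n ⟧)) ^ k  ≤⟨ ^-near m (z n) (g * (z n + 1/⟦suc n ⟧)) (0≤z n) (z≤b² n)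
              (ℚₚ.≤-trans (p≤p+q (ℚₚ.<⇒≤ 0<1/⟦suc n ⟧)) (1≤a⇒b≤a*b 1≤g (0≤z+ n)))
              (near n N≤n (z n) (0≤z n) (z≤b² n)) (0≤^ j 0≤b) (small m ℕₚ.≤-refl) ⟩
          b ^ j * z n ^ k + ½ * ε  <⟨ ℚₚ.+-monoʳ-< (b ^ j * z n ^ k) (½ε<ε 0<ε) ⟩
          b ^ j * z n ^ k + ε  ≡⟨ cong (λ t → b ^ j * t + ε) (sym (seq-^ power k n)) ⟩
          b ^ j * seq (power ℝ^.^ k) n + ε  ∎

      upper : s ≤ℝ fromℚ r → fromℚ (b ^ j) *ℝ power ℝ^.^ k ≤ℝ fromℚ (b ^ i)
      upper s≤r ε 0<ε =
        let m , small = archimedean (0≤* (0≤^ i 0≤b) 0≤c) (0<½ε 0<ε)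
            g , d , N , 1≤g , b≤g^D , near = almost-one {b} {b ^ 2} 0≤b (0≤^ 2 0≤b) 0<1/⟦suc m ⟧
            0≤g = ℚₚ.≤-trans 0≤1 1≤g
            1≤b² = 1≤^ 2 1≤b
            -- `near` at z = 1 bounds the factor itself: g ≤ 1 + 1/(m+1).
            g≤ = ℚₚ.≤-trans (ℚₚ.≤-reflexive (sym (ℚₚ.*-identityʳ g)))
                   (ℚₚ.≤-trans (*-monoˡ 0≤g (p≤p+q (ℚₚ.<⇒≤ 0<1/⟦suc N ⟧))) (near N ℕₚ.≤-refl 1ℚ 0≤1 1≤b²))
        in ev-map (s≤r 1/⟦suc d ⟧ 0<1/⟦suc d ⟧) λ n s<r+δ → begin-strict
          b ^ j * seq (power ℝ^.^ k) n  ≡⟨ cong (b ^ j *_) (seq-^ power k n) ⟩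
          b ^ j * z n ^ k  ≤⟨ power-upper i j k (u n) (v n) d 1≤b 0≤g (0≤z n)
              (s≤r+δ r i j k n d ([i⊖j]/k*k i j k) (ℚₚ.<⇒≤ s<r+δ)) (z^V≤b^u n) b≤g^D ⟩
          b ^ i * g ^ k  ≤⟨ ^-near m 1ℚ g 0≤1 1≤b² 1≤g g≤ (0≤^ i 0≤b) (small m ℕₚ.≤-refl) ⟩
          b ^ i * 1ℚ ^ k + ½ * ε  ≡⟨ cong (_+ ½ * ε) (trans (cong (b ^ i *_) (1^n≡1 k)) (ℚₚ.*-identityʳ (b ^ i))) ⟩
          b ^ i + ½ * ε  <⟨ ℚₚ.+-monoʳ-< (b ^ i) (½ε<ε 0<ε) ⟩
          b ^ i + ε  ∎

    isPower : IsPower b s power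
    isPower = record
      { 1≤base  = 1≤b
      ; 0<power = 0<power
      ; lower   = lower
      ; upper   = upper
      }

  -- Real absolute values of elements of K

  module Field {c ℓ} (K : EmbeddedQuadraticField c ℓ) where

    open EmbeddedQuadraticField K public
    open Comparison K public using (f-ℚ; zero?; sign; compare)
    module R = CommutativeRing commutativeRing
    module ιH = RingMorphisms.IsRingHomomorphism ι-isRingHomomorphism
    module σ∞H = RingMorphisms.IsRingMonomorphism σ∞-embedding
    module σ₂H = RingMorphisms.IsRingMonomorphism σ₂-embedding
    module K^ = Exp R.commutativeSemiring
    open K^ public using () renaming (_^_ to _^K_)

    ℚ-algebra = fromCommutativeRing commutativeRing

    ι-morphism : +-*-rawRing -Raw-AlmostCommutative⟶ ℚ-algebra
    ι-morphism = record
      { ⟦_⟧ = ι ; +-homo = ιH.+-homo ; *-homo = ιH.*-homo ; -‿homo = ιH.-‿homo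
      ; 0-homo = ιH.0#-homo ; 1-homo = ιH.1#-homo }

    ι-≟ : WeaklyDecidable (Induced-equivalence ι-morphism)
    ι-≟ x y = map (λ x≡y → R.reflexive (cong ι x≡y)) (dec⇒maybe (x ℚₚ.≟ y))

    -- Coefficients are taken in ℚ, so that identities containing rational literals are solved as
    -- well.
    module K-Solver where
      module S = Algebra.Solver.Ring +-*-rawRing ℚ-algebra ι-morphism ι-≟
      open S public using (solve; con; _:+_; _:*_; _:-_; :-_; _:=_)

    1K≈ : ι 1ℚ ≈K 1K
    1K≈ = ιH.1#-homo

    ι-cong : ∀ {p q} → p ≡ q → ι p ≈K ι q
    ι-cong p≡q = R.reflexive (cong ι p≡q)

    ι-injective : ∀ {p q} → ι p ≈K ι q → p ≡ q
    ι-injective {p} {q} h = begin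
      p  ≡⟨ lem p q ⟩
      (p - q) + q  ≡⟨ cong (_+ q) (proj₁ (independent (p - q) 0ℚ ι[p-q]≈0)) ⟩
      0ℚ + q  ≡⟨ ℚₚ.+-identityˡ q ⟩
      q  ∎
      where
      open ≡-Reasoning
      lem : ∀ p q → p ≡ (p - q) + q
      lem = solve 2 (λ p q → p := (p :- q) :+ q) refl
        where open ℚ-Solver
      ι[p-q]≈0 : ι (p - q) +K ι 0ℚ *K θ ≈K 0K
      ι[p-q]≈0 = R.trans
        (R.+-cong (R.trans (ιH.+-homo p (- q)) (R.trans (R.+-cong h (ιH.-‿homo q)) (R.-‿inverseʳ (ι q))))
          (R.trans (R.*-congʳ ιH.0#-homo) (R.zeroˡ θ)))
        (R.+-identityˡ 0K)

    ι-^ : ∀ r n → ι (r ^ n) ≈K ι r ^K n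
    ι-^ r zero    = ιH.1#-homo
    ι-^ r (suc n) = R.trans (ιH.*-homo r (r ^ n)) (R.*-congˡ (ι-^ r n))

    ι-*₃ : ∀ r s t → ι (r * s * t) ≈K ι r *K ι s *K ι t
    ι-*₃ r s t = R.trans (ιH.*-homo (r * s) t) (R.*-congʳ (ιH.*-homo r s))

    -0≈0 : -K 0K ≈K 0K
    -0≈0 = R.trans (R.sym (R.+-identityˡ (-K 0K))) (R.-‿inverseʳ 0K)

    -‿≉0 : ∀ {x} → ¬ x ≈K 0K → ¬ -K x ≈K 0K
    -‿≉0 {x} x≉0 -x≈0 = x≉0 (R.trans (solve 1 (λ x → x := :- (:- x)) R.refl x) (R.trans (R.-‿cong -x≈0) -0≈0))
      where open K-Solver

    *-inverse-unique : ∀ {x y z} → x *K y ≈K 1K → x *K z ≈K 1K → y ≈K z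
    *-inverse-unique {x} {y} {z} xy≈1 xz≈1 = begin
      y  ≈⟨ R.sym (R.*-identityˡ y) ⟩
      1K *K y  ≈⟨ R.*-congʳ (R.sym xz≈1) ⟩
      x *K z *K y  ≈⟨ solve 3 (λ x y z → x :* z :* y := x :* y :* z) R.refl x y z ⟩
      x *K y *K z  ≈⟨ R.*-congʳ xy≈1 ⟩
      1K *K z  ≈⟨ R.*-identityˡ z ⟩
      z  ∎
      where
      open K-Solver
      open import Relation.Binary.Reasoning.Setoid R.setoid

    *≉0 : ∀ {x y} → ¬ x ≈K 0K → ¬ y ≈K 0K → ¬ x *K y ≈K 0K
    *≉0 {x} {y} x≉0 y≉0 xy≈0 = y≉0 (begin
      y  ≈⟨ R.sym (R.*-identityˡ y) ⟩
      1K *K y  ≈⟨ R.*-congʳ (R.sym (*-inverse x x≉0)) ⟩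
      x *K x ⁻¹ *K y  ≈⟨ solve 3 (λ x x′ y → x :* x′ :* y := x′ :* (x :* y)) R.refl x (x ⁻¹) y ⟩
      x ⁻¹ *K (x *K y)  ≈⟨ R.*-congˡ xy≈0 ⟩
      x ⁻¹ *K 0K  ≈⟨ R.zeroʳ (x ⁻¹) ⟩
      0K  ∎)
      where
      open K-Solver
      open import Relation.Binary.Reasoning.Setoid R.setoid

    1≉0 : ¬ 1K ≈K 0K
    1≉0 h = contradiction (ι-injective (R.trans 1K≈ (R.trans h (R.sym ιH.0#-homo)))) ℚₚ.1≢0

    infix 4 ∣_∣∞≤_

    -- A record rather than the inequality itself, so that `x` and `q` can be inferred by
    -- unification. Sizes are tracked only through rational upper bounds; a lower bound on an
    -- element is an upper bound on its inverse.
    record ∣_∣∞≤_ (x : Carrier) (q : ℚ) : Set where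
      constructor bounded
      field
        bound : ∣ σ∞ x ∣ℝ ≤ℝ fromℚ q

    open ∣_∣∞≤_ public

    ∣∣∞-mono : ∀ {x q r} → q ≤ r → ∣ x ∣∞≤ q → ∣ x ∣∞≤ r
    ∣∣∞-mono q≤r (bounded h) = bounded λ ε 0<ε → ev-map (h ε 0<ε) λ n k → ℚₚ.<-≤-trans k (ℚₚ.+-monoˡ-≤ ε q≤r)

    ∣∣∞-nonNeg : ∀ {x q} → ∣ x ∣∞≤ q → 0ℚ ≤ q
    ∣∣∞-nonNeg {x} {q} (bounded h) = ℚₚ.≮⇒≥ λ q<0 →
      let N , k = h (- q) (ℚₚ.neg-antimono-< q<0) in
      ℚₚ.<-irrefl refl (ℚₚ.≤-<-trans (ℚₚ.0≤∣p∣ (seq (σ∞ x) N))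
        (subst (∣ seq (σ∞ x) N ∣ <_) (ℚₚ.+-inverseʳ q) (k N ℕₚ.≤-refl)))

    ∣∣-resp-≈ℝ : ∀ x y q → x ≈ℝ y → ∣ x ∣ℝ ≤ℝ fromℚ q → ∣ y ∣ℝ ≤ℝ fromℚ q
    ∣∣-resp-≈ℝ x y q x≈y h ε 0<ε = ev-map₂ (x≈y (½ * ε) (0<½ε 0<ε)) (h (½ * ε) (0<½ε 0<ε)) λ n k l → begin-strict
      ∣ seq y n ∣  ≡⟨ cong ∣_∣ (lem₁ (seq x n) (seq y n)) ⟩
      ∣ seq x n + - (seq x n - seq y n) ∣  ≤⟨ ℚₚ.∣p+q∣≤∣p∣+∣q∣ (seq x n) (- (seq x n - seq y n)) ⟩
      ∣ seq x n ∣ + ∣ - (seq x n - seq y n) ∣ ≡⟨ cong (λ t → ∣ seq x n ∣ + t) (ℚₚ.∣-p∣≡∣p∣ (seq x n - seq y n)) ⟩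
      ∣ seq x n ∣ + ∣ seq x n - seq y n ∣  <⟨ ℚₚ.+-mono-< l k ⟩
      q + ½ * ε + ½ * ε  ≡⟨ trans (ℚₚ.+-assoc q (½ * ε) (½ * ε)) (cong (λ t → q + t) (½ε+½ε≡ε ε)) ⟩
      q + ε  ∎
      where
      open ℚₚ.≤-Reasoning
      open ℚ-Solver
      lem₁ : ∀ a b → b ≡ a + - (a - b)
      lem₁ = solve 2 (λ a b → b := a :+ (:- (a :- b))) refl

    ∣∣∞-cong : ∀ {x y q} → x ≈K y → ∣ x ∣∞≤ q → ∣ y ∣∞≤ q
    ∣∣∞-cong {x} {y} {q} x≈y (bounded h) = bounded (∣∣-resp-≈ℝ (σ∞ x) (σ∞ y) q (σ∞H.⟦⟧-cong x≈y) h)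

    ∣∣∞-ι : ∀ {r q} → ∣ r ∣ ≤ q → ∣ ι r ∣∞≤ q
    ∣∣∞-ι {r} {q} h = bounded (∣∣-resp-≈ℝ (fromℚ r) (σ∞ (ι r)) q (≈-sym (σ∞ (ι r)) (fromℚ r) (f-ℚ r))
      λ ε 0<ε → 0 , λ _ _ → ℚₚ.≤-<-trans h (p+ε>p 0<ε))

    ∣∣∞-ι⁻¹ : ∀ {r q} → ∣ ι r ∣∞≤ q → ∣ r ∣ ≤ q
    ∣∣∞-ι⁻¹ {r} {q} (bounded h) = ℚₚ.≮⇒≥ λ q<∣r∣ →
      let ε = ∣ r ∣ - q
          N , k = ∣∣-resp-≈ℝ (σ∞ (ι r)) (fromℚ r) q (f-ℚ r) h ε
            (lin< {0ℚ} {ε} {q} {∣ r ∣} (lem₁ ∣ r ∣ q) q<∣r∣)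
      in ℚₚ.<-irrefl (lem₂ ∣ r ∣ q) (k N ℕₚ.≤-refl)
      where
      open ℚ-Solver
      lem₁ : ∀ r q → (r - q) - 0ℚ ≡ r - q
      lem₁ = solve 2 (λ r q → (r :- q) :- con 0ℚ := r :- q) refl
      lem₂ : ∀ r q → r ≡ q + (r - q)
      lem₂ = solve 2 (λ r q → r := q :+ (r :- q)) refl

    ∣∣∞-1 : ∣ 1K ∣∞≤ 1ℚ
    ∣∣∞-1 = ∣∣∞-cong 1K≈ (∣∣∞-ι {1ℚ} ℚₚ.≤-refl)

    ∣∣∞-1⁻¹ : ∀ {q} → ∣ 1K ∣∞≤ q → 1ℚ ≤ q
    ∣∣∞-1⁻¹ h = ∣∣∞-ι⁻¹ (∣∣∞-cong (R.sym 1K≈) h)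

    ∣∣∞-+ : ∀ {x y q r} → ∣ x ∣∞≤ q → ∣ y ∣∞≤ r → ∣ x +K y ∣∞≤ q + r
    ∣∣∞-+ {x} {y} {q} {r} (bounded hx) (bounded hy) = bounded (∣∣-resp-≈ℝ (σ∞ x +ℝ σ∞ y) (σ∞ (x +K y)) (q + r)
      (≈-sym (σ∞ (x +K y)) (σ∞ x +ℝ σ∞ y) (σ∞H.+-homo x y))
      λ ε 0<ε → ev-map₂ (hx (½ * ε) (0<½ε 0<ε)) (hy (½ * ε) (0<½ε 0<ε)) λ n k l →
        ℚₚ.≤-<-trans (ℚₚ.∣p+q∣≤∣p∣+∣q∣ (seq (σ∞ x) n) (seq (σ∞ y) n))
          (subst (_ <_) (trans (lem q r (½ * ε)) (cong (λ t → q + r + t) (½ε+½ε≡ε ε))) (ℚₚ.+-mono-< k l)))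
      where
      open ℚ-Solver
      lem : ∀ q r ε → (q + ε) + (r + ε) ≡ q + r + (ε + ε)
      lem = solve 3 (λ q r ε → (q :+ ε) :+ (r :+ ε) := q :+ r :+ (ε :+ ε)) refl

    ∣∣∞-neg : ∀ {x q} → ∣ x ∣∞≤ q → ∣ -K x ∣∞≤ q
    ∣∣∞-neg {x} {q} (bounded h) = bounded (∣∣-resp-≈ℝ (-ℝ σ∞ x) (σ∞ (-K x)) q (≈-sym (σ∞ (-K x)) (-ℝ σ∞ x) (σ∞H.-‿homo x))
      λ ε 0<ε → ev-map (h ε 0<ε) λ n → subst (_< q + ε) (sym (ℚₚ.∣-p∣≡∣p∣ (seq (σ∞ x) n))))

    ∣∣∞-* : ∀ {x y q r} → ∣ x ∣∞≤ q → ∣ y ∣∞≤ r → ∣ x *K y ∣∞≤ q * r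
    ∣∣∞-* {x} {y} {q} {r} (bounded hx) (bounded hy) = bounded (∣∣-resp-≈ℝ (σ∞ x *ℝ σ∞ y) (σ∞ (x *K y)) (q * r)
      (≈-sym (σ∞ (x *K y)) (σ∞ x *ℝ σ∞ y) (σ∞H.*-homo x y)) product)
      where
      open ℚₚ.≤-Reasoning
      open ℚ-Solver
      0≤q = ∣∣∞-nonNeg {x} {q} (bounded hx)
      0≤r = ∣∣∞-nonNeg {y} {r} (bounded hy)
      lem : ∀ q r δ → (q + δ) * (r + δ) ≡ q * r + (q + r + δ) * δ
      lem = solve 3 (λ q r δ → (q :+ δ) :* (r :+ δ) := q :* r :+ (q :+ r :+ δ) :* δ) refl
      product : ∣ σ∞ x *ℝ σ∞ y ∣ℝ ≤ℝ fromℚ (q * r)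
      product ε 0<ε =
        let N , small = archimedean (0≤+ (0≤+ 0≤q 0≤r) 0≤1) (0<½ε 0<ε)
            δ = 1/⟦suc N ⟧
            0<δ = 0<1/⟦suc N ⟧
        in ev-map₂ (hx δ 0<δ) (hy δ 0<δ) λ n k l → begin-strict
          ∣ seq (σ∞ x) n * seq (σ∞ y) n ∣  ≡⟨ ℚₚ.∣p*q∣≡∣p∣*∣q∣ (seq (σ∞ x) n) (seq (σ∞ y) n) ⟩
          ∣ seq (σ∞ x) n ∣ * ∣ seq (σ∞ y) n ∣  ≤⟨ *-mono (ℚₚ.0≤∣p∣ (seq (σ∞ x) n)) (ℚₚ.<⇒≤ k) (ℚₚ.0≤∣p∣ (seq (σ∞ y) n)) (ℚₚ.<⇒≤ l) ⟩
          (q + δ) * (r + δ)  ≡⟨ lem q r δ ⟩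
          q * r + (q + r + δ) * δ  ≤⟨ ℚₚ.+-monoʳ-≤ (q * r) (*-monoʳ (ℚₚ.<⇒≤ 0<δ) (ℚₚ.+-monoʳ-≤ (q + r) 1/⟦suc N ⟧≤1)) ⟩
          q * r + (q + r + 1ℚ) * δ  ≤⟨ ℚₚ.+-monoʳ-≤ (q * r) (small N ℕₚ.≤-refl) ⟩
          q * r + ½ * ε  <⟨ ℚₚ.+-monoʳ-< (q * r) (½ε<ε 0<ε) ⟩
          q * r + ε  ∎

    ∣∣∞-^ : ∀ {x q} n → ∣ x ∣∞≤ q → ∣ x ^K n ∣∞≤ q ^ n
    ∣∣∞-^ zero    h = ∣∣∞-1
    ∣∣∞-^ {x} (suc n) h = ∣∣∞-* h (∣∣∞-^ n h)

    ∣∣∞-bound : ∀ x → ∃ λ q → ∣ x ∣∞≤ q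
    ∣∣∞-bound x =
      let N , B , _ , h = eventually-bounded (σ∞ x) in
      B , bounded λ ε 0<ε → N , λ n N≤n → ℚₚ.≤-<-trans (h n N≤n) (p+ε>p 0<ε)

    -- The real counterpart of `^-cancel-≤`: a term of size at least q + ε would have its power
    -- above that of q by at least the fixed gap `δ`.
    ∣∣∞-root : ∀ {x q} n → 0ℚ ≤ q → ∣ x ^K suc n ∣∞≤ q ^ suc n → ∣ x ∣∞≤ q
    ∣∣∞-root {x} {q} n 0≤q (bounded h) = bounded λ ε 0<ε → let open Gap ε 0<ε in
      ev-map (∣∣-resp-≈ℝ (σ∞ (x ^K suc n)) (σ∞ x ℝ^.^ suc n) (q ^ suc n) (σ∞-^ (suc n)) h δ 0<δ) λ m k →
        ℚₚ.≰⇒> λ q+ε≤ → ℚₚ.<-irrefl refl (begin-strict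
          (q + ε) ^ suc n  ≤⟨ ^-monoˡ (suc n) (ℚₚ.<⇒≤ 0<q+ε) q+ε≤ ⟩
          ∣ seq (σ∞ x) m ∣ ^ suc n  ≡⟨ sym (∣^∣ (seq (σ∞ x) m) (suc n)) ⟩
          ∣ seq (σ∞ x) m ^ suc n ∣  ≡⟨ cong ∣_∣ (sym (seq-^ (σ∞ x) (suc n) m)) ⟩
          ∣ seq (σ∞ x ℝ^.^ suc n) m ∣  <⟨ k ⟩
          q ^ suc n + δ  ≡⟨ lem₂ ((q + ε) ^ suc n) (q ^ suc n) ⟩
          (q + ε) ^ suc n  ∎)
      where
      open ℚₚ.≤-Reasoning
      open ℚ-Solver
      module Gap (ε : ℚ) (0<ε : 0ℚ < ε) where
        δ = (q + ε) ^ suc n - q ^ suc n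
        lem₁ : ∀ a b → (a - b) - 0ℚ ≡ a - b
        lem₁ = solve 2 (λ a b → (a :- b) :- con 0ℚ := a :- b) refl
        lem₂ : ∀ a b → b + (a - b) ≡ a
        lem₂ = solve 2 (λ a b → b :+ (a :- b) := a) refl
        0<δ : 0ℚ < δ
        0<δ = lin< {0ℚ} {δ} {q ^ suc n} {(q + ε) ^ suc n} (lem₁ ((q + ε) ^ suc n) (q ^ suc n)) (^-mono-< n 0≤q (p+ε>p 0<ε))
        0<q+ε : 0ℚ < q + ε
        0<q+ε = ℚₚ.≤-<-trans 0≤q (p+ε>p 0<ε)
      ∣^∣ : ∀ a n → ∣ a ^ n ∣ ≡ ∣ a ∣ ^ n
      ∣^∣ a zero    = refl
      ∣^∣ a (suc n) = trans (ℚₚ.∣p*q∣≡∣p∣*∣q∣ a (a ^ n)) (cong (∣ a ∣ *_) (∣^∣ a n))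
      σ∞-^ : ∀ n → σ∞ (x ^K n) ≈ℝ σ∞ x ℝ^.^ n
      σ∞-^ zero    = σ∞H.1#-homo
      σ∞-^ (suc n) = ≈-trans (σ∞ (x *K x ^K n)) (σ∞ x *ℝ σ∞ (x ^K n)) (σ∞ x *ℝ σ∞ x ℝ^.^ n)
        (σ∞H.*-homo x (x ^K n)) (*-congˡ (σ∞ x) (σ∞ (x ^K n)) (σ∞ x ℝ^.^ n) (σ∞-^ n))

    ∣∣∞-neg⁻¹ : ∀ {x q} → ∣ -K x ∣∞≤ q → ∣ x ∣∞≤ q
    ∣∣∞-neg⁻¹ {x} h = ∣∣∞-cong (solve 1 (λ x → :- (:- x) := x) R.refl x) (∣∣∞-neg h)
      where open K-Solver

    ∣∣∞-reciprocal : ∀ {x x′ q} → 0ℚ ≤ q → x *K x′ ≈K 1K → fromℚ q <ℝ σ∞ x → ∃ λ t → ∣ x′ ∣∞≤ t × q * t < 1ℚ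
    ∣∣∞-reciprocal {x} {x′} {q} 0≤q xx′≈1 (η , 0<η , q+η<x) = t , ∣x′∣≤t , qt<1
      where
      open ℚₚ.≤-Reasoning
      open ℚ-Solver
      -- The strict inequality supplies the margin η, and t = 1/(q + η) then gives q t < 1 strictly.
      d = q + η
      0<d = ℚₚ.≤-<-trans 0≤q (p+ε>p 0<η)
      t = inv d 0<d * 1ℚ
      dt≡1 : d * t ≡ 1ℚ
      dt≡1 = *-inv d 0<d 1ℚ
      0<t : 0ℚ < t
      0<t = 0<* (0<inv d 0<d) 0<1
      qt<1 : q * t < 1ℚ
      qt<1 = subst (q * t <_) dt≡1 (ℚₚ.*-monoˡ-<-pos t {{positive 0<t}} (p+ε>p {q} 0<η))
      product≈1 : (σ∞ x *ℝ σ∞ x′) ≈ℝ 1ℝ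
      product≈1 = ≈-trans (σ∞ x *ℝ σ∞ x′) (σ∞ (x *K x′)) 1ℝ
        (≈-sym (σ∞ (x *K x′)) (σ∞ x *ℝ σ∞ x′) (σ∞H.*-homo x x′))
        (≈-trans (σ∞ (x *K x′)) (σ∞ 1K) 1ℝ (σ∞H.⟦⟧-cong xx′≈1) σ∞H.1#-homo)
      split : ∀ a → a ≡ (a - 1ℚ) + 1ℚ
      split = solve 1 (λ a → a := (a :- con 1ℚ) :+ con 1ℚ) refl
      expand : ∀ d t ε → ε * d + d * t ≡ d * (t + ε)
      expand = solve 3 (λ d t ε → ε :* d :+ d :* t := d :* (t :+ ε)) refl
      ∣x′∣≤t : ∣ x′ ∣∞≤ t
      ∣x′∣≤t = bounded λ ε 0<ε → ev-map₂ q+η<x (product≈1 (ε * d) (0<* 0<ε 0<d)) λ n k l →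
        ℚₚ.*-cancelˡ-<-nonNeg d {{nonNegative (ℚₚ.<⇒≤ 0<d)}} (begin-strict
          d * ∣ seq (σ∞ x′) n ∣  ≤⟨ *-monoʳ (ℚₚ.0≤∣p∣ _) (ℚₚ.≤-trans (ℚₚ.<⇒≤ k) (p≤∣p∣ _)) ⟩
          ∣ seq (σ∞ x) n ∣ * ∣ seq (σ∞ x′) n ∣  ≡⟨ sym (ℚₚ.∣p*q∣≡∣p∣*∣q∣ (seq (σ∞ x) n) (seq (σ∞ x′) n)) ⟩
          ∣ seq (σ∞ x) n * seq (σ∞ x′) n ∣  ≡⟨ cong ∣_∣ (split (seq (σ∞ x) n * seq (σ∞ x′) n)) ⟩
          ∣ (seq (σ∞ x) n * seq (σ∞ x′) n - 1ℚ) + 1ℚ ∣ ≤⟨ ℚₚ.∣p+q∣≤∣p∣+∣q∣ (seq (σ∞ x) n * seq (σ∞ x′) n - 1ℚ) 1ℚ ⟩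
          ∣ seq (σ∞ x) n * seq (σ∞ x′) n - 1ℚ ∣ + 1ℚ  <⟨ ℚₚ.+-monoˡ-< 1ℚ l ⟩
          ε * d + 1ℚ  ≡⟨ cong (λ s → ε * d + s) (sym dt≡1) ⟩
          ε * d + d * t  ≡⟨ expand d t ε ⟩
          d * (t + ε)  ∎)

    ≤⇒∣∣∞ : ∀ {x q} → σ∞ x ≤ℝ fromℚ q → σ∞ (-K x) ≤ℝ fromℚ q → ∣ x ∣∞≤ q
    ≤⇒∣∣∞ {x} {q} x≤q -x≤q = bounded λ ε 0<ε →
      ev-map₂ (x≤q ε 0<ε) (ev-map₂ (-x≤q (½ * ε) (0<½ε 0<ε)) (σ∞H.-‿homo x (½ * ε) (0<½ε 0<ε)) λ n k l →
        subst₂ _<_ (lem (seq (σ∞ (-K x)) n) (seq (σ∞ x) n))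
          (trans (ℚₚ.+-assoc q (½ * ε) (½ * ε)) (cong (λ t → q + t) (½ε+½ε≡ε ε)))
          (ℚₚ.+-mono-< k (ℚₚ.≤-<-trans (-p≤∣p∣ (seq (σ∞ (-K x)) n - - seq (σ∞ x) n)) l)))
        λ n k l → ∣p∣<q k l
      where
      open ℚ-Solver
      lem : ∀ a b → a + - (a - - b) ≡ - b
      lem = solve 2 (λ a b → a :+ (:- (a :- (:- b))) := :- b) refl

    -- The alternative to ∣x∣ ≤ q is ∣x∣ > q, expressed through the inverse. It is decidable because
    -- elements of K can be compared with rationals; the construction of γ and the lower bound on
    -- `w` both branch on it.
    ∣∣∞-dichotomy : ∀ {x x′ q} → 0ℚ ≤ q → x *K x′ ≈K 1K → ∣ x ∣∞≤ q ⊎ ∃ λ t → ∣ x′ ∣∞≤ t × q * t < 1ℚ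
    ∣∣∞-dichotomy {x} {x′} {q} 0≤q xx′≈1 with compare x q | compare (-K x) q
    ... | inj₁ q<x  | _         = inj₂ (∣∣∞-reciprocal {x} 0≤q xx′≈1 q<x)
    ... | inj₂ _    | inj₁ q<-x =
      let t , ∣-x′∣≤t , qt<1 = ∣∣∞-reciprocal { -K x} { -K x′} 0≤q (R.trans (lem x x′) xx′≈1) q<-x
      in inj₂ (t , ∣∣∞-neg⁻¹ ∣-x′∣≤t , qt<1)
      where
      open K-Solver
      lem : ∀ x x′ → (-K x) *K (-K x′) ≈K x *K x′
      lem = solve 2 (λ x x′ → (:- x) :* (:- x′) := x :* x′) R.refl
    ... | inj₂ x≤q  | inj₂ -x≤q = inj₁ (≤⇒∣∣∞ x≤q -x≤q)

  -- Divisibility by powers of 2 and valuations in ℚ₂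

  pow₂ : ℕ → ℤ
  pow₂ k = + (2 ℕ.^ k)

  pow₂-+ : ∀ k l → pow₂ (k ℕ.+ l) ≡ pow₂ k ℤ.* pow₂ l
  pow₂-+ k l = trans (cong +_ (ℕₚ.^-distribˡ-+-* 2 k l)) (ℤₚ.pos-* (2 ℕ.^ k) (2 ℕ.^ l))

  pow₂≢0 : ∀ k → ℤ.NonZero (pow₂ k)
  pow₂≢0 k = ℕₚ.m^n≢0 2 k

  Odd : ℤ → Set
  Odd d = ∃ λ t → d ≡ ℤ.1ℤ ℤ.+ + 2 ℤ.* t

  ∣-sym-diff : ∀ {d a b} → d ℤ∣.∣ a ℤ.- b → d ℤ∣.∣ b ℤ.- a
  ∣-sym-diff {d} {a} {b} h = subst (d ℤ∣.∣_) (lem a b) (ℤ∣.∣m⇒∣-m h)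
    where
    open ℤ-Solver
    lem : ∀ a b → ℤ.- (a ℤ.- b) ≡ b ℤ.- a
    lem = solve 2 (λ a b → :- (a :- b) := b :- a) refl

  ∣-trans-diff : ∀ {d a b c} → d ℤ∣.∣ a ℤ.- b → d ℤ∣.∣ b ℤ.- c → d ℤ∣.∣ a ℤ.- c
  ∣-trans-diff {d} {a} {b} {c} h k = subst (d ℤ∣.∣_) (lem a b c) (ℤ∣.∣m∣n⇒∣m+n h k)
    where
    open ℤ-Solver
    lem : ∀ a b c → (a ℤ.- b) ℤ.+ (b ℤ.- c) ≡ a ℤ.- c
    lem = solve 3 (λ a b c → (a :- b) :+ (b :- c) := a :- c) refl

  pow₂-∣-* : ∀ {a b x y} → pow₂ a ℤ∣.∣ x → pow₂ b ℤ∣.∣ y → pow₂ (a ℕ.+ b) ℤ∣.∣ x ℤ.* y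
  pow₂-∣-* {a} {b} {x} {y} h k = subst (ℤ∣._∣ x ℤ.* y) (sym (pow₂-+ a b))
    (ℤ∣.∣-trans (ℤ∣.*-monoˡ-∣ (pow₂ b) h) (ℤ∣.*-monoʳ-∣ x k))

  pow₂-∣-cancel : ∀ {a b x} → pow₂ (a ℕ.+ b) ℤ∣.∣ pow₂ a ℤ.* x → pow₂ b ℤ∣.∣ x
  pow₂-∣-cancel {a} {b} {x} h = ℤ∣.*-cancelˡ-∣ (pow₂ a) {{pow₂≢0 a}} (subst (ℤ∣._∣ pow₂ a ℤ.* x) (pow₂-+ a b) h)

  ∣-pow₂-* : ∀ a {b x} → pow₂ b ℤ∣.∣ x → pow₂ (a ℕ.+ b) ℤ∣.∣ pow₂ a ℤ.* x
  ∣-pow₂-* a {b} {x} h = pow₂-∣-* {a} {b} ℤ∣.∣-refl h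

  -- With d = 1 + 2t, z = z d - 2 t z. If 2^k divides z, then 2^(k+1) divides 2 t z, so one more
  -- factor 2 passes from z d to z.
  odd-cancel : ∀ k {z d} → Odd d → pow₂ k ℤ∣.∣ z ℤ.* d → pow₂ k ℤ∣.∣ z
  odd-cancel zero    {z} odd h = ℤ∣.divides z (sym (ℤₚ.*-identityʳ z))
  odd-cancel (suc k) {z} {d} odd@(t , refl) h@(ℤ∣.divides w eq)
    with ℤ∣.divides y refl ← odd-cancel k {z} {d} odd (ℤ∣.∣-trans (2^-mono-∣ (ℕₚ.n≤1+n k)) h)
    = ℤ∣.divides (w ℤ.- t ℤ.* y) (begin
      y ℤ.* pow₂ k  ≡⟨ lem₁ y t (pow₂ k) ⟩
      y ℤ.* (ℤ.1ℤ ℤ.+ + 2 ℤ.* t) ℤ.* pow₂ k ℤ.- t ℤ.* y ℤ.* (+ 2 ℤ.* pow₂ k)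
        ≡⟨ cong (ℤ._- t ℤ.* y ℤ.* (+ 2 ℤ.* pow₂ k)) (trans (lem₂ y d (pow₂ k)) (trans eq (cong (w ℤ.*_) (pow₂-+ 1 k)))) ⟩
      w ℤ.* (+ 2 ℤ.* pow₂ k) ℤ.- t ℤ.* y ℤ.* (+ 2 ℤ.* pow₂ k)  ≡⟨ lem₃ w (t ℤ.* y) (+ 2 ℤ.* pow₂ k) ⟩
      (w ℤ.- t ℤ.* y) ℤ.* (+ 2 ℤ.* pow₂ k)  ≡⟨ cong ((w ℤ.- t ℤ.* y) ℤ.*_) (sym (pow₂-+ 1 k)) ⟩
      (w ℤ.- t ℤ.* y) ℤ.* pow₂ (suc k)  ∎)
    where
    open ≡-Reasoning
    open ℤ-Solver
    lem₁ : ∀ y t p → y ℤ.* p ≡ y ℤ.* (ℤ.1ℤ ℤ.+ + 2 ℤ.* t) ℤ.* p ℤ.- t ℤ.* y ℤ.* (+ 2 ℤ.* p)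
    lem₁ = solve 3 (λ y t p → y :* p := y :* (con ℤ.1ℤ :+ con (+ 2) :* t) :* p :- t :* y :* (con (+ 2) :* p)) refl
    lem₂ : ∀ y d p → y ℤ.* d ℤ.* p ≡ y ℤ.* p ℤ.* d
    lem₂ = solve 3 (λ y d p → y :* d :* p := y :* p :* d) refl
    lem₃ : ∀ w t p → w ℤ.* p ℤ.- t ℤ.* p ≡ (w ℤ.- t) ℤ.* p
    lem₃ = solve 3 (λ w t p → w :* p :- t :* p := (w :- t) :* p) refl

  odd⇒2∤ : ∀ {d} → Odd d → ¬ + 2 ℤ∣.∣ d
  odd⇒2∤ {d} odd h = contradiction (ℕ∣.∣1⇒≡1 (ℤ∣.∣⇒∣ᵤ (odd-cancel 1 {ℤ.1ℤ} {d} odd (subst (+ 2 ℤ∣.∣_) (sym (ℤₚ.*-identityˡ d)) h)))) λ ()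

  -- `_≤v₂_` inspects the residue at e + k only; by coherence any later one serves as well, which
  -- allows numbers with different denominators to be compared at a common depth.
  ≤v₂-res : ∀ {e} x k n → e ℕ.+ k ℕ.≤ n → e ≤v₂ (x /2^ k) → pow₂ (e ℕ.+ k) ℤ∣.∣ res x n
  ≤v₂-res {e} x k n h = transfer (coherent″ x (e ℕ.+ k) (e ℕ.+ k) n ℕₚ.≤-refl h)

  res-≤v₂ : ∀ {e} x k n → e ℕ.+ k ℕ.≤ n → pow₂ (e ℕ.+ k) ℤ∣.∣ res x n → e ≤v₂ (x /2^ k)
  res-≤v₂ {e} x k n h = transfer (coherent″ x (e ℕ.+ k) n (e ℕ.+ k) h ℕₚ.≤-refl)

  ≈₂-sym : ∀ u w → u ≈ℚ₂ w → w ≈ℚ₂ u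
  ≈₂-sym (x /2^ k) (y /2^ l) h n = ∣-sym-diff {a = pow₂ l ℤ.* res x n} (h n)

  ≈₂-trans : ∀ u v w → u ≈ℚ₂ v → v ≈ℚ₂ w → u ≈ℚ₂ w
  ≈₂-trans (x /2^ k) (y /2^ l) (z /2^ m) h h′ n =
    -- Cancelling the middle denominator 2^l costs l digits, so the hypotheses are used at depth l +
    -- n and coherence carries the result back to depth n.
    transfer-diff (coherent″ x n (l ℕ.+ n) n (ℕₚ.m≤n+m n l) ℕₚ.≤-refl) (coherent″ z n (l ℕ.+ n) n (ℕₚ.m≤n+m n l) ℕₚ.≤-refl)
      (pow₂-∣-cancel {l} {n} (subst (pow₂ (l ℕ.+ n) ℤ∣.∣_)
        (lem (pow₂ k) (pow₂ l) (pow₂ m) (res x (l ℕ.+ n)) (res y (l ℕ.+ n)) (res z (l ℕ.+ n)))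
        (ℤ∣.∣m∣n⇒∣m+n (ℤ∣.∣n⇒∣m*n (pow₂ m) (h (l ℕ.+ n))) (ℤ∣.∣n⇒∣m*n (pow₂ k) (h′ (l ℕ.+ n))))))
    where
    open ℤ-Solver
    lem : ∀ k l m x y z → m ℤ.* (l ℤ.* x ℤ.- k ℤ.* y) ℤ.+ k ℤ.* (m ℤ.* y ℤ.- l ℤ.* z) ≡ l ℤ.* (m ℤ.* x ℤ.- k ℤ.* z)
    lem = solve 6 (λ k l m x y z → m :* (l :* x :- k :* y) :+ k :* (m :* y :- l :* z) := l :* (m :* x :- k :* z)) refl
    lem′ : ∀ m k x x′ z z′ → m ℤ.* x′ ℤ.- k ℤ.* z′ ≡ (m ℤ.* x ℤ.- k ℤ.* z) ℤ.+ (k ℤ.* (z ℤ.- z′) ℤ.- m ℤ.* (x ℤ.- x′))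
    lem′ = solve 6 (λ m k x x′ z z′ → m :* x′ :- k :* z′ := (m :* x :- k :* z) :+ (k :* (z :- z′) :- m :* (x :- x′))) refl
    transfer-diff : ∀ {x x′ z z′} → pow₂ n ℤ∣.∣ x ℤ.- x′ → pow₂ n ℤ∣.∣ z ℤ.- z′ →
                    pow₂ n ℤ∣.∣ pow₂ m ℤ.* x ℤ.- pow₂ k ℤ.* z → pow₂ n ℤ∣.∣ pow₂ m ℤ.* x′ ℤ.- pow₂ k ℤ.* z′
    transfer-diff {x} {x′} {z} {z′} hx hz h = subst (pow₂ n ℤ∣.∣_) (sym (lem′ (pow₂ m) (pow₂ k) x x′ z z′))
      (ℤ∣.∣m∣n⇒∣m+n h (ℤ∣.∣m∣n⇒∣m-n (ℤ∣.∣n⇒∣m*n (pow₂ k) hz) (ℤ∣.∣n⇒∣m*n (pow₂ m) hx)))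

  +₂-cong : ∀ u u′ w w′ → u ≈ℚ₂ u′ → w ≈ℚ₂ w′ → (u +ℚ₂ w) ≈ℚ₂ (u′ +ℚ₂ w′)
  +₂-cong (x /2^ k) (x′ /2^ k′) (y /2^ l) (y′ /2^ l′) h h′ n = subst (pow₂ n ℤ∣.∣_)
    (trans (lem (pow₂ k) (pow₂ k′) (pow₂ l) (pow₂ l′) (res x n) (res x′ n) (res y n) (res y′ n))
      (sym (cong₂ (λ s t → s ℤ.* (pow₂ l ℤ.* res x n ℤ.+ pow₂ k ℤ.* res y n) ℤ.- t ℤ.* (pow₂ l′ ℤ.* res x′ n ℤ.+ pow₂ k′ ℤ.* res y′ n))
        (pow₂-+ k′ l′) (pow₂-+ k l))))
    (ℤ∣.∣m∣n⇒∣m+n (ℤ∣.∣n⇒∣m*n (pow₂ l ℤ.* pow₂ l′) (h n)) (ℤ∣.∣n⇒∣m*n (pow₂ k ℤ.* pow₂ k′) (h′ n)))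
    where
    open ℤ-Solver
    lem : ∀ k k′ l l′ x x′ y y′ →
      l ℤ.* l′ ℤ.* (k′ ℤ.* x ℤ.- k ℤ.* x′) ℤ.+ k ℤ.* k′ ℤ.* (l′ ℤ.* y ℤ.- l ℤ.* y′) ≡
      k′ ℤ.* l′ ℤ.* (l ℤ.* x ℤ.+ k ℤ.* y) ℤ.- k ℤ.* l ℤ.* (l′ ℤ.* x′ ℤ.+ k′ ℤ.* y′)
    lem = solve 8 (λ k k′ l l′ x x′ y y′ →
      l :* l′ :* (k′ :* x :- k :* x′) :+ k :* k′ :* (l′ :* y :- l :* y′) :=
      k′ :* l′ :* (l :* x :+ k :* y) :- k :* l :* (l′ :* x′ :+ k′ :* y′)) refl

  *₂-cong : ∀ u u′ w w′ → u ≈ℚ₂ u′ → w ≈ℚ₂ w′ → (u *ℚ₂ w) ≈ℚ₂ (u′ *ℚ₂ w′)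
  *₂-cong (x /2^ k) (x′ /2^ k′) (y /2^ l) (y′ /2^ l′) h h′ n = subst (pow₂ n ℤ∣.∣_)
    (trans (lem (pow₂ k) (pow₂ k′) (pow₂ l) (pow₂ l′) (res x n) (res x′ n) (res y n) (res y′ n))
      (sym (cong₂ (λ s t → s ℤ.* (res x n ℤ.* res y n) ℤ.- t ℤ.* (res x′ n ℤ.* res y′ n)) (pow₂-+ k′ l′) (pow₂-+ k l))))
    (ℤ∣.∣m∣n⇒∣m+n (ℤ∣.∣n⇒∣m*n (pow₂ l′ ℤ.* res y n) (h n)) (ℤ∣.∣n⇒∣m*n (pow₂ k ℤ.* res x′ n) (h′ n)))
    where
    open ℤ-Solver
    lem : ∀ k k′ l l′ x x′ y y′ →
      l′ ℤ.* y ℤ.* (k′ ℤ.* x ℤ.- k ℤ.* x′) ℤ.+ k ℤ.* x′ ℤ.* (l′ ℤ.* y ℤ.- l ℤ.* y′) ≡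
      k′ ℤ.* l′ ℤ.* (x ℤ.* y) ℤ.- k ℤ.* l ℤ.* (x′ ℤ.* y′)
    lem = solve 8 (λ k k′ l l′ x x′ y y′ →
      l′ :* y :* (k′ :* x :- k :* x′) :+ k :* x′ :* (l′ :* y :- l :* y′) :=
      k′ :* l′ :* (x :* y) :- k :* l :* (x′ :* y′)) refl

  -₂-cong : ∀ u w → u ≈ℚ₂ w → (-ℚ₂ u) ≈ℚ₂ (-ℚ₂ w)
  -₂-cong (x /2^ k) (y /2^ l) h n = subst (pow₂ n ℤ∣.∣_) (lem (pow₂ k) (pow₂ l) (res x n) (res y n)) (ℤ∣.∣m⇒∣-m (h n))
    where
    open ℤ-Solver
    lem : ∀ k l x y → ℤ.- (l ℤ.* x ℤ.- k ℤ.* y) ≡ l ℤ.* (ℤ.- x) ℤ.- k ℤ.* (ℤ.- y)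
    lem = solve 4 (λ k l x y → :- (l :* x :- k :* y) := l :* (:- x) :- k :* (:- y)) refl

  ≈₂-refl : ∀ u → u ≈ℚ₂ u
  ≈₂-refl (x /2^ k) n = ℤ∣.divides ℤ.0ℤ (ℤₚ.+-inverseʳ (pow₂ k ℤ.* res x n))

  ≤v₂-resp-≈ : ∀ {e} u w → u ≈ℚ₂ w → e ≤v₂ u → e ≤v₂ w
  ≤v₂-resp-≈ {e} (x /2^ k) (y /2^ l) u≈w h =
    res-≤v₂ y l N (ℕₚ.m≤n+m (e ℕ.+ l) k)
      (pow₂-∣-cancel {k} (transfer (u≈w N)
        (subst (λ t → pow₂ t ℤ∣.∣ pow₂ l ℤ.* res x N) (lem l e k)
          (∣-pow₂-* l (≤v₂-res x k N (subst (e ℕ.+ k ℕ.≤_) (lem l e k) (ℕₚ.m≤n+m (e ℕ.+ k) l)) h)))))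
    where
    N = k ℕ.+ (e ℕ.+ l)
    open ℕ-Solver
    lem : ∀ l e k → l ℕ.+ (e ℕ.+ k) ≡ k ℕ.+ (e ℕ.+ l)
    lem = solve 3 (λ l e k → l :+ (e :+ k) := k :+ (e :+ l)) refl

  ≤v₂-+ : ∀ {e} u w → e ≤v₂ u → e ≤v₂ w → e ≤v₂ (u +ℚ₂ w)
  ≤v₂-+ {e} (x /2^ k) (y /2^ l) hx hy = ℤ∣.∣m∣n⇒∣m+n
    (subst (λ t → pow₂ t ℤ∣.∣ pow₂ l ℤ.* res x N) (lem₁ l e k)
      (∣-pow₂-* l (≤v₂-res x k N (subst (e ℕ.+ k ℕ.≤_) (lem₁ l e k) (ℕₚ.m≤n+m (e ℕ.+ k) l)) hx)))
    (subst (λ t → pow₂ t ℤ∣.∣ pow₂ k ℤ.* res y N) (lem₂ l e k)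
      (∣-pow₂-* k (≤v₂-res y l N (subst (e ℕ.+ l ℕ.≤_) (lem₂ l e k) (ℕₚ.m≤n+m (e ℕ.+ l) k)) hy)))
    where
    N = e ℕ.+ (k ℕ.+ l)
    open ℕ-Solver
    lem₁ : ∀ l e k → l ℕ.+ (e ℕ.+ k) ≡ e ℕ.+ (k ℕ.+ l)
    lem₁ = solve 3 (λ l e k → l :+ (e :+ k) := e :+ (k :+ l)) refl
    lem₂ : ∀ l e k → k ℕ.+ (e ℕ.+ l) ≡ e ℕ.+ (k ℕ.+ l)
    lem₂ = solve 3 (λ l e k → k :+ (e :+ l) := e :+ (k :+ l)) refl

  ≤v₂-neg : ∀ {e} u → e ≤v₂ u → e ≤v₂ (-ℚ₂ u)
  ≤v₂-neg (x /2^ k) = ℤ∣.∣m⇒∣-m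

  ≤v₂-* : ∀ {e f} u w → e ≤v₂ u → f ≤v₂ w → e ℕ.+ f ≤v₂ (u *ℚ₂ w)
  ≤v₂-* {e} {f} (x /2^ k) (y /2^ l) hx hy = subst (λ t → pow₂ t ℤ∣.∣ res x N ℤ.* res y N) (lem e f k l)
    (pow₂-∣-* {e ℕ.+ k} {f ℕ.+ l}
      (≤v₂-res x k N (subst (e ℕ.+ k ℕ.≤_) (lem e f k l) (ℕₚ.m≤m+n (e ℕ.+ k) (f ℕ.+ l))) hx)
      (≤v₂-res y l N (subst (f ℕ.+ l ℕ.≤_) (lem e f k l) (ℕₚ.m≤n+m (f ℕ.+ l) (e ℕ.+ k))) hy))
    where
    N = (e ℕ.+ f) ℕ.+ (k ℕ.+ l)
    open ℕ-Solver
    lem : ∀ e f k l → (e ℕ.+ k) ℕ.+ (f ℕ.+ l) ≡ (e ℕ.+ f) ℕ.+ (k ℕ.+ l)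
    lem = solve 4 (λ e f k l → (e :+ k) :+ (f :+ l) := (e :+ f) :+ (k :+ l)) refl

  ≤v₂-weaken : ∀ {e f} u → e ℕ.≤ f → f ≤v₂ u → e ≤v₂ u
  ≤v₂-weaken {e} {f} (x /2^ k) e≤f h = res-≤v₂ x k (f ℕ.+ k) (ℕₚ.+-monoˡ-≤ k e≤f) (ℤ∣.∣-trans (2^-mono-∣ (ℕₚ.+-monoˡ-≤ k e≤f)) h)

  ≤v₂-odd : ∀ {e m} x k → Odd m → e ≤v₂ ((fromℤ m /2^ 0) *ℚ₂ (x /2^ k)) → e ≤v₂ (x /2^ k)
  ≤v₂-odd {e} {m} x k odd h = odd-cancel (e ℕ.+ k) odd (subst (pow₂ (e ℕ.+ k) ℤ∣.∣_) (ℤₚ.*-comm m (res x (e ℕ.+ k))) h)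

  -- The n-th term of `∣ u ∣₂` sees only min(v₂, n), so the bound is reached from n = e + k on.
  ∣∣₂≤ : ∀ {e} u → e ≤v₂ u → Eventually λ n → seq ∣ u ∣₂ n ≤ ½ ^ e
  ∣∣₂≤ {e} (x /2^ k) h = e ℕ.+ k , λ n N≤n → begin
    2^ (+ k) * ½ ^ v₂-upTo (res x n) n  ≤⟨ *-monoˡ (ℚₚ.<⇒≤ (0<2^ k)) (½^-anti-≤ (v₂-upTo-greatest (res x n) n (e ℕ.+ k) N≤n (≤v₂-res x k n N≤n h))) ⟩
    2^ (+ k) * ½ ^ (e ℕ.+ k)  ≡⟨ cong (2^ (+ k) *_) (trans (cong (½ ^_) (ℕₚ.+-comm e k)) (ℚ^ₚ.^-homo-* ½ k e)) ⟩
    2^ (+ k) * (½ ^ k * ½ ^ e)  ≡⟨ sym (ℚₚ.*-assoc (2^ (+ k)) (½ ^ k) (½ ^ e)) ⟩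
    2^ (+ k) * ½ ^ k * ½ ^ e  ≡⟨ cong (_* ½ ^ e) (2^*½^≡1 k) ⟩
    1ℚ * ½ ^ e  ≡⟨ ℚₚ.*-identityˡ (½ ^ e) ⟩
    ½ ^ e  ∎
    where open ℚₚ.≤-Reasoning

  -- Binary digits and the ring ℤ[1/2]

  ≡-mod⇒≡ : ∀ {m n} d → m ℕ.< d → n ℕ.< d → + d ℤ∣.∣ + m ℤ.- + n → m ≡ n
  ≡-mod⇒≡ {m} {n} d m<d n<d h with ℤ.∣ m ℤ.⊖ n ∣ in eq
  ... | zero  = ℤₚ.+-injective (trans (lem (+ m) (+ n)) (trans (cong (ℤ._+ + n) (trans (ℤₚ.[+m]-[+n]≡m⊖n m n) (ℤₚ.∣i∣≡0⇒i≡0 eq))) (ℤₚ.+-identityˡ (+ n))))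
    where
    open ℤ-Solver
    lem : ∀ m n → m ≡ (m ℤ.- n) ℤ.+ n
    lem = solve 2 (λ m n → m := (m :- n) :+ n) refl
  ... | suc j = contradiction (ℕₚ.≤-trans (ℕ∣.∣⇒≤ (subst (d ℕ∣.∣_) eq (ℤ∣.∣⇒∣ᵤ (subst (+ d ℤ∣.∣_) (ℤₚ.[+m]-[+n]≡m⊖n m n) h))))
          (subst (ℕ._≤ m ℕ.⊔ n) eq (ℤₚ.∣m⊝n∣≤m⊔n m n))) (ℕₚ.<⇒≱ (ℕₚ.⊔-pres-<m m<d n<d))

  -- Since d divides e, the remainder R of r modulo e reduces to S modulo d; the identity is
  -- division of R by d.
  %-extend : ∀ {S} d e r .{{_ : ℕ.NonZero d}} .{{_ : ℕ.NonZero e}} → S ℕ.< d → + d ℤ∣.∣ + e →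
             + d ℤ∣.∣ + S ℤ.- r → S ℕ.+ (r ℤ.%ℕ e) ℕ./ d ℕ.* d ≡ r ℤ.%ℕ e
  %-extend {S} d e r S<d d∣e S≡r = sym (trans R-split (cong (ℕ._+ R ℕ./ d ℕ.* d) (sym S≡R%)))
    where
    open ℤ-Solver
    lem : ∀ r p → (r ℤ.+ p) ℤ.- r ≡ p
    lem = solve 2 (λ r p → (r :+ p) :- r := p) refl
    R = r ℤ.%ℕ e
    r≡R : + e ℤ∣.∣ r ℤ.- + R
    r≡R = ℤ∣.divides (r ℤ%./ℕ e) (trans (cong (ℤ._- + R) (ℤ%.a≡a%ℕn+[a/ℕn]*n r e)) (lem (+ R) (r ℤ%./ℕ e ℤ.* + e)))
    R-split : R ≡ R ℕ.% d ℕ.+ R ℕ./ d ℕ.* d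
    R-split = ℕ%.m≡m%n+[m/n]*n R d
    R≡R% : + d ℤ∣.∣ + R ℤ.- + (R ℕ.% d)
    R≡R% = ℤ∣.divides (+ (R ℕ./ d))
      (trans (cong (λ t → + t ℤ.- + (R ℕ.% d)) R-split)
        (trans (cong (ℤ._- + (R ℕ.% d)) (ℤₚ.pos-+ (R ℕ.% d) (R ℕ./ d ℕ.* d)))
          (trans (lem (+ (R ℕ.% d)) (+ (R ℕ./ d ℕ.* d))) (ℤₚ.pos-* (R ℕ./ d) d))))
    S≡R% : S ≡ R ℕ.% d
    S≡R% = ≡-mod⇒≡ d S<d (ℕ%.m%n<n R d)
      (∣-trans-diff {a = + S} {r} {+ (R ℕ.% d)} S≡r
        (∣-trans-diff {a = r} {+ R} {+ (R ℕ.% d)} (ℤ∣.∣-trans d∣e r≡R) R≡R%))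

  -- Partial digit sums are the canonical residues. Successive digits are read off different
  -- residues of x, and coherence makes them fit together.
  digitSum-residue : ∀ x j → digitSum x j ℕ.< 2 ℕ.^ j × pow₂ j ℤ∣.∣ + digitSum x j ℤ.- res x j
  digitSum-residue x zero = ℕ.s≤s ℕ.z≤n , ℤ∣.divides (+ 0 ℤ.- res x 0) (sym (ℤₚ.*-identityʳ _))
  digitSum-residue x (suc j) = subst (ℕ._< e) (sym extend) (ℤ%.n%ℕd<d r e) ,
    subst (λ t → pow₂ (suc j) ℤ∣.∣ + t ℤ.- r) (sym extend)
      (∣-sym-diff {a = r} {+ (r ℤ.%ℕ e)} (ℤ∣.divides (r ℤ%./ℕ e)
        (trans (cong (ℤ._- + (r ℤ.%ℕ e)) (ℤ%.a≡a%ℕn+[a/ℕn]*n r e)) (lem (+ (r ℤ.%ℕ e)) (r ℤ%./ℕ e ℤ.* + e)))))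
    where
    instance
      d≢0 : ℕ.NonZero (2 ℕ.^ j)
      d≢0 = ℕₚ.m^n≢0 2 j
      e≢0 : ℕ.NonZero (2 ℕ.^ suc j)
      e≢0 = ℕₚ.m^n≢0 2 (suc j)
    e = 2 ℕ.^ suc j
    r = res x (suc j)
    open ℤ-Solver
    lem : ∀ r p → (r ℤ.+ p) ℤ.- r ≡ p
    lem = solve 2 (λ r p → (r :+ p) :- r := p) refl
    extend : digitSum x (suc j) ≡ r ℤ.%ℕ e
    extend = %-extend (2 ℕ.^ j) e r (proj₁ (digitSum-residue x j)) (2^-mono-∣ (ℕₚ.n≤1+n j))
      (∣-trans-diff {a = + digitSum x j} {res x j} {r} (proj₂ (digitSum-residue x j))
        (∣-sym-diff {a = r} {res x j} (coherent x j)))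

  2^≡ : ∀ k → 2^ (+ k) ≡ pow₂ k / 1
  2^≡ zero    = refl
  2^≡ (suc k) = trans (cong ((+ 2 / 1) *_) (2^≡ k)) (trans (sym (/1-* (+ 2) (pow₂ k))) (cong (_/ 1) (sym (pow₂-+ 1 k))))

  2^-cancel : ∀ k {x y} → x * 2^ (+ k) ≡ y * 2^ (+ k) → x ≡ y
  2^-cancel k {x} {y} h = begin
    x  ≡⟨ lem x ⟩
    x * 2^ (+ k) * ½ ^ k  ≡⟨ cong (_* ½ ^ k) h ⟩
    y * 2^ (+ k) * ½ ^ k  ≡⟨ sym (lem y) ⟩
    y  ∎
    where
    open ≡-Reasoning
    lem : ∀ x → x ≡ x * 2^ (+ k) * ½ ^ k
    lem x = sym (trans (ℚₚ.*-assoc x _ _) (trans (cong (x *_) (2^*½^≡1 k)) (ℚₚ.*-identityʳ x)))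

  -- Membership in ℤ[1/2]. The fraction is left unreduced, which keeps sums and products free of
  -- case distinctions.
  record Dyadic (r : ℚ) : Set where
    constructor mkDyadic
    field
      numerator   : ℤ
      exponent    : ℕ
      numerator≡  : r * 2^ (+ exponent) ≡ numerator / 1

  dyadic-/1 : ∀ z → Dyadic (z / 1)
  dyadic-/1 z = mkDyadic z 0 (ℚₚ.*-identityʳ (z / 1))

  dyadic-+ : ∀ {r s} → Dyadic r → Dyadic s → Dyadic (r + s)
  dyadic-+ {r} {s} (mkDyadic z k hr) (mkDyadic w l hs) = mkDyadic (z ℤ.* pow₂ l ℤ.+ w ℤ.* pow₂ k) (k ℕ.+ l) (begin
    (r + s) * 2^ (+ (k ℕ.+ l))  ≡⟨ cong ((r + s) *_) (ℚ^ₚ.^-homo-* (+ 2 / 1) k l) ⟩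
    (r + s) * (2^ (+ k) * 2^ (+ l))  ≡⟨ lem r s (2^ (+ k)) (2^ (+ l)) ⟩
    r * 2^ (+ k) * 2^ (+ l) + s * 2^ (+ l) * 2^ (+ k)  ≡⟨ cong₂ _+_ (cong₂ _*_ hr (2^≡ l)) (cong₂ _*_ hs (2^≡ k)) ⟩
    (z / 1) * (pow₂ l / 1) + (w / 1) * (pow₂ k / 1)  ≡⟨ cong₂ _+_ (sym (/1-* z (pow₂ l))) (sym (/1-* w (pow₂ k))) ⟩
    (z ℤ.* pow₂ l) / 1 + (w ℤ.* pow₂ k) / 1  ≡⟨ sym (/1-+ (z ℤ.* pow₂ l) (w ℤ.* pow₂ k)) ⟩
    (z ℤ.* pow₂ l ℤ.+ w ℤ.* pow₂ k) / 1  ∎)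
    where
    open ≡-Reasoning
    open ℚ-Solver
    lem : ∀ r s k l → (r + s) * (k * l) ≡ r * k * l + s * l * k
    lem = solve 4 (λ r s k l → (r :+ s) :* (k :* l) := r :* k :* l :+ s :* l :* k) refl

  dyadic-* : ∀ {r s} → Dyadic r → Dyadic s → Dyadic (r * s)
  dyadic-* {r} {s} (mkDyadic z k hr) (mkDyadic w l hs) = mkDyadic (z ℤ.* w) (k ℕ.+ l) (begin
    (r * s) * 2^ (+ (k ℕ.+ l))  ≡⟨ cong ((r * s) *_) (ℚ^ₚ.^-homo-* (+ 2 / 1) k l) ⟩
    (r * s) * (2^ (+ k) * 2^ (+ l))  ≡⟨ lem r s (2^ (+ k)) (2^ (+ l)) ⟩
    (r * 2^ (+ k)) * (s * 2^ (+ l))  ≡⟨ cong₂ _*_ hr hs ⟩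
    (z / 1) * (w / 1)  ≡⟨ sym (/1-* z w) ⟩
    (z ℤ.* w) / 1  ∎)
    where
    open ≡-Reasoning
    open ℚ-Solver
    lem : ∀ r s k l → (r * s) * (k * l) ≡ (r * k) * (s * l)
    lem = solve 4 (λ r s k l → (r :* s) :* (k :* l) := (r :* k) :* (s :* l)) refl

  dyadic-neg : ∀ {r} → Dyadic r → Dyadic (- r)
  dyadic-neg {r} h = subst Dyadic (solve 1 (λ r → con (- 1ℚ) :* r := :- r) refl r) (dyadic-* (dyadic-/1 ℤ.-1ℤ) h)
    where open ℚ-Solver

  dyadic-2^ : ∀ i → Dyadic (2^ i)
  dyadic-2^ (+ n)    = subst Dyadic (sym (2^≡ n)) (dyadic-/1 (pow₂ n))
  dyadic-2^ -[1+ n ] = mkDyadic ℤ.1ℤ (suc n) (trans (ℚₚ.*-comm (½ ^ suc n) (2^ (+ suc n))) (2^*½^≡1 (suc n)))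

  ⌊⌋₂*2^ : ∀ x k → ⌊ x /2^ k ⌋₂ * 2^ (+ k) ≡ + digitSum x (suc k) / 1
  ⌊⌋₂*2^ x k = trans (cong (⌊ x /2^ k ⌋₂ *_) (2^≡ k)) (/-* (+ digitSum x (suc k)) (2 ℕ.^ k) {{ℕₚ.m^n≢0 2 k}})

  -- The 2-adic valuation on K

  module Valuation {c ℓ} (K : EmbeddedQuadraticField c ℓ) where

    open Field K public

    infix 4 _≤ν_

    -- As with `∣_∣∞≤_`, the record lets `e` and `x` be inferred.
    record _≤ν_ (e : ℕ) (x : Carrier) : Set where
      constructor valued
      field
        value : e ≤v₂ σ₂ x

    open _≤ν_ public

    ≤ν-cong : ∀ {e x y} → x ≈K y → e ≤ν x → e ≤ν y
    ≤ν-cong {e} {x} {y} x≈y (valued h) = valued (≤v₂-resp-≈ (σ₂ x) (σ₂ y) (σ₂H.⟦⟧-cong x≈y) h)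

    ≤ν-+ : ∀ {e x y} → e ≤ν x → e ≤ν y → e ≤ν x +K y
    ≤ν-+ {e} {x} {y} (valued hx) (valued hy) = valued (≤v₂-resp-≈ (σ₂ x +ℚ₂ σ₂ y) (σ₂ (x +K y))
      (≈₂-sym (σ₂ (x +K y)) (σ₂ x +ℚ₂ σ₂ y) (σ₂H.+-homo x y)) (≤v₂-+ (σ₂ x) (σ₂ y) hx hy))

    ≤ν-neg : ∀ {e x} → e ≤ν x → e ≤ν -K x
    ≤ν-neg {e} {x} (valued h) = valued (≤v₂-resp-≈ (-ℚ₂ σ₂ x) (σ₂ (-K x))
      (≈₂-sym (σ₂ (-K x)) (-ℚ₂ σ₂ x) (σ₂H.-‿homo x)) (≤v₂-neg (σ₂ x) h))

    ≤ν-* : ∀ {e f x y} → e ≤ν x → f ≤ν y → e ℕ.+ f ≤ν x *K y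
    ≤ν-* {e} {f} {x} {y} (valued hx) (valued hy) = valued (≤v₂-resp-≈ (σ₂ x *ℚ₂ σ₂ y) (σ₂ (x *K y))
      (≈₂-sym (σ₂ (x *K y)) (σ₂ x *ℚ₂ σ₂ y) (σ₂H.*-homo x y)) (≤v₂-* (σ₂ x) (σ₂ y) hx hy))

    ≤ν-weaken : ∀ {e f x} → e ℕ.≤ f → f ≤ν x → e ≤ν x
    ≤ν-weaken {x = x} e≤f (valued h) = valued (≤v₂-weaken (σ₂ x) e≤f h)

    σ₂-ℕ : ∀ n → σ₂ (ι (+ n / 1)) ≈ℚ₂ (fromℤ (+ n) /2^ 0)
    σ₂-ℕ zero = ≈₂-trans (σ₂ (ι 0ℚ)) (σ₂ 0K) (fromℤ (+ 0) /2^ 0) (σ₂H.⟦⟧-cong ιH.0#-homo) σ₂H.0#-homo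
    σ₂-ℕ (suc n) = subst (λ q → σ₂ (ι q) ≈ℚ₂ (fromℤ (+ suc n) /2^ 0)) (sym (/1-+ (+ 1) (+ n)))
      (≈₂-trans (σ₂ (ι (1ℚ + + n / 1))) (σ₂ (ι 1ℚ +K ι (+ n / 1))) (fromℤ (+ suc n) /2^ 0)
        (σ₂H.⟦⟧-cong (ιH.+-homo 1ℚ (+ n / 1)))
        (≈₂-trans (σ₂ (ι 1ℚ +K ι (+ n / 1))) (σ₂ (ι 1ℚ) +ℚ₂ σ₂ (ι (+ n / 1))) (fromℤ (+ suc n) /2^ 0)
          (σ₂H.+-homo (ι 1ℚ) (ι (+ n / 1)))
          (≈₂-trans (σ₂ (ι 1ℚ) +ℚ₂ σ₂ (ι (+ n / 1))) ((fromℤ (+ 1) /2^ 0) +ℚ₂ (fromℤ (+ n) /2^ 0)) (fromℤ (+ suc n) /2^ 0)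
            (+₂-cong (σ₂ (ι 1ℚ)) (fromℤ (+ 1) /2^ 0) (σ₂ (ι (+ n / 1))) (fromℤ (+ n) /2^ 0)
              (≈₂-trans (σ₂ (ι 1ℚ)) (σ₂ 1K) (fromℤ (+ 1) /2^ 0) (σ₂H.⟦⟧-cong ιH.1#-homo) σ₂H.1#-homo) (σ₂-ℕ n))
            λ _ → ℤ∣.divides ℤ.0ℤ (lem (+ n)))))
      where
      open ℤ-Solver
      lem : ∀ n → + 1 ℤ.* (+ 1 ℤ.* + 1 ℤ.+ + 1 ℤ.* n) ℤ.- + 1 ℤ.* (+ 1 ℤ.+ n) ≡ + 0
      lem = solve 1 (λ n → con (+ 1) :* (con (+ 1) :* con (+ 1) :+ con (+ 1) :* n) :- con (+ 1) :* (con (+ 1) :+ n) := con (+ 0)) refl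

    σ₂-ℤ : ∀ z → σ₂ (ι (z / 1)) ≈ℚ₂ (fromℤ z /2^ 0)
    σ₂-ℤ (+ n)    = σ₂-ℕ n
    σ₂-ℤ -[1+ n ] = ≈₂-trans (σ₂ (ι (- r))) (σ₂ (-K ι r)) (-ℚ₂ (fromℤ (+ suc n) /2^ 0)) (σ₂H.⟦⟧-cong (ιH.-‿homo r))
      (≈₂-trans (σ₂ (-K ι r)) (-ℚ₂ σ₂ (ι r)) (-ℚ₂ (fromℤ (+ suc n) /2^ 0)) (σ₂H.-‿homo (ι r))
        (-₂-cong (σ₂ (ι r)) (fromℤ (+ suc n) /2^ 0) (σ₂-ℕ (suc n))))
      where r = + suc n / 1

    -- The values of `σ₂` on rationals are forced by the ring laws alone: integers are sums of 1,
    -- and a dyadic number is determined by its product with a power of 2.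
    σ₂-dyadic : ∀ r z k → r * 2^ (+ k) ≡ z / 1 → σ₂ (ι r) ≈ℚ₂ (fromℤ z /2^ k)
    σ₂-dyadic r z k h = divide (σ₂ (ι r))
      (≈₂-trans (σ₂ (ι r) *ℚ₂ p) (σ₂ (ι r) *ℚ₂ σ₂ (ι (pow₂ k / 1))) (fromℤ z /2^ 0)
        (*₂-cong (σ₂ (ι r)) (σ₂ (ι r)) p (σ₂ (ι (pow₂ k / 1))) (≈₂-refl (σ₂ (ι r))) (≈₂-sym (σ₂ (ι (pow₂ k / 1))) p (σ₂-ℤ (pow₂ k))))
        (≈₂-trans (σ₂ (ι r) *ℚ₂ σ₂ (ι (pow₂ k / 1))) (σ₂ (ι r *K ι (pow₂ k / 1))) (fromℤ z /2^ 0)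
          (≈₂-sym (σ₂ (ι r *K ι (pow₂ k / 1))) (σ₂ (ι r) *ℚ₂ σ₂ (ι (pow₂ k / 1))) (σ₂H.*-homo (ι r) (ι (pow₂ k / 1))))
          (≈₂-trans (σ₂ (ι r *K ι (pow₂ k / 1))) (σ₂ (ι (z / 1))) (fromℤ z /2^ 0)
            (σ₂H.⟦⟧-cong (R.trans (R.sym (ιH.*-homo r (pow₂ k / 1))) (ι-cong (trans (cong (r *_) (sym (2^≡ k))) h))))
            (σ₂-ℤ z))))
      where
      p = fromℤ (pow₂ k) /2^ 0
      divide : ∀ w → (w *ℚ₂ p) ≈ℚ₂ (fromℤ z /2^ 0) → w ≈ℚ₂ (fromℤ z /2^ k)
      divide (y /2^ l) h n = subst (pow₂ n ℤ∣.∣_)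
        (trans (cong (λ t → pow₂ 0 ℤ.* (res y n ℤ.* pow₂ k) ℤ.- pow₂ t ℤ.* z) (ℕₚ.+-identityʳ l))
          (lem (res y n) (pow₂ k) (pow₂ l ℤ.* z))) (h n)
        where
        open ℤ-Solver
        lem : ∀ y p w → + 1 ℤ.* (y ℤ.* p) ℤ.- w ≡ p ℤ.* y ℤ.- w
        lem = solve 3 (λ y p w → con (+ 1) :* (y :* p) :- w := p :* y :- w) refl

    ≤ν-ι : ∀ {e} r z k → r * 2^ (+ k) ≡ z / 1 → pow₂ (e ℕ.+ k) ℤ∣.∣ z → e ≤ν ι r
    ≤ν-ι {e} r z k eq h = valued (≤v₂-resp-≈ (fromℤ z /2^ k) (σ₂ (ι r))
      (≈₂-sym (σ₂ (ι r)) (fromℤ z /2^ k) (σ₂-dyadic r z k eq)) h)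

    ≤ν-ι/1 : ∀ {e} z → pow₂ e ℤ∣.∣ z → e ≤ν ι (z / 1)
    ≤ν-ι/1 {e} z h = ≤ν-ι (z / 1) z 0 (ℚₚ.*-identityʳ (z / 1)) (subst (λ t → pow₂ t ℤ∣.∣ z) (sym (ℕₚ.+-identityʳ e)) h)

    0≤ν-ι/1 : ∀ z → 0 ≤ν ι (z / 1)
    0≤ν-ι/1 z = ≤ν-ι/1 z (ℤ∣.divides z (sym (ℤₚ.*-identityʳ z)))

    ≤ν-2^ : ∀ e → e ≤ν ι (2^ (+ e))
    ≤ν-2^ e = subst (λ t → e ≤ν ι t) (sym (2^≡ e)) (≤ν-ι/1 (pow₂ e) ℤ∣.∣-refl)

    ≰ν1 : ¬ 1 ≤ν 1K
    ≰ν1 (valued h) = odd⇒2∤ {+ 1} (+ 0 , refl) (≤v₂-resp-≈ (σ₂ 1K) (fromℤ (+ 1) /2^ 0) σ₂H.1#-homo h)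

    -- An element of ℤ[1/2] has no odd denominator, so 2-adic integrality alone makes it an integer.
    -- This is how bounds at the two places yield finiteness.
    dyadic-integral : ∀ {e r} → Dyadic r → e ≤ν ι r → ∃ λ m → r ≡ m / 1 * 2^ (+ e)
    dyadic-integral {e} {r} (mkDyadic z k eq) (valued h) =
      let ℤ∣.divides m z≡ = ≤v₂-resp-≈ (σ₂ (ι r)) (fromℤ z /2^ k) (σ₂-dyadic r z k eq) h
      in m , integral m z≡
      where
      open ≡-Reasoning
      integral : ∀ m → z ≡ m ℤ.* pow₂ (e ℕ.+ k) → r ≡ m / 1 * 2^ (+ e)
      integral m z≡ = 2^-cancel k (begin
        r * 2^ (+ k)  ≡⟨ trans eq (cong (_/ 1) z≡) ⟩
        (m ℤ.* pow₂ (e ℕ.+ k)) / 1  ≡⟨ /1-* m (pow₂ (e ℕ.+ k)) ⟩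
        m / 1 * (pow₂ (e ℕ.+ k) / 1)  ≡⟨ cong (m / 1 *_) (trans (sym (2^≡ (e ℕ.+ k))) (ℚ^ₚ.^-homo-* (+ 2 / 1) e k)) ⟩
        m / 1 * (2^ (+ e) * 2^ (+ k))  ≡⟨ sym (ℚₚ.*-assoc (m / 1) _ _) ⟩
        m / 1 * 2^ (+ e) * 2^ (+ k)  ∎)

    ≤ν-odd : ∀ {e m x} → Odd m → e ≤ν ι (m / 1) *K x → e ≤ν x
    ≤ν-odd {e} {m} {x} odd (valued h) = valued (≤v₂-odd (ℚ₂.num (σ₂ x)) (ℚ₂.exp (σ₂ x)) odd
      (≤v₂-resp-≈ (σ₂ (ι (m / 1) *K x)) ((fromℤ m /2^ 0) *ℚ₂ σ₂ x)
        (≈₂-trans (σ₂ (ι (m / 1) *K x)) (σ₂ (ι (m / 1)) *ℚ₂ σ₂ x) ((fromℤ m /2^ 0) *ℚ₂ σ₂ x) (σ₂H.*-homo (ι (m / 1)) x)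
          (*₂-cong (σ₂ (ι (m / 1))) (fromℤ m /2^ 0) (σ₂ x) (σ₂ x) (σ₂-ℤ m) (≈₂-refl (σ₂ x)))) h))

    σ₂-‿- : ∀ x y → σ₂ (x -K y) ≈ℚ₂ (σ₂ x -ℚ₂ σ₂ y)
    σ₂-‿- x y = ≈₂-trans (σ₂ (x -K y)) (σ₂ x +ℚ₂ σ₂ (-K y)) (σ₂ x -ℚ₂ σ₂ y) (σ₂H.+-homo x (-K y))
      (+₂-cong (σ₂ x) (σ₂ x) (σ₂ (-K y)) (-ℚ₂ σ₂ y) (≈₂-refl (σ₂ x)) (σ₂H.-‿homo y))

    ∣∣₂-bound : ∀ {e} x y → e ≤ν x -K y → Eventually λ n → seq ∣ σ₂ x -ℚ₂ σ₂ y ∣₂ n ≤ ½ ^ e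
    ∣∣₂-bound {e} x y (valued h) = ∣∣₂≤ {e} (σ₂ x -ℚ₂ σ₂ y) (≤v₂-resp-≈ (σ₂ (x -K y)) (σ₂ x -ℚ₂ σ₂ y) (σ₂-‿- x y) h)

    dyadic-⌊⌋₂ : ∀ x → Dyadic ⌊ σ₂ x ⌋₂
    dyadic-⌊⌋₂ x = mkDyadic (+ digitSum (ℚ₂.num (σ₂ x)) (suc (ℚ₂.exp (σ₂ x)))) (ℚ₂.exp (σ₂ x))
      (⌊⌋₂*2^ (ℚ₂.num (σ₂ x)) (ℚ₂.exp (σ₂ x)))

    -- Removing the digits at places j - k ≤ 0 leaves a multiple of 2^(k+1) over 2^k. Subtraction in
    -- ℚ₂ puts both terms over 2^(k+k), which is why the residue at `N` is inspected.
    1≤ν-fractional : ∀ x → 1 ≤ν x -K ι ⌊ σ₂ x ⌋₂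
    1≤ν-fractional x = valued (≤v₂-resp-≈ (σ₂ x -ℚ₂ (fromℤ (+ S) /2^ k)) (σ₂ (x -K ι ⌊ σ₂ x ⌋₂))
      (≈₂-sym (σ₂ (x -K ι ⌊ σ₂ x ⌋₂)) (σ₂ x -ℚ₂ (fromℤ (+ S) /2^ k))
        (≈₂-trans (σ₂ (x -K ι ⌊ σ₂ x ⌋₂)) (σ₂ x -ℚ₂ σ₂ (ι ⌊ σ₂ x ⌋₂)) (σ₂ x -ℚ₂ (fromℤ (+ S) /2^ k)) (σ₂-‿- x (ι ⌊ σ₂ x ⌋₂))
          (+₂-cong (σ₂ x) (σ₂ x) (-ℚ₂ σ₂ (ι ⌊ σ₂ x ⌋₂)) (-ℚ₂ (fromℤ (+ S) /2^ k)) (≈₂-refl (σ₂ x))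
            (-₂-cong (σ₂ (ι ⌊ σ₂ x ⌋₂)) (fromℤ (+ S) /2^ k) (σ₂-dyadic ⌊ σ₂ x ⌋₂ (+ S) k (⌊⌋₂*2^ y k))))))
      (subst (λ t → pow₂ t ℤ∣.∣ pow₂ k ℤ.* res y N ℤ.+ pow₂ k ℤ.* (ℤ.- + S)) (ℕₚ.+-suc k k)
        (subst (pow₂ (k ℕ.+ suc k) ℤ∣.∣_) (lem (pow₂ k) (res y N) (+ S))
          (∣-pow₂-* k {suc k} (∣-trans-diff {a = res y N} {res y (suc k)} {+ S}
            (coherent″ y (suc k) N (suc k) (ℕ.s≤s (ℕₚ.m≤m+n k k)) ℕₚ.≤-refl)
            (∣-sym-diff {a = + S} {res y (suc k)} (proj₂ (digitSum-residue y (suc k)))))))))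
      where
      y = ℚ₂.num (σ₂ x)
      k = ℚ₂.exp (σ₂ x)
      S = digitSum y (suc k)
      N = suc (k ℕ.+ k)
      open ℤ-Solver
      lem : ∀ p y s → p ℤ.* (y ℤ.- s) ≡ p ℤ.* y ℤ.+ p ℤ.* (ℤ.- s)
      lem = solve 3 (λ p y s → p :* (y :- s) := p :* y :+ p :* (:- s)) refl

  -- Odd parts of dyadic rationals

  parity? : ∀ z → (∃ λ t → z ≡ t ℤ.* + 2) ⊎ Odd z
  parity? z with z ℤ.%ℕ 2 | z ℤ%./ℕ 2 | ℤ%.a≡a%ℕn+[a/ℕn]*n z 2 | ℤ%.n%ℕd<d z 2
  ... | 0 | t | eq | _ = inj₁ (t , trans eq (ℤₚ.+-identityˡ (t ℤ.* + 2)))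
  ... | 1 | t | eq | _ = inj₂ (t , trans eq (cong (λ s → + 1 ℤ.+ s) (ℤₚ.*-comm t (+ 2))))
  ... | suc (suc _) | _ | _ | ℕ.s≤s (ℕ.s≤s ())

  n<2^n-ℕ : ∀ n → n ℕ.< 2 ℕ.^ n
  n<2^n-ℕ zero    = ℕ.s≤s ℕ.z≤n
  n<2^n-ℕ (suc n) = ℕₚ.≤-trans (ℕₚ.+-mono-≤ (ℕₚ.m^n>0 2 n) (n<2^n-ℕ n))
    (ℕₚ.+-monoʳ-≤ (2 ℕ.^ n) (ℕₚ.≤-reflexive (sym (ℕₚ.+-identityʳ (2 ℕ.^ n)))))

  -- The search bound ∣z∣ cuts nothing off: if 2^(i+1) divided z, then i + 1 < 2^(i+1) ≤ ∣z∣ would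
  -- put i + 1 within reach of the search.
  v₂-upTo-exact : ∀ z .{{_ : ℤ.NonZero z}} → ∃ λ w → z ≡ w ℤ.* pow₂ (v₂-upTo z ℤ.∣ z ∣) × Odd w
  v₂-upTo-exact z with v₂-upTo-∣ z ℤ.∣ z ∣
  ... | ℤ∣.divides w eq with parity? w
  ...   | inj₂ odd        = w , eq , odd
  ...   | inj₁ (t , refl) = contradiction (v₂-upTo-greatest z ℤ.∣ z ∣ (suc i) i<∣z∣ 2^1+i∣z) (ℕₚ.<-irrefl refl)
    where
    i = v₂-upTo z ℤ.∣ z ∣
    2^1+i∣z : pow₂ (suc i) ℤ∣.∣ z
    2^1+i∣z = ℤ∣.divides t (trans eq (trans (ℤₚ.*-assoc t (+ 2) (pow₂ i)) (cong (t ℤ.*_) (sym (pow₂-+ 1 i)))))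
    i<∣z∣ : suc i ℕ.≤ ℤ.∣ z ∣
    i<∣z∣ = ℕₚ.≤-trans (ℕₚ.<⇒≤ (n<2^n-ℕ (suc i))) (ℕ∣.∣⇒≤ (ℤ∣.∣⇒∣ᵤ 2^1+i∣z))

  2^-diff : ∀ i j → 2^ (ℤ.- (+ i ℤ.- + j)) * 2^ (+ i) ≡ 2^ (+ j)
  2^-diff i j = trans (cong (λ k → 2^ (ℤ.- k) * 2^ (+ i)) (ℤₚ.[+m]-[+n]≡m⊖n i j)) (go i j)
    where
    open ℚ-Solver
    go : ∀ i j → 2^ (ℤ.- (i ℤ.⊖ j)) * 2^ (+ i) ≡ 2^ (+ j)
    go zero    zero    = refl
    go zero    (suc j) = ℚₚ.*-identityʳ (2^ (+ suc j))
    go (suc i) zero    = trans (ℚₚ.*-comm (½ ^ suc i) (2^ (+ suc i))) (2^*½^≡1 (suc i))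
    go (suc i) (suc j) = trans (cong (λ k → 2^ (ℤ.- k) * 2^ (+ suc i)) (ℤₚ.[1+m]⊖[1+n]≡m⊖n i j))
      (trans (solve 2 (λ a b → a :* (con (+ 2 / 1) :* b) := con (+ 2 / 1) :* (a :* b)) refl (2^ (ℤ.- (i ℤ.⊖ j))) (2^ (+ i)))
        (cong ((+ 2 / 1) *_) (go i j)))

  -- Let z and d be the odd parts of numerator and denominator, so β d = z. As β = z′ / 2^k is
  -- dyadic, z′ d = z 2^k, and d being odd, 2^k divides z′. Thus β is an integer m, and m d = z
  -- makes m odd.
  odd-part : ∀ {q} → Dyadic q → q ≢ 0ℚ → ∃ λ m → Odd m × 2^ (ℤ.- v₂ q) * q ≡ m / 1
  odd-part {q} dyadic q≢0 =
    let z , ↥q≡ , z-odd = v₂-upTo-exact (↥ q) {{ℤ.≢-nonZero λ ↥q≡0 → q≢0 (ℚₚ.↥p≡0⇒p≡0 q ↥q≡0)}}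
        d , ↧q≡ , d-odd = v₂-upTo-exact (↧ q)
        i = v₂-upTo (↥ q) ℤ.∣ ↥ q ∣
        j = v₂-upTo (↧ q) (↧ₙ q)
        β = 2^ (ℤ.- v₂ q) * q
        βd≡z : β * (d / 1) ≡ z / 1
        βd≡z = 2^-cancel i (begin
          β * (d / 1) * 2^ (+ i)  ≡⟨ lem (2^ (ℤ.- v₂ q)) q (d / 1) (2^ (+ i)) ⟩
          (2^ (ℤ.- v₂ q) * 2^ (+ i)) * (q * (d / 1))  ≡⟨ cong (_* (q * (d / 1))) (2^-diff i j) ⟩
          2^ (+ j) * (q * (d / 1))  ≡⟨ lem′ (2^ (+ j)) q (d / 1) ⟩
          q * ((d / 1) * 2^ (+ j))  ≡⟨ cong (q *_) (trans (cong ((d / 1) *_) (2^≡ j)) (trans (sym (/1-* d (pow₂ j))) (cong (_/ 1) (sym ↧q≡)))) ⟩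
          q * (↧ q / 1)  ≡⟨ *-denominator q ⟩
          ↥ q / 1  ≡⟨ trans (cong (_/ 1) ↥q≡) (trans (/1-* z (pow₂ i)) (cong ((z / 1) *_) (sym (2^≡ i)))) ⟩
          (z / 1) * 2^ (+ i)  ∎)
        mkDyadic z′ k βk≡z′ = dyadic-* (dyadic-2^ (ℤ.- v₂ q)) dyadic
        z′d≡zk : z′ ℤ.* d ≡ z ℤ.* pow₂ k
        z′d≡zk = /1-injective (begin
          (z′ ℤ.* d) / 1  ≡⟨ /1-* z′ d ⟩
          (z′ / 1) * (d / 1)  ≡⟨ cong (_* (d / 1)) (sym βk≡z′) ⟩
          β * 2^ (+ k) * (d / 1)  ≡⟨ lem″ β (2^ (+ k)) (d / 1) ⟩
          β * (d / 1) * 2^ (+ k)  ≡⟨ cong₂ _*_ βd≡z (2^≡ k) ⟩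
          (z / 1) * (pow₂ k / 1)  ≡⟨ sym (/1-* z (pow₂ k)) ⟩
          (z ℤ.* pow₂ k) / 1  ∎)
        ℤ∣.divides m z′≡mk = odd-cancel k {z′} {d} d-odd (ℤ∣.divides z z′d≡zk)
        β≡m : β ≡ m / 1
        β≡m = 2^-cancel k (trans βk≡z′ (trans (cong (_/ 1) z′≡mk) (trans (/1-* m (pow₂ k)) (cong ((m / 1) *_) (sym (2^≡ k))))))
        md≡z : m ℤ.* d ≡ z
        md≡z = /1-injective (trans (/1-* m d) (trans (cong (_* (d / 1)) (sym β≡m)) βd≡z))
    in m , not-even m d z md≡z z-odd , β≡m
    where
    open ≡-Reasoning
    open ℚ-Solver
    not-even : ∀ m d z → m ℤ.* d ≡ z → Odd z → Odd m
    not-even m d z md≡z z-odd with parity? m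
    ... | inj₂ odd        = odd
    ... | inj₁ (t , refl) = contradiction (subst (+ 2 ℤ∣.∣_) md≡z (ℤ∣.∣m⇒∣m*n d (ℤ∣.divides t refl))) (odd⇒2∤ z-odd)
    lem : ∀ a q d i → a * q * d * i ≡ (a * i) * (q * d)
    lem = solve 4 (λ a q d i → a :* q :* d :* i := (a :* i) :* (q :* d)) refl
    lem′ : ∀ j q d → j * (q * d) ≡ q * (d * j)
    lem′ = solve 3 (λ j q d → j :* (q :* d) := q :* (d :* j)) refl
    lem″ : ∀ b k d → b * k * d ≡ b * d * k
    lem″ = solve 3 (λ b k d → b :* k :* d := b :* d :* k) refl

  -- One step of the algorithm

  gain : Parity → ℕ
  gain 0ℙ = 1
  gain 1ℙ = 0

  -- The trade-off between the places: if `scale ε` is 2^g, the remainder has valuation at least g,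
  -- but its real size may be as large as 2^g / 2.
  scale≡2^gain : ∀ ε → scale ε ≡ 2^ (+ gain ε)
  scale≡2^gain 0ℙ = refl
  scale≡2^gain 1ℙ = refl

  0<scale : ∀ ε → 0ℚ < scale ε
  0<scale ε = ℚₚ.<-≤-trans 0<1 (1≤scale ε)

  module Step {c ℓ} (K : EmbeddedQuadraticField c ℓ) where

    open Valuation K public
    open Algorithm K public

    irrational⇒≉0 : ∀ {x} → Irrational x → ¬ x ≈K 0K
    irrational⇒≉0 irr x≈0 = irr 0ℚ (R.trans x≈0 (R.sym ιH.0#-homo))

    dyadic-partialQuotient : ∀ ε x → Dyadic (partialQuotient ε x)
    dyadic-partialQuotient ε x = dyadic-+ (dyadic-* (subst Dyadic (sym (scale≡2^gain ε)) (dyadic-2^ (+ gain ε)))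
      (dyadic-/1 (proj₁ (nearest ε x)))) (dyadic-⌊⌋₂ (x ⁻¹))

    T-≤ν : ∀ ε x → gain ε ≤ν T ε x
    T-≤ν ε x = ≤ν-cong (R.sym split) (≤ν-+ (≤ν-weaken (gain≤1 ε) (1≤ν-fractional (x ⁻¹)))
      (≤ν-neg (≤ν-cong (R.sym (ιH.*-homo (scale ε) (m / 1)))
        (subst (_≤ν ι (scale ε) *K ι (m / 1)) (ℕₚ.+-identityʳ (gain ε))
          (≤ν-* (subst (λ t → gain ε ≤ν ι t) (sym (scale≡2^gain ε)) (≤ν-2^ (gain ε))) (0≤ν-ι/1 m))))))
      where
      m = proj₁ (nearest ε x)
      r = ⌊ σ₂ (x ⁻¹) ⌋₂
      gain≤1 : ∀ ε → gain ε ℕ.≤ 1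
      gain≤1 0ℙ = ℕₚ.≤-refl
      gain≤1 1ℙ = ℕ.z≤n
      split : T ε x ≈K (x ⁻¹ -K ι r) -K ι (scale ε * (m / 1))
      split = R.trans (R.+-congˡ (R.-‿cong (ιH.+-homo (scale ε * (m / 1)) r)))
        (solve 3 (λ x a b → x :- (a :+ b) := (x :- b) :- a) R.refl (x ⁻¹) (ι (scale ε * (m / 1))) (ι r))
        where open K-Solver

    -- Minimality is compared only with the neighbours m + 1 and m - 1, which shift the remainder by
    -- `s` in either direction.
    T-≤∞ : ∀ ε x → ∣ T ε x ∣∞≤ ½ * scale ε
    T-≤∞ ε x = bounded (∣∣-resp-≈ℝ Xℝ (σ∞ (T ε x)) (½ * s) X≈T ∣X∣≤)
      where
      m = proj₁ (nearest ε x)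
      minimal = proj₁ (proj₂ (nearest ε x))
      r = ⌊ σ₂ (x ⁻¹) ⌋₂
      s = scale ε
      0<s = 0<scale ε
      y = σ∞ (x ⁻¹)
      Xℝ = y -ℝ fromℚ (s * (m / 1)) -ℝ fromℚ r
      X : ℕ → ℚ
      X = seq Xℝ
      open ℚ-Solver
      near : ∀ {X δ ε} → 0ℚ < ε → δ ≤ ε → δ ≤ s → ∣ X ∣ < ∣ X - s ∣ + δ → X < ½ * s + ε
      near {X} {δ} {ε} 0<ε δ≤ε δ≤s h with ℚₚ.∣p∣≡p∨∣p∣≡-p (X - s)
      -- For X ≥ s the shift shortens X by all of s, which δ ≤ s cannot make up for.
      ... | inj₁ eq = contradiction
        (ℚₚ.<-≤-trans (ℚₚ.≤-<-trans (p≤∣p∣ X) (subst (λ t → ∣ X ∣ < t + δ) eq h))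
          (lin≤ {X - s + δ} {X} {δ} {s} (lem₁ X s δ) δ≤s)) (ℚₚ.<-irrefl refl)
        where
        lem₁ : ∀ X s δ → X - (X - s + δ) ≡ s - δ
        lem₁ = solve 3 (λ X s δ → X :- (X :- s :+ δ) := s :- δ) refl
      ... | inj₂ eq = lin< {X} {½ * s + ε} {½ * X + ½ * δ} {½ * (- (X - s) + δ) + ε} (lem₂ X s δ ε)
        (ℚₚ.+-mono-<-≤ (ℚₚ.*-monoʳ-<-pos ½ (ℚₚ.≤-<-trans (p≤∣p∣ X) (subst (λ t → ∣ X ∣ < t + δ) eq h)))
          (ℚₚ.≤-trans (*-monoˡ (ℚₚ.<⇒≤ (ℚₚ.positive⁻¹ ½)) δ≤ε) (ℚₚ.<⇒≤ (½ε<ε 0<ε))))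
        where
        lem₂ : ∀ X s δ ε → (½ * s + ε) - X ≡ (½ * (- (X - s) + δ) + ε) - (½ * X + ½ * δ)
        lem₂ = solve 4 (λ X s δ ε → (con ½ :* s :+ ε) :- X :=
          (con ½ :* (:- (X :- s) :+ δ) :+ ε) :- (con ½ :* X :+ con ½ :* δ)) refl
      right : ∀ n → seq y n - s * ((m ℤ.+ + 1) / 1) - r ≡ X n - s
      right n = trans (cong (λ t → seq y n - s * t - r) (/1-+ m (+ 1)))
        (solve 4 (λ y s m r → y :- s :* (m :+ con 1ℚ) :- r := y :- s :* m :- r :- s) refl (seq y n) s (m / 1) r)
      left : ∀ n → seq y n - s * ((m ℤ.+ -[1+ 0 ]) / 1) - r ≡ - (- X n - s)
      left n = trans (cong (λ t → seq y n - s * t - r) (/1-+ m -[1+ 0 ]))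
        (solve 4 (λ y s m r → y :- s :* (m :+ con (- 1ℚ)) :- r := :- (:- (y :- s :* m :- r) :- s)) refl (seq y n) s (m / 1) r)
      ∣X∣≤ : ∣ Xℝ ∣ℝ ≤ℝ fromℚ (½ * s)
      ∣X∣≤ ε 0<ε =
        let δ , 0<δ , δ≤ε , δ≤s = min ε s 0<ε 0<s in
        ev-map₂ (minimal (m ℤ.+ + 1) δ 0<δ) (minimal (m ℤ.+ -[1+ 0 ]) δ 0<δ) λ n h k →
          ∣p∣<q (near {X n} 0<ε δ≤ε δ≤s (subst (λ t → ∣ X n ∣ < ∣ t ∣ + δ) (right n) h))
                (near { - X n} 0<ε δ≤ε δ≤s (subst₂ _<_ (sym (ℚₚ.∣-p∣≡∣p∣ (X n)))
                  (cong (_+ δ) (trans (cong ∣_∣ (left n)) (ℚₚ.∣-p∣≡∣p∣ (- X n - s)))) k))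
        where
        min : ∀ a b → 0ℚ < a → 0ℚ < b → ∃ λ δ → 0ℚ < δ × δ ≤ a × δ ≤ b
        min a b 0<a 0<b with ℚₚ.≤-total a b
        ... | inj₁ a≤b = a , 0<a , ℚₚ.≤-refl , a≤b
        ... | inj₂ b≤a = b , 0<b , b≤a , ℚₚ.≤-refl
      b = partialQuotient ε x
      X≈T : Xℝ ≈ℝ σ∞ (T ε x)
      X≈T = ≈-sym (σ∞ (T ε x)) Xℝ (≈-trans (σ∞ (T ε x)) (y +ℝ σ∞ (-K ι b)) Xℝ (σ∞H.+-homo (x ⁻¹) (-K ι b))
        (≈-trans (y +ℝ σ∞ (-K ι b)) (y -ℝ fromℚ b) Xℝ
          (+-cong y y (σ∞ (-K ι b)) (-ℝ fromℚ b) (≈-refl y)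
            (≈-trans (σ∞ (-K ι b)) (-ℝ σ∞ (ι b)) (-ℝ fromℚ b) (σ∞H.-‿homo (ι b)) (neg-cong (σ∞ (ι b)) (fromℚ b) (f-ℚ b))))
          λ ε 0<ε → 0 , λ n _ → subst (λ t → ∣ t ∣ < ε) (sym (lem (seq y n) (s * (m / 1)) r)) 0<ε))
        where
        lem : ∀ y m r → (y - (m + r)) - (y - m - r) ≡ 0ℚ
        lem = solve 3 (λ y m r → (y :- (m :+ r)) :- (y :- m :- r) := con 0ℚ) refl

    0<⇒∣+∣≰ : ∀ {x t} → fromℚ 0ℚ <ℝ σ∞ x → ¬ ∣ x +K ι t ∣∞≤ t
    0<⇒∣+∣≰ {x} {t} (η , 0<η , η<x) (bounded h) =
      let N , k = ev-map₂ η<x (∣∣-resp-≈ℝ (σ∞ (x +K ι t)) (σ∞ x +ℝ fromℚ t) t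
                    (≈-trans (σ∞ (x +K ι t)) (σ∞ x +ℝ σ∞ (ι t)) (σ∞ x +ℝ fromℚ t) (σ∞H.+-homo x (ι t))
                      (+-cong (σ∞ x) (σ∞ x) (σ∞ (ι t)) (fromℚ t) (≈-refl (σ∞ x)) (f-ℚ t))) h η 0<η)
                    λ n k l → ℚₚ.<-irrefl refl (ℚₚ.<-trans l
                      (ℚₚ.<-≤-trans (lin< (lem (seq (σ∞ x) n) t η) k) (p≤∣p∣ (seq (σ∞ x) n + t))))
      in k N ℕₚ.≤-refl
      where
      open ℚ-Solver
      lem : ∀ x t η → (x + t) - (t + η) ≡ x - (0ℚ + η)
      lem = solve 3 (λ x t η → (x :+ t) :- (t :+ η) := x :- (con 0ℚ :+ η)) refl

    -- Two points of [-t, t] at distance 2t are its end points.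
    distance-2t : ∀ {x t} → ¬ x ≈K 0K → ∣ x +K ι t ∣∞≤ t → ¬ ∣ x -K ι t ∣∞≤ t
    distance-2t {x} {t} x≉0 h k with compare x 0ℚ | compare (-K x) 0ℚ
    ... | inj₁ 0<x | _         = 0<⇒∣+∣≰ 0<x h
    ... | inj₂ _   | inj₁ 0<-x = 0<⇒∣+∣≰ 0<-x
      (∣∣∞-cong (solve 2 (λ x t → :- (x :- t) := :- x :+ t) R.refl x (ι t)) (∣∣∞-neg k))
      where open K-Solver
    ... | inj₂ x≤0 | inj₂ -x≤0 =
      let B , ∣x⁻¹∣≤B = ∣∣∞-bound (x ⁻¹)
          1≤0 = subst (1ℚ ≤_) (ℚₚ.*-zeroˡ B) (∣∣∞-1⁻¹ (∣∣∞-cong (*-inverse x x≉0) (∣∣∞-* {x} {x ⁻¹} {0ℚ} {B} (≤⇒∣∣∞ x≤0 -x≤0) ∣x⁻¹∣≤B)))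
      in ℚₚ.<-irrefl refl (ℚₚ.<-≤-trans 0<1 1≤0)

    -- x and y differ by a multiple of scale ε and lie in an interval of that
    -- length, with x in its interior.
    difference-unique : ∀ ε {x y δ} → Irrational x → ∣ x ∣∞≤ ½ * scale ε → ∣ y ∣∞≤ ½ * scale ε →
                        gain ε ≤ν x → gain ε ≤ν y → Dyadic δ → x -K y ≈K ι δ → δ ≡ 0ℚ
    difference-unique ε {x} {y} {δ} irr ∣x∣≤ ∣y∣≤ νx νy dyadic x-y≈δ =
      let k , δ≡k2^ = dyadic-integral dyadic (≤ν-cong x-y≈δ (≤ν-+ νx (≤ν-neg νy)))
          δ≡ks = trans δ≡k2^ (cong (k / 1 *_) (sym (scale≡2^gain ε)))
          ∣δ∣≤s = subst (∣ δ ∣ ≤_) (½ε+½ε≡ε s) (∣∣∞-ι⁻¹ (∣∣∞-cong x-y≈δ (∣∣∞-+ ∣x∣≤ (∣∣∞-neg ∣y∣≤))))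
          ∣k∣≤1 = ⟦⟧-cancel-≤ {n = 1} (subst₂ _≤_ (∣/1∣ k) (sym ⟦1⟧) (ℚₚ.*-cancelʳ-≤-pos s {{positive (0<scale ε)}}
            (subst₂ _≤_ (trans (cong ∣_∣ δ≡ks) (trans (ℚₚ.∣p*q∣≡∣p∣*∣q∣ (k / 1) s)
              (cong (∣ k / 1 ∣ *_) (ℚₚ.0≤p⇒∣p∣≡p (ℚₚ.<⇒≤ (0<scale ε)))))) (sym (ℚₚ.*-identityˡ s)) ∣δ∣≤s)))
      in cases k δ≡ks ∣k∣≤1
      where
      s = scale ε
      open K-Solver
      end : ∀ {x y t} → Irrational x → ∣ x ∣∞≤ t → ∣ y ∣∞≤ t → ¬ x -K y ≈K ι t +K ι t
      -- If x - y = 2t, then x and y are (x - t) + t and (x - t) - t, and irrationality keeps x - t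
      -- away from 0.
      end {x} {y} {t} irr ∣x∣≤ ∣y∣≤ eq = distance-2t {x -K ι t} {t}
        (λ x-t≈0 → irr t (R.trans (R.sym (lem₁ x (ι t))) (R.trans (R.+-congʳ x-t≈0) (R.+-identityˡ (ι t)))))
        (∣∣∞-cong (R.sym (lem₁ x (ι t))) ∣x∣≤)
        (∣∣∞-cong (R.trans (lem₂ x y) (R.trans (R.+-congˡ (R.-‿cong eq)) (lem₃ x (ι t)))) ∣y∣≤)
        where
        lem₁ : ∀ x t → (x -K t) +K t ≈K x
        lem₁ = solve 2 (λ x t → (x :- t) :+ t := x) R.refl
        lem₂ : ∀ x y → y ≈K x -K (x -K y)
        lem₂ = solve 2 (λ x y → y := x :- (x :- y)) R.refl
        lem₃ : ∀ x t → x -K (t +K t) ≈K (x -K t) -K t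
        lem₃ = solve 2 (λ x t → x :- (t :+ t) := (x :- t) :- t) R.refl
      s≈ : ι s ≈K ι (½ * s) +K ι (½ * s)
      s≈ = R.trans (ι-cong (sym (½ε+½ε≡ε s))) (ιH.+-homo (½ * s) (½ * s))
      neg-irr : Irrational (-K x)
      neg-irr r -x≈r = irr (- r) (R.trans (solve 1 (λ x → x := :- (:- x)) R.refl x) (R.trans (R.-‿cong -x≈r) (R.sym (ιH.-‿homo r))))
      cases : ∀ k → δ ≡ k / 1 * s → ℤ.∣ k ∣ ℕ.≤ 1 → δ ≡ 0ℚ
      cases (+ 0) eq _ = trans eq (ℚₚ.*-zeroˡ s)
      cases (+ 1) eq _ = contradiction
        (R.trans x-y≈δ (R.trans (ι-cong (trans eq (ℚₚ.*-identityˡ s))) s≈)) (end irr ∣x∣≤ ∣y∣≤)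
      cases -[1+ 0 ] eq _ = contradiction
        (R.trans (solve 2 (λ x y → :- x :- :- y := :- (x :- y)) R.refl x y)
          (R.trans (R.-‿cong x-y≈δ) (R.trans (R.sym (ιH.-‿homo δ)) (R.trans (ι-cong (trans (cong -_ eq) (lem s))) s≈))))
        (end neg-irr (∣∣∞-neg ∣x∣≤) (∣∣∞-neg ∣y∣≤))
        where
        lem : ∀ s → - (- 1ℚ * s) ≡ s
        lem = ℚ-Solver.solve 1 (λ s → ℚ-Solver.:- (ℚ-Solver.con (- 1ℚ) ℚ-Solver.:* s) ℚ-Solver.:= s) refl
      cases (+ suc (suc _)) eq (ℕ.s≤s ())
      cases -[1+ suc _ ] eq (ℕ.s≤s ())

    ⁻¹-cong : ∀ {x y} → ¬ x ≈K 0K → x ≈K y → x ⁻¹ ≈K y ⁻¹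
    ⁻¹-cong {x} {y} x≉0 x≈y = *-inverse-unique (*-inverse x x≉0)
      (R.trans (R.*-congʳ x≈y) (*-inverse y λ y≈0 → x≉0 (R.trans x≈y y≈0)))

    -- Neither the floor nor the minimiser is compared directly. The remainders of x and y satisfy
    -- the same bounds at both places and differ by a dyadic number, so `difference-unique` applies.
    partialQuotient-cong : ∀ ε {x y} → ¬ x ≈K 0K → Irrational (T ε x) → x ≈K y → partialQuotient ε x ≡ partialQuotient ε y
    partialQuotient-cong ε {x} {y} x≉0 irr x≈y = begin
      b₀  ≡⟨ ℚ-Solver.solve 2 (λ b₀ b → b₀ ℚ-Solver.:= b ℚ-Solver.:- (b ℚ-Solver.:- b₀)) refl b₀ b ⟩
      b - (b - b₀)  ≡⟨ cong (λ t → b - t) (difference-unique ε irr (T-≤∞ ε x) (T-≤∞ ε y) (T-≤ν ε x) (T-≤ν ε y)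
          (dyadic-+ (dyadic-partialQuotient ε y) (dyadic-neg (dyadic-partialQuotient ε x))) T-T≈) ⟩
      b - 0ℚ  ≡⟨ ℚₚ.+-identityʳ b ⟩
      b  ∎
      where
      open ≡-Reasoning
      b₀ = partialQuotient ε x
      b = partialQuotient ε y
      open K-Solver
      T-T≈ : T ε x -K T ε y ≈K ι (b - b₀)
      T-T≈ = R.trans (R.+-congʳ (R.+-congʳ (⁻¹-cong x≉0 x≈y)))
        (R.trans (solve 3 (λ i b₀ b → (i :- b₀) :- (i :- b) := b :- b₀) R.refl (y ⁻¹) (ι b₀) (ι b))
          (R.sym (R.trans (ιH.+-homo b (- b₀)) (R.+-congˡ (ιH.-‿homo b₀)))))

    T-irrational : ∀ ε {x} → Irrational x → Irrational (T ε x)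
    T-irrational ε {x} irr r T≈r = irr (inverse d) (R.trans (R.sym (R.*-identityʳ x)) (R.trans (R.*-congˡ (R.sym 1K≈))
      (R.trans (R.*-congˡ (ι-cong (sym (d*inverse d≢0)))) (R.trans (R.*-congˡ (ιH.*-homo d (inverse d)))
        (R.trans (R.sym (R.*-assoc x (ι d) (ι (inverse d)))) (R.trans (R.*-congʳ xd≈1) (R.*-identityˡ _)))))))
      where
      b₀ = partialQuotient ε x
      d = r + b₀
      open K-Solver
      x⁻¹≈d : x ⁻¹ ≈K ι d
      x⁻¹≈d = R.trans (solve 2 (λ i b₀ → i := (i :- b₀) :+ b₀) R.refl (x ⁻¹) (ι b₀)) (R.trans (R.+-congʳ T≈r) (R.sym (ιH.+-homo r b₀)))
      xd≈1 : x *K ι d ≈K 1K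
      xd≈1 = R.trans (R.*-congˡ (R.sym x⁻¹≈d)) (*-inverse x (irrational⇒≉0 irr))
      d≢0 : d ≢ 0ℚ
      d≢0 d≡0 = 1≉0 (R.trans (R.sym xd≈1) (R.trans (R.*-congˡ (R.trans (ι-cong d≡0) ιH.0#-homo)) (R.zeroʳ x)))
      inverse : ℚ → ℚ
      inverse q = 1ℚ /₀ q
      d*inverse : ∀ {q} → q ≢ 0ℚ → q * inverse q ≡ 1ℚ
      d*inverse {q} q≢0 with q ℚₚ.≟ 0ℚ
      ... | yes q≡0 = contradiction q≡0 q≢0
      ... | no _    = trans (cong (q *_) (ℚₚ.*-identityˡ _)) (ℚₚ.*-inverseʳ q {{≢-nonZero q≢0}})

  -- The expansion of α and its convergents

  opposite-parities : ∀ n → (parity n ≡ 0ℙ × parity (suc n) ≡ 1ℙ) ⊎ (parity n ≡ 1ℙ × parity (suc n) ≡ 0ℙ)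
  opposite-parities 0             = inj₁ (refl , refl)
  opposite-parities 1             = inj₂ (refl , refl)
  opposite-parities (suc (suc n)) = opposite-parities n

  module Expansion {c ℓ} (K : EmbeddedQuadraticField c ℓ) (α : EmbeddedQuadraticField.Carrier K)
                   (irr : Algorithm.Irrational K α) (prop : Algorithm.PropertyI K α) where

    open Step K public

    -- A n is α_(n+1) and b n is a_(n+1).
    A : ℕ → Carrier
    A n = orbit α (suc n)

    b : ℕ → ℚ
    b n = a α (suc n)

    A-irrational : ∀ n → Irrational (A n)
    A-irrational zero    = irr
    A-irrational (suc n) = T-irrational (parity (suc n)) (A-irrational n)

    A≉0 : ∀ n → ¬ A n ≈K 0K
    A≉0 n = irrational⇒≉0 (A-irrational n)

    α≤1 : ∣ α ∣∞≤ 1ℚ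
    α≤1 =
      let (η , 0<η , -1<α) , α≤1 = proj₁ prop in
      ≤⇒∣∣∞ α≤1 λ ε 0<ε → ev-map₂ -1<α (σ∞H.-‿homo α ε 0<ε) λ n h k →
        lin< {seq (σ∞ (-K α)) n} {1ℚ + ε} {(- 1ℚ + η) + (seq (σ∞ (-K α)) n - - seq (σ∞ α) n) + 0ℚ} {seq (σ∞ α) n + ε + η}
          (lem (seq (σ∞ (-K α)) n) (seq (σ∞ α) n) ε η)
          (ℚₚ.+-mono-< (ℚₚ.+-mono-< h (ℚₚ.≤-<-trans (p≤∣p∣ _) k)) 0<η)
      where
      open ℚ-Solver
      lem : ∀ s t ε η → (1ℚ + ε) - s ≡ (t + ε + η) - ((- 1ℚ + η) + (s - - t) + 0ℚ)
      lem = solve 4 (λ s t ε η → (con 1ℚ :+ ε) :- s := (t :+ ε :+ η) :- ((con (- 1ℚ) :+ η) :+ (s :- (:- t)) :+ con 0ℚ)) refl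

    -- Property I makes α look like the output of a step with ε = 0, so index 0 obeys the same
    -- bounds as the later remainders.
    A≤ : ∀ n → ∣ A n ∣∞≤ ½ * scale (parity n)
    A≤ zero    = α≤1
    A≤ (suc n) = T-≤∞ (parity (suc n)) (A n)

    A-ν : ∀ n → gain (parity n) ≤ν A n
    A-ν zero    = valued (proj₂ prop)
    A-ν (suc n) = T-≤ν (parity (suc n)) (A n)

    A≤1 : ∀ n → ∣ A n ∣∞≤ 1ℚ
    A≤1 n = ∣∣∞-mono (½scale≤1 (parity n)) (A≤ n)
      where
      ½scale≤1 : ∀ ε → ½ * scale ε ≤ 1ℚ
      ½scale≤1 0ℙ = ℚₚ.≤-refl
      ½scale≤1 1ℙ = from-yes (½ ℚₚ.≤? 1ℚ)

    0≤ν-A : ∀ n → 0 ≤ν A n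
    0≤ν-A n = ≤ν-weaken ℕ.z≤n (A-ν n)

    AA≤½ : ∀ n → ∣ A n *K A (suc n) ∣∞≤ ½
    AA≤½ n = ∣∣∞-mono (ℚₚ.≤-reflexive (½scale*½scale (opposite-parities n))) (∣∣∞-* (A≤ n) (A≤ (suc n)))
      where
      ½scale*½scale : ∀ {ε ε′} → (ε ≡ 0ℙ × ε′ ≡ 1ℙ) ⊎ (ε ≡ 1ℙ × ε′ ≡ 0ℙ) → ½ * scale ε * (½ * scale ε′) ≡ ½
      ½scale*½scale (inj₁ (refl , refl)) = refl
      ½scale*½scale (inj₂ (refl , refl)) = refl

    AA-ν : ∀ n → 1 ≤ν A n *K A (suc n)
    AA-ν n = ≤ν-weaken (ℕₚ.≤-reflexive (gain+gain (opposite-parities n))) (≤ν-* (A-ν n) (A-ν (suc n)))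
      where
      gain+gain : ∀ {ε ε′} → (ε ≡ 0ℙ × ε′ ≡ 1ℙ) ⊎ (ε ≡ 1ℙ × ε′ ≡ 0ℙ) → 1 ≡ gain ε ℕ.+ gain ε′
      gain+gain (inj₁ (refl , refl)) = refl
      gain+gain (inj₂ (refl , refl)) = refl

    A*b : ∀ n → A n *K ι (b n) ≈K 1K -K A n *K A (suc n)
    A*b n = R.trans (solve 3 (λ x i b → x :* b := x :* i :- x :* (i :- b)) R.refl (A n) (A n ⁻¹) (ι (b n)))
      (R.+-congʳ (*-inverse (A n) (A≉0 n)))
      where open K-Solver

    -- By `A*b` the product is 1 minus an element of positive valuation. Hence v₂ of `b n` is
    -- exactly minus the valuation of `A n`.
    Ab-unit : ∀ n → ¬ 1 ≤ν A n *K ι (b n)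
    Ab-unit n h = ≰ν1 (≤ν-cong (solve 2 (λ o x → (o :- x) :+ x := o) R.refl 1K (A n *K A (suc n)))
      (≤ν-+ (≤ν-cong (A*b n) h) (AA-ν n)))
      where open K-Solver

    dyadic-b : ∀ n → Dyadic (b n)
    dyadic-b n = dyadic-partialQuotient (parity (suc n)) (A n)

    b≢0 : ∀ n → b n ≢ 0ℚ
    b≢0 n b≡0 = Ab-unit n (≤ν-cong (R.sym (R.*-congˡ (ι-cong b≡0)))
      (≤ν-* (0≤ν-A n) (≤ν-ι/1 (+ 0) (ℤ∣.divides (+ 0) refl))))

    -- The valuation is never positive, by `v₂-b`, so this is its negative.
    f : ℕ → ℕ
    f n = ℤ.∣ v₂ (b n) ∣

    abstract
      m : ℕ → ℤ
      m n = proj₁ (odd-part (dyadic-b n) (b≢0 n))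

      m-odd : ∀ n → Odd (m n)
      m-odd n = proj₁ (proj₂ (odd-part (dyadic-b n) (b≢0 n)))

      m≡ : ∀ n → 2^ (ℤ.- v₂ (b n)) * b n ≡ m n / 1
      m≡ n = proj₂ (proj₂ (odd-part (dyadic-b n) (b≢0 n)))

    -- A valuation k ≥ 0 of `b n` would add to the gain of `A n`, and `Ab-unit` forces both to
    -- vanish.
    v₂-b : ∀ n → v₂ (b n) ≡ ℤ.- + f n × gain (parity n) ℕ.≤ f n
    v₂-b n = go (v₂ (b n)) (m≡ n)
      where
      go : ∀ v → 2^ (ℤ.- v) * b n ≡ m n / 1 → v ≡ ℤ.- + ℤ.∣ v ∣ × gain (parity n) ℕ.≤ ℤ.∣ v ∣
      go -[1+ k ] eq = refl , ℕₚ.≤-trans (gain≤1 (parity n)) (ℕ.s≤s ℕ.z≤n)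
        where
        gain≤1 : ∀ ε → gain ε ℕ.≤ 1
        gain≤1 0ℙ = ℕₚ.≤-refl
        gain≤1 1ℙ = ℕ.z≤n
      go (+ k) eq = vanish (gain (parity n)) k (≤ν-* (A-ν n) k≤b)
        where
        b≡ : 2^ (+ k) * (m n / 1) ≡ b n
        b≡ = trans (cong (2^ (+ k) *_) (sym eq)) (trans (sym (ℚₚ.*-assoc (2^ (+ k)) (2^ (ℤ.- + k)) (b n)))
          (trans (cong (_* b n) (inverse k)) (ℚₚ.*-identityˡ (b n))))
          where
          inverse : ∀ k → 2^ (+ k) * 2^ (ℤ.- + k) ≡ 1ℚ
          inverse zero    = refl
          inverse (suc k) = 2^*½^≡1 (suc k)
        k≤b : k ≤ν ι (b n)
        k≤b = ≤ν-cong (R.trans (R.sym (ιH.*-homo (2^ (+ k)) (m n / 1))) (ι-cong b≡))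
          (subst (_≤ν ι (2^ (+ k)) *K ι (m n / 1)) (ℕₚ.+-identityʳ k) (≤ν-* (≤ν-2^ k) (0≤ν-ι/1 (m n))))
        vanish : ∀ g k → g ℕ.+ k ≤ν A n *K ι (b n) → + k ≡ ℤ.- + k × g ℕ.≤ k
        vanish zero    zero    h = refl , ℕ.z≤n
        vanish zero    (suc k) h = contradiction (≤ν-weaken (ℕ.s≤s ℕ.z≤n) h) (Ab-unit n)
        vanish (suc g) k       h = contradiction (≤ν-weaken (ℕ.s≤s ℕ.z≤n) h) (Ab-unit n)

    2^f*b : ∀ n → 2^ (+ f n) * b n ≡ m n / 1
    2^f*b n = trans (cong (λ v → 2^ v * b n) (sym (trans (cong ℤ.-_ (proj₁ (v₂-b n))) (ℤₚ.neg-involutive (+ f n))))) (m≡ n)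

    1≤f+f : ∀ n → 1 ℕ.≤ f n ℕ.+ f (suc n)
    1≤f+f n = 1≤i+j (opposite-parities n) (proj₂ (v₂-b n)) (proj₂ (v₂-b (suc n)))
      where
      1≤i+j : ∀ {ε ε′ i j} → (ε ≡ 0ℙ × ε′ ≡ 1ℙ) ⊎ (ε ≡ 1ℙ × ε′ ≡ 0ℙ) → gain ε ℕ.≤ i → gain ε′ ℕ.≤ j → 1 ℕ.≤ i ℕ.+ j
      1≤i+j {i = i} {j} (inj₁ (refl , refl)) h _ = ℕₚ.≤-trans h (ℕₚ.m≤m+n i j)
      1≤i+j {i = i} {j} (inj₂ (refl , refl)) _ h = ℕₚ.≤-trans h (ℕₚ.m≤n+m j i)

    -- Multiplying `A*b` by 2^f replaces `b n` by the odd integer `m n`, which does not affect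
    -- valuations, and leaves 2^f times an integral element on the right.
    f≤ν-A : ∀ n → f n ≤ν A n
    f≤ν-A n = ≤ν-odd (m-odd n) (≤ν-cong (R.sym mA≈) (subst (_≤ν ι (2^ (+ f n)) *K (1K -K A n *K A (suc n))) (ℕₚ.+-identityʳ (f n))
      (≤ν-* (≤ν-2^ (f n)) 0≤ν-1-AA)))
      where
      open K-Solver
      0≤ν-1-AA : 0 ≤ν 1K -K A n *K A (suc n)
      0≤ν-1-AA = ≤ν-+ (≤ν-cong 1K≈ (0≤ν-ι/1 (+ 1))) (≤ν-neg (≤ν-weaken ℕ.z≤n (AA-ν n)))
      mA≈ : ι (m n / 1) *K A n ≈K ι (2^ (+ f n)) *K (1K -K A n *K A (suc n))
      mA≈ = R.trans (R.*-congʳ (R.trans (ι-cong (sym (2^f*b n))) (ιH.*-homo (2^ (+ f n)) (b n))))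
        (R.trans (solve 3 (λ t b x → t :* b :* x := t :* (x :* b)) R.refl (ι (2^ (+ f n))) (ι (b n)) (A n)) (R.*-congˡ (A*b n)))

    e : ℕ → ℕ
    e zero    = 0
    e (suc n) = e n ℕ.+ f n

    Σv₂≡ : ∀ n → Σv₂ α n ≡ ℤ.- + e n
    Σv₂≡ zero    = refl
    Σv₂≡ (suc n) = trans (cong₂ ℤ._+_ (Σv₂≡ n) (proj₁ (v₂-b n)))
      (trans (sym (ℤₚ.neg-distrib-+ (+ e n) (+ f n))) (cong ℤ.-_ (sym (ℤₚ.pos-+ (e n) (f n)))))

    p⁻ q⁻ : ℕ → ℚ
    p⁻ n = Mat₂.m₁₁ (convergents α n)
    q⁻ n = Mat₂.m₂₁ (convergents α n)

    private
      first-column : ∀ s t → s * 0ℚ + t * 1ℚ ≡ t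
      first-column = solve 2 (λ s t → s :* con 0ℚ :+ t :* con 1ℚ := t) refl
        where open ℚ-Solver
      second-column : ∀ s t u → s * 1ℚ + t * u ≡ s + t * u
      second-column s t u = cong (_+ t * u) (ℚₚ.*-identityʳ s)

    p⁻-suc : ∀ n → p⁻ (suc n) ≡ p α n
    p⁻-suc n = first-column (p⁻ n) (p α n)

    q⁻-suc : ∀ n → q⁻ (suc n) ≡ q α n
    q⁻-suc n = first-column (q⁻ n) (q α n)

    p-suc : ∀ n → p α (suc n) ≡ p⁻ n + p α n * b n
    p-suc n = second-column (p⁻ n) (p α n) (b n)

    q-suc : ∀ n → q α (suc n) ≡ q⁻ n + q α n * b n
    q-suc n = second-column (q⁻ n) (q α n) (b n)

    dyadic-convergents : ∀ n → (Dyadic (p⁻ n) × Dyadic (p α n)) × (Dyadic (q⁻ n) × Dyadic (q α n))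
    dyadic-convergents zero = (dyadic-/1 (+ 1) , dyadic-/1 (+ 0)) , (dyadic-/1 (+ 0) , dyadic-/1 (+ 1))
    dyadic-convergents (suc n) =
      let (p⁻-dy , p-dy) , (q⁻-dy , q-dy) = dyadic-convergents n in
      (subst Dyadic (sym (p⁻-suc n)) p-dy , subst Dyadic (sym (p-suc n)) (dyadic-+ p⁻-dy (dyadic-* p-dy (dyadic-b n)))) ,
      (subst Dyadic (sym (q⁻-suc n)) q-dy , subst Dyadic (sym (q-suc n)) (dyadic-+ q⁻-dy (dyadic-* q-dy (dyadic-b n))))

    -- y n is q_{n-1} α - p_{n-1}.
    y : ℕ → Carrier
    y zero    = -K 1K
    y (suc n) = -K (A n *K y n)

    y-suc-suc : ∀ n → y (suc (suc n)) ≈K A n *K A (suc n) *K y n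
    y-suc-suc n = solve 3 (λ x x′ y → :- (x′ :* (:- (x :* y))) := x :* x′ :* y) R.refl (A n) (A (suc n)) (y n)
      where open K-Solver

    ι-second : ∀ n s t → ι (s + t * b n) ≈K ι s +K ι t *K ι (b n)
    ι-second n s t = R.trans (ιH.+-homo s (t * b n)) (R.+-congˡ (ιH.*-homo t (b n)))

    -- Both sides satisfy the recursion of the convergents: y (n+2) = y n + y (n+1) b n amounts to
    -- `A*b`.
    y-convergents : ∀ n → (ι (q⁻ n) *K α -K ι (p⁻ n) ≈K y n) × (ι (q α n) *K α -K ι (p α n) ≈K y (suc n))
    y-convergents zero =
      R.trans (R.+-cong (R.trans (R.*-congʳ ιH.0#-homo) (R.zeroˡ α)) (R.-‿cong 1K≈)) (R.+-identityˡ (-K 1K)) ,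
      R.trans (R.+-cong (R.trans (R.*-congʳ 1K≈) (R.*-identityˡ α)) (R.-‿cong ιH.0#-homo))
        (R.trans (R.trans (R.+-congˡ -0≈0) (R.+-identityʳ α)) (R.trans (R.sym (R.*-identityʳ α))
          (solve 2 (λ x o → x :* o := :- (x :* (:- o))) R.refl α 1K)))
      where
      open K-Solver
    y-convergents (suc n) = let h , k = y-convergents n in
      R.trans (R.+-cong (R.*-congʳ (ι-cong (q⁻-suc n))) (R.-‿cong (ι-cong (p⁻-suc n)))) k , (begin
      ι (q α (suc n)) *K α -K ι (p α (suc n))
        ≈⟨ R.+-cong (R.*-congʳ (R.trans (ι-cong (q-suc n)) (ι-second n (q⁻ n) (q α n))))
             (R.-‿cong (R.trans (ι-cong (p-suc n)) (ι-second n (p⁻ n) (p α n)))) ⟩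
      (ι (q⁻ n) +K ι (q α n) *K ι (b n)) *K α -K (ι (p⁻ n) +K ι (p α n) *K ι (b n))
        ≈⟨ solve 6 (λ q⁻ q b x p⁻ p → (q⁻ :+ q :* b) :* x :- (p⁻ :+ p :* b) := (q⁻ :* x :- p⁻) :+ (q :* x :- p) :* b) R.refl
             (ι (q⁻ n)) (ι (q α n)) (ι (b n)) α (ι (p⁻ n)) (ι (p α n)) ⟩
      (ι (q⁻ n) *K α -K ι (p⁻ n)) +K (ι (q α n) *K α -K ι (p α n)) *K ι (b n)
        ≈⟨ R.+-cong h (R.*-congʳ k) ⟩
      y n +K (-K (A n *K y n)) *K ι (b n)
        ≈⟨ solve 3 (λ y x b → y :+ (:- (x :* y)) :* b := y :- (x :* b) :* y) R.refl (y n) (A n) (ι (b n)) ⟩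
      y n -K (A n *K ι (b n)) *K y n
        ≈⟨ R.+-cong (R.sym (R.*-identityˡ (y n))) (R.-‿cong (R.*-congʳ (A*b n))) ⟩
      1K *K y n -K (1K -K A n *K A (suc n)) *K y n
        ≈⟨ solve 3 (λ o x y → o :* y :- (o :- x) :* y := x :* y) R.refl 1K (A n *K A (suc n)) (y n) ⟩
      A n *K A (suc n) *K y n
        ≈⟨ R.sym (y-suc-suc n) ⟩
      y (suc (suc n)) ∎)
      where
      open K-Solver
      open import Relation.Binary.Reasoning.Setoid R.setoid

    y≉0 : ∀ n → ¬ y n ≈K 0K
    y≉0 zero    = -‿≉0 1≉0
    y≉0 (suc n) = -‿≉0 (*≉0 (A≉0 n) (y≉0 n))

    y≤1 : ∀ n → ∣ y n ∣∞≤ 1ℚ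
    y≤1 zero    = ∣∣∞-neg ∣∣∞-1
    y≤1 (suc n) = ∣∣∞-neg (∣∣∞-* (A≤1 n) (y≤1 n))

    y≤½^ : ∀ n → ∣ y (n ℕ.+ n) ∣∞≤ ½ ^ n
    y≤½^ zero    = y≤1 0
    y≤½^ (suc n) = subst (λ k → ∣ y (suc k) ∣∞≤ ½ ^ suc n) (sym (ℕₚ.+-suc n n))
      (∣∣∞-cong (R.sym (y-suc-suc (n ℕ.+ n))) (∣∣∞-* (AA≤½ (n ℕ.+ n)) (y≤½^ n)))

    e≤ν-y : ∀ n → e n ≤ν y n
    e≤ν-y zero    = ≤ν-neg (≤ν-cong 1K≈ (0≤ν-ι/1 (+ 1)))
    e≤ν-y (suc n) = ≤ν-neg (subst (_≤ν A n *K y n) (ℕₚ.+-comm (f n) (e n)) (≤ν-* (f≤ν-A n) (e≤ν-y n)))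

    D : ℕ → ℚ
    D zero    = 1ℚ
    D (suc n) = - D n

    determinant : ∀ n → p⁻ n * q α n - p α n * q⁻ n ≡ D n
    determinant zero    = refl
    determinant (suc n) = begin
      p⁻ (suc n) * q α (suc n) - p α (suc n) * q⁻ (suc n)
        ≡⟨ cong₂ _-_ (cong₂ _*_ (p⁻-suc n) (q-suc n)) (cong₂ _*_ (p-suc n) (q⁻-suc n)) ⟩
      p α n * (q⁻ n + q α n * b n) - (p⁻ n + p α n * b n) * q α n
        ≡⟨ solve 5 (λ p⁻ p q⁻ q b → p :* (q⁻ :+ q :* b) :- (p⁻ :+ p :* b) :* q := :- (p⁻ :* q :- p :* q⁻)) refl (p⁻ n) (p α n) (q⁻ n) (q α n) (b n) ⟩
      - (p⁻ n * q α n - p α n * q⁻ n)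
        ≡⟨ cong -_ (determinant n) ⟩
      D (suc n) ∎
      where
      open ≡-Reasoning
      open ℚ-Solver

    D-ν : ∀ n → 0 ≤ν ι (D n)
    D-ν zero    = 0≤ν-ι/1 (+ 1)
    D-ν (suc n) = ≤ν-cong (R.sym (ιH.-‿homo (D n))) (≤ν-neg (D-ν n))

    D≤1 : ∀ n → ∣ ι (D n) ∣∞≤ 1ℚ
    D≤1 zero    = ∣∣∞-ι {1ℚ} ℚₚ.≤-refl
    D≤1 (suc n) = ∣∣∞-cong (R.sym (ιH.-‿homo (D n))) (∣∣∞-neg (D≤1 n))

    -- Growth of q and decay of y compensate at both places, so bounds on this product replace
    -- separate estimates of q.
    w : ℕ → Carrier
    w n = ι (q α n) *K y n

    -- q_{n+1} y (n+1) and q_n y (n+2) differ only by the determinant of two consecutive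
    -- convergents.
    w-suc : ∀ n → w (suc n) ≈K A n *K A (suc n) *K w n -K ι (D (suc n))
    w-suc n = begin
      Q′ *K y (suc n)  ≈⟨ R.*-congˡ (R.sym (proj₂ (y-convergents n))) ⟩
      Q′ *K (Q *K α -K P)  ≈⟨ solve 5 (λ Q′ Q x P P′ → Q′ :* (Q :* x :- P) := Q :* (Q′ :* x :- P′) :- (P :* Q′ :- P′ :* Q)) R.refl Q′ Q α P P′ ⟩
      Q *K (Q′ *K α -K P′) -K (P *K Q′ -K P′ *K Q)  ≈⟨ R.+-cong (R.*-congˡ (R.trans (proj₂ (y-convergents (suc n))) (y-suc-suc n))) (R.-‿cong det) ⟩
      Q *K (A n *K A (suc n) *K y n) -K ι (D (suc n))  ≈⟨ R.+-congʳ (solve 3 (λ Q x y → Q :* (x :* y) := x :* (Q :* y)) R.refl Q (A n *K A (suc n)) (y n)) ⟩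
      A n *K A (suc n) *K w n -K ι (D (suc n))  ∎
      where
      open K-Solver
      open import Relation.Binary.Reasoning.Setoid R.setoid
      Q = ι (q α n)
      Q′ = ι (q α (suc n))
      P = ι (p α n)
      P′ = ι (p α (suc n))
      det : P *K Q′ -K P′ *K Q ≈K ι (D (suc n))
      det = R.trans (R.+-cong (R.sym (ιH.*-homo (p α n) (q α (suc n))))
          (R.trans (R.-‿cong (R.sym (ιH.*-homo (p α (suc n)) (q α n)))) (R.sym (ιH.-‿homo (p α (suc n) * q α n)))))
        (R.trans (R.sym (ιH.+-homo (p α n * q α (suc n)) (- (p α (suc n) * q α n))))
          (ι-cong (trans (cong₂ (λ s t → s * q α (suc n) - p α (suc n) * t) (sym (p⁻-suc n)) (sym (q⁻-suc n))) (determinant (suc n)))))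

    -- 2 is the fixed point of t ↦ t/2 + 1.
    w≤2 : ∀ n → ∣ w n ∣∞≤ + 2 / 1
    w≤2 zero    = ∣∣∞-mono (from-yes (1ℚ * 1ℚ ℚₚ.≤? + 2 / 1)) (∣∣∞-* (∣∣∞-ι {1ℚ} ℚₚ.≤-refl) (y≤1 0))
    w≤2 (suc n) = ∣∣∞-cong (R.sym (w-suc n)) (∣∣∞-+ (∣∣∞-* (AA≤½ n) (w≤2 n)) (∣∣∞-neg (D≤1 (suc n))))

    w-ν : ∀ n → 0 ≤ν w n
    w-ν zero    = ≤ν-* (0≤ν-ι/1 (+ 1)) (e≤ν-y 0)
    w-ν (suc n) = ≤ν-cong (R.sym (w-suc n)) (≤ν-+ (≤ν-* (≤ν-weaken ℕ.z≤n (AA-ν n)) (w-ν n)) (≤ν-neg (D-ν (suc n))))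

    -- The next scaled denominator is the second, even number plus the product of the odd numbers
    -- `N` and `m n`. Evenness persists because f n + f (n+1) ≥ 1. Oddness allows multiplication by
    -- q′ without changing valuations.
    odd-q : ∀ n → (∃ λ N → Odd N × 2^ (+ e n) * q α n ≡ N / 1) × (∃ λ t → 2^ (+ (e n ℕ.+ f n)) * q⁻ n ≡ (+ 2 ℤ.* t) / 1)
    odd-q zero = (+ 1 , (+ 0 , refl) , refl) , (+ 0 , ℚₚ.*-zeroʳ (2^ (+ f 0)))
    odd-q (suc n) =
      let (N , N-odd , N≡) , (t , t≡) = odd-q n in
      (N ℤ.* m n ℤ.+ + 2 ℤ.* t , odd-*-+ N-odd (m-odd n) t , (begin
        2^ (+ e (suc n)) * q α (suc n)  ≡⟨ cong (2^ (+ e (suc n)) *_) (q-suc n) ⟩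
        2^ (+ e (suc n)) * (q⁻ n + q α n * b n)  ≡⟨ ℚₚ.*-distribˡ-+ (2^ (+ e (suc n))) (q⁻ n) (q α n * b n) ⟩
        2^ (+ e (suc n)) * q⁻ n + 2^ (+ e (suc n)) * (q α n * b n)
          ≡⟨ cong₂ _+_ t≡ (trans (cong (_* (q α n * b n)) (ℚ^ₚ.^-homo-* (+ 2 / 1) (e n) (f n)))
               (trans (solve 4 (λ s u q b → s :* u :* (q :* b) := (s :* q) :* (u :* b)) refl (2^ (+ e n)) (2^ (+ f n)) (q α n) (b n))
                 (trans (cong₂ _*_ N≡ (2^f*b n)) (sym (/1-* N (m n)))))) ⟩
        (+ 2 ℤ.* t) / 1 + (N ℤ.* m n) / 1  ≡⟨ ℚₚ.+-comm ((+ 2 ℤ.* t) / 1) ((N ℤ.* m n) / 1) ⟩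
        (N ℤ.* m n) / 1 + (+ 2 ℤ.* t) / 1  ≡⟨ sym (/1-+ (N ℤ.* m n) (+ 2 ℤ.* t)) ⟩
        (N ℤ.* m n ℤ.+ + 2 ℤ.* t) / 1  ∎)) ,
      even N (f n ℕ.+ f (suc n)) (1≤f+f n) (begin
        2^ (+ (e n ℕ.+ f n ℕ.+ f (suc n))) * q⁻ (suc n)  ≡⟨ cong₂ _*_ (trans (cong ((+ 2 / 1) ^_) (ℕₚ.+-assoc (e n) (f n) (f (suc n))))
            (ℚ^ₚ.^-homo-* (+ 2 / 1) (e n) (f n ℕ.+ f (suc n)))) (q⁻-suc n) ⟩
        2^ (+ e n) * 2^ (+ (f n ℕ.+ f (suc n))) * q α n  ≡⟨ solve 3 (λ s u q → s :* u :* q := u :* (s :* q)) refl (2^ (+ e n)) (2^ (+ (f n ℕ.+ f (suc n)))) (q α n) ⟩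
        2^ (+ (f n ℕ.+ f (suc n))) * (2^ (+ e n) * q α n)  ≡⟨ cong (2^ (+ (f n ℕ.+ f (suc n))) *_) N≡ ⟩
        2^ (+ (f n ℕ.+ f (suc n))) * (N / 1)  ∎)
      where
      open ≡-Reasoning
      open ℚ-Solver
      odd-*-+ : ∀ {x y} → Odd x → Odd y → ∀ t → Odd (x ℤ.* y ℤ.+ + 2 ℤ.* t)
      odd-*-+ (s , refl) (u , refl) t = s ℤ.+ u ℤ.+ + 2 ℤ.* (s ℤ.* u) ℤ.+ t , lem s u t
        where
        lem : ∀ s u t → (+ 1 ℤ.+ + 2 ℤ.* s) ℤ.* (+ 1 ℤ.+ + 2 ℤ.* u) ℤ.+ + 2 ℤ.* t ≡ + 1 ℤ.+ + 2 ℤ.* (s ℤ.+ u ℤ.+ + 2 ℤ.* (s ℤ.* u) ℤ.+ t)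
        lem = S.solve 3 (λ s u t → (S.con (+ 1) S.:+ S.con (+ 2) S.:* s) S.:* (S.con (+ 1) S.:+ S.con (+ 2) S.:* u) S.:+ S.con (+ 2) S.:* t
          S.:= S.con (+ 1) S.:+ S.con (+ 2) S.:* (s S.:+ u S.:+ S.con (+ 2) S.:* (s S.:* u) S.:+ t)) refl
          where module S = ℤ-Solver
      even : ∀ N k → 1 ℕ.≤ k → ∀ {x} → x ≡ 2^ (+ k) * (N / 1) → ∃ λ t → x ≡ (+ 2 ℤ.* t) / 1
      even N (suc k) _ eq = pow₂ k ℤ.* N , trans eq (trans (cong (_* (N / 1)) (2^≡ (suc k)))
        (trans (sym (/1-* (pow₂ (suc k)) N)) (cong (_/ 1) (trans (cong (ℤ._* N) (pow₂-+ 1 k)) (ℤₚ.*-assoc (+ 2) (pow₂ k) N)))))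

    q′≡ : ∀ n → q′ α n ≡ 2^ (+ e n) * q α n
    q′≡ n = cong (λ i → 2^ i * q α n) (trans (cong ℤ.-_ (Σv₂≡ n)) (ℤₚ.neg-involutive (+ e n)))

    p′≡ : ∀ n → p′ α n ≡ 2^ (+ e n) * p α n
    p′≡ n = cong (λ i → 2^ i * p α n) (trans (cong ℤ.-_ (Σv₂≡ n)) (ℤₚ.neg-involutive (+ e n)))

    N : ℕ → ℤ
    N n = proj₁ (proj₁ (odd-q n))

    N-odd : ∀ n → Odd (N n)
    N-odd n = proj₁ (proj₂ (proj₁ (odd-q n)))

    q′≡N : ∀ n → q′ α n ≡ N n / 1
    q′≡N n = trans (q′≡ n) (proj₂ (proj₂ (proj₁ (odd-q n))))

  -- The approximation error and the quadratic forms

  /₀-* : ∀ r {s} → s ≢ 0ℚ → (r /₀ s) * s ≡ r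
  /₀-* r {s} s≢0 with s ℚₚ.≟ 0ℚ
  ... | yes s≡0 = contradiction s≡0 s≢0
  ... | no _    = trans (ℚₚ.*-assoc r _ s) (trans (cong (r *_) (ℚₚ.*-inverseˡ s {{≢-nonZero s≢0}})) (ℚₚ.*-identityʳ r))

  positive-*≡0 : ∀ k {x} → 0ℚ < k → k * x ≡ 0ℚ → x ≡ 0ℚ
  positive-*≡0 k {x} 0<k kx≡0 = begin
    x  ≡⟨ sym (*-inv k 0<k x) ⟩
    k * (inv k 0<k * x)  ≡⟨ solve 3 (λ k i x → k :* (i :* x) := i :* (k :* x)) refl k (inv k 0<k) x ⟩
    inv k 0<k * (k * x)  ≡⟨ cong (inv k 0<k *_) kx≡0 ⟩
    inv k 0<k * 0ℚ  ≡⟨ ℚₚ.*-zeroʳ (inv k 0<k) ⟩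
    0ℚ  ∎
    where
    open ≡-Reasoning
    open ℚ-Solver

  1≤∣integer∣ : ∀ i → i / 1 ≢ 0ℚ → 1ℚ ≤ ∣ i / 1 ∣
  1≤∣integer∣ (+ 0)     i≢0 = contradiction refl i≢0
  1≤∣integer∣ (+ suc k) _   = ℚₚ.≤-trans (/1-mono-≤ {+ 1} {+ suc k} (ℤ.+≤+ (ℕ.s≤s ℕ.z≤n))) (p≤∣p∣ (+ suc k / 1))
  1≤∣integer∣ -[1+ k ]  _   = ℚₚ.≤-trans (1≤∣integer∣ (+ suc k) λ eq → contradiction (/1-injective {+ suc k} {+ 0} eq) λ ())
    (ℚₚ.≤-reflexive (sym (ℚₚ.∣-p∣≡∣p∣ (+ suc k / 1))))

  odd⇒≢0 : ∀ {z} → Odd z → z / 1 ≢ 0ℚ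
  odd⇒≢0 {z} odd z≡0 = odd⇒2∤ odd (subst (+ 2 ℤ∣.∣_) (sym (/1-injective {z} {+ 0} z≡0)) (ℤ∣.divides (+ 0) refl))

  module Approximation {c ℓ} (K : EmbeddedQuadraticField c ℓ) (α : EmbeddedQuadraticField.Carrier K)
                       (irr : Algorithm.Irrational K α) (prop : Algorithm.PropertyI K α) where

    open Expansion K α irr prop public

    q′≢0 : ∀ n → q′ α n ≢ 0ℚ
    q′≢0 n q′≡0 = odd⇒≢0 (N-odd n) (trans (sym (q′≡N n)) q′≡0)

    q≢0 : ∀ n → q α n ≢ 0ℚ
    q≢0 n q≡0 = q′≢0 n (trans (q′≡ n) (trans (cong (2^ (+ e n) *_) q≡0) (ℚₚ.*-zeroʳ (2^ (+ e n)))))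

    E : ℕ → Carrier
    E n = α -K ι (p′ α n /₀ q′ α n)

    q*E : ∀ n → ι (q α n) *K E n ≈K y (suc n)
    q*E n = R.trans (solve 3 (λ q x r → q :* (x :- r) := q :* x :- r :* q) R.refl (ι (q α n)) α (ι r))
      (R.trans (R.+-congˡ (R.-‿cong (R.trans (R.sym (ιH.*-homo r (q α n))) (ι-cong rq≡p)))) (proj₂ (y-convergents n)))
      where
      open K-Solver
      r = p′ α n /₀ q′ α n
      rq≡p : r * q α n ≡ p α n
      rq≡p = 2^-cancel (e n) (begin
        r * q α n * 2^ (+ e n)  ≡⟨ trans (ℚₚ.*-assoc r (q α n) (2^ (+ e n))) (cong (r *_) (ℚₚ.*-comm (q α n) (2^ (+ e n)))) ⟩
        r * (2^ (+ e n) * q α n)  ≡⟨ cong (r *_) (sym (q′≡ n)) ⟩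
        r * q′ α n  ≡⟨ /₀-* (p′ α n) (q′≢0 n) ⟩
        p′ α n  ≡⟨ p′≡ n ⟩
        2^ (+ e n) * p α n  ≡⟨ ℚₚ.*-comm (2^ (+ e n)) (p α n) ⟩
        p α n * 2^ (+ e n)  ∎)
        where open ≡-Reasoning

    -- q′ times the error is 2^e y (n+1), and y (n+1) contributes at least another e; the odd q′ is
    -- then cancelled.
    2e≤ν-E : ∀ n → e n ℕ.+ e n ≤ν E n
    2e≤ν-E n = ≤ν-odd (N-odd n) (≤ν-cong (R.sym NE≈)
      (≤ν-weaken (ℕₚ.+-monoʳ-≤ (e n) (ℕₚ.m≤m+n (e n) (f n))) (≤ν-* (≤ν-2^ (e n)) (e≤ν-y (suc n)))))
      where
      NE≈ : ι (N n / 1) *K E n ≈K ι (2^ (+ e n)) *K y (suc n)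
      NE≈ = R.trans (R.*-congʳ (R.trans (ι-cong (trans (sym (q′≡N n)) (q′≡ n))) (ιH.*-homo (2^ (+ e n)) (q α n))))
        (R.trans (R.*-assoc (ι (2^ (+ e n))) (ι (q α n)) (E n)) (R.*-congˡ (q*E n)))

    w≉0 : ∀ n → ¬ w n ≈K 0K
    w≉0 n = *≉0 (λ q≈0 → q≢0 n (ι-injective (R.trans q≈0 (R.sym ιH.0#-homo)))) (y≉0 n)

    -- Isolates the square of the decaying form. What remains is bounded as soon as the inverse of
    -- `w n` is.
    E≈ : ∀ n → E n ≈K -K (A n *K w n ⁻¹) *K (y n *K y n)
    E≈ n = begin
      E n  ≈⟨ R.sym (R.*-identityʳ (E n)) ⟩
      E n *K 1K  ≈⟨ R.*-congˡ (R.sym (*-inverse (w n) (w≉0 n))) ⟩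
      E n *K (ι (q α n) *K y n *K w n ⁻¹)  ≈⟨ solve 4 (λ x q y w → x :* (q :* y :* w) := (q :* x) :* (y :* w)) R.refl (E n) (ι (q α n)) (y n) (w n ⁻¹) ⟩
      (ι (q α n) *K E n) *K (y n *K w n ⁻¹)  ≈⟨ R.*-congʳ (q*E n) ⟩
      (-K (A n *K y n)) *K (y n *K w n ⁻¹)  ≈⟨ solve 3 (λ x y w → (:- (x :* y)) :* (y :* w) := (:- (x :* w)) :* (y :* y)) R.refl (A n) (y n) (w n ⁻¹) ⟩
      -K (A n *K w n ⁻¹) *K (y n *K y n)  ∎
      where
      open K-Solver
      open import Relation.Binary.Reasoning.Setoid R.setoid

    -- Squaring s + t θ with θ² = u + v θ; the rationals found are the trace and the norm of α.
    quadratic : ∃₂ λ τ ν → α *K α ≈K ι τ *K α -K ι ν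
    quadratic =
      let s , t , α≈ = spanning α
          u , v , θ²≈ = spanning (θ *K θ)
          τ = (+ 2 / 1) * s + t * v
          ν = s * s + s * t * v - t * t * u
      in τ , ν , (begin
        α *K α
          ≈⟨ R.*-cong α≈ α≈ ⟩
        (ι s +K ι t *K θ) *K (ι s +K ι t *K θ)
          ≈⟨ solve 3 (λ s t x → (s :+ t :* x) :* (s :+ t :* x) := s :* s :+ con (+ 2 / 1) :* s :* t :* x :+ t :* t :* (x :* x)) R.refl (ι s) (ι t) θ ⟩
        ι s *K ι s +K ι (+ 2 / 1) *K ι s *K ι t *K θ +K ι t *K ι t *K (θ *K θ)
          ≈⟨ R.+-congˡ (R.*-congˡ θ²≈) ⟩
        ι s *K ι s +K ι (+ 2 / 1) *K ι s *K ι t *K θ +K ι t *K ι t *K (ι u +K ι v *K θ)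
          ≈⟨ solve 5 (λ s t u v x → s :* s :+ con (+ 2 / 1) :* s :* t :* x :+ t :* t :* (u :+ v :* x) :=
               (con (+ 2 / 1) :* s :+ t :* v) :* (s :+ t :* x) :- (s :* s :+ s :* t :* v :- t :* t :* u)) R.refl (ι s) (ι t) (ι u) (ι v) θ ⟩
        (ι (+ 2 / 1) *K ι s +K ι t *K ι v) *K (ι s +K ι t *K θ) -K (ι s *K ι s +K ι s *K ι t *K ι v -K ι t *K ι t *K ι u)
          ≈⟨ R.+-cong (R.*-cong
               (R.sym (R.trans (ιH.+-homo ((+ 2 / 1) * s) (t * v)) (R.+-cong (ιH.*-homo (+ 2 / 1) s) (ιH.*-homo t v)))) (R.sym α≈))
               (R.-‿cong (R.sym (R.trans (ιH.+-homo (s * s + s * t * v) (- (t * t * u)))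
                 (R.+-cong (R.trans (ιH.+-homo (s * s) (s * t * v)) (R.+-cong (ιH.*-homo s s) (ι-*₃ s t v)))
                   (R.trans (ιH.-‿homo (t * t * u)) (R.-‿cong (ι-*₃ t t u))))))) ⟩
        ι τ *K α -K ι ν ∎)
      where
      open K-Solver
      open import Relation.Binary.Reasoning.Setoid R.setoid

    abstract
      τ ν : ℚ
      τ = proj₁ quadratic
      ν = proj₁ (proj₂ quadratic)

      α² : α *K α ≈K ι τ *K α -K ι ν
      α² = proj₂ (proj₂ quadratic)

    -- κ clears the denominators of τ and ν.
    κ : ℚ
    κ = (↧ τ / 1) * (↧ ν / 1)

    1≤κ : 1ℚ ≤ κ
    1≤κ = 1≤* (1≤-denominator τ) (1≤-denominator ν)

    0<κ : 0ℚ < κ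
    0<κ = ℚₚ.<-≤-trans 0<1 1≤κ

    0≤κ : 0ℚ ≤ κ
    0≤κ = ℚₚ.<⇒≤ 0<κ

    κ-integer : κ ≡ (↧ τ ℤ.* ↧ ν) / 1
    κ-integer = sym (/1-* (↧ τ) (↧ ν))

    κτ-integer : κ * τ ≡ (↥ τ ℤ.* ↧ ν) / 1
    κτ-integer = trans (solve 3 (λ s t u → s :* t :* u := (u :* s) :* t) refl (↧ τ / 1) (↧ ν / 1) τ)
      (trans (cong (_* (↧ ν / 1)) (*-denominator τ)) (sym (/1-* (↥ τ) (↧ ν))))
      where open ℚ-Solver

    κν-integer : κ * ν ≡ (↧ τ ℤ.* ↥ ν) / 1
    κν-integer = trans (solve 3 (λ s t u → s :* t :* u := s :* (u :* t)) refl (↧ τ / 1) (↧ ν / 1) ν)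
      (trans (cong ((↧ τ / 1) *_) (*-denominator ν)) (sym (/1-* (↧ τ) (↥ ν))))
      where open ℚ-Solver

    -- norm n is the norm of y n, the coefficient of x² in the quadratic form
    -- of discriminant τ² - 4ν with root A n.
    norm G : ℕ → ℚ
    norm n = p⁻ n * p⁻ n - p⁻ n * q⁻ n * τ + q⁻ n * q⁻ n * ν
    G n = p α n * q⁻ n * τ - p α n * p⁻ n - q α n * q⁻ n * ν

    ι-norm : ∀ n → ι (norm n) ≈K ι (p⁻ n) *K ι (p⁻ n) -K ι (p⁻ n) *K ι (q⁻ n) *K ι τ +K ι (q⁻ n) *K ι (q⁻ n) *K ι ν
    ι-norm n = R.trans (ιH.+-homo (p⁻ n * p⁻ n - p⁻ n * q⁻ n * τ) (q⁻ n * q⁻ n * ν))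
      (R.+-cong (R.trans (ιH.+-homo (p⁻ n * p⁻ n) (- (p⁻ n * q⁻ n * τ))) (R.+-cong (ιH.*-homo (p⁻ n) (p⁻ n))
        (R.trans (ιH.-‿homo (p⁻ n * q⁻ n * τ)) (R.-‿cong (ι-*₃ (p⁻ n) (q⁻ n) τ))))) (ι-*₃ (q⁻ n) (q⁻ n) ν))

    ι-G : ∀ n → ι (G n) ≈K ι (p α n) *K ι (q⁻ n) *K ι τ -K ι (p α n) *K ι (p⁻ n) -K ι (q α n) *K ι (q⁻ n) *K ι ν
    ι-G n = R.trans (ιH.+-homo (p α n * q⁻ n * τ - p α n * p⁻ n) (- (q α n * q⁻ n * ν)))
      (R.+-cong (R.trans (ιH.+-homo (p α n * q⁻ n * τ) (- (p α n * p⁻ n))) (R.+-cong (ι-*₃ (p α n) (q⁻ n) τ)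
        (R.trans (ιH.-‿homo (p α n * p⁻ n)) (R.-‿cong (ιH.*-homo (p α n) (p⁻ n))))))
        (R.trans (ιH.-‿homo (q α n * q⁻ n * ν)) (R.-‿cong (ι-*₃ (q α n) (q⁻ n) ν))))

    2α = ι (+ 2 / 1) *K α

    -- τ - α is the conjugate of α, so y n + q⁻ (τ - 2α) is the conjugate of y n.
    norm≈ : ∀ n → ι (norm n) ≈K y n *K y n +K y n *K ι (q⁻ n) *K (ι τ -K 2α)
    norm≈ n = begin
      ι (norm n)  ≈⟨ ι-norm n ⟩
      P *K P -K P *K Q *K ι τ +K Q *K Q *K ι ν  ≈⟨ solve 5 (λ P Q t v x → P :* P :- P :* Q :* t :+ Q :* Q :* v :=
          (Q :* x :- P) :* (Q :* x :- P) :+ (Q :* x :- P) :* Q :* (t :- con (+ 2 / 1) :* x)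
          :+ Q :* Q :* (x :* x :- (t :* x :- v))) R.refl P Q (ι τ) (ι ν) α ⟩
      (Q *K α -K P) *K (Q *K α -K P) +K (Q *K α -K P) *K Q *K (ι τ -K 2α) +K Q *K Q *K (α *K α -K (ι τ *K α -K ι ν))
        ≈⟨ R.+-cong (R.+-cong (R.*-cong h h) (R.*-congʳ (R.*-congʳ h)))
             (R.trans (R.*-congˡ (R.trans (R.+-congʳ α²) (R.-‿inverseʳ _))) (R.zeroʳ _)) ⟩
      y n *K y n +K y n *K Q *K (ι τ -K 2α) +K 0K  ≈⟨ R.+-identityʳ _ ⟩
      y n *K y n +K y n *K Q *K (ι τ -K 2α)  ∎
      where
      open K-Solver
      open import Relation.Binary.Reasoning.Setoid R.setoid
      P = ι (p⁻ n)
      Q = ι (q⁻ n)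
      h = proj₁ (y-convergents n)

    -- As q⁻ (n+1) is q_n, the second summand becomes a multiple of w n, which is controlled at both
    -- places.
    norm-suc≈ : ∀ n → ι (norm (suc n)) ≈K y (suc n) *K y (suc n) -K A n *K w n *K (ι τ -K 2α)
    norm-suc≈ n = R.trans (norm≈ (suc n)) (R.+-congˡ
      (R.trans (R.*-congʳ (R.*-congˡ (ι-cong (q⁻-suc n))))
        (solve 4 (λ x y q t → (:- (x :* y)) :* q :* t := :- (x :* (q :* y) :* t)) R.refl (A n) (y n) (ι (q α n)) (ι τ -K 2α))))
      where open K-Solver

    -- A n is -y (n+1) / y n, so the left side is -y (n+1) times the conjugate of y n. Expanded, its
    -- coefficient of α is the determinant of the convergents.
    norm*A : ∀ n → ι (norm n) *K A n ≈K ι (D n) *K α +K ι (G n)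
    norm*A n = begin
      ι (norm n) *K A n
        ≈⟨ R.*-congʳ (norm≈ n) ⟩
      (y n *K y n +K y n *K Q⁻ *K (ι τ -K 2α)) *K A n
        ≈⟨ solve 5 (λ y q t s x → (y :* y :+ y :* q :* (t :- s)) :* x := :- ((:- (x :* y)) :* (y :+ q :* (t :- s)))) R.refl (y n) Q⁻ (ι τ) 2α (A n) ⟩
      -K (y (suc n) *K (y n +K Q⁻ *K (ι τ -K 2α)))
        ≈⟨ R.-‿cong (R.*-cong (R.sym (proj₂ (y-convergents n))) (R.+-congʳ (R.sym (proj₁ (y-convergents n))))) ⟩
      -K ((Q *K α -K P) *K (Q⁻ *K α -K P⁻ +K Q⁻ *K (ι τ -K 2α)))
        ≈⟨ solve 7 (λ Q⁻ Q P⁻ P t v x → :- ((Q :* x :- P) :* (Q⁻ :* x :- P⁻ :+ Q⁻ :* (t :- con (+ 2 / 1) :* x))) :=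
             ((P⁻ :* Q :- P :* Q⁻) :* x :+ (P :* Q⁻ :* t :- P :* P⁻ :- Q :* Q⁻ :* v)) :+ Q :* Q⁻ :* (x :* x :- (t :* x :- v))) R.refl Q⁻ Q P⁻ P (ι τ) (ι ν) α ⟩
      ((P⁻ *K Q -K P *K Q⁻) *K α +K (P *K Q⁻ *K ι τ -K P *K P⁻ -K Q *K Q⁻ *K ι ν)) +K Q *K Q⁻ *K (α *K α -K (ι τ *K α -K ι ν))
        ≈⟨ R.+-cong (R.+-cong (R.*-congʳ det) (R.sym (ι-G n))) (R.trans (R.*-congˡ (R.trans (R.+-congʳ α²) (R.-‿inverseʳ _))) (R.zeroʳ _)) ⟩
      (ι (D n) *K α +K ι (G n)) +K 0K
        ≈⟨ R.+-identityʳ _ ⟩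
      ι (D n) *K α +K ι (G n) ∎
      where
      open K-Solver
      open import Relation.Binary.Reasoning.Setoid R.setoid
      P⁻ = ι (p⁻ n)
      Q⁻ = ι (q⁻ n)
      P = ι (p α n)
      Q = ι (q α n)
      det : P⁻ *K Q -K P *K Q⁻ ≈K ι (D n)
      det = R.trans (R.+-cong (R.sym (ιH.*-homo (p⁻ n) (q α n))) (R.trans (R.-‿cong (R.sym (ιH.*-homo (p α n) (q⁻ n)))) (R.sym (ιH.-‿homo (p α n * q⁻ n)))))
        (R.trans (R.sym (ιH.+-homo (p⁻ n * q α n) (- (p α n * q⁻ n)))) (ι-cong (determinant n)))

    D*D : ∀ n → D n * D n ≡ 1ℚ
    D*D zero    = refl
    D*D (suc n) = trans (solve 1 (λ x → (:- x) :* (:- x) := x :* x) refl (D n)) (D*D n)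
      where open ℚ-Solver

    -- Vanishing would make D α + G zero, and as D² = 1, α would be the rational -D G.
    norm≢0 : ∀ n → norm n ≢ 0ℚ
    norm≢0 n norm≡0 = irr (- (D n * G n)) (begin
      α  ≈⟨ R.sym (R.*-identityˡ α) ⟩
      1K *K α  ≈⟨ R.*-congʳ (R.trans (R.sym 1K≈) (R.trans (ι-cong (sym (D*D n))) (ιH.*-homo (D n) (D n)))) ⟩
      ι (D n) *K ι (D n) *K α  ≈⟨ solve 3 (λ d x g → d :* d :* x := d :* (d :* x :+ g) :- d :* g) R.refl (ι (D n)) α (ι (G n)) ⟩
      ι (D n) *K (ι (D n) *K α +K ι (G n)) -K ι (D n) *K ι (G n) ≈⟨ R.+-cong (R.trans (R.*-congˡ zero-sum) (R.zeroʳ _)) (R.-‿cong (R.sym (ιH.*-homo (D n) (G n)))) ⟩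
      0K -K ι (D n * G n)  ≈⟨ R.+-identityˡ _ ⟩
      -K ι (D n * G n)  ≈⟨ R.sym (ιH.-‿homo (D n * G n)) ⟩
      ι (- (D n * G n))  ∎)
      where
      open K-Solver
      open import Relation.Binary.Reasoning.Setoid R.setoid
      zero-sum : ι (D n) *K α +K ι (G n) ≈K 0K
      zero-sum = R.trans (R.sym (norm*A n)) (R.trans (R.*-congʳ (R.trans (ι-cong norm≡0) ιH.0#-homo)) (R.zeroˡ (A n)))

    W : ℚ
    W = κ * (∣ τ ∣ + (+ 2 / 1))

    κ[τ-2α]≤W : ∣ ι κ *K (ι τ -K 2α) ∣∞≤ W
    κ[τ-2α]≤W = ∣∣∞-* (∣∣∞-ι {κ} (ℚₚ.≤-reflexive (ℚₚ.0≤p⇒∣p∣≡p 0≤κ)))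
      (∣∣∞-+ (∣∣∞-ι {τ} ℚₚ.≤-refl) (∣∣∞-neg (∣∣∞-mono (ℚₚ.≤-reflexive (ℚₚ.*-identityʳ (+ 2 / 1))) (∣∣∞-* (∣∣∞-ι {+ 2 / 1} ℚₚ.≤-refl) α≤1))))

    0≤ν-κ : 0 ≤ν ι κ
    0≤ν-κ = subst (λ t → 0 ≤ν ι t) (sym κ-integer) (0≤ν-ι/1 (↧ τ ℤ.* ↧ ν))

    κ[τ-2α]-ν : 0 ≤ν ι κ *K (ι τ -K 2α)
    κ[τ-2α]-ν = ≤ν-cong (solve 3 (λ k t x → k :* t :- k :* x := k :* (t :- x)) R.refl (ι κ) (ι τ) 2α)
      (≤ν-+ (≤ν-cong (ιH.*-homo κ τ) (subst (λ t → 0 ≤ν ι t) (sym κτ-integer) (0≤ν-ι/1 (↥ τ ℤ.* ↧ ν))))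
        (≤ν-neg (≤ν-* 0≤ν-κ (≤ν-* (0≤ν-ι/1 (+ 2)) (0≤ν-A 0)))))
      where open K-Solver

    κnorm≈ : ∀ n → ι (κ * norm (suc n)) ≈K ι κ *K (y (suc n) *K y (suc n)) -K A n *K w n *K (ι κ *K (ι τ -K 2α))
    κnorm≈ n = R.trans (ιH.*-homo κ (norm (suc n))) (R.trans (R.*-congˡ (norm-suc≈ n))
      (solve 5 (λ k y x w t → k :* (y :- x :* w :* t) := k :* y :- x :* w :* (k :* t)) R.refl (ι κ) (y (suc n) *K y (suc n)) (A n) (w n) (ι τ -K 2α)))
      where open K-Solver

    -- Expressed through `norm*A`, so that size and integrality of κ G are inherited from κ norm.
    κG≈ : ∀ n → ι (κ * G n) ≈K ι (κ * norm n) *K A n -K ι κ *K (ι (D n) *K α)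
    κG≈ n = R.trans (ιH.*-homo κ (G n)) (R.trans
      (solve 3 (λ k g x → k :* g := k :* (x :+ g) :- k :* x) R.refl (ι κ) (ι (G n)) (ι (D n) *K α))
      (R.+-congʳ (R.trans (R.*-congˡ (R.sym (norm*A n))) (R.trans (R.sym (R.*-assoc (ι κ) (ι (norm n)) (A n))) (R.*-congʳ (R.sym (ιH.*-homo κ (norm n))))))))
      where open K-Solver

    dyadic-κ : Dyadic κ
    dyadic-κ = subst Dyadic (sym κ-integer) (dyadic-/1 (↧ τ ℤ.* ↧ ν))

    dyadic-κτ : Dyadic (κ * τ)
    dyadic-κτ = subst Dyadic (sym κτ-integer) (dyadic-/1 (↥ τ ℤ.* ↧ ν))

    dyadic-κν : Dyadic (κ * ν)
    dyadic-κν = subst Dyadic (sym κν-integer) (dyadic-/1 (↧ τ ℤ.* ↥ ν))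

    dyadic-κnorm : ∀ n → Dyadic (κ * norm n)
    dyadic-κnorm n =
      let (p⁻-dy , _) , (q⁻-dy , _) = dyadic-convergents n in
      subst Dyadic (solve 5 (λ k P Q t v → P :* P :* k :- P :* Q :* (k :* t) :+ Q :* Q :* (k :* v) := k :* (P :* P :- P :* Q :* t :+ Q :* Q :* v))
          refl κ (p⁻ n) (q⁻ n) τ ν)
        (dyadic-+ (dyadic-+ (dyadic-* (dyadic-* p⁻-dy p⁻-dy) dyadic-κ) (dyadic-neg (dyadic-* (dyadic-* p⁻-dy q⁻-dy) dyadic-κτ)))
          (dyadic-* (dyadic-* q⁻-dy q⁻-dy) dyadic-κν))
      where open ℚ-Solver

    dyadic-κG : ∀ n → Dyadic (κ * G n)
    dyadic-κG n =
      let (p⁻-dy , p-dy) , (q⁻-dy , q-dy) = dyadic-convergents n in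
      subst Dyadic (solve 7 (λ k P⁻ P Q⁻ Q t v → P :* Q⁻ :* (k :* t) :- P :* P⁻ :* k :- Q :* Q⁻ :* (k :* v) := k :* (P :* Q⁻ :* t :- P :* P⁻ :- Q :* Q⁻ :* v))
          refl κ (p⁻ n) (p α n) (q⁻ n) (q α n) τ ν)
        (dyadic-+ (dyadic-+ (dyadic-* (dyadic-* p-dy q⁻-dy) dyadic-κτ) (dyadic-neg (dyadic-* (dyadic-* p-dy p⁻-dy) dyadic-κ)))
          (dyadic-neg (dyadic-* (dyadic-* q-dy q⁻-dy) dyadic-κν)))
      where open ℚ-Solver

    integral : ∀ {r} → Dyadic r → 0 ≤ν ι r → ∃ λ i → r ≡ i / 1
    integral dyadic h = let i , r≡ = dyadic-integral dyadic h in i , trans r≡ (ℚₚ.*-identityʳ (i / 1))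

    κnorm-ν : ∀ n → 0 ≤ν ι (κ * norm (suc n))
    κnorm-ν n = ≤ν-cong (R.sym (κnorm≈ n)) (≤ν-+ (≤ν-* 0≤ν-κ (≤ν-* 0≤ν-y 0≤ν-y))
      (≤ν-neg (≤ν-* (≤ν-* (0≤ν-A n) (w-ν n)) κ[τ-2α]-ν)))
      where
      0≤ν-y : 0 ≤ν y (suc n)
      0≤ν-y = ≤ν-weaken ℕ.z≤n (e≤ν-y (suc n))

    κG-ν : ∀ n → 0 ≤ν ι (κ * G (suc n))
    κG-ν n = ≤ν-cong (R.sym (κG≈ (suc n))) (≤ν-+ (≤ν-* (κnorm-ν n) (0≤ν-A (suc n)))
      (≤ν-neg (≤ν-* 0≤ν-κ (≤ν-* (D-ν (suc n)) (0≤ν-A 0)))))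

    -- Open in r and t because it serves twice: with 1 and 2 for an overall bound, and with small
    -- values to keep `w` away from 0.
    κnorm-bound : ∀ n {r} → ∣ y (suc n) ∣∞≤ r → ∀ {t} → ∣ w n ∣∞≤ t → ∣ ι (κ * norm (suc n)) ∣∞≤ κ * (r * r) + 1ℚ * t * W
    κnorm-bound n ∣y∣≤r ∣w∣≤t = ∣∣∞-cong (R.sym (κnorm≈ n))
      (∣∣∞-+ (∣∣∞-* (∣∣∞-ι {κ} (ℚₚ.≤-reflexive (ℚₚ.0≤p⇒∣p∣≡p 0≤κ))) (∣∣∞-* ∣y∣≤r ∣y∣≤r))
        (∣∣∞-neg (∣∣∞-* (∣∣∞-* (A≤1 n) ∣w∣≤t) κ[τ-2α]≤W)))

    -- κ norm lies in ℤ[1/2] and is 2-adically integral, hence is a non-zero integer.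
    κnorm≥1 : ∀ n {r} → ∣ ι (κ * norm (suc n)) ∣∞≤ r → 1ℚ ≤ r
    κnorm≥1 n {r} h = conclude (proj₁ κnorm-integral) (proj₂ κnorm-integral)
      where
      κnorm-integral : ∃ λ i → κ * norm (suc n) ≡ i / 1
      κnorm-integral = integral (dyadic-κnorm (suc n)) (κnorm-ν n)
      conclude : ∀ i → κ * norm (suc n) ≡ i / 1 → 1ℚ ≤ r
      conclude i eq = ℚₚ.≤-trans (1≤∣integer∣ i i≢0) (∣∣∞-ι⁻¹ (∣∣∞-cong (ι-cong eq) h))
        where
        i≢0 : i / 1 ≢ 0ℚ
        i≢0 i≡0 = norm≢0 (suc n) (positive-*≡0 κ 0<κ (trans eq i≡0))

  -- Finitely many forms

  code : ∀ B i → ℤ.∣ i ∣ ℕ.≤ B → Fin (suc (B ℕ.+ B))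
  code B (+ n)    n≤B = fromℕ< (ℕ.s≤s (ℕₚ.+-monoʳ-≤ B n≤B))
  code B -[1+ n ] n<B = fromℕ< (ℕ.s≤s (ℕₚ.≤-trans (ℕₚ.m∸n≤m B (suc n)) (ℕₚ.m≤m+n B B)))

  code-injective : ∀ B i j (i≤B : ℤ.∣ i ∣ ℕ.≤ B) (j≤B : ℤ.∣ j ∣ ℕ.≤ B) → code B i i≤B ≡ code B j j≤B → i ≡ j
  code-injective B (+ m)    (+ n)    h k eq = cong +_ (ℕₚ.+-cancelˡ-≡ B m n (Finₚ.fromℕ<-injective _ _ _ _ eq))
  code-injective B (+ m)    -[1+ n ] h k eq = contradiction
    (subst (B ℕ.≤_) (Finₚ.fromℕ<-injective _ _ _ _ eq) (ℕₚ.m≤m+n B m)) (ℕₚ.<⇒≱ (ℕₚ.∸-monoʳ-< (ℕ.s≤s ℕ.z≤n) k))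
  code-injective B -[1+ m ] (+ n)    h k eq = sym (code-injective B (+ n) -[1+ m ] k h (sym eq))
  code-injective B -[1+ m ] -[1+ n ] h k eq = cong -[1+_] (ℕₚ.suc-injective (ℕₚ.∸-cancelˡ-≡ h k (Finₚ.fromℕ<-injective _ _ _ _ eq)))

  bounded-pairs-repeat : ∀ B (I J : ℕ → ℤ) → (∀ k → ℤ.∣ I k ∣ ℕ.≤ B) → (∀ k → ℤ.∣ J k ∣ ℕ.≤ B) →
                         ∃₂ λ k l → k ℕ.< l × I k ≡ I l × J k ≡ J l
  bounded-pairs-repeat B I J I≤B J≤B =
    let i , j , i<j , eq = Finₚ.pigeonhole (ℕₚ.n<1+n (suc (B ℕ.+ B) ℕ.* suc (B ℕ.+ B)))
          (λ k → combine (code B (I (toℕ k)) (I≤B (toℕ k))) (code B (J (toℕ k)) (J≤B (toℕ k))))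
        eqI , eqJ = Finₚ.combine-injective (code B (I (toℕ i)) (I≤B (toℕ i))) (code B (J (toℕ i)) (J≤B (toℕ i)))
          (code B (I (toℕ j)) (I≤B (toℕ j))) (code B (J (toℕ j)) (J≤B (toℕ j))) eq
    in toℕ i , toℕ j , i<j , code-injective B (I (toℕ i)) (I (toℕ j)) (I≤B (toℕ i)) (I≤B (toℕ j)) eqI ,
       code-injective B (J (toℕ i)) (J (toℕ j)) (J≤B (toℕ i)) (J≤B (toℕ j)) eqJ

  uniform-bound : ∀ {P : ℕ → ℚ → Set} → (∀ {n r s} → r ≤ s → P n r → P n s) → (∀ n → ∃ λ r → P n r) →
                  ∀ M → ∃ λ r → ∀ n → n ℕ.< M → P n r
  uniform-bound mono h zero = 0ℚ , λ _ ()
  uniform-bound {P} mono h (suc M) =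
    let r , below = uniform-bound {P} mono h M
        s , at    = h M
    in r ⊔ s , λ n n<1+M → choose (ℕₚ.m≤n⇒m<n∨m≡n (ℕₚ.≤-pred n<1+M)) below at
    where
    choose : ∀ {n r s} → (n ℕ.< M) ⊎ (n ≡ M) → (∀ n → n ℕ.< M → P n r) → P M s → P n (r ⊔ s)
    choose {n} {r} {s} (inj₁ n<M)  below at = mono (ℚₚ.p≤p⊔q r s) (below n n<M)
    choose {n} {r} {s} (inj₂ refl) below at = mono (ℚₚ.p≤q⊔p r s) at

  module Finiteness {c ℓ} (K : EmbeddedQuadraticField c ℓ) (α : EmbeddedQuadraticField.Carrier K)
                    (irr : Algorithm.Irrational K α) (prop : Algorithm.PropertyI K α) where

    open Approximation K α irr prop public

    y-decay : ∀ k j → ∣ y (j ℕ.+ (k ℕ.+ k)) ∣∞≤ ½ ^ k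
    y-decay k zero    = y≤½^ k
    y-decay k (suc j) = ∣∣∞-mono (ℚₚ.≤-reflexive (ℚₚ.*-identityˡ (½ ^ k))) (∣∣∞-neg (∣∣∞-* (A≤1 (j ℕ.+ (k ℕ.+ k))) (y-decay k j)))

    0≤W : 0ℚ ≤ W
    0≤W = ∣∣∞-nonNeg κ[τ-2α]≤W

    -- By `½^-small`, the denominator of 1/(2κ) is an exponent that brings the power of ½ below
    -- 1/(2κ).
    k₀ : ℕ
    k₀ = ↧ₙ (inv κ 0<κ * ½)

    κ½^≤½ : κ * (½ ^ k₀ * ½ ^ k₀) ≤ ½
    κ½^≤½ = begin
      κ * (½ ^ k₀ * ½ ^ k₀)  ≤⟨ *-monoˡ 0≤κ (ℚₚ.≤-trans (*-monoʳ 0≤½^k (^≤1 k₀ 0≤½ (from-yes (½ ℚₚ.≤? 1ℚ)))) (ℚₚ.≤-reflexive (ℚₚ.*-identityˡ _))) ⟩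
      κ * ½ ^ k₀  ≤⟨ *-monoˡ 0≤κ (ℚₚ.<⇒≤ (½^-small (0<* (0<inv κ 0<κ) (ℚₚ.positive⁻¹ ½)))) ⟩
      κ * (inv κ 0<κ * ½)  ≡⟨ *-inv κ 0<κ ½ ⟩
      ½  ∎
      where
      open ℚₚ.≤-Reasoning
      0≤½ = ℚₚ.<⇒≤ (ℚₚ.positive⁻¹ ½)
      0≤½^k = 0≤^ k₀ 0≤½

    -- If w n were too small, then the non-zero integer κ * norm (n + 1) would
    -- be smaller than 1.
    w⁻¹-eventually : ∀ n → k₀ ℕ.+ k₀ ℕ.≤ suc n → ∣ w n ⁻¹ ∣∞≤ W + W
    w⁻¹-eventually n h = conclude (∣∣∞-dichotomy {w n ⁻¹} {w n} {W + W} (0≤+ 0≤W 0≤W) (R.trans (R.*-comm (w n ⁻¹) (w n)) (*-inverse (w n) (w≉0 n))))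
      where
      open ℚ-Solver
      y≤ : ∣ y (suc n) ∣∞≤ ½ ^ k₀
      y≤ = subst (λ i → ∣ y i ∣∞≤ ½ ^ k₀) (ℕₚ.m∸n+n≡m h) (y-decay k₀ (suc n ℕ.∸ (k₀ ℕ.+ k₀)))
      impossible : ∀ t → (W + W) * t < 1ℚ → ¬ 1ℚ ≤ κ * (½ ^ k₀ * ½ ^ k₀) + 1ℚ * t * W
      impossible t Wt<1 1≤ = ℚₚ.<-irrefl refl (ℚₚ.≤-<-trans (ℚₚ.≤-trans 1≤ (ℚₚ.+-monoˡ-≤ (1ℚ * t * W) κ½^≤½))
        (lin< {½ + 1ℚ * t * W} {1ℚ} {½ * ((W + W) * t)} {½ * 1ℚ} (lem W t) (ℚₚ.*-monoʳ-<-pos ½ Wt<1)))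
        where
        lem : ∀ W t → 1ℚ - (½ + 1ℚ * t * W) ≡ ½ * 1ℚ - ½ * ((W + W) * t)
        lem = solve 2 (λ W t → con 1ℚ :- (con ½ :+ con 1ℚ :* t :* W) := con ½ :* con 1ℚ :- con ½ :* ((W :+ W) :* t)) refl
      conclude : ∣ w n ⁻¹ ∣∞≤ W + W ⊎ (∃ λ t → ∣ w n ∣∞≤ t × (W + W) * t < 1ℚ) → ∣ w n ⁻¹ ∣∞≤ W + W
      conclude (inj₁ bound)          = bound
      conclude (inj₂ (t , w≤t , lt)) = contradiction (κnorm≥1 n (κnorm-bound n y≤ w≤t)) (impossible t lt)

    w⁻¹-bound : ∃ λ C → ∀ n → ∣ w n ⁻¹ ∣∞≤ C
    w⁻¹-bound =
      let B , below = uniform-bound {λ n r → ∣ w n ⁻¹ ∣∞≤ r} ∣∣∞-mono (λ n → ∣∣∞-bound (w n ⁻¹)) (k₀ ℕ.+ k₀)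
      in B ⊔ (W + W) , λ n → choose B below n (k₀ ℕ.+ k₀ ℕₚ.≤? suc n)
      where
      choose : ∀ B → (∀ n → n ℕ.< k₀ ℕ.+ k₀ → ∣ w n ⁻¹ ∣∞≤ B) → ∀ n → Dec (k₀ ℕ.+ k₀ ℕ.≤ suc n) → ∣ w n ⁻¹ ∣∞≤ B ⊔ (W + W)
      choose B below n (yes h) = ∣∣∞-mono (ℚₚ.p≤q⊔p B (W + W)) (w⁻¹-eventually n h)
      choose B below n (no ¬h) = ∣∣∞-mono (ℚₚ.p≤p⊔q B (W + W)) (below n (ℕₚ.<⇒≤ (ℕₚ.≰⇒> ¬h)))

    M : ℚ
    M = κ * (1ℚ * 1ℚ) + 1ℚ * (+ 2 / 1) * W

    κnorm≤M : ∀ n → ∣ ι (κ * norm (suc n)) ∣∞≤ M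
    κnorm≤M n = κnorm-bound n (y≤1 (suc n)) (w≤2 n)

    κG≤M+κ : ∀ n → ∣ ι (κ * G (suc n)) ∣∞≤ M * 1ℚ + κ * (1ℚ * 1ℚ)
    κG≤M+κ n = ∣∣∞-cong (R.sym (κG≈ (suc n))) (∣∣∞-+ (∣∣∞-* (κnorm≤M n) (A≤1 (suc n)))
      (∣∣∞-neg (∣∣∞-* (∣∣∞-ι {κ} (ℚₚ.≤-reflexive (ℚₚ.0≤p⇒∣p∣≡p 0≤κ))) (∣∣∞-* (D≤1 (suc n)) α≤1))))

    -- Even indices give D = 1 and steps of equal parity, so that equal forms mean equal remainders
    -- and an even period. They start at 2 because the bounds on `norm` and `G` are stated for
    -- successors.
    index : ℕ → ℕ
    index k = suc (suc (k ℕ.+ k))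

    D-index : ∀ k → D (index k) ≡ 1ℚ
    D-index k = trans (neg-neg (D (k ℕ.+ k))) (D-even k)
      where
      neg-neg : ∀ x → - (- x) ≡ x
      neg-neg = solve 1 (λ x → :- (:- x) := x) refl
        where open ℚ-Solver
      D-even : ∀ k → D (k ℕ.+ k) ≡ 1ℚ
      D-even zero    = refl
      D-even (suc k) = trans (cong (λ i → - D i) (ℕₚ.+-suc k k)) (trans (neg-neg (D (k ℕ.+ k))) (D-even k))

    abstract
      κnorm-integral : ∀ k → ∃ λ i → κ * norm (index k) ≡ i / 1
      κnorm-integral k = integral (dyadic-κnorm (index k)) (κnorm-ν (suc (k ℕ.+ k)))

      κG-integral : ∀ k → ∃ λ i → κ * G (index k) ≡ i / 1
      κG-integral k = integral (dyadic-κG (index k)) (κG-ν (suc (k ℕ.+ k)))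

    U V : ℕ → ℤ
    U k = proj₁ (κnorm-integral k)
    V k = proj₁ (κG-integral k)

    U≡ : ∀ k → κ * norm (index k) ≡ U k / 1
    U≡ k = proj₂ (κnorm-integral k)

    V≡ : ∀ k → κ * G (index k) ≡ V k / 1
    V≡ k = proj₂ (κG-integral k)

    integer-bound : ∀ {r} i {B} → ∣ ι r ∣∞≤ B → r ≡ i / 1 → ∀ {n} → B ≤ ⟦ n ⟧ → ℤ.∣ i ∣ ℕ.≤ n
    integer-bound i h eq B≤n = ⟦⟧-cancel-≤ (subst (_≤ _) (∣/1∣ i) (ℚₚ.≤-trans (∣∣∞-ι⁻¹ (∣∣∞-cong (ι-cong eq) h)) B≤n))

    -- At these indices U A = κ α + V, so the two integers determine the remainder by division.
    equal-forms : ∀ k l → U k ≡ U l → V k ≡ V l → A (index k) ≈K A (index l)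
    equal-forms k l U≡U V≡V = begin
      A (index k)  ≈⟨ divide k ⟩
      i ⁻¹ *K (ι κ *K α +K ι (V k / 1))  ≈⟨ R.*-congˡ (R.+-congˡ (ι-cong (cong (_/ 1) V≡V))) ⟩
      i ⁻¹ *K (ι κ *K α +K ι (V l / 1))  ≈⟨ R.*-congʳ (⁻¹-cong (i≉0 k) (ι-cong (cong (_/ 1) U≡U))) ⟩
      ι (U l / 1) ⁻¹ *K (ι κ *K α +K ι (V l / 1)) ≈⟨ R.sym (divide l) ⟩
      A (index l)  ∎
      where
      open import Relation.Binary.Reasoning.Setoid R.setoid
      i = ι (U k / 1)
      i≉0 : ∀ k → ¬ ι (U k / 1) ≈K 0K
      i≉0 k h = norm≢0 (index k) (positive-*≡0 κ 0<κ (trans (U≡ k) (ι-injective (R.trans h (R.sym ιH.0#-homo)))))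
      form : ∀ k → ι (U k / 1) *K A (index k) ≈K ι κ *K α +K ι (V k / 1)
      form k = begin
        ι (U k / 1) *K A (index k)  ≈⟨ R.*-congʳ (R.trans (ι-cong (sym (U≡ k))) (ιH.*-homo κ (norm (index k)))) ⟩
        ι κ *K ι (norm (index k)) *K A (index k)  ≈⟨ R.trans (R.*-assoc _ _ _) (R.*-congˡ (norm*A (index k))) ⟩
        ι κ *K (ι (D (index k)) *K α +K ι (G (index k)))  ≈⟨ R.distribˡ _ _ _ ⟩
        ι κ *K (ι (D (index k)) *K α) +K ι κ *K ι (G (index k))
          ≈⟨ R.+-cong (R.*-congˡ (R.trans (R.*-congʳ (R.trans (ι-cong (D-index k)) 1K≈)) (R.*-identityˡ α)))
               (R.trans (R.sym (ιH.*-homo κ (G (index k)))) (ι-cong (V≡ k))) ⟩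
        ι κ *K α +K ι (V k / 1)  ∎
      divide : ∀ k → A (index k) ≈K ι (U k / 1) ⁻¹ *K (ι κ *K α +K ι (V k / 1))
      divide k = begin
        A (index k)  ≈⟨ R.sym (R.*-identityˡ _) ⟩
        1K *K A (index k)  ≈⟨ R.*-congʳ (R.sym (R.trans (R.*-comm _ _) (*-inverse (ι (U k / 1)) (i≉0 k)))) ⟩
        ι (U k / 1) ⁻¹ *K ι (U k / 1) *K A (index k)  ≈⟨ R.trans (R.*-assoc _ _ _) (R.*-congˡ (form k)) ⟩
        ι (U k / 1) ⁻¹ *K (ι κ *K α +K ι (V k / 1))  ∎

    abstract
      repetition : ∃₂ λ k l → k ℕ.< l × A (index k) ≈K A (index l)
      repetition =
        let B , h = ≤⟦⟧ (M + (M * 1ℚ + κ * (1ℚ * 1ℚ))) (0≤+ 0≤M 0≤M′)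
            k , l , k<l , U≡U , V≡V = bounded-pairs-repeat B U V
              (λ k → integer-bound (U k) (κnorm≤M (suc (k ℕ.+ k))) (U≡ k) (ℚₚ.≤-trans (p≤p+q 0≤M′) h))
              (λ k → integer-bound (V k) (κG≤M+κ (suc (k ℕ.+ k))) (V≡ k) (ℚₚ.≤-trans (p≤q+p 0≤M) h))
        in k , l , k<l , equal-forms k l U≡U V≡V
        where
        0≤M : 0ℚ ≤ M
        0≤M = ∣∣∞-nonNeg (κnorm≤M 0)
        0≤M′ : 0ℚ ≤ M * 1ℚ + κ * (1ℚ * 1ℚ)
        0≤M′ = ∣∣∞-nonNeg (κG≤M+κ 0)

  -- Eventual periodicity

  parity-+ : ∀ n d → parity (n ℕ.+ (d ℕ.+ d)) ≡ parity n
  parity-+ n zero    = cong parity (ℕₚ.+-identityʳ n)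
  parity-+ n (suc d) = trans (cong parity (trans (ℕₚ.+-suc n (d ℕ.+ suc d)) (cong suc (trans (cong (n ℕ.+_) (ℕₚ.+-suc d d)) (ℕₚ.+-suc n (d ℕ.+ d))))))
    (parity-+ n d)

  module Periodicity {c ℓ} (K : EmbeddedQuadraticField c ℓ) (α : EmbeddedQuadraticField.Carrier K)
                     (irr : Algorithm.Irrational K α) (prop : Algorithm.PropertyI K α) where

    open Finiteness K α irr prop public

    e-mono : ∀ s n → e n ℕ.≤ e (s ℕ.+ n)
    e-mono zero    n = ℕₚ.≤-refl
    e-mono (suc s) n = ℕₚ.≤-trans (e-mono s n) (ℕₚ.m≤m+n (e (s ℕ.+ n)) (f (s ℕ.+ n)))

    e-grows : ∀ s n → e n ℕ.< e (s ℕ.+ suc (suc n))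
    e-grows s n = ℕₚ.≤-trans (begin
      suc (e n)  ≡⟨ ℕₚ.+-comm 1 (e n) ⟩
      e n ℕ.+ 1  ≤⟨ ℕₚ.+-monoʳ-≤ (e n) (1≤f+f n) ⟩
      e n ℕ.+ (f n ℕ.+ f (suc n))  ≡⟨ sym (ℕₚ.+-assoc (e n) (f n) (f (suc n))) ⟩
      e (suc (suc n))  ∎) (e-mono s (suc (suc n)))
      where open ℕₚ.≤-Reasoning

    ρ : ℕ → ℕ → Carrier
    ρ n zero    = 1K
    ρ n (suc s) = -K (A (s ℕ.+ n) *K ρ n s)

    y-ρ : ∀ n s → y (s ℕ.+ n) ≈K ρ n s *K y n
    y-ρ n zero    = R.sym (R.*-identityˡ (y n))
    y-ρ n (suc s) = R.trans (R.-‿cong (R.*-congˡ (y-ρ n s)))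
      (solve 3 (λ x r y → :- (x :* (r :* y)) := (:- (x :* r)) :* y) R.refl (A (s ℕ.+ n)) (ρ n s) (y n))
      where open K-Solver

    ρ≤½ : ∀ n s → ∣ ρ n (suc (suc s)) ∣∞≤ ½
    ρ≤½ n zero    = ∣∣∞-cong (R.sym (R.trans (solve 3 (λ x x′ o → :- (x′ :* (:- (x :* o))) := x :* x′ :* o) R.refl (A n) (A (suc n)) 1K) (R.*-identityʳ _))) (AA≤½ n)
      where open K-Solver
    ρ≤½ n (suc s) = ∣∣∞-mono (ℚₚ.≤-reflexive (ℚₚ.*-identityˡ ½)) (∣∣∞-neg (∣∣∞-* (A≤1 (suc (suc s) ℕ.+ n)) (ρ≤½ n s)))

    T-cong : ∀ ε {x y} → Irrational x → x ≈K y → T ε x ≈K T ε y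
    T-cong ε irr x≈y = R.+-cong (⁻¹-cong (irrational⇒≉0 irr) x≈y)
      (R.-‿cong (ι-cong (partialQuotient-cong ε (irrational⇒≉0 irr) (T-irrational ε irr) x≈y)))

    -- All that the final estimates retain of the n-th convergent, k being the number of periods
    -- removed from n; `B` and `C` serve every n. An upper bound on ∣q′∣ is what is wanted, since
    -- ∣q′∣ stands in the denominator of the claim.
    record PeriodData (η : Carrier) (F : ℕ) (B C : ℚ) (n : ℕ) : Set (c Level.⊔ ℓ) where
      constructor periodData
      field
        k     : ℕ
        q′η≤  : ∣ ι (q′ α n) *K η ^K k ∣∞≤ B * (2^ (+ F)) ^ k
        ζ     : Carrier
        E≈ζη² : E n ≈K ζ *K (η ^K k *K η ^K k)
        ζ≤    : ∣ ζ ∣∞≤ C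
        ν-E   : k ℕ.* F ℕ.+ k ℕ.* F ≤ν E n

    module WithPeriod (i₀ d : ℕ) (A-repeats : A (i₀ ℕ.+ (suc d ℕ.+ suc d)) ≈K A i₀) where

      L : ℕ
      L = suc d ℕ.+ suc d

      -- The step applied at an index depends on its parity, which the even period preserves.
      A-periodic : ∀ t → A (t ℕ.+ i₀ ℕ.+ L) ≈K A (t ℕ.+ i₀)
      A-periodic zero    = A-repeats
      A-periodic (suc t) = R.trans
        (R.reflexive (cong (λ ε → T ε (A (t ℕ.+ i₀ ℕ.+ L))) (parity-+ (suc (t ℕ.+ i₀)) (suc d))))
        (T-cong (parity (suc (t ℕ.+ i₀))) (A-irrational (t ℕ.+ i₀ ℕ.+ L)) (A-periodic t))

      -- An equality in ℚ rather than in K: v₂ is computed from it, and so `e` grows by the same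
      -- amount over every period.
      b-periodic : ∀ t → b (t ℕ.+ i₀ ℕ.+ L) ≡ b (t ℕ.+ i₀)
      b-periodic t = trans
        (cong (λ ε → partialQuotient ε (A (t ℕ.+ i₀ ℕ.+ L))) (parity-+ (suc (t ℕ.+ i₀)) (suc d)))
        (partialQuotient-cong ε (A≉0 (t ℕ.+ i₀ ℕ.+ L)) (T-irrational ε (A-irrational (t ℕ.+ i₀ ℕ.+ L))) (A-periodic t))
        where ε = parity (suc (t ℕ.+ i₀))

      η : Carrier
      η = ρ i₀ L

      η≤½ : ∣ η ∣∞≤ ½
      η≤½ = subst (λ s → ∣ ρ i₀ (suc s) ∣∞≤ ½) (sym (ℕₚ.+-suc d d)) (ρ≤½ i₀ (d ℕ.+ d))

      y-periodic : ∀ t → y (t ℕ.+ i₀ ℕ.+ L) ≈K η *K y (t ℕ.+ i₀)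
      y-periodic zero    = R.trans (R.reflexive (cong y (ℕₚ.+-comm i₀ L))) (y-ρ i₀ L)
      y-periodic (suc t) = R.trans (R.-‿cong (R.*-cong (A-periodic t) (y-periodic t)))
        (solve 3 (λ x η y → :- (x :* (η :* y)) := η :* (:- (x :* y))) R.refl (A (t ℕ.+ i₀)) η (y (t ℕ.+ i₀)))
        where open K-Solver

      η≉0 : ¬ η ≈K 0K
      η≉0 η≈0 = y≉0 (i₀ ℕ.+ L) (R.trans (y-periodic 0) (R.trans (R.*-congʳ η≈0) (R.zeroˡ (y i₀))))

      -- The valuation of η, read off the exponents of the convergents.
      F : ℕ
      F = e (i₀ ℕ.+ L) ℕ.∸ e i₀

      e-step : e i₀ ℕ.< e (i₀ ℕ.+ L)
      e-step = subst (λ n → e i₀ ℕ.< e n) lem (e-grows (d ℕ.+ d) i₀)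
        where
        lem : d ℕ.+ d ℕ.+ suc (suc i₀) ≡ i₀ ℕ.+ (suc d ℕ.+ suc d)
        lem = solve 2 (λ d i → d :+ d :+ (con 2 :+ i) := i :+ ((con 1 :+ d) :+ (con 1 :+ d))) refl d i₀
          where open ℕ-Solver

      1≤F : 1 ℕ.≤ F
      1≤F = ℕₚ.m<n⇒0<n∸m e-step

      e-periodic : ∀ t → e (t ℕ.+ i₀ ℕ.+ L) ≡ e (t ℕ.+ i₀) ℕ.+ F
      e-periodic zero    = sym (ℕₚ.m+[n∸m]≡n (ℕₚ.<⇒≤ e-step))
      e-periodic (suc t) = trans (cong₂ ℕ._+_ (e-periodic t) (cong (λ x → ℤ.∣ v₂ x ∣) (b-periodic t)))
        (lem (e (t ℕ.+ i₀)) F (f (t ℕ.+ i₀)))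
        where
        open ℕ-Solver
        lem : ∀ e F f → e ℕ.+ F ℕ.+ f ≡ e ℕ.+ f ℕ.+ F
        lem = solve 3 (λ e F f → e :+ F :+ f := e :+ f :+ F) refl

      -- Division of n by the period, with the remainder kept below i₀ + L so that the preperiod is
      -- included.
      Reduced : ℕ → Set ℓ
      Reduced n = ∃₂ λ k n₀ → n₀ ℕ.< i₀ ℕ.+ L × y n ≈K η ^K k *K y n₀ × e n ≡ k ℕ.* F ℕ.+ e n₀

      reduce-step : ∀ t → Reduced (t ℕ.+ i₀) → Reduced (t ℕ.+ i₀ ℕ.+ L)
      reduce-step t (k , n₀ , n₀< , y≈ , e≡) = suc k , n₀ , n₀< ,
        R.trans (y-periodic t) (R.trans (R.*-congˡ y≈) (R.sym (R.*-assoc η (η ^K k) (y n₀)))) ,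
        trans (e-periodic t) (trans (cong (ℕ._+ F) e≡) (lem k F (e n₀)))
        where
        lem : ∀ k F e → k ℕ.* F ℕ.+ e ℕ.+ F ≡ F ℕ.+ k ℕ.* F ℕ.+ e
        lem = solve 3 (λ k F e → k :* F :+ e :+ F := F :+ k :* F :+ e) refl
          where open ℕ-Solver

      reduce : ∀ n → Reduced n
      reduce = <-rec Reduced λ n rec → go n rec (n ℕₚ.<? i₀ ℕ.+ L)
        where
        go : ∀ n → (∀ {m} → m ℕ.< n → Reduced m) → Dec (n ℕ.< i₀ ℕ.+ L) → Reduced n
        go n rec (yes n<) = 0 , n , n< , R.sym (R.*-identityˡ (y n)) , refl
        go n rec (no n≮) = subst Reduced n≡ (reduce-step t (rec (subst (t ℕ.+ i₀ ℕ.<_) n≡ (ℕₚ.m<m+n (t ℕ.+ i₀) {L} (ℕ.s≤s ℕ.z≤n)))))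
          where
          t = n ℕ.∸ (i₀ ℕ.+ L)
          n≡ : t ℕ.+ i₀ ℕ.+ L ≡ n
          n≡ = trans (ℕₚ.+-assoc t i₀ L) (ℕₚ.m∸n+n≡m (ℕₚ.≮⇒≥ n≮))

      Q : ℚ
      Q = 2^ (+ F)

      2^kF : ∀ k → 2^ (+ (k ℕ.* F)) ≡ Q ^ k
      2^kF k = trans (cong ((+ 2 / 1) ^_) (ℕₚ.*-comm k F)) (sym (ℚ^ₚ.^-assocʳ (+ 2 / 1) F k))

      0≤Q^ : ∀ k → 0ℚ ≤ Q ^ k
      0≤Q^ k = 0≤^ k (ℚₚ.<⇒≤ (0<2^ F))

      scaled-y⁻¹-bound : ∃ λ B → ∀ n₀ → n₀ ℕ.< i₀ ℕ.+ L → ∣ ι (2^ (+ e n₀)) *K y n₀ ⁻¹ ∣∞≤ B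
      scaled-y⁻¹-bound = uniform-bound {λ n B → ∣ ι (2^ (+ e n)) *K y n ⁻¹ ∣∞≤ B} ∣∣∞-mono
        (λ n → ∣∣∞-bound (ι (2^ (+ e n)) *K y n ⁻¹)) (i₀ ℕ.+ L)

      -- Writing q_n as w n / y n and y n as η^k y n₀ leaves, besides Q^k, only w n and quantities
      -- of the finitely many n₀.
      q′η^k : ∀ n k n₀ → y n ≈K η ^K k *K y n₀ → e n ≡ k ℕ.* F ℕ.+ e n₀ →
              ι (q′ α n) *K η ^K k ≈K ι (Q ^ k) *K (ι (2^ (+ e n₀)) *K y n₀ ⁻¹ *K w n)
      q′η^k n k n₀ y≈ e≡ = begin
        ι (q′ α n) *K x
          ≈⟨ R.*-congʳ (R.trans (ι-cong (trans (q′≡ n) (cong (_* q α n) 2^e≡))) (R.trans (ιH.*-homo (Q ^ k * 2^ (+ e n₀)) (q α n)) (R.*-congʳ (ιH.*-homo (Q ^ k) (2^ (+ e n₀)))))) ⟩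
        ι (Q ^ k) *K g *K ι (q α n) *K x
          ≈⟨ R.*-congˡ (R.sym (R.trans (R.*-congˡ (*-inverse (y n₀) (y≉0 n₀))) (R.*-identityʳ x))) ⟩
        ι (Q ^ k) *K g *K ι (q α n) *K (x *K (y n₀ *K y n₀ ⁻¹))
          ≈⟨ solve 6 (λ Q g q x y i → Q :* g :* q :* (x :* (y :* i)) := Q :* (g :* i :* (q :* (x :* y)))) R.refl (ι (Q ^ k)) g (ι (q α n)) x (y n₀) (y n₀ ⁻¹) ⟩
        ι (Q ^ k) *K (g *K y n₀ ⁻¹ *K (ι (q α n) *K (x *K y n₀)))
          ≈⟨ R.*-congˡ (R.*-congˡ (R.*-congˡ (R.sym y≈))) ⟩
        ι (Q ^ k) *K (g *K y n₀ ⁻¹ *K w n) ∎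
        where
        open K-Solver
        open import Relation.Binary.Reasoning.Setoid R.setoid
        x = η ^K k
        g = ι (2^ (+ e n₀))
        2^e≡ : 2^ (+ e n) ≡ Q ^ k * 2^ (+ e n₀)
        2^e≡ = trans (cong (λ i → 2^ (+ i)) e≡) (trans (ℚ^ₚ.^-homo-* (+ 2 / 1) (k ℕ.* F) (e n₀)) (cong (_* 2^ (+ e n₀)) (2^kF k)))

      E-η : ∀ n k n₀ → y n ≈K η ^K k *K y n₀ →
            E n ≈K -K (A n *K w n ⁻¹) *K (y n₀ *K y n₀) *K (η ^K k *K η ^K k)
      E-η n k n₀ y≈ = R.trans (E≈ n) (R.trans (R.*-congˡ (R.*-cong y≈ y≈))
        (solve 3 (λ z x y → z :* (x :* y :* (x :* y)) := z :* (y :* y) :* (x :* x)) R.refl (-K (A n *K w n ⁻¹)) (η ^K k) (y n₀)))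
        where open K-Solver

      -- The maximum with 1 allows the exponents of its powers to be increased in upper bounds.
      B′ : ℚ
      B′ = (proj₁ scaled-y⁻¹-bound * (+ 2 / 1)) ⊔ 1ℚ

      C′ : ℚ
      C′ = 1ℚ * proj₁ w⁻¹-bound * (1ℚ * 1ℚ)

      1≤B′ : 1ℚ ≤ B′
      1≤B′ = ℚₚ.p≤q⊔p (proj₁ scaled-y⁻¹-bound * (+ 2 / 1)) 1ℚ

      abstract
        analysis : ∀ n → PeriodData η F B′ C′ n
        analysis n = let k , n₀ , n₀< , y≈ , e≡ = reduce n in go k n₀ n₀< y≈ e≡
          where
          go : ∀ k n₀ → n₀ ℕ.< i₀ ℕ.+ L → y n ≈K η ^K k *K y n₀ → e n ≡ k ℕ.* F ℕ.+ e n₀ → PeriodData η F B′ C′ n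
          go k n₀ n₀< y≈ e≡ = periodData k
            (∣∣∞-mono (ℚₚ.≤-trans (*-monoˡ (0≤Q^ k) (ℚₚ.p≤p⊔q (proj₁ scaled-y⁻¹-bound * (+ 2 / 1)) 1ℚ)) (ℚₚ.≤-reflexive (ℚₚ.*-comm (Q ^ k) B′)))
              (∣∣∞-cong (R.sym (q′η^k n k n₀ y≈ e≡))
                (∣∣∞-* (∣∣∞-ι {Q ^ k} (ℚₚ.≤-reflexive (ℚₚ.0≤p⇒∣p∣≡p (0≤Q^ k))))
                  (∣∣∞-* (proj₂ scaled-y⁻¹-bound n₀ n₀<) (w≤2 n)))))
            (-K (A n *K w n ⁻¹) *K (y n₀ *K y n₀))
            (E-η n k n₀ y≈)
            (∣∣∞-* (∣∣∞-neg (∣∣∞-* (A≤1 n) (proj₂ w⁻¹-bound n))) (∣∣∞-* (y≤1 n₀) (y≤1 n₀)))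
            (≤ν-weaken (ℕₚ.+-mono-≤ kF≤e kF≤e) (2e≤ν-E n))
            where
            kF≤e : k ℕ.* F ℕ.≤ e n
            kF≤e = subst (k ℕ.* F ℕ.≤_) (sym e≡) (ℕₚ.m≤m+n (k ℕ.* F) (e n₀))

    abstract
      period : ∃₂ λ i₀ d → A (i₀ ℕ.+ (suc d ℕ.+ suc d)) ≈K A i₀
      period =
        let k , l , k<l , A≈A = repetition
            o , eq = ℕₚ.m≤n⇒∃[o]m+o≡n k<l
        -- With l = k + 1 + o the two indices differ by 2 (o + 1).
        in index k , o , R.trans (R.reflexive (cong A (trans (lem k o) (cong index eq)))) (R.sym A≈A)
        where
        lem : ∀ k o → index k ℕ.+ (suc o ℕ.+ suc o) ≡ index (suc k ℕ.+ o)
        lem = solve 2 (λ k o → (con 2 :+ (k :+ k)) :+ ((con 1 :+ o) :+ (con 1 :+ o)) := con 2 :+ ((con 1 :+ k :+ o) :+ (con 1 :+ k :+ o))) refl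
          where open ℕ-Solver

  -- The exponent γ

  2^*½^ : ∀ a b → 1ℚ ≤ 2^ (+ a) * ½ ^ b → b ℕ.≤ a
  2^*½^ a b h = ℕₚ.≮⇒≥ λ a<b → ℚₚ.<-irrefl refl (begin-strict
    1ℚ  ≤⟨ h ⟩
    2^ (+ a) * ½ ^ b  ≤⟨ *-monoˡ (ℚₚ.<⇒≤ (0<2^ a)) (½^-anti-≤ a<b) ⟩
    2^ (+ a) * (½ * ½ ^ a)  ≡⟨ solve 2 (λ s t → s :* (con ½ :* t) := con ½ :* (s :* t)) refl (2^ (+ a)) (½ ^ a) ⟩
    ½ * (2^ (+ a) * ½ ^ a)  ≡⟨ cong (½ *_) (2^*½^≡1 a) ⟩
    ½ * 1ℚ  <⟨ from-yes (½ * 1ℚ ℚₚ.<? 1ℚ) ⟩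
    1ℚ  ∎)
    where
    open ℚₚ.≤-Reasoning
    open ℚ-Solver

  ⟦m⟧*1/⟦⟧≤ : ∀ {m n r} → ⟦ m ⟧ ≤ r * ⟦ suc n ⟧ → ⟦ m ⟧ * 1/⟦suc n ⟧ ≤ r
  ⟦m⟧*1/⟦⟧≤ {m} {n} {r} h = begin
    ⟦ m ⟧ * 1/⟦suc n ⟧  ≤⟨ *-monoʳ (ℚₚ.<⇒≤ 0<1/⟦suc n ⟧) h ⟩
    r * ⟦ suc n ⟧ * 1/⟦suc n ⟧  ≡⟨ trans (ℚₚ.*-assoc r _ _) (trans (cong (r *_) (⟦suc⟧*1/ n)) (ℚₚ.*-identityʳ r)) ⟩
    r  ∎
    where open ℚₚ.≤-Reasoning

  1/⟦suc⟧≤ : ∀ {m n M} → suc n ℕ.≤ suc M ℕ.* m → 1/⟦suc M ⟧ ≤ ⟦ m ⟧ * 1/⟦suc n ⟧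
  1/⟦suc⟧≤ {m} {n} {M} h = begin
    1/⟦suc M ⟧  ≡⟨ sym (trans (cong (1/⟦suc M ⟧ *_) (⟦suc⟧*1/ n)) (ℚₚ.*-identityʳ _)) ⟩
    1/⟦suc M ⟧ * (⟦ suc n ⟧ * 1/⟦suc n ⟧)  ≤⟨ *-monoˡ (ℚₚ.<⇒≤ 0<1/⟦suc M ⟧) (*-monoʳ (ℚₚ.<⇒≤ 0<1/⟦suc n ⟧)
        (ℚₚ.≤-trans (⟦⟧-mono-≤ h) (ℚₚ.≤-reflexive (⟦*⟧ (suc M) m)))) ⟩
    1/⟦suc M ⟧ * (⟦ suc M ⟧ * ⟦ m ⟧ * 1/⟦suc n ⟧)  ≡⟨ solve 4 (λ i M m j → i :* (M :* m :* j) := (M :* i) :* (m :* j)) refl 1/⟦suc M ⟧ ⟦ suc M ⟧ ⟦ m ⟧ 1/⟦suc n ⟧ ⟩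
    (⟦ suc M ⟧ * 1/⟦suc M ⟧) * (⟦ m ⟧ * 1/⟦suc n ⟧)  ≡⟨ trans (cong (_* (⟦ m ⟧ * 1/⟦suc n ⟧)) (⟦suc⟧*1/ M)) (ℚₚ.*-identityˡ _) ⟩
    ⟦ m ⟧ * 1/⟦suc n ⟧  ∎
    where
    open ℚₚ.≤-Reasoning
    open ℚ-Solver

  -- The exponent γ = log Q / log (Q / ∣ η ∣) is approximated by u / (N + 1),
  -- where u is the largest integer with (Q / ∣ η ∣)ᵘ ≤ Q^(N + 1).
  module Exponent {c ℓ} (K : EmbeddedQuadraticField c ℓ) (η ξ : EmbeddedQuadraticField.Carrier K) (F : ℕ) (1≤F : 1 ℕ.≤ F)
    (η≤½ : Field.∣_∣∞≤_ K η ½)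
    (ηξ≈1 : EmbeddedQuadraticField._≈K_ K (EmbeddedQuadraticField._*K_ K η ξ) (EmbeddedQuadraticField.1K K)) where

    open Field K

    Q h : ℚ
    Q = 2^ (+ F)
    h = ½ ^ F

    Qh≡1 : Q * h ≡ 1ℚ
    Qh≡1 = 2^*½^≡1 F

    1≤Q : 1ℚ ≤ Q
    1≤Q = ^-monoʳ {m = 0} {F} (from-yes (1ℚ ℚₚ.≤? + 2 / 1)) ℕ.z≤n

    0≤Q : 0ℚ ≤ Q
    0≤Q = ℚₚ.≤-trans 0≤1 1≤Q

    0≤h : 0ℚ ≤ h
    0≤h = ℚₚ.<⇒≤ (0<½^ F)

    Q^h^≡1 : ∀ n → Q ^ n * h ^ n ≡ 1ℚ
    Q^h^≡1 n = trans (sym (ℚ^ₚ.^-distrib-* Q h n)) (trans (cong (_^ n) Qh≡1) (1^n≡1 n))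

    ηξ^≈1 : ∀ n → η ^K n *K ξ ^K n ≈K 1K
    ηξ^≈1 n = R.trans (R.sym (K^.^-distrib-* η ξ n)) (R.trans (K^.^-congˡ n ηξ≈1) (1^ n))
      where
      1^ : ∀ n → 1K ^K n ≈K 1K
      1^ zero    = R.refl
      1^ (suc n) = R.trans (R.*-identityˡ _) (1^ n)

    1≤product : ∀ n {r s} → ∣ η ^K n ∣∞≤ r → ∣ ξ ^K n ∣∞≤ s → 1ℚ ≤ r * s
    1≤product n hη hξ = ∣∣∞-1⁻¹ (∣∣∞-cong (ηξ^≈1 n) (∣∣∞-* hη hξ))

    -- For u + d = n the two bounds say (Q/∣η∣)^u ≤ Q^(n+1) ≤ (Q/∣η∣)^(u+1), the second one stated
    -- through inverses.
    Approximant : ℕ → ℕ → Set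
    Approximant u d = ∣ ξ ^K u ∣∞≤ Q ^ suc d × ∣ η ^K suc u ∣∞≤ h ^ d

    -- Each round trades one unit of d for one of u, until the next power of ξ is too large. At d =
    -- 0 this must happen, since ∣η∣ ≤ 1/2 excludes ∣ξ^(u+1)∣ ≤ 1.
    search : ∀ d u → ∣ ξ ^K u ∣∞≤ Q ^ suc d → ∃₂ λ u′ d′ → u′ ℕ.+ d′ ≡ u ℕ.+ d × Approximant u′ d′
    search d u ξ^u≤ = decide d ξ^u≤ (∣∣∞-dichotomy {ξ ^K suc u} {η ^K suc u} {Q ^ d} (0≤^ d 0≤Q) (R.trans (R.*-comm _ _) (ηξ^≈1 (suc u))))
      where
      below : ∀ d {t} → Q ^ d * t < 1ℚ → t ≤ h ^ d
      below d {t} lt = begin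
        t  ≡⟨ sym (ℚₚ.*-identityˡ t) ⟩
        1ℚ * t  ≡⟨ cong (_* t) (sym (Q^h^≡1 d)) ⟩
        Q ^ d * h ^ d * t  ≡⟨ solve 3 (λ Q h t → Q :* h :* t := h :* (Q :* t)) refl (Q ^ d) (h ^ d) t ⟩
        h ^ d * (Q ^ d * t)  ≤⟨ *-monoˡ (0≤^ d 0≤h) (ℚₚ.<⇒≤ lt) ⟩
        h ^ d * 1ℚ  ≡⟨ ℚₚ.*-identityʳ (h ^ d) ⟩
        h ^ d  ∎
        where
        open ℚₚ.≤-Reasoning
        open ℚ-Solver
      decide : ∀ d → ∣ ξ ^K u ∣∞≤ Q ^ suc d → (∣ ξ ^K suc u ∣∞≤ Q ^ d) ⊎ (∃ λ t → ∣ η ^K suc u ∣∞≤ t × Q ^ d * t < 1ℚ) →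
               ∃₂ λ u′ d′ → u′ ℕ.+ d′ ≡ u ℕ.+ d × Approximant u′ d′
      decide d       ξ^u≤ (inj₂ (t , η≤t , lt)) = u , d , refl , ξ^u≤ , ∣∣∞-mono (below d lt) η≤t
      decide zero    _    (inj₁ ξ^1+u≤1)        = contradiction
        (2^*½^ 0 (suc u) (subst (1ℚ ≤_) (ℚₚ.*-comm (½ ^ suc u) 1ℚ) (1≤product (suc u) (∣∣∞-^ (suc u) η≤½) ξ^1+u≤1))) λ ()
      decide (suc d) _    (inj₁ ξ^1+u≤)         =
        let u′ , d′ , eq , approx = search d (suc u) ξ^1+u≤ in u′ , d′ , trans eq (sym (ℕₚ.+-suc u d)) , approx

    abstract
      approximants : ∀ n → ∃₂ λ u d → u ℕ.+ d ≡ n × Approximant u d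
      approximants n = search n 0 (∣∣∞-mono (1≤^ (suc n) 1≤Q) ∣∣∞-1)

    u d : ℕ → ℕ
    u n = proj₁ (approximants n)
    d n = proj₁ (proj₂ (approximants n))

    u+d : ∀ n → u n ℕ.+ d n ≡ n
    u+d n = proj₁ (proj₂ (proj₂ (approximants n)))

    ξ^u≤ : ∀ n → ∣ ξ ^K u n ∣∞≤ Q ^ suc (d n)
    ξ^u≤ n = proj₁ (proj₂ (proj₂ (proj₂ (approximants n))))

    η^1+u≤ : ∀ n → ∣ η ^K suc (u n) ∣∞≤ h ^ d n
    η^1+u≤ n = proj₂ (proj₂ (proj₂ (proj₂ (approximants n))))

    u+1+d : ∀ n → u n ℕ.+ suc (d n) ≡ suc n
    u+1+d n = trans (ℕₚ.+-suc (u n) (d n)) (cong suc (u+d n))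

    -- As ∣ξ∣ ≥ 2, ∣ξ∣^a strictly exceeds ∣ξ∣^a′ ≥ Q^b′, so b > b′. In terms of upper bounds:
    -- otherwise the bounds on η^a and ξ^a would multiply to at most 1/2.
    ξ^-ratio : ∀ {a b a′ b′} → ∣ ξ ^K a ∣∞≤ Q ^ b → ∣ η ^K a′ ∣∞≤ h ^ b′ → a′ ℕ.< a → ¬ b ℕ.≤ b′
    ξ^-ratio {a} {b} {a′} {b′} ξ≤ η≤ a′<a b≤b′ =
      let o , eq = ℕₚ.m≤n⇒∃[o]m+o≡n a′<a
          η^a≤ = ∣∣∞-cong (R.trans (R.sym (K^.^-homo-* η a′ (suc o))) (R.reflexive (cong (η ^K_) (trans (ℕₚ.+-suc a′ o) eq))))
                   (∣∣∞-* η≤ (∣∣∞-^ (suc o) η≤½))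
      in contradiction (2^*½^ 0 (suc o) (ℚₚ.≤-trans (1≤product a η^a≤ ξ≤) (small o))) λ ()
      where
      open ℚₚ.≤-Reasoning
      open ℚ-Solver
      small : ∀ o → h ^ b′ * ½ ^ suc o * Q ^ b ≤ 1ℚ * ½ ^ suc o
      small o = begin
        h ^ b′ * ½ ^ suc o * Q ^ b  ≤⟨ *-monoˡ (0≤* (0≤^ b′ 0≤h) (ℚₚ.<⇒≤ (0<½^ (suc o)))) (^-monoʳ 1≤Q b≤b′) ⟩
        h ^ b′ * ½ ^ suc o * Q ^ b′  ≡⟨ solve 3 (λ h o Q → h :* o :* Q := (Q :* h) :* o) refl (h ^ b′) (½ ^ suc o) (Q ^ b′) ⟩
        (Q ^ b′ * h ^ b′) * ½ ^ suc o  ≡⟨ cong (_* ½ ^ suc o) (Q^h^≡1 b′) ⟩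
        1ℚ * ½ ^ suc o  ∎

    -- The integer form of γ_m ≤ γ_n + 1/(n+1). Both approximations are raised to the level
    -- (m+1)(n+1), where by `sums` a larger exponent of ξ means a smaller exponent of Q, against
    -- `ξ^-ratio`.
    cross : ∀ m n → u m ℕ.* suc n ℕ.≤ suc (u n) ℕ.* suc m
    cross m n = ℕₚ.≮⇒≥ λ a′<a → ξ^-ratio
      (∣∣∞-mono (ℚₚ.≤-reflexive (ℚ^ₚ.^-assocʳ Q (suc (d m)) (suc n))) (∣∣∞-cong (K^.^-assocʳ ξ (u m) (suc n)) (∣∣∞-^ (suc n) (ξ^u≤ m))))
      (∣∣∞-mono (ℚₚ.≤-reflexive (ℚ^ₚ.^-assocʳ h (d n) (suc m))) (∣∣∞-cong (K^.^-assocʳ η (suc (u n)) (suc m)) (∣∣∞-^ (suc m) (η^1+u≤ n))))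
      a′<a (≤-complement sums (ℕₚ.<⇒≤ a′<a))
      where
      ≤-complement : ∀ {a b a′ b′} → a ℕ.+ b ≡ a′ ℕ.+ b′ → a′ ℕ.≤ a → b ℕ.≤ b′
      ≤-complement {a} {b} {a′} {b′} eq a′≤a = ℕₚ.+-cancelˡ-≤ a b b′ (ℕₚ.≤-trans (ℕₚ.≤-reflexive eq) (ℕₚ.+-monoˡ-≤ b′ a′≤a))
      sums : u m ℕ.* suc n ℕ.+ suc (d m) ℕ.* suc n ≡ suc (u n) ℕ.* suc m ℕ.+ d n ℕ.* suc m
      sums = trans (sym (ℕₚ.*-distribʳ-+ (suc n) (u m) (suc (d m)))) (trans (cong (ℕ._* suc n) (u+1+d m))
        (trans (ℕₚ.*-comm (suc m) (suc n)) (trans (cong (ℕ._* suc m) (sym (cong suc (u+d n)))) (ℕₚ.*-distribʳ-+ (suc m) (suc (u n)) (d n)))))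

    γₙ : ℕ → ℚ
    γₙ n = ⟦ u n ⟧ * 1/⟦suc n ⟧

    γₙ*suc : ∀ n → γₙ n * ⟦ suc n ⟧ ≡ ⟦ u n ⟧
    γₙ*suc n = trans (ℚₚ.*-assoc ⟦ u n ⟧ _ _) (trans (cong (⟦ u n ⟧ *_) (trans (ℚₚ.*-comm 1/⟦suc n ⟧ ⟦ suc n ⟧) (⟦suc⟧*1/ n))) (ℚₚ.*-identityʳ _))

    [1-γₙ]*suc : ∀ n → (1ℚ - γₙ n) * ⟦ suc n ⟧ ≡ ⟦ suc (d n) ⟧
    [1-γₙ]*suc n = begin
      (1ℚ - γₙ n) * ⟦ suc n ⟧  ≡⟨ solve 2 (λ g s → (con 1ℚ :- g) :* s := s :- g :* s) refl (γₙ n) ⟦ suc n ⟧ ⟩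
      ⟦ suc n ⟧ - γₙ n * ⟦ suc n ⟧  ≡⟨ cong₂ _-_ (trans (cong ⟦_⟧ (sym (u+1+d n))) (⟦+⟧ (u n) (suc (d n)))) (γₙ*suc n) ⟩
      ⟦ u n ⟧ + ⟦ suc (d n) ⟧ - ⟦ u n ⟧  ≡⟨ solve 2 (λ a b → a :+ b :- a := b) refl ⟦ u n ⟧ ⟦ suc (d n) ⟧ ⟩
      ⟦ suc (d n) ⟧  ∎
      where
      open ≡-Reasoning
      open ℚ-Solver

    1-γₙ≡ : ∀ n → 1ℚ - γₙ n ≡ ⟦ suc (d n) ⟧ * 1/⟦suc n ⟧
    1-γₙ≡ n = trans (sym (ℚₚ.*-identityʳ _)) (trans (cong ((1ℚ - γₙ n) *_) (sym (⟦suc⟧*1/ n)))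
      (trans (sym (ℚₚ.*-assoc (1ℚ - γₙ n) _ _)) (cong (_* 1/⟦suc n ⟧) ([1-γₙ]*suc n))))

    0≤γₙ : ∀ n → 0ℚ ≤ γₙ n
    0≤γₙ n = 0≤* 0≤⟦ u n ⟧ (ℚₚ.<⇒≤ 0<1/⟦suc n ⟧)

    0≤1-γₙ : ∀ n → 0ℚ ≤ 1ℚ - γₙ n
    0≤1-γₙ n = subst (0ℚ ≤_) (sym (1-γₙ≡ n)) (0≤* 0≤⟦ suc (d n) ⟧ (ℚₚ.<⇒≤ 0<1/⟦suc n ⟧))

    γₙ-close : ∀ m n → γₙ m ≤ γₙ n + 1/⟦suc n ⟧
    γₙ-close m n = ⟦m⟧*1/⟦⟧≤ {u m} {m} (ℚₚ.*-cancelʳ-≤-pos ⟦ suc n ⟧ {{positive 0<⟦suc n ⟧}} (begin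
      ⟦ u m ⟧ * ⟦ suc n ⟧  ≡⟨ sym (⟦*⟧ (u m) (suc n)) ⟩
      ⟦ u m ℕ.* suc n ⟧  ≤⟨ ⟦⟧-mono-≤ (cross m n) ⟩
      ⟦ suc (u n) ℕ.* suc m ⟧  ≡⟨ trans (⟦*⟧ (suc (u n)) (suc m)) (cong (_* ⟦ suc m ⟧) (trans (⟦+⟧ 1 (u n)) (cong (_+ ⟦ u n ⟧) ⟦1⟧))) ⟩
      (1ℚ + ⟦ u n ⟧) * ⟦ suc m ⟧  ≡⟨ cong (_* ⟦ suc m ⟧) (trans (cong₂ _+_ (sym (⟦suc⟧*1/ n)) (sym (γₙ*suc n)))
          (solve 3 (λ s i g → s :* i :+ g :* s := (g :+ i) :* s) refl ⟦ suc n ⟧ 1/⟦suc n ⟧ (γₙ n))) ⟩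
      (γₙ n + 1/⟦suc n ⟧) * ⟦ suc n ⟧ * ⟦ suc m ⟧  ≡⟨ solve 3 (λ g s t → g :* s :* t := g :* t :* s) refl (γₙ n + 1/⟦suc n ⟧) ⟦ suc n ⟧ ⟦ suc m ⟧ ⟩
      (γₙ n + 1/⟦suc n ⟧) * ⟦ suc m ⟧ * ⟦ suc n ⟧  ∎))
      where
      open ℚₚ.≤-Reasoning
      open ℚ-Solver

    γ : ℝ
    γ = mkℝ γₙ λ ε 0<ε →
      let M , small = archimedean 0≤1 (0<½ε 0<ε) in
      M , λ m n M≤m M≤n → ∣p∣<q
        (ℚₚ.≤-<-trans (lin≤ (lem₁ (γₙ m) (γₙ n) 1/⟦suc n ⟧ (½ * ε)) (ℚₚ.+-mono-≤ (γₙ-close m n) (small n M≤n))) (½ε<ε 0<ε))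
        (ℚₚ.≤-<-trans (lin≤ (lem₂ (γₙ m) (γₙ n) 1/⟦suc m ⟧ (½ * ε)) (ℚₚ.+-mono-≤ (γₙ-close n m) (small m M≤m))) (½ε<ε 0<ε))
      where
      open ℚ-Solver
      lem₁ : ∀ a b i ε → ε - (a - b) ≡ (b + i + ε) - (a + 1ℚ * i)
      lem₁ = solve 4 (λ a b i ε → ε :- (a :- b) := (b :+ i :+ ε) :- (a :+ con 1ℚ :* i)) refl
      lem₂ : ∀ a b i ε → ε - (- (a - b)) ≡ (a + i + ε) - (b + 1ℚ * i)
      lem₂ = solve 4 (λ a b i ε → ε :- (:- (a :- b)) := (a :+ i :+ ε) :- (b :+ con 1ℚ :* i)) refl

    -- If ∣ξ∣ ≤ 2^M, then ∣η^(u+1)∣ ≤ Q^(-d) forces F d ≤ M (u+1), so u + 1 is at least the fraction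
    -- 1/(M+1) of n + 1.
    0<γ : 0ℝ <ℝ γ
    0<γ =
      let X , ξ≤X = ∣∣∞-bound ξ
          M , X≤M = ≤⟦⟧ X (∣∣∞-nonNeg ξ≤X)
          ξ≤2^M = ∣∣∞-mono (ℚₚ.≤-trans X≤M (subst (_≤ 2^ (+ M)) (sym ⟦ M ⟧≡) (ℚₚ.<⇒≤ (n<2^n M)))) ξ≤X
          δ = 1/⟦suc M ⟧
          0<δ = 0<1/⟦suc M ⟧
          N , small = archimedean 0≤1 (0<½ε 0<δ)
      in ½ * (½ * δ) , 0<½ε (0<½ε 0<δ) , N , λ n N≤n →
        lin< {0ℚ + ½ * (½ * δ)} {γₙ n} {δ + 1ℚ * 1/⟦suc n ⟧ + 0ℚ} {(γₙ n + 1/⟦suc n ⟧) + ½ * δ + ½ * (½ * δ)}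
          (lem (γₙ n) δ 1/⟦suc n ⟧)
          (ℚₚ.+-mono-≤-< (ℚₚ.+-mono-≤ (lower M ξ≤2^M n) (small n N≤n)) (0<½ε (0<½ε 0<δ)))
      where
      open ℚ-Solver
      lem : ∀ g δ i → g - (0ℚ + ½ * (½ * δ)) ≡ ((g + i) + ½ * δ + ½ * (½ * δ)) - (δ + 1ℚ * i + 0ℚ)
      lem = solve 3 (λ g δ i → g :- (con 0ℚ :+ con ½ :* (con ½ :* δ)) :=
        ((g :+ i) :+ con ½ :* δ :+ con ½ :* (con ½ :* δ)) :- (δ :+ con 1ℚ :* i :+ con 0ℚ)) refl
      lower : ∀ M → ∣ ξ ∣∞≤ 2^ (+ M) → ∀ n → 1/⟦suc M ⟧ ≤ γₙ n + 1/⟦suc n ⟧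
      lower M ξ≤2^M n = ℚₚ.≤-trans (1/⟦suc⟧≤ {suc (u n)} {n} {M} 1+n≤) (ℚₚ.≤-reflexive
        (trans (cong (_* 1/⟦suc n ⟧) (trans (⟦+⟧ 1 (u n)) (cong (_+ ⟦ u n ⟧) ⟦1⟧)))
          (solve 2 (λ u i → (con 1ℚ :+ u) :* i := u :* i :+ i) refl ⟦ u n ⟧ 1/⟦suc n ⟧)))
        where
        Fd≤ : F ℕ.* d n ℕ.≤ M ℕ.* suc (u n)
        Fd≤ = 2^*½^ (M ℕ.* suc (u n)) (F ℕ.* d n) (subst₂ (λ r s → 1ℚ ≤ r * s) (ℚ^ₚ.^-assocʳ (+ 2 / 1) M (suc (u n))) (ℚ^ₚ.^-assocʳ ½ F (d n))
          (subst (1ℚ ≤_) (ℚₚ.*-comm (h ^ d n) ((2^ (+ M)) ^ suc (u n))) (1≤product (suc (u n)) (η^1+u≤ n) (∣∣∞-^ (suc (u n)) ξ≤2^M))))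
        1+n≤ : suc n ℕ.≤ suc M ℕ.* suc (u n)
        1+n≤ = ℕₚ.≤-trans (ℕₚ.≤-reflexive (sym (cong suc (u+d n)))) (ℕₚ.+-monoʳ-≤ (suc (u n))
          (ℕₚ.≤-trans (ℕₚ.≤-trans (ℕₚ.≤-reflexive (sym (ℕₚ.*-identityˡ (d n)))) (ℕₚ.*-monoˡ-≤ (d n) 1≤F)) Fd≤))

    -- Since ∣ξ∣ ≥ 2, the bound on ξ^u gives u ≤ F (d+1), so d + 1 is at least the fraction 1/(F+1)
    -- of n + 1.
    γ<1 : γ <ℝ 1ℝ
    γ<1 = ½ * δ , 0<½ε 0<δ , 0 , λ n _ →
      lin< {γₙ n + ½ * δ} {1ℚ} {δ + 0ℚ} {(1ℚ - γₙ n) + ½ * δ} (lem (γₙ n) δ)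
        (ℚₚ.+-mono-≤-< (subst (δ ≤_) (sym (1-γₙ≡ n)) (1/⟦suc⟧≤ {suc (d n)} {n} {F} (1+n≤ n))) (0<½ε 0<δ))
      where
      open ℚ-Solver
      δ = 1/⟦suc F ⟧
      0<δ = 0<1/⟦suc F ⟧
      lem : ∀ g δ → 1ℚ - (g + ½ * δ) ≡ ((1ℚ - g) + ½ * δ) - (δ + 0ℚ)
      lem = solve 2 (λ g δ → con 1ℚ :- (g :+ con ½ :* δ) := ((con 1ℚ :- g) :+ con ½ :* δ) :- (δ :+ con 0ℚ)) refl
      u≤ : ∀ n → u n ℕ.≤ F ℕ.* suc (d n)
      u≤ n = 2^*½^ (F ℕ.* suc (d n)) (u n) (subst (λ r → 1ℚ ≤ r * ½ ^ u n) (ℚ^ₚ.^-assocʳ (+ 2 / 1) F (suc (d n)))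
        (subst (1ℚ ≤_) (ℚₚ.*-comm (½ ^ u n) (Q ^ suc (d n))) (1≤product (u n) (∣∣∞-^ (u n) η≤½) (ξ^u≤ n))))
      1+n≤ : ∀ n → suc n ℕ.≤ suc F ℕ.* suc (d n)
      1+n≤ n = ℕₚ.≤-trans (ℕₚ.≤-reflexive (trans (sym (u+1+d n)) (ℕₚ.+-comm (u n) (suc (d n))))) (ℕₚ.+-monoʳ-≤ (suc (d n)) (u≤ n))

  -- The bound is known with z frozen at an index m, and the point from which it holds along x
  -- depends on m. Freezing a single m beyond k and the Cauchy modulus of z costs at most B δ = ε/2,
  -- where B bounds x.
  *-limit : ∀ x z C k → (∀ n → 0ℚ ≤ seq x n) → (∀ m → k ℕ.≤ m → x *ℝ fromℚ (seq z m) ≤ℝ fromℚ C) → x *ℝ z ≤ℝ fromℚ C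
  *-limit x z C k 0≤x h ε 0<ε =
    let N₁ , B , 0<B , x≤B = eventually-bounded x
        δ = inv B 0<B * (½ * ε)
        N₂ , close = cauchy z δ (0<* (0<inv B 0<B) (0<½ε 0<ε))
        m = N₂ ℕ.⊔ k
    in ev-map₂ (ev-map₂ (N₁ , x≤B) (N₂ , λ n N₂≤n → close n m N₂≤n (ℕₚ.m≤m⊔n N₂ k)) λ n p q → p , q)
         (h m (ℕₚ.m≤n⊔m N₂ k) (½ * ε) (0<½ε 0<ε)) λ n (p , q) l → begin-strict
      seq x n * seq z n  ≡⟨ split (seq x n) (seq z n) (seq z m) ⟩
      seq x n * seq z m + seq x n * (seq z n - seq z m)  ≤⟨ ℚₚ.+-monoʳ-≤ (seq x n * seq z m) (ℚₚ.≤-trans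
          (*-monoˡ (0≤x n) (ℚₚ.≤-trans (p≤∣p∣ _) (ℚₚ.<⇒≤ q)))
          (*-monoʳ (ℚₚ.<⇒≤ (0<* (0<inv B 0<B) (0<½ε 0<ε))) (ℚₚ.≤-trans (p≤∣p∣ _) p))) ⟩
      seq x n * seq z m + B * δ  <⟨ ℚₚ.+-monoˡ-< (B * δ) l ⟩
      C + ½ * ε + B * δ  ≡⟨ trans (cong (λ t → C + ½ * ε + t) (*-inv B 0<B (½ * ε)))
          (trans (ℚₚ.+-assoc C (½ * ε) (½ * ε)) (cong (λ t → C + t) (½ε+½ε≡ε ε))) ⟩
      C + ε  ∎
    where
    open ℚₚ.≤-Reasoning
    open ℚ-Solver
    split : ∀ x z z′ → x * z ≡ x * z′ + x * (z - z′)
    split = solve 3 (λ x z z′ → x :* z := x :* z′ :+ x :* (z :- z′)) refl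

  -- Powers of ∣q′∣ against powers of Q and η

  module Estimates {c ℓ} (K : EmbeddedQuadraticField c ℓ) (η ξ : EmbeddedQuadraticField.Carrier K) (F : ℕ) (1≤F : 1 ℕ.≤ F)
    (η≤½ : Field.∣_∣∞≤_ K η ½)
    (ηξ≈1 : EmbeddedQuadraticField._≈K_ K (EmbeddedQuadraticField._*K_ K η ξ) (EmbeddedQuadraticField.1K K)) where

    open Field K
    open Exponent K η ξ F 1≤F η≤½ ηξ≈1 public

    module _ {b B : ℚ} {k : ℕ} (1≤b : 1ℚ ≤ b) (1≤B : 1ℚ ≤ B) (bη^k≤ : ∣ ι b *K η ^K k ∣∞≤ B * Q ^ k) where

      private
        x = η ^K k
        0≤b = ℚₚ.≤-trans 0≤1 1≤b
        0≤B = ℚₚ.≤-trans 0≤1 1≤B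

      0≤BQ^k : 0ℚ ≤ B * Q ^ k
      0≤BQ^k = 0≤* 0≤B (0≤^ k 0≤Q)

      -- The inequality b^γ ≤ B Q^k at level n + 1. Multiplying (b η^k)^u by (ξ^u)^k cancels η, and
      -- the exponents of Q add up to k u + k (d+1) = k (n+1).
      b^u≤ : ∀ n → b ^ u n ≤ (B * Q ^ k) ^ suc n
      b^u≤ n = ℚₚ.≤-trans (p≤∣p∣ (b ^ u n)) (∣∣∞-ι⁻¹ (∣∣∞-mono rational (∣∣∞-cong element
        (∣∣∞-* (∣∣∞-^ (u n) bη^k≤) (∣∣∞-^ k (ξ^u≤ n))))))
        where
        element : (ι b *K x) ^K u n *K (ξ ^K u n) ^K k ≈K ι (b ^ u n)
        element = begin
          (ι b *K x) ^K u n *K (ξ ^K u n) ^K k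
            ≈⟨ R.*-cong (K^.^-distrib-* (ι b) x (u n)) (R.trans (K^.^-assocʳ ξ (u n) k) (R.reflexive (cong (ξ ^K_) (ℕₚ.*-comm (u n) k)))) ⟩
          ι b ^K u n *K x ^K u n *K ξ ^K (k ℕ.* u n)
            ≈⟨ R.trans (R.*-assoc _ _ _) (R.*-cong (R.sym (ι-^ b (u n))) (R.trans (R.*-congʳ (K^.^-assocʳ η k (u n))) (ηξ^≈1 (k ℕ.* u n)))) ⟩
          ι (b ^ u n) *K 1K
            ≈⟨ R.*-identityʳ _ ⟩
          ι (b ^ u n) ∎
          where open import Relation.Binary.Reasoning.Setoid R.setoid
        rational : (B * Q ^ k) ^ u n * (Q ^ suc (d n)) ^ k ≤ (B * Q ^ k) ^ suc n
        rational = begin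
          (B * Q ^ k) ^ u n * (Q ^ suc (d n)) ^ k
            ≡⟨ cong₂ _*_ (ℚ^ₚ.^-distrib-* B (Q ^ k) (u n))
                 (trans (ℚ^ₚ.^-assocʳ Q (suc (d n)) k) (trans (cong (Q ^_) (ℕₚ.*-comm (suc (d n)) k)) (sym (ℚ^ₚ.^-assocʳ Q k (suc (d n)))))) ⟩
          B ^ u n * (Q ^ k) ^ u n * (Q ^ k) ^ suc (d n)
            ≡⟨ trans (ℚₚ.*-assoc (B ^ u n) _ _) (cong (B ^ u n *_) (trans (sym (ℚ^ₚ.^-homo-* (Q ^ k) (u n) (suc (d n)))) (cong ((Q ^ k) ^_) (u+1+d n)))) ⟩
          B ^ u n * (Q ^ k) ^ suc n
            ≤⟨ *-monoʳ (0≤^ (suc n) (0≤^ k 0≤Q)) (^-monoʳ 1≤B (subst (u n ℕ.≤_) (u+1+d n) (ℕₚ.m≤m+n (u n) (suc (d n))))) ⟩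
          B ^ suc n * (Q ^ k) ^ suc n
            ≡⟨ sym (ℚ^ₚ.^-distrib-* B (Q ^ k) (suc n)) ⟩
          (B * Q ^ k) ^ suc n ∎
          where open ℚₚ.≤-Reasoning

      b^2γ≤ : ∀ n {z} → z ^ suc n ≤ b ^ (u n ℕ.+ u n) → z ≤ (B * Q ^ k) * (B * Q ^ k)
      b^2γ≤ n {z} h = ^-cancel-≤ n (0≤* 0≤BQ^k 0≤BQ^k) (begin
        z ^ suc n  ≤⟨ h ⟩
        b ^ (u n ℕ.+ u n)  ≡⟨ ℚ^ₚ.^-homo-* b (u n) (u n) ⟩
        b ^ u n * b ^ u n  ≤⟨ *-mono (0≤^ (u n) 0≤b) (b^u≤ n) (0≤^ (u n) 0≤b) (b^u≤ n) ⟩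
        (B * Q ^ k) ^ suc n * (B * Q ^ k) ^ suc n  ≡⟨ sym (ℚ^ₚ.^-distrib-* (B * Q ^ k) (B * Q ^ k) (suc n)) ⟩
        ((B * Q ^ k) * (B * Q ^ k)) ^ suc n  ∎)
        where open ℚₚ.≤-Reasoning

      module _ {X : ℚ} (1≤X : 1ℚ ≤ X) (ξ≤X : ∣ ξ ∣∞≤ X) where

        private
          0≤X = ℚₚ.≤-trans 0≤1 1≤X
          1≤QX = 1≤* 1≤Q 1≤X
          0≤QX = ℚₚ.≤-trans 0≤1 1≤QX
          C = B * (Q * X)
          0≤C = 0≤* 0≤B 0≤QX

        -- The inequality b^(1-γ) ∣η∣^k ≤ C at level n + 1. The factor η^(k u) is bounded only
        -- through η^(u+1), whence the correction ξ^k. Its bound X^k and the surplus Q^k are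
        -- absorbed into (n+1)-st powers because k ≤ n + 1.
        b^[1+d]≤ : ∀ n → k ℕ.≤ suc n → ∣ ι (b ^ suc (d n)) *K x ^K suc n ∣∞≤ C ^ suc n
        b^[1+d]≤ n k≤1+n = ∣∣∞-mono rational (∣∣∞-cong element
          (∣∣∞-* (∣∣∞-^ (suc (d n)) bη^k≤) (∣∣∞-* (∣∣∞-^ k (η^1+u≤ n)) (∣∣∞-^ k ξ≤X))))
          where
          x^u : (η ^K suc (u n)) ^K k *K ξ ^K k ≈K x ^K u n
          x^u = begin
            (η ^K suc (u n)) ^K k *K ξ ^K k
              ≈⟨ R.*-congʳ (R.trans (K^.^-assocʳ η (suc (u n)) k) (R.trans (K^.^-homo-* η k (u n ℕ.* k)) (R.*-comm (η ^K k) (η ^K (u n ℕ.* k))))) ⟩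
            η ^K (u n ℕ.* k) *K η ^K k *K ξ ^K k
              ≈⟨ R.trans (R.*-assoc _ _ _) (R.trans (R.*-congˡ (ηξ^≈1 k)) (R.*-identityʳ _)) ⟩
            η ^K (u n ℕ.* k)
              ≈⟨ R.trans (R.reflexive (cong (η ^K_) (ℕₚ.*-comm (u n) k))) (R.sym (K^.^-assocʳ η k (u n))) ⟩
            x ^K u n ∎
            where open import Relation.Binary.Reasoning.Setoid R.setoid
          element : (ι b *K x) ^K suc (d n) *K ((η ^K suc (u n)) ^K k *K ξ ^K k) ≈K ι (b ^ suc (d n)) *K x ^K suc n
          element = begin
            (ι b *K x) ^K suc (d n) *K ((η ^K suc (u n)) ^K k *K ξ ^K k)
              ≈⟨ R.*-cong (K^.^-distrib-* (ι b) x (suc (d n))) x^u ⟩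
            ι b ^K suc (d n) *K x ^K suc (d n) *K x ^K u n
              ≈⟨ R.trans (R.*-assoc _ _ _) (R.*-cong (R.sym (ι-^ b (suc (d n)))) (R.trans (R.sym (K^.^-homo-* x (suc (d n)) (u n)))
                   (R.reflexive (cong (x ^K_) (trans (ℕₚ.+-comm (suc (d n)) (u n)) (u+1+d n)))))) ⟩
            ι (b ^ suc (d n)) *K x ^K suc n ∎
            where open import Relation.Binary.Reasoning.Setoid R.setoid
          rational : (B * Q ^ k) ^ suc (d n) * ((h ^ d n) ^ k * X ^ k) ≤ C ^ suc n
          rational = begin
            (B * Q ^ k) ^ suc (d n) * ((h ^ d n) ^ k * X ^ k)
              ≡⟨ cong₂ _*_ (trans (ℚ^ₚ.^-distrib-* B (Q ^ k) (suc (d n))) (cong (B ^ suc (d n) *_) (cong (Q ^ k *_) (ℚ^ₚ.^-assocʳ Q k (d n)))))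
                   (cong (_* X ^ k) (trans (ℚ^ₚ.^-assocʳ h (d n) k) (cong (h ^_) (ℕₚ.*-comm (d n) k)))) ⟩
            B ^ suc (d n) * (Q ^ k * Q ^ (k ℕ.* d n)) * (h ^ (k ℕ.* d n) * X ^ k)
              ≡⟨ rearrange (B ^ suc (d n)) (Q ^ k) (Q ^ (k ℕ.* d n)) (h ^ (k ℕ.* d n)) (X ^ k) ⟩
            B ^ suc (d n) * (Q ^ k * X ^ k) * (Q ^ (k ℕ.* d n) * h ^ (k ℕ.* d n))
              ≡⟨ trans (cong (B ^ suc (d n) * (Q ^ k * X ^ k) *_) (Q^h^≡1 (k ℕ.* d n))) (trans (ℚₚ.*-identityʳ _) (cong (B ^ suc (d n) *_) (sym (ℚ^ₚ.^-distrib-* Q X k)))) ⟩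
            B ^ suc (d n) * (Q * X) ^ k
              ≤⟨ *-mono (0≤^ (suc (d n)) 0≤B) (^-monoʳ 1≤B (subst (suc (d n) ℕ.≤_) (u+1+d n) (ℕₚ.m≤n+m (suc (d n)) (u n)))) (0≤^ k 0≤QX) (^-monoʳ 1≤QX k≤1+n) ⟩
            B ^ suc n * (Q * X) ^ suc n
              ≡⟨ sym (ℚ^ₚ.^-distrib-* B (Q * X) (suc n)) ⟩
            C ^ suc n ∎
            where
            open ℚₚ.≤-Reasoning
            open ℚ-Solver
            rearrange : ∀ b q r h x → b * (q * r) * (h * x) ≡ b * (q * x) * (r * h)
            rearrange = solve 5 (λ b q r h x → b :* (q :* r) :* (h :* x) := b :* (q :* x) :* (r :* h)) refl

        -- The square of the preceding bound, with z for the power of b. As r = z^(n+1) / β² is at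
        -- most 1, the (n+1)-st power of z x² is bounded and `∣∣∞-root` applies.
        b^[2-2γ]≤ : ∀ n → k ℕ.≤ suc n → ∀ {z} → 0ℚ ≤ z → z ^ suc n ≤ b ^ (suc (d n) ℕ.+ suc (d n)) → ∣ ι z *K (x *K x) ∣∞≤ C * C
        b^[2-2γ]≤ n k≤1+n {z} 0≤z z^≤ = ∣∣∞-root n (0≤* 0≤C 0≤C) (∣∣∞-mono (ℚₚ.≤-reflexive rational)
          (∣∣∞-cong element (∣∣∞-* (∣∣∞-ι {r} ∣r∣≤1) (∣∣∞-* (b^[1+d]≤ n k≤1+n) (b^[1+d]≤ n k≤1+n)))))
          where
          β = b ^ suc (d n)
          β²≡ : b ^ (suc (d n) ℕ.+ suc (d n)) ≡ β * β
          β²≡ = ℚ^ₚ.^-homo-* b (suc (d n)) (suc (d n))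
          0<β : 0ℚ < β
          0<β = 0<^ (suc (d n)) (ℚₚ.<-≤-trans 0<1 1≤b)
          0<β² : 0ℚ < β * β
          0<β² = 0<* 0<β 0<β
          i = inv (β * β) 0<β²
          r = i * z ^ suc n
          β²r≡z^ : (β * β) * r ≡ z ^ suc n
          β²r≡z^ = *-inv (β * β) 0<β² (z ^ suc n)
          ∣r∣≤1 : ∣ r ∣ ≤ 1ℚ
          ∣r∣≤1 = subst (_≤ 1ℚ) (sym (ℚₚ.0≤p⇒∣p∣≡p (0≤* (ℚₚ.<⇒≤ (0<inv (β * β) 0<β²)) (0≤^ (suc n) 0≤z))))
            (ℚₚ.*-cancelˡ-≤-pos (β * β) {{positive 0<β²}} (subst₂ _≤_ (sym β²r≡z^) (trans β²≡ (sym (ℚₚ.*-identityʳ (β * β)))) z^≤))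
          rational : 1ℚ * (C ^ suc n * C ^ suc n) ≡ (C * C) ^ suc n
          rational = trans (ℚₚ.*-identityˡ _) (sym (ℚ^ₚ.^-distrib-* C C (suc n)))
          element : ι r *K ((ι β *K x ^K suc n) *K (ι β *K x ^K suc n)) ≈K (ι z *K (x *K x)) ^K suc n
          element = begin
            ι r *K ((ι β *K x ^K suc n) *K (ι β *K x ^K suc n))
              ≈⟨ solve 3 (λ r b y → r :* ((b :* y) :* (b :* y)) := ((b :* b) :* r) :* (y :* y)) R.refl (ι r) (ι β) (x ^K suc n) ⟩
            ((ι β *K ι β) *K ι r) *K (x ^K suc n *K x ^K suc n)
              ≈⟨ R.*-cong (R.trans (R.*-congʳ (R.sym (ιH.*-homo β β))) (R.trans (R.sym (ιH.*-homo (β * β) r)) (R.trans (ι-cong β²r≡z^) (ι-^ z (suc n)))))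
                   (R.sym (K^.^-distrib-* x x (suc n))) ⟩
            ι z ^K suc n *K (x *K x) ^K suc n
              ≈⟨ R.sym (K^.^-distrib-* (ι z) (x *K x) (suc n)) ⟩
            (ι z *K (x *K x)) ^K suc n ∎
            where
            open K-Solver
            open import Relation.Binary.Reasoning.Setoid R.setoid

  -- The two inequalities

  module Conclusion {c ℓ} (K : EmbeddedQuadraticField c ℓ) (α : EmbeddedQuadraticField.Carrier K)
                    (irr : Algorithm.Irrational K α) (prop : Algorithm.PropertyI K α) where

    open Periodicity K α irr prop
    module P = WithPeriod (proj₁ period) (proj₁ (proj₂ period)) (proj₂ (proj₂ period))
    open P using (η; F)

    ξ : Carrier
    ξ = η ⁻¹

    open Estimates K η ξ F P.1≤F P.η≤½ (*-inverse η P.η≉0) public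

    B C₁ X C₂ : ℚ
    B = P.B′
    C₁ = P.C′
    X = proj₁ (∣∣∞-bound ξ) ⊔ 1ℚ
    C₂ = B * (Q * X)

    1≤X : 1ℚ ≤ X
    1≤X = ℚₚ.p≤q⊔p (proj₁ (∣∣∞-bound ξ)) 1ℚ

    ξ≤X : ∣ ξ ∣∞≤ X
    ξ≤X = ∣∣∞-mono (ℚₚ.p≤p⊔q (proj₁ (∣∣∞-bound ξ)) 1ℚ) (proj₂ (∣∣∞-bound ξ))

    1≤∣q′∣ : ∀ n → 1ℚ ≤ ∣ q′ α n ∣
    1≤∣q′∣ n = subst (λ r → 1ℚ ≤ ∣ r ∣) (sym (q′≡N n)) (1≤∣integer∣ (N n) (odd⇒≢0 (N-odd n)))

    ∣∣∞-∣ι∣ : ∀ {r x s} → ∣ ι r *K x ∣∞≤ s → ∣ ι ∣ r ∣ *K x ∣∞≤ s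
    ∣∣∞-∣ι∣ {r} {x} {s} h = cases (ℚₚ.∣p∣≡p∨∣p∣≡-p r)
      where
      open K-Solver
      cases : (∣ r ∣ ≡ r) ⊎ (∣ r ∣ ≡ - r) → ∣ ι ∣ r ∣ *K x ∣∞≤ s
      cases (inj₁ eq) = ∣∣∞-cong (R.*-congʳ (ι-cong (sym eq))) h
      cases (inj₂ eq) = ∣∣∞-cong (R.trans (solve 2 (λ r x → :- (r :* x) := (:- r) :* x) R.refl (ι r) x)
        (R.*-congʳ (R.sym (R.trans (ι-cong eq) (ιH.-‿homo r))))) (∣∣∞-neg h)

    s∞ s₂ : ℝ
    s∞ = 2ℝ -ℝ 2ℝ *ℝ γ
    s₂ = 2ℝ *ℝ γ

    s₂*suc : ∀ n → seq s₂ n * ⟦ suc n ⟧ ≡ ⟦ u n ℕ.+ u n ⟧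
    s₂*suc n = trans (lem (γₙ n) ⟦ suc n ⟧) (trans (cong₂ _+_ (γₙ*suc n) (γₙ*suc n)) (sym (⟦+⟧ (u n) (u n))))
      where
      open ℚ-Solver
      lem : ∀ g s → (+ 2 / 1) * g * s ≡ g * s + g * s
      lem = solve 2 (λ g s → con (+ 2 / 1) :* g :* s := g :* s :+ g :* s) refl

    s∞*suc : ∀ n → seq s∞ n * ⟦ suc n ⟧ ≡ ⟦ suc (d n) ℕ.+ suc (d n) ⟧
    s∞*suc n = trans (lem (γₙ n) ⟦ suc n ⟧) (trans (cong₂ _+_ ([1-γₙ]*suc n) ([1-γₙ]*suc n)) (sym (⟦+⟧ (suc (d n)) (suc (d n)))))
      where
      open ℚ-Solver
      lem : ∀ g s → ((+ 2 / 1) - (+ 2 / 1) * g) * s ≡ (1ℚ - g) * s + (1ℚ - g) * s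
      lem = solve 2 (λ g s → (con (+ 2 / 1) :- con (+ 2 / 1) :* g) :* s := (con 1ℚ :- g) :* s :+ (con 1ℚ :- g) :* s) refl

    0≤2 : 0ℚ ≤ + 2 / 1
    0≤2 = ℚₚ.<⇒≤ (ℚₚ.positive⁻¹ (+ 2 / 1))

    0≤s₂ : ∀ n → 0ℚ ≤ seq s₂ n
    0≤s₂ n = 0≤* 0≤2 (0≤γₙ n)

    0≤s∞ : ∀ n → 0ℚ ≤ seq s∞ n
    0≤s∞ n = subst (0ℚ ≤_) (lem (γₙ n)) (0≤* 0≤2 (0≤1-γₙ n))
      where
      open ℚ-Solver
      lem : ∀ g → (+ 2 / 1) * (1ℚ - g) ≡ (+ 2 / 1) - (+ 2 / 1) * g
      lem = solve 1 (λ g → con (+ 2 / 1) :* (con 1ℚ :- g) := con (+ 2 / 1) :- con (+ 2 / 1) :* g) refl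

    s₂≤2 : ∀ n → seq s₂ n ≤ ⟦ 2 ⟧
    s₂≤2 n = subst (seq s₂ n ≤_) (sym ⟦ 2 ⟧≡) (lin≤ (lem (γₙ n)) (0≤s∞ n))
      where
      open ℚ-Solver
      lem : ∀ g → (+ 2 / 1) - (+ 2 / 1) * g ≡ ((+ 2 / 1) - (+ 2 / 1) * g) - 0ℚ
      lem = solve 1 (λ g → con (+ 2 / 1) :- con (+ 2 / 1) :* g := (con (+ 2 / 1) :- con (+ 2 / 1) :* g) :- con 0ℚ) refl

    s∞≤2 : ∀ n → seq s∞ n ≤ ⟦ 2 ⟧
    s∞≤2 n = subst (seq s∞ n ≤_) (sym ⟦ 2 ⟧≡) (lin≤ (lem (γₙ n)) (0≤s₂ n))
      where
      open ℚ-Solver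
      lem : ∀ g → (+ 2 / 1) - ((+ 2 / 1) - (+ 2 / 1) * g) ≡ (+ 2 / 1) * g - 0ℚ
      lem = solve 1 (λ g → con (+ 2 / 1) :- (con (+ 2 / 1) :- con (+ 2 / 1) :* g) := con (+ 2 / 1) :* g :- con 0ℚ) refl

    -- The added 1 makes `C∞` positive, `C₁` being known only to be nonnegative.
    C∞ C₂² : ℚ
    C∞ = C₁ * (C₂ * C₂) + 1ℚ
    C₂² = B * B

    module _ (n : ℕ) where

      private
        module D = PeriodData (P.analysis n)
        k = D.k
        b₀ = ∣ q′ α n ∣
        r = p′ α n /₀ q′ α n
        module Z₂ = Power b₀ (1≤∣q′∣ n) s₂ 0≤s₂ s₂≤2
        module Z∞ = Power b₀ (1≤∣q′∣ n) s∞ 0≤s∞ s∞≤2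

      b₀η^k≤ : ∣ ι b₀ *K η ^K k ∣∞≤ B * Q ^ k
      b₀η^k≤ = ∣∣∞-∣ι∣ D.q′η≤

      -- The power of b₀ is at most (B Q^k)² at every index and the error eventually at most h^(2k);
      -- Q h = 1 then removes k.
      2-adic-bound : _≤ℝ_/_^_ ∣ σ₂ α -ℚ₂ σ₂ (ι r) ∣₂ (fromℚ C₂²) b₀ s₂
      2-adic-bound = Z₂.power , Z₂.isPower , λ ε 0<ε →
        ev-map (∣∣₂-bound {k ℕ.* F ℕ.+ k ℕ.* F} α (ι r) D.ν-E) λ m h → begin-strict
          seq ∣ σ₂ α -ℚ₂ σ₂ (ι r) ∣₂ m * Z₂.z m
            ≤⟨ *-monoʳ (Z₂.0≤z m) h ⟩
          ½ ^ (k ℕ.* F ℕ.+ k ℕ.* F) * Z₂.z m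
            ≤⟨ *-monoˡ (ℚₚ.<⇒≤ (0<½^ (k ℕ.* F ℕ.+ k ℕ.* F))) (b^2γ≤ {k = k} (1≤∣q′∣ n) P.1≤B′ b₀η^k≤ m (Z₂.z^k≤b^i m (u m ℕ.+ u m) (suc m) (s₂*suc m))) ⟩
          ½ ^ (k ℕ.* F ℕ.+ k ℕ.* F) * ((B * Q ^ k) * (B * Q ^ k))
            ≡⟨ cancel ⟩
          C₂²
            <⟨ p+ε>p 0<ε ⟩
          C₂² + ε ∎
        where
        open ℚₚ.≤-Reasoning
        ½^kF : ½ ^ (k ℕ.* F) ≡ h ^ k
        ½^kF = trans (cong (½ ^_) (ℕₚ.*-comm k F)) (sym (ℚ^ₚ.^-assocʳ ½ F k))
        cancel : ½ ^ (k ℕ.* F ℕ.+ k ℕ.* F) * ((B * Q ^ k) * (B * Q ^ k)) ≡ C₂²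
        cancel = trans (cong (_* ((B * Q ^ k) * (B * Q ^ k))) (trans (ℚ^ₚ.^-homo-* ½ (k ℕ.* F) (k ℕ.* F)) (cong₂ _*_ ½^kF ½^kF)))
          (trans (lem (h ^ k) B (Q ^ k)) (trans (cong (λ t → B * B * (t * t)) (Q^h^≡1 k)) (ℚₚ.*-identityʳ (B * B))))
          where
          open ℚ-Solver
          lem : ∀ h B Q → h * h * ((B * Q) * (B * Q)) ≡ B * B * ((Q * h) * (Q * h))
          lem = solve 3 (λ h B Q → h :* h :* ((B :* Q) :* (B :* Q)) := B :* B :* ((Q :* h) :* (Q :* h))) refl

      zE≤ : ∀ m → k ℕ.≤ m → ∣ ι (Z∞.z m) *K E n ∣∞≤ C∞
      zE≤ m k≤m = ∣∣∞-mono (p≤p+q 0≤1) (∣∣∞-cong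
        (R.trans (solve 3 (λ ζ z x → ζ :* (z :* x) := z :* (ζ :* x)) R.refl D.ζ (ι (Z∞.z m)) (η ^K k *K η ^K k)) (R.*-congˡ (R.sym D.E≈ζη²)))
        (∣∣∞-* D.ζ≤ (b^[2-2γ]≤ {k = k} (1≤∣q′∣ n) P.1≤B′ b₀η^k≤ 1≤X ξ≤X m (ℕₚ.m≤n⇒m≤1+n k≤m) (Z∞.0≤z m)
          (Z∞.z^k≤b^i m (suc (d m) ℕ.+ suc (d m)) (suc m) (s∞*suc m)))))
        where open K-Solver

      -- `zE≤` holds from index k on only, and k varies with n. As n is fixed here, `*-limit` passes
      -- to the full power with a constant free of n.
      real-bound : _≤ℝ_/_^_ ∣ σ∞ α -ℝ fromℚ r ∣ℝ (fromℚ C∞) b₀ s∞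
      real-bound = Z∞.power , Z∞.isPower , *-limit ∣ Y ∣ℝ Z∞.power C∞ k (λ m → ℚₚ.0≤∣p∣ (seq Y m)) λ m k≤m ε 0<ε →
        ev-map (∣∣-resp-≈ℝ (σ∞ (ι (Z∞.z m) *K E n)) (fromℚ (Z∞.z m) *ℝ Y) C∞ (zE≈ m) (bound (zE≤ m k≤m)) ε 0<ε) λ i h →
          subst (_< C∞ + ε) (trans (ℚₚ.∣p*q∣≡∣p∣*∣q∣ (Z∞.z m) (seq Y i))
            (trans (cong (_* ∣ seq Y i ∣) (ℚₚ.0≤p⇒∣p∣≡p (Z∞.0≤z m))) (ℚₚ.*-comm (Z∞.z m) ∣ seq Y i ∣))) h
        where
        Y = σ∞ α -ℝ fromℚ r
        E≈Y : σ∞ (E n) ≈ℝ Y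
        E≈Y = ≈-trans (σ∞ (E n)) (σ∞ α +ℝ σ∞ (-K ι r)) Y (σ∞H.+-homo α (-K ι r))
          (+-cong (σ∞ α) (σ∞ α) (σ∞ (-K ι r)) (-ℝ fromℚ r) (≈-refl (σ∞ α))
            (≈-trans (σ∞ (-K ι r)) (-ℝ σ∞ (ι r)) (-ℝ fromℚ r) (σ∞H.-‿homo (ι r)) (neg-cong (σ∞ (ι r)) (fromℚ r) (f-ℚ r))))
        zE≈ : ∀ m → σ∞ (ι (Z∞.z m) *K E n) ≈ℝ (fromℚ (Z∞.z m) *ℝ Y)
        zE≈ m = ≈-trans (σ∞ (ι z *K E n)) (σ∞ (ι z) *ℝ σ∞ (E n)) (fromℚ z *ℝ Y) (σ∞H.*-homo (ι z) (E n))
          (≈-trans (σ∞ (ι z) *ℝ σ∞ (E n)) (σ∞ (ι z) *ℝ Y) (fromℚ z *ℝ Y) (*-congˡ (σ∞ (ι z)) (σ∞ (E n)) Y E≈Y)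
            (*-congʳ (σ∞ (ι z)) (fromℚ z) (f-ℚ z)))
          where
          z = Z∞.z m
          *-congʳ : ∀ x x′ → x ≈ℝ x′ → (x *ℝ Y) ≈ℝ (x′ *ℝ Y)
          *-congʳ x x′ x≈x′ ε 0<ε = ev-map (*-congˡ Y x x′ x≈x′ ε 0<ε) λ i →
            subst (_< ε) (cong ∣_∣ (cong₂ _-_ (ℚₚ.*-comm (seq Y i) (seq x i)) (ℚₚ.*-comm (seq Y i) (seq x′ i))))

    0<fromℚ : ∀ {r} → 0ℚ < r → 0ℝ <ℝ fromℚ r
    0<fromℚ {r} 0<r = ½ * r , 0<½ε 0<r , 0 , λ _ _ → subst (_< r) (sym (ℚₚ.+-identityˡ (½ * r))) (½ε<ε 0<r)

    0<C∞ : 0ℚ < C∞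
    0<C∞ = ℚₚ.<-≤-trans 0<1 (p≤q+p (0≤* (∣∣∞-nonNeg (PeriodData.ζ≤ (P.analysis 0))) (0≤* 0≤C₂ 0≤C₂)))
      where
      0≤C₂ : 0ℚ ≤ C₂
      0≤C₂ = ℚₚ.≤-trans 0≤1 (1≤* P.1≤B′ (1≤* 1≤Q 1≤X))

    0<C₂² : 0ℚ < C₂²
    0<C₂² = ℚₚ.<-≤-trans 0<1 (1≤* P.1≤B′ P.1≤B′)

open import Data.Nat.Base using (ℕ; _≤_)
open import Data.Product.Base using (_×_; ∃; _,_)
open import Data.Rational.Base using (∣_∣)

theorem3p24 : ∀ {c ℓ} (K : EmbeddedQuadraticField c ℓ) →
    let open EmbeddedQuadraticField K
        open Algorithm K
    in
    (α : Carrier) → Irrational α → PropertyI α →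
    ∃ λ γ → ∃ λ C → ∃ λ C′ →
      (0ℝ <ℝ γ × γ <ℝ 1ℝ) × 0ℝ <ℝ C × 0ℝ <ℝ C′ ×
      (∀ (n : ℕ) → 1 ≤ n →
        (∣ σ∞ α -ℝ fromℚ (p′ α n /₀ q′ α n) ∣ℝ
           ≤ℝ C / ∣ q′ α n ∣ ^ (2ℝ -ℝ 2ℝ *ℝ γ)) ×
        (∣ σ₂ α -ℚ₂ σ₂ (ι (p′ α n /₀ q′ α n)) ∣₂
           ≤ℝ C′ / ∣ q′ α n ∣ ^ (2ℝ *ℝ γ)))
theorem3p24 K α irr prop =
  γ , fromℚ C∞ , fromℚ C₂² , (0<γ , γ<1) , 0<fromℚ 0<C∞ , 0<fromℚ 0<C₂² ,
  λ n _ → real-bound n , 2-adic-bound n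
  where open SimultaneousApproximation.Conclusion K α irr prop
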